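{- Let $k\ge 1$ be a fixed integer and let $G_{\le k}(z)$ be the generating function (by size) of closed lambda-terms in which all bindings have unary length at most $k$. Then $$[z^n]G_{\le k}(z)\sim \sqrt{\frac{2k+\sqrt{k}}{4\pi\prod_{j=2}^{k+1}c_j}}\; n^{ -3/2}\,(1+2\sqrt{k})^n,\qquad n\to\infty,$$ where $c_1=1$ and $c_j=4j-5+2\sqrt{c_{j-1}}$ for $2\le j\le k+1$.
   Context: A Motzkin tree is a finite plane rooted tree in which every node has 0, 1 or 2 children (leaf, unary node, binary node). A closed lambda-term (up to $\alpha$-equivalence) is a Motzkin tree together with a map assigning to every leaf $e$ one unary node $v$ on the path from the root to $e$ (the abstraction binding $e$). The size of a term is its total number of nodes. The unary length of the binding of $e$ by $v$ is the number of unary nodes on the path from $v$ to $e$ in the Motzkin tree, with $v$ itself counted. $G_{\le k}(z)=\sum_n g_n z^n$, where $g_n$ is the number of closed lambda-terms of size $n$ in which all bindings have unary length at most $k$. Equivalently, $G_{\le k}=\hat P^{(0,k)}$, where $\hat P^{(k,k)}(z)=\frac{1-z-\sqrt{(1-z)^2-4kz^2}}{2z}$ and $\hat P^{(i,k)}(z)=\frac{1-\sqrt{1-4iz^2-4z^2\hat P^{(i+1,k)}(z)}}{2z}$ for $0\le i<k$. The notation $a_n\sim b_n$ means $a_n/b_n\to1$. -}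

module Defs where

open import Data.Integer as ℤ using (+_; -[1+_])
import Data.Integer.Properties as ℤ
open import Data.Nat as ℕ using (ℕ; zero; suc)
import Data.Nat.Coprimality as Coprime
import Data.Nat.Properties as ℕ
import Data.Nat.Solver
open import Data.Product using (Σ; ∃; _×_; _,_; proj₁; proj₂)
open import Data.Rational as ℚ using (ℚ; mkℚ; 0ℚ; 1ℚ; ½)
import Data.Rational.Properties as ℚ
open import Data.Rational.Solver using (module +-*-Solver)
open import Data.Rational.Unnormalised as ℚᵘ using (mkℚᵘ)
import Data.Rational.Unnormalised.Properties as ℚᵘ
open import Data.Sum using (inj₁; inj₂)
open import Relation.Binary.PropositionalEquality
open import Relation.Nullary using (¬_; Dec; yes; no; contradiction)

0<1 : 0ℚ ℚ.< 1ℚ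
0<1 = ℚ.positive⁻¹ 1ℚ

pos-* : ∀ {p q} → 0ℚ ℚ.< p → 0ℚ ℚ.< q → 0ℚ ℚ.< p ℚ.* q
pos-* {p} {q} 0<p 0<q =
  ℚ.positive⁻¹ (p ℚ.* q) {{ℚ.pos*pos⇒pos p {{ℚ.positive 0<p}} q {{ℚ.positive 0<q}}}}

half : ℚ → ℚ
half ε = ½ ℚ.* ε

0<half : ∀ {ε} → 0ℚ ℚ.< ε → 0ℚ ℚ.< half ε
0<half = pos-* (ℚ.positive⁻¹ ½)

half+half : ∀ ε → half ε ℚ.+ half ε ≡ ε
half+half = solve 1 (λ e → con ½ :* e :+ con ½ :* e := e) refl
  where open +-*-Solver

*-mono-≤ : ∀ {p q r s} → 0ℚ ℚ.≤ r → 0ℚ ℚ.≤ q →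
           p ℚ.≤ q → r ℚ.≤ s → p ℚ.* r ℚ.≤ q ℚ.* s
*-mono-≤ {p} {q} {r} {s} 0≤r 0≤q p≤q r≤s = ℚ.≤-trans
  (ℚ.*-monoʳ-≤-nonNeg r {{ℚ.nonNegative 0≤r}} p≤q)
  (ℚ.*-monoˡ-≤-nonNeg q {{ℚ.nonNegative 0≤q}} r≤s)

triangle : ∀ p q r → ℚ.∣ p ℚ.- r ∣ ℚ.≤ ℚ.∣ p ℚ.- q ∣ ℚ.+ ℚ.∣ q ℚ.- r ∣
triangle p q r = subst (λ x → ℚ.∣ x ∣ ℚ.≤ ℚ.∣ p ℚ.- q ∣ ℚ.+ ℚ.∣ q ℚ.- r ∣)
  (solve 3 (λ p q r → (p :- q) :+ (q :- r) := p :- r) refl p q r)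
  (ℚ.∣p+q∣≤∣p∣+∣q∣ (p ℚ.- q) (q ℚ.- r))
  where open +-*-Solver

∣-∣-comm : ∀ p q → ℚ.∣ p ℚ.- q ∣ ≡ ℚ.∣ q ℚ.- p ∣
∣-∣-comm p q = trans (sym (ℚ.∣-p∣≡∣p∣ (p ℚ.- q)))
  (cong ℚ.∣_∣ (solve 2 (λ p q → :- (p :- q) := q :- p) refl p q))
  where open +-*-Solver

p≤∣p∣ : ∀ p → p ℚ.≤ ℚ.∣ p ∣
p≤∣p∣ p with ℚ.≤-total 0ℚ p
... | inj₁ 0≤p = ℚ.≤-reflexive (sym (ℚ.0≤p⇒∣p∣≡p 0≤p))
... | inj₂ p≤0 = ℚ.≤-trans p≤0 (ℚ.0≤∣p∣ p)

p-q≤r⇒p≤q+r : ∀ {p q r} → p ℚ.- q ℚ.≤ r → p ℚ.≤ q ℚ.+ r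
p-q≤r⇒p≤q+r {p} {q} {r} h = subst (ℚ._≤ q ℚ.+ r)
  (solve 2 (λ p q → q :+ (p :- q) := p) refl p q) (ℚ.+-monoʳ-≤ q h)
  where open +-*-Solver

p≤q+r⇒p-q≤r : ∀ {p q r} → p ℚ.≤ q ℚ.+ r → p ℚ.- q ℚ.≤ r
p≤q+r⇒p-q≤r {p} {q} {r} h = subst (p ℚ.- q ℚ.≤_)
  (solve 2 (λ q r → (q :+ r) :- q := r) refl q r) (ℚ.+-monoˡ-≤ (ℚ.- q) h)
  where open +-*-Solver

∣p-q∣<r : ∀ {p q r} → p ℚ.- q ℚ.< r → q ℚ.- p ℚ.< r → ℚ.∣ p ℚ.- q ∣ ℚ.< r
∣p-q∣<r {p} {q} {r} h₁ h₂ with ℚ.∣p∣≡p∨∣p∣≡-p (p ℚ.- q)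
... | inj₁ eq = subst (ℚ._< r) (sym eq) h₁
... | inj₂ eq = subst (ℚ._< r)
  (sym (trans eq (solve 2 (λ p q → :- (p :- q) := q :- p) refl p q))) h₂
  where open +-*-Solver

∣∣p∣-∣q∣∣≤∣p-q∣ : ∀ p q → ℚ.∣ ℚ.∣ p ∣ ℚ.- ℚ.∣ q ∣ ∣ ℚ.≤ ℚ.∣ p ℚ.- q ∣
∣∣p∣-∣q∣∣≤∣p-q∣ p q with ℚ.∣p∣≡p∨∣p∣≡-p (ℚ.∣ p ∣ ℚ.- ℚ.∣ q ∣)
... | inj₁ eq = subst (ℚ._≤ ℚ.∣ p ℚ.- q ∣) (sym eq) (one-side p q)
  where
  one-side : ∀ p q → ℚ.∣ p ∣ ℚ.- ℚ.∣ q ∣ ℚ.≤ ℚ.∣ p ℚ.- q ∣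
  one-side p q = p≤q+r⇒p-q≤r (subst (λ x → ℚ.∣ x ∣ ℚ.≤ ℚ.∣ q ∣ ℚ.+ ℚ.∣ p ℚ.- q ∣)
    (solve 2 (λ p q → q :+ (p :- q) := p) refl p q)
    (ℚ.∣p+q∣≤∣p∣+∣q∣ q (p ℚ.- q)))
    where open +-*-Solver
... | inj₂ eq = subst₂ ℚ._≤_
  (sym (trans eq (solve 2 (λ p q → :- (p :- q) := q :- p) refl ℚ.∣ p ∣ ℚ.∣ q ∣)))
  (∣-∣-comm q p) (one-side q p)
  where
  open +-*-Solver
  one-side : ∀ p q → ℚ.∣ p ∣ ℚ.- ℚ.∣ q ∣ ℚ.≤ ℚ.∣ p ℚ.- q ∣
  one-side p q = p≤q+r⇒p-q≤r (subst (λ x → ℚ.∣ x ∣ ℚ.≤ ℚ.∣ q ∣ ℚ.+ ℚ.∣ p ℚ.- q ∣)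
    (solve 2 (λ p q → q :+ (p :- q) := p) refl p q)
    (ℚ.∣p+q∣≤∣p∣+∣q∣ q (p ℚ.- q)))

_÷⁺_ : (p : ℚ) {q : ℚ} → 0ℚ ℚ.< q → ℚ
_÷⁺_ p {q} 0<q = (p ℚ.÷ q) {{ℚ.>-nonZero 0<q}}

÷⁺-pos : ∀ {p q} → 0ℚ ℚ.< p → (0<q : 0ℚ ℚ.< q) → 0ℚ ℚ.< p ÷⁺ 0<q
÷⁺-pos {p} {q} 0<p 0<q = pos-* 0<p
  (ℚ.positive⁻¹ _ {{ℚ.1/pos⇒pos q {{ℚ.positive 0<q}}}})

÷⁺-* : ∀ p {q} (0<q : 0ℚ ℚ.< q) → (p ÷⁺ 0<q) ℚ.* q ≡ p
÷⁺-* p {q} 0<q = trans (ℚ.*-assoc p _ q)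
  (trans (cong (p ℚ.*_) (ℚ.*-inverseˡ q {{ℚ.>-nonZero 0<q}})) (ℚ.*-identityʳ p))

Cauchy : (ℕ → ℚ) → Set
Cauchy u = ∀ ε → 0ℚ ℚ.< ε → ∃ λ N → ∀ m n → N ℕ.≤ m → N ℕ.≤ n → ℚ.∣ u m ℚ.- u n ∣ ℚ.< ε

-- Two such sequences denote the same real when their difference tends to 0; everything used to
-- state the theorem respects this equivalence.
record ℝ : Set where
  constructor mkℝ
  field
    approx : ℕ → ℚ
    cauchy : Cauchy approx

open ℝ public

fromℚ : ℚ → ℝ
fromℚ q .approx _ = q
fromℚ q .cauchy ε 0<ε = 0 , λ _ _ _ _ →
  subst (ℚ._< ε) (cong ℚ.∣_∣ (sym (ℚ.+-inverseʳ q))) 0<ε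

fromℕ : ℕ → ℝ
fromℕ n = fromℚ (+ n ℚ./ 1)

infixl 6 _+_ _-_
infixl 7 _*_
infix 8 -_
infixr 8 _^_

-_ : ℝ → ℝ
(- x) .approx n = ℚ.- approx x n
(- x) .cauchy ε 0<ε = let N , h = cauchy x ε 0<ε in N , λ m n N≤m N≤n →
  subst (ℚ._< ε)
    (trans (∣-∣-comm (approx x m) (approx x n)) (cong ℚ.∣_∣
      (solve 2 (λ p q → q :- p := :- p :- :- q) refl (approx x m) (approx x n))))
    (h m n N≤m N≤n)
  where open +-*-Solver

∣_∣ : ℝ → ℝ
∣ x ∣ .approx n = ℚ.∣ approx x n ∣
∣ x ∣ .cauchy ε 0<ε = let N , h = cauchy x ε 0<ε in N , λ m n N≤m N≤n →
  ℚ.≤-<-trans (∣∣p∣-∣q∣∣≤∣p-q∣ (approx x m) (approx x n)) (h m n N≤m N≤n)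

_+_ : ℝ → ℝ → ℝ
(x + y) .approx n = approx x n ℚ.+ approx y n
(x + y) .cauchy ε 0<ε =
  let M , f = cauchy x (half ε) (0<half 0<ε)
      N , g = cauchy y (half ε) (0<half 0<ε)
  in M ℕ.⊔ N , λ m n M⊔N≤m M⊔N≤n → begin-strict
    ℚ.∣ (approx x m ℚ.+ approx y m) ℚ.- (approx x n ℚ.+ approx y n) ∣
      ≡⟨ cong ℚ.∣_∣ (solve 4 (λ a b c d → (a :+ b) :- (c :+ d) := (a :- c) :+ (b :- d)) refl
           (approx x m) (approx y m) (approx x n) (approx y n)) ⟩
    ℚ.∣ (approx x m ℚ.- approx x n) ℚ.+ (approx y m ℚ.- approx y n) ∣
      ≤⟨ ℚ.∣p+q∣≤∣p∣+∣q∣ (approx x m ℚ.- approx x n) (approx y m ℚ.- approx y n) ⟩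
    ℚ.∣ approx x m ℚ.- approx x n ∣ ℚ.+ ℚ.∣ approx y m ℚ.- approx y n ∣
      <⟨ ℚ.+-mono-<
           (f m n (ℕ.m⊔n≤o⇒m≤o M N M⊔N≤m) (ℕ.m⊔n≤o⇒m≤o M N M⊔N≤n))
           (g m n (ℕ.m⊔n≤o⇒n≤o M N M⊔N≤m) (ℕ.m⊔n≤o⇒n≤o M N M⊔N≤n)) ⟩
    half ε ℚ.+ half ε
      ≡⟨ half+half ε ⟩
    ε ∎
  where
  open +-*-Solver using (solve; _:+_; _:-_; _:=_)
  open ℚ.≤-Reasoning

_-_ : ℝ → ℝ → ℝ
x - y = x + - y

bounded : ∀ x → ∃ λ B → 0ℚ ℚ.≤ B × ∃ λ N → ∀ n → N ℕ.≤ n → ℚ.∣ approx x n ∣ ℚ.≤ B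
bounded x = let N , h = cauchy x 1ℚ 0<1 in
  ℚ.∣ approx x N ∣ ℚ.+ 1ℚ ,
  ℚ.+-mono-≤ (ℚ.0≤∣p∣ (approx x N)) (ℚ.<⇒≤ 0<1) ,
  N , λ n N≤n → p-q≤r⇒p≤q+r (ℚ.≤-trans (p≤∣p∣ _)
    (ℚ.≤-trans (∣∣p∣-∣q∣∣≤∣p-q∣ (approx x n) (approx x N))
      (ℚ.<⇒≤ (h n N N≤n ℕ.≤-refl))))

p≤p+q : ∀ {p q} → 0ℚ ℚ.≤ q → p ℚ.≤ p ℚ.+ q
p≤p+q {p} {q} 0≤q = subst (ℚ._≤ p ℚ.+ q) (ℚ.+-identityʳ p) (ℚ.+-monoʳ-≤ p 0≤q)

q≤p+q : ∀ {p q} → 0ℚ ℚ.≤ p → q ℚ.≤ p ℚ.+ q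
q≤p+q {p} {q} 0≤p = subst (ℚ._≤ p ℚ.+ q) (ℚ.+-identityˡ q) (ℚ.+-monoˡ-≤ q 0≤p)

_*_ : ℝ → ℝ → ℝ
(x * y) .approx n = approx x n ℚ.* approx y n
(x * y) .cauchy ε 0<ε =
  let A , 0≤A , K , a = bounded x
      B , 0≤B , L , b = bounded y
      C = (A ℚ.+ B) ℚ.+ 1ℚ
      0≤A+B = ℚ.+-mono-≤ 0≤A 0≤B
      A≤C = ℚ.≤-trans (p≤p+q 0≤B) (p≤p+q (ℚ.<⇒≤ 0<1))
      B≤C = ℚ.≤-trans (q≤p+q 0≤A) (p≤p+q (ℚ.<⇒≤ 0<1))
      0<C = ℚ.+-mono-≤-< 0≤A+B 0<1
      δ = half ε ÷⁺ 0<C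
      0<δ = ÷⁺-pos (0<half 0<ε) 0<C
      M , f = cauchy x δ 0<δ
      N , g = cauchy y δ 0<δ
  in (K ℕ.⊔ L) ℕ.⊔ (M ℕ.⊔ N) , λ m n ≤m ≤n →
    let K⊔L≤m = ℕ.m⊔n≤o⇒m≤o (K ℕ.⊔ L) (M ℕ.⊔ N) ≤m
        K⊔L≤n = ℕ.m⊔n≤o⇒m≤o (K ℕ.⊔ L) (M ℕ.⊔ N) ≤n
        M⊔N≤m = ℕ.m⊔n≤o⇒n≤o (K ℕ.⊔ L) (M ℕ.⊔ N) ≤m
        M⊔N≤n = ℕ.m⊔n≤o⇒n≤o (K ℕ.⊔ L) (M ℕ.⊔ N) ≤n
        p = approx x m ; q = approx y m ; r = approx x n ; s = approx y n
    in begin-strict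
    ℚ.∣ p ℚ.* q ℚ.- r ℚ.* s ∣
      ≡⟨ cong ℚ.∣_∣ (solve 4 (λ p q r s → p :* q :- r :* s := (q :- s) :* p :+ (p :- r) :* s)
           refl p q r s) ⟩
    ℚ.∣ (q ℚ.- s) ℚ.* p ℚ.+ (p ℚ.- r) ℚ.* s ∣
      ≤⟨ ℚ.∣p+q∣≤∣p∣+∣q∣ ((q ℚ.- s) ℚ.* p) ((p ℚ.- r) ℚ.* s) ⟩
    ℚ.∣ (q ℚ.- s) ℚ.* p ∣ ℚ.+ ℚ.∣ (p ℚ.- r) ℚ.* s ∣
      ≡⟨ cong₂ ℚ._+_ (ℚ.∣p*q∣≡∣p∣*∣q∣ (q ℚ.- s) p) (ℚ.∣p*q∣≡∣p∣*∣q∣ (p ℚ.- r) s) ⟩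
    ℚ.∣ q ℚ.- s ∣ ℚ.* ℚ.∣ p ∣ ℚ.+ ℚ.∣ p ℚ.- r ∣ ℚ.* ℚ.∣ s ∣
      ≤⟨ ℚ.+-mono-≤
           (ℚ.*-monoˡ-≤-nonNeg ℚ.∣ q ℚ.- s ∣ {{ℚ.∣-∣-nonNeg (q ℚ.- s)}}
             (ℚ.≤-trans (a m (ℕ.m⊔n≤o⇒m≤o K L K⊔L≤m)) A≤C))
           (ℚ.*-monoˡ-≤-nonNeg ℚ.∣ p ℚ.- r ∣ {{ℚ.∣-∣-nonNeg (p ℚ.- r)}}
             (ℚ.≤-trans (b n (ℕ.m⊔n≤o⇒n≤o K L K⊔L≤n)) B≤C)) ⟩
    ℚ.∣ q ℚ.- s ∣ ℚ.* C ℚ.+ ℚ.∣ p ℚ.- r ∣ ℚ.* C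
      <⟨ ℚ.+-mono-<
           (ℚ.*-monoˡ-<-pos C {{ℚ.positive 0<C}}
             (g m n (ℕ.m⊔n≤o⇒n≤o M N M⊔N≤m) (ℕ.m⊔n≤o⇒n≤o M N M⊔N≤n)))
           (ℚ.*-monoˡ-<-pos C {{ℚ.positive 0<C}}
             (f m n (ℕ.m⊔n≤o⇒m≤o M N M⊔N≤m) (ℕ.m⊔n≤o⇒m≤o M N M⊔N≤n))) ⟩
    δ ℚ.* C ℚ.+ δ ℚ.* C
      ≡⟨ cong₂ ℚ._+_ (÷⁺-* (half ε) 0<C) (÷⁺-* (half ε) 0<C) ⟩
    half ε ℚ.+ half ε
      ≡⟨ half+half ε ⟩
    ε ∎
  where
  open +-*-Solver using (solve; _:+_; _:-_; _:*_; _:=_)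
  open ℚ.≤-Reasoning

_^_ : ℝ → ℕ → ℝ
x ^ zero = fromℕ 1
x ^ suc n = x * x ^ n

infix 4 _<_ _#0

Positive : ℝ → Set
Positive x = ∃ λ δ → 0ℚ ℚ.< δ × ∃ λ N → ∀ n → N ℕ.≤ n → δ ℚ.≤ approx x n

_<_ : ℝ → ℝ → Set
x < y = Positive (y - x)

_#0 : ℝ → Set
x #0 = Positive ∣ x ∣

-- 1/q, with the value 0 at q = 0
inverse : ℚ → ℚ
inverse q with q ℚ.≟ 0ℚ
... | yes _  = 0ℚ
... | no q≢0 = (ℚ.1/ q) {{ℚ.≢-nonZero q≢0}}

inverse-* : ∀ {q} → 0ℚ ℚ.< ℚ.∣ q ∣ → inverse q ℚ.* q ≡ 1ℚ
inverse-* {q} 0<∣q∣ with q ℚ.≟ 0ℚ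
... | yes refl = contradiction refl (ℚ.<⇒≢ 0<∣q∣)
... | no q≢0  = ℚ.*-inverseˡ q {{ℚ.≢-nonZero q≢0}}

inverse-diff : ∀ {a b δ ε} → 0ℚ ℚ.< δ → δ ℚ.≤ ℚ.∣ a ∣ → δ ℚ.≤ ℚ.∣ b ∣ →
               ℚ.∣ a ℚ.- b ∣ ℚ.< ε ℚ.* (δ ℚ.* δ) → ℚ.∣ inverse a ℚ.- inverse b ∣ ℚ.< ε
inverse-diff {a} {b} {δ} {ε} 0<δ δ≤a δ≤b a-b<εδδ =
  ℚ.*-cancelʳ-<-nonNeg (δ ℚ.* δ) {{ℚ.nonNegative (ℚ.<⇒≤ (pos-* 0<δ 0<δ))}} (begin-strict
    ℚ.∣ a⁻¹ ℚ.- b⁻¹ ∣ ℚ.* (δ ℚ.* δ)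
      ≤⟨ ℚ.*-monoˡ-≤-nonNeg ℚ.∣ a⁻¹ ℚ.- b⁻¹ ∣ {{ℚ.∣-∣-nonNeg (a⁻¹ ℚ.- b⁻¹)}}
           (*-mono-≤ (ℚ.<⇒≤ 0<δ) (ℚ.0≤∣p∣ a) δ≤a δ≤b) ⟩
    ℚ.∣ a⁻¹ ℚ.- b⁻¹ ∣ ℚ.* (ℚ.∣ a ∣ ℚ.* ℚ.∣ b ∣)
      ≡⟨ cong (ℚ.∣ a⁻¹ ℚ.- b⁻¹ ∣ ℚ.*_) (sym (ℚ.∣p*q∣≡∣p∣*∣q∣ a b)) ⟩
    ℚ.∣ a⁻¹ ℚ.- b⁻¹ ∣ ℚ.* ℚ.∣ a ℚ.* b ∣
      ≡⟨ sym (ℚ.∣p*q∣≡∣p∣*∣q∣ (a⁻¹ ℚ.- b⁻¹) (a ℚ.* b)) ⟩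
    ℚ.∣ (a⁻¹ ℚ.- b⁻¹) ℚ.* (a ℚ.* b) ∣
      ≡⟨ cong ℚ.∣_∣ (solve 4 (λ a b i j → (i :- j) :* (a :* b) := (i :* a) :* b :- (j :* b) :* a)
           refl a b a⁻¹ b⁻¹) ⟩
    ℚ.∣ (a⁻¹ ℚ.* a) ℚ.* b ℚ.- (b⁻¹ ℚ.* b) ℚ.* a ∣
      ≡⟨ cong₂ (λ p q → ℚ.∣ p ℚ.* b ℚ.- q ℚ.* a ∣)
           (inverse-* {a} (ℚ.<-≤-trans 0<δ δ≤a)) (inverse-* {b} (ℚ.<-≤-trans 0<δ δ≤b)) ⟩
    ℚ.∣ 1ℚ ℚ.* b ℚ.- 1ℚ ℚ.* a ∣
      ≡⟨ cong₂ (λ p q → ℚ.∣ p ℚ.- q ∣) (ℚ.*-identityˡ b) (ℚ.*-identityˡ a) ⟩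
    ℚ.∣ b ℚ.- a ∣
      ≡⟨ ∣-∣-comm b a ⟩
    ℚ.∣ a ℚ.- b ∣
      <⟨ a-b<εδδ ⟩
    ε ℚ.* (δ ℚ.* δ) ∎)
  where
  open +-*-Solver using (solve; _:+_; _:-_; _:*_; _:=_)
  open ℚ.≤-Reasoning
  a⁻¹ = inverse a
  b⁻¹ = inverse b

infix 8 _⁻¹[_]
-- The proof of apartness provides only the modulus; finitely many approximations of x may be 0.
_⁻¹[_] : (x : ℝ) → x #0 → ℝ
(x ⁻¹[ _ ]) .approx n = inverse (approx x n)
(x ⁻¹[ δ , 0<δ , M , δ≤x ]) .cauchy ε 0<ε =
  let N , h = cauchy x (ε ℚ.* (δ ℚ.* δ)) (pos-* 0<ε (pos-* 0<δ 0<δ))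
  in M ℕ.⊔ N , λ m n ≤m ≤n → inverse-diff {approx x m} {approx x n} 0<δ
    (δ≤x m (ℕ.m⊔n≤o⇒m≤o M N ≤m)) (δ≤x n (ℕ.m⊔n≤o⇒m≤o M N ≤n))
    (h m n (ℕ.m⊔n≤o⇒n≤o M N ≤m) (ℕ.m⊔n≤o⇒n≤o M N ≤n))

infixl 7 _÷_[_]
_÷_[_] : (x y : ℝ) → y #0 → ℝ
x ÷ y [ y#0 ] = x * y ⁻¹[ y#0 ]

ι : ℕ → ℚ
ι n = mkℚ (+ n) 0 (Coprime.sym (Coprime.1-coprimeTo n))

ι≡ : ∀ n → + n ℚ./ 1 ≡ ι n
ι≡ n = ℚ.normalize-coprime (Coprime.sym (Coprime.1-coprimeTo n))

ι-suc : ∀ n → ι (suc n) ≡ ι n ℚ.+ 1ℚ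
ι-suc n = trans (sym (ι≡ (suc n))) (ℚ./-cong
  (sym (trans (cong (ℤ._+ + 1) (ℤ.*-identityʳ (+ n))) (cong +_ (ℕ.+-comm n 1)))) refl)

0≤ι : ∀ n → 0ℚ ℚ.≤ ι n
0≤ι n = ℚ.nonNegative⁻¹ (ι n)

<-ι : ∀ q → ∃ λ n → q ℚ.< ι n
<-ι q@(mkℚ (+ p) d _) = suc p , ℚ.*<* (subst₂ ℤ._<_ (ℤ.pos-* p 1) (ℤ.pos-* (suc p) (suc d)) (ℤ.+<+ (begin-strict
  p ℕ.* 1         ≡⟨ ℕ.*-identityʳ p ⟩
  p               <⟨ ℕ.n<1+n p ⟩
  suc p           ≤⟨ ℕ.m≤m*n (suc p) (suc d) ⟩
  suc p ℕ.* suc d ∎)))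
  where open ℕ.≤-Reasoning
<-ι (mkℚ -[1+ p ] d _) = 0 , ℚ.*<* ℤ.-<+

1/suc : ℕ → ℚ
1/suc n = ℚ.1/ ι (suc n)

0<1/suc : ∀ n → 0ℚ ℚ.< 1/suc n
0<1/suc n = ℚ.positive⁻¹ (1/suc n)

1/suc<ε : ∀ ε → 0ℚ ℚ.< ε → ∃ λ N → ∀ n → N ℕ.≤ n → 1/suc n ℚ.< ε
1/suc<ε ε@(mkℚ (+ zero) _ _) (ℚ.*<* (ℤ.+<+ ()))
1/suc<ε ε@(mkℚ (+ suc p) d _) _ = suc d , λ n d<n → ℚ.*<* (subst₂ ℤ._<_ (ℤ.pos-* 1 (suc d)) (ℤ.pos-* (suc p) (suc n)) (ℤ.+<+ (begin-strict
  1 ℕ.* suc d     ≡⟨ ℕ.*-identityˡ (suc d) ⟩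
  suc d           <⟨ ℕ.s≤s d<n ⟩
  suc n           ≤⟨ ℕ.m≤n*m (suc n) (suc p) ⟩
  suc p ℕ.* suc n ∎)))
  where open ℕ.≤-Reasoning
1/suc<ε (mkℚ -[1+ p ] d _) (ℚ.*<* ())

find : ∀ {P : ℕ → Set} → (∀ n → Dec (P n)) → P 0 → ∀ n → ¬ P n → ∃ λ i → P i × ¬ P (suc i)
find P? p₀ zero    ¬p = contradiction p₀ ¬p
find P? p₀ (suc n) ¬p with P? n
... | yes p  = n , p , ¬p
... | no ¬p′ = find P? p₀ n ¬p′

sq : ℚ → ℚ
sq q = q ℚ.* q

sq-mono : ∀ {p q} → 0ℚ ℚ.≤ p → p ℚ.≤ q → sq p ℚ.≤ sq q
sq-mono 0≤p p≤q = *-mono-≤ 0≤p (ℚ.≤-trans 0≤p p≤q) p≤q p≤q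

-- a rational approximation r of the square root of max(q, 0): r ≤ √q < r + 1/(n+1)
sqrtSpec : ∀ q n → ∃ λ r → 0ℚ ℚ.≤ r × sq r ℚ.≤ q ℚ.⊔ 0ℚ × q ℚ.⊔ 0ℚ ℚ.< sq (r ℚ.+ 1/suc n)
sqrtSpec q n =
  let b , b> = <-ι ((q⁺ ℚ.+ 1ℚ) ℚ.* ι (suc n))
      i , ≤q⁺ , ≰q⁺ = find (λ i → sq (ι i ℚ.* h) ℚ.≤? q⁺) P0 b
                          (λ ≤q⁺ → ℚ.<-irrefl refl (ℚ.<-≤-trans (large b b>) ≤q⁺))
  in ι i ℚ.* h ,
     subst (ℚ._≤ ι i ℚ.* h) (ℚ.*-zeroʳ 0ℚ) (*-mono-≤ ℚ.≤-refl (0≤ι i) (0≤ι i) 0≤h) ,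
     ≤q⁺ ,
     subst (λ r → q⁺ ℚ.< sq r) (next i) (ℚ.≰⇒> ≰q⁺)
  where
  open ℚ.≤-Reasoning
  h = 1/suc n
  q⁺ = q ℚ.⊔ 0ℚ
  0≤h = ℚ.<⇒≤ (0<1/suc n)
  0≤q⁺ : 0ℚ ℚ.≤ q⁺
  0≤q⁺ = ℚ.p≤q⊔p q 0ℚ
  P0 : sq (ι 0 ℚ.* h) ℚ.≤ q⁺
  P0 = subst (λ r → sq r ℚ.≤ q⁺) (sym (ℚ.*-zeroˡ h)) 0≤q⁺
  next : ∀ i → ι (suc i) ℚ.* h ≡ ι i ℚ.* h ℚ.+ h
  next i = trans (cong (ℚ._* h) (ι-suc i)) (trans (ℚ.*-distribʳ-+ h (ι i) 1ℚ)
    (cong (ι i ℚ.* h ℚ.+_) (ℚ.*-identityˡ h)))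
  large : ∀ b → (q⁺ ℚ.+ 1ℚ) ℚ.* ι (suc n) ℚ.< ι b → q⁺ ℚ.< sq (ι b ℚ.* h)
  large b b> = begin-strict
    q⁺                              ≡⟨ sym (ℚ.*-identityʳ q⁺) ⟩
    q⁺ ℚ.* 1ℚ                       ≤⟨ *-mono-≤ (ℚ.<⇒≤ 0<1) (ℚ.≤-trans 0≤q⁺ q⁺≤) q⁺≤ 1≤ ⟩
    (q⁺ ℚ.+ 1ℚ) ℚ.* (q⁺ ℚ.+ 1ℚ)     <⟨ ℚ.*-monoʳ-<-pos (q⁺ ℚ.+ 1ℚ) {{ℚ.positive 0<q⁺+1}} below ⟩
    (q⁺ ℚ.+ 1ℚ) ℚ.* (ι b ℚ.* h)     ≤⟨ ℚ.*-monoʳ-≤-nonNeg (ι b ℚ.* h)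
                                         {{ℚ.nonNegative (ℚ.<⇒≤ (ℚ.<-trans 0<q⁺+1 below))}} (ℚ.<⇒≤ below) ⟩
    sq (ι b ℚ.* h)                  ∎
    where
    q⁺≤ : q⁺ ℚ.≤ q⁺ ℚ.+ 1ℚ
    q⁺≤ = p≤p+q (ℚ.<⇒≤ 0<1)
    1≤ : 1ℚ ℚ.≤ q⁺ ℚ.+ 1ℚ
    1≤ = q≤p+q 0≤q⁺
    0<q⁺+1 : 0ℚ ℚ.< q⁺ ℚ.+ 1ℚ
    0<q⁺+1 = ℚ.<-≤-trans 0<1 1≤
    below : q⁺ ℚ.+ 1ℚ ℚ.< ι b ℚ.* h
    below = subst (ℚ._< ι b ℚ.* h)
      (trans (ℚ.*-assoc (q⁺ ℚ.+ 1ℚ) (ι (suc n)) h)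
        (trans (cong ((q⁺ ℚ.+ 1ℚ) ℚ.*_) (ℚ.*-inverseʳ (ι (suc n)))) (ℚ.*-identityʳ _)))
      (ℚ.*-monoˡ-<-pos h b>)

⊔0-diff : ∀ {p q ε} → 0ℚ ℚ.< ε → p ℚ.- q ℚ.< ε → p ℚ.⊔ 0ℚ ℚ.≤ (q ℚ.⊔ 0ℚ) ℚ.+ ε
⊔0-diff {p} {q} {ε} 0<ε p-q<ε = ℚ.⊔-lub
  (ℚ.≤-trans (p-q≤r⇒p≤q+r {p} {q} (ℚ.<⇒≤ p-q<ε)) (ℚ.+-monoˡ-≤ ε (ℚ.p≤p⊔q q 0ℚ)))
  (ℚ.≤-trans (ℚ.p≤q⊔p q 0ℚ) (p≤p+q (ℚ.<⇒≤ 0<ε)))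

sqrt-diff : ∀ {p q ε r s h} → 0ℚ ℚ.< ε → 0ℚ ℚ.< h → h ℚ.< half ε → p ℚ.- q ℚ.< sq (half ε) →
            sq r ℚ.≤ p ℚ.⊔ 0ℚ → 0ℚ ℚ.≤ s → q ℚ.⊔ 0ℚ ℚ.< sq (s ℚ.+ h) → r ℚ.- s ℚ.< ε
sqrt-diff {p} {q} {ε} {r} {s} {h} 0<ε 0<h h<e p-q<ee rr≤p 0≤s q<tt with r ℚ.- s ℚ.<? ε
... | yes r-s<ε = r-s<ε
... | no  r-s≮ε = contradiction (begin-strict
  sq r                          ≤⟨ rr≤p ⟩
  p ℚ.⊔ 0ℚ                      ≤⟨ ⊔0-diff {p} {q} (pos-* 0<e 0<e) p-q<ee ⟩
  (q ℚ.⊔ 0ℚ) ℚ.+ sq e           <⟨ ℚ.+-monoˡ-< (sq e) q<tt ⟩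
  sq t ℚ.+ sq e                 ≤⟨ p≤p+q 0≤te+te ⟩
  sq t ℚ.+ sq e ℚ.+ (t ℚ.* e ℚ.+ t ℚ.* e)
    ≡⟨ solve 2 (λ t e → t :* t :+ e :* e :+ (t :* e :+ t :* e) := (t :+ e) :* (t :+ e)) refl t e ⟩
  sq (t ℚ.+ e)                  ≤⟨ sq-mono (ℚ.+-mono-≤ 0≤t (ℚ.<⇒≤ 0<e)) t+e≤r ⟩
  sq r                          ∎) (ℚ.<-irrefl refl)
  where
  open +-*-Solver using (solve; _:+_; _:-_; _:*_; _:=_)
  open ℚ.≤-Reasoning
  e = half ε
  t = s ℚ.+ h
  0<e = 0<half 0<ε
  0≤t : 0ℚ ℚ.≤ t
  0≤t = ℚ.+-mono-≤ 0≤s (ℚ.<⇒≤ 0<h)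
  0≤te : 0ℚ ℚ.≤ t ℚ.* e
  0≤te = subst (ℚ._≤ t ℚ.* e) (ℚ.*-zeroʳ 0ℚ) (*-mono-≤ ℚ.≤-refl 0≤t 0≤t (ℚ.<⇒≤ 0<e))
  0≤te+te = ℚ.+-mono-≤ 0≤te 0≤te
  t+e≤r : t ℚ.+ e ℚ.≤ r
  t+e≤r = begin
    (s ℚ.+ h) ℚ.+ e  ≤⟨ ℚ.+-monoˡ-≤ e (ℚ.+-monoʳ-≤ s (ℚ.<⇒≤ h<e)) ⟩
    (s ℚ.+ e) ℚ.+ e        ≡⟨ trans (ℚ.+-assoc s e e) (cong (s ℚ.+_) (half+half ε)) ⟩
    s ℚ.+ ε                ≤⟨ ℚ.+-monoʳ-≤ s (ℚ.≮⇒≥ r-s≮ε) ⟩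
    s ℚ.+ (r ℚ.- s)        ≡⟨ solve 2 (λ s r → s :+ (r :- s) := r) refl s r ⟩
    r                      ∎

infix 9 √_

-- square root of max(x, 0)
√_ : ℝ → ℝ
(√ x) .approx n = proj₁ (sqrtSpec (approx x n) n)
(√ x) .cauchy ε 0<ε =
  let M , f = 1/suc<ε (half ε) (0<half 0<ε)
      N , g = cauchy x (sq (half ε)) (pos-* (0<half 0<ε) (0<half 0<ε))
      bound : ∀ m n → M ℕ.⊔ N ℕ.≤ m → M ℕ.⊔ N ℕ.≤ n → (√ x) .approx m ℚ.- (√ x) .approx n ℚ.< ε
      bound m n ≤m ≤n =
        let _ , _ , rr≤ , _ = sqrtSpec (approx x m) m
            _ , 0≤s , _ , <tt = sqrtSpec (approx x n) n
        in sqrt-diff {approx x m} {approx x n} {r = (√ x) .approx m} {s = (√ x) .approx n} 0<ε (0<1/suc n) (f n (ℕ.m⊔n≤o⇒m≤o M N ≤n))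
          (ℚ.≤-<-trans (p≤∣p∣ _) (g m n (ℕ.m⊔n≤o⇒n≤o M N ≤m) (ℕ.m⊔n≤o⇒n≤o M N ≤n)))
          rr≤ 0≤s <tt
  in M ℕ.⊔ N , λ m n ≤m ≤n → ∣p-q∣<r {(√ x) .approx m} {(√ x) .approx n} (bound m n ≤m ≤n) (bound n m ≤n ≤m)

∑< : ℕ → (ℕ → ℕ) → ℕ
∑< zero    f = 0
∑< (suc n) f = ∑< n f ℕ.+ f n

⟦_⟧ : ∀ {P : Set} → Dec P → ℕ
⟦ yes _ ⟧ = 1
⟦ no _ ⟧  = 0

-- the number of cells [i,i+1]×[j,j+1] of the first quadrant inside the disk of radius n about 0
cellsInside : ℕ → ℕ
cellsInside n = ∑< n λ i → ∑< n λ j →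
  ⟦ suc i ℕ.^ 2 ℕ.+ suc j ℕ.^ 2 ℕ.≤? n ℕ.^ 2 ⟧

module ℕS = Data.Nat.Solver.+-*-Solver

∑-mono : ∀ n {f g : ℕ → ℕ} → (∀ i → f i ℕ.≤ g i) → ∑< n f ℕ.≤ ∑< n g
∑-mono zero    h = ℕ.z≤n
∑-mono (suc n) h = ℕ.+-mono-≤ (∑-mono n h) (h n)

∑-cong : ∀ n {f g : ℕ → ℕ} → (∀ i → f i ≡ g i) → ∑< n f ≡ ∑< n g
∑-cong zero    h = refl
∑-cong (suc n) h = cong₂ ℕ._+_ (∑-cong n h) (h n)

∑-+ : ∀ n (f g : ℕ → ℕ) → ∑< n (λ i → f i ℕ.+ g i) ≡ ∑< n f ℕ.+ ∑< n g
∑-+ zero    f g = refl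
∑-+ (suc n) f g = trans (cong (ℕ._+ (f n ℕ.+ g n)) (∑-+ n f g))
  (solve 4 (λ a b c d → (a :+ b) :+ (c :+ d) := (a :+ c) :+ (b :+ d)) refl
    (∑< n f) (∑< n g) (f n) (g n))
  where open ℕS

∑-* : ∀ c n (f : ℕ → ℕ) → ∑< n (λ i → c ℕ.* f i) ≡ c ℕ.* ∑< n f
∑-* c zero    f = sym (ℕ.*-zeroʳ c)
∑-* c (suc n) f = trans (cong (ℕ._+ c ℕ.* f n) (∑-* c n f)) (sym (ℕ.*-distribˡ-+ c (∑< n f) (f n)))

∑-head : ∀ n (f : ℕ → ℕ) → ∑< (suc n) f ≡ f 0 ℕ.+ ∑< n (λ i → f (suc i))
∑-head zero    f = sym (ℕ.+-identityʳ (f 0))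
∑-head (suc n) f = trans (cong (ℕ._+ f (suc n)) (∑-head n f)) (ℕ.+-assoc (f 0) _ _)

∑-const : ∀ n c → ∑< n (λ _ → c) ≡ n ℕ.* c
∑-const zero    c = refl
∑-const (suc n) c = trans (cong (ℕ._+ c) (∑-const n c)) (ℕ.+-comm (n ℕ.* c) c)

∑-double : ∀ n (f : ℕ → ℕ) → ∑< (2 ℕ.* n) f ≡ ∑< n (λ i → f (2 ℕ.* i) ℕ.+ f (suc (2 ℕ.* i)))
∑-double zero    f = refl
∑-double (suc n) f = trans (cong (λ m → ∑< m f) (ℕ.*-suc 2 n))
  (trans (cong (λ s → s ℕ.+ f (2 ℕ.* n) ℕ.+ f (suc (2 ℕ.* n))) (∑-double n f))
    (ℕ.+-assoc _ (f (2 ℕ.* n)) (f (suc (2 ℕ.* n)))))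

∑∑ : ℕ → (ℕ → ℕ → ℕ) → ℕ
∑∑ n f = ∑< n λ i → ∑< n (f i)

quad : (ℕ → ℕ → ℕ) → ℕ → ℕ → ℕ
quad f i j = (f (2 ℕ.* i) (2 ℕ.* j) ℕ.+ f (2 ℕ.* i) (suc (2 ℕ.* j))) ℕ.+
             (f (suc (2 ℕ.* i)) (2 ℕ.* j) ℕ.+ f (suc (2 ℕ.* i)) (suc (2 ℕ.* j)))

∑∑-double : ∀ n f → ∑∑ (2 ℕ.* n) f ≡ ∑∑ n (quad f)
∑∑-double n f = trans (∑-double n _) (∑-cong n λ i →
  trans (cong₂ ℕ._+_ (∑-double n (f (2 ℕ.* i))) (∑-double n (f (suc (2 ℕ.* i)))))
    (sym (∑-+ n _ _)))

∑∑-mono : ∀ n {f g : ℕ → ℕ → ℕ} → (∀ i j → f i j ℕ.≤ g i j) → ∑∑ n f ℕ.≤ ∑∑ n g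
∑∑-mono n h = ∑-mono n λ i → ∑-mono n (h i)

∑∑-* : ∀ c n f → ∑∑ n (λ i j → c ℕ.* f i j) ≡ c ℕ.* ∑∑ n f
∑∑-* c n f = trans (∑-cong n λ i → ∑-* c n (f i)) (∑-* c n _)

⟦⟧-mono : ∀ {P Q : Set} (p : Dec P) (q : Dec Q) → (P → Q) → ⟦ p ⟧ ℕ.≤ ⟦ q ⟧
⟦⟧-mono (yes p) (yes q) h = ℕ.≤-refl
⟦⟧-mono (yes p) (no ¬q) h = contradiction (h p) ¬q
⟦⟧-mono (no ¬p) q       h = ℕ.z≤n

⟦⟧≤1 : ∀ {P : Set} (p : Dec P) → ⟦ p ⟧ ℕ.≤ 1
⟦⟧≤1 (yes p) = ℕ.≤-refl
⟦⟧≤1 (no ¬p) = ℕ.z≤n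

4* : ∀ m → (m ℕ.+ m) ℕ.+ (m ℕ.+ m) ≡ 4 ℕ.* m
4* = solve 1 (λ m → (m :+ m) :+ (m :+ m) := con 4 :* m) refl
  where open ℕS

inside : ℕ → ℕ → ℕ → ℕ
inside n i j = ⟦ suc i ℕ.^ 2 ℕ.+ suc j ℕ.^ 2 ℕ.≤? n ℕ.^ 2 ⟧

meets : ℕ → ℕ → ℕ → ℕ
meets n i j = ⟦ i ℕ.^ 2 ℕ.+ j ℕ.^ 2 ℕ.<? n ℕ.^ 2 ⟧

sqsum-mono : ∀ {i j k l} → i ℕ.≤ k → j ℕ.≤ l → i ℕ.^ 2 ℕ.+ j ℕ.^ 2 ℕ.≤ k ℕ.^ 2 ℕ.+ l ℕ.^ 2
sqsum-mono i≤k j≤l = ℕ.+-mono-≤ (ℕ.^-monoˡ-≤ 2 i≤k) (ℕ.^-monoˡ-≤ 2 j≤l)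

double-suc : ∀ i → suc (suc (2 ℕ.* i)) ≡ 2 ℕ.* suc i
double-suc i = sym (ℕ.*-suc 2 i)

sq-double : ∀ i → (2 ℕ.* i) ℕ.^ 2 ≡ 4 ℕ.* i ℕ.^ 2
sq-double = solve 1 (λ i → (con 2 :* i) :* ((con 2 :* i) :* con 1) := con 4 :* (i :* (i :* con 1))) refl
  where open ℕS

2^k*2^k : ∀ k → 2 ℕ.^ k ℕ.* 2 ℕ.^ k ≡ 4 ℕ.^ k
2^k*2^k zero    = refl
2^k*2^k (suc k) = trans
  (solve 1 (λ m → (con 2 :* m) :* (con 2 :* m) := con 4 :* (m :* m)) refl (2 ℕ.^ k))
  (cong (4 ℕ.*_) (2^k*2^k k))
  where open ℕS using (solve; _:*_; con; _:=_)

sqsum-double : ∀ i j → (2 ℕ.* i) ℕ.^ 2 ℕ.+ (2 ℕ.* j) ℕ.^ 2 ≡ 4 ℕ.* (i ℕ.^ 2 ℕ.+ j ℕ.^ 2)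
sqsum-double i j = trans (cong₂ ℕ._+_ (sq-double i) (sq-double j)) (sym (ℕ.*-distribˡ-+ 4 (i ℕ.^ 2) (j ℕ.^ 2)))

inside-down : ∀ n i j k l → k ℕ.≤ 2 ℕ.* suc i → l ℕ.≤ 2 ℕ.* suc j →
              suc i ℕ.^ 2 ℕ.+ suc j ℕ.^ 2 ℕ.≤ n ℕ.^ 2 → k ℕ.^ 2 ℕ.+ l ℕ.^ 2 ℕ.≤ (2 ℕ.* n) ℕ.^ 2
inside-down n i j k l k≤ l≤ h = begin
  k ℕ.^ 2 ℕ.+ l ℕ.^ 2                               ≤⟨ sqsum-mono k≤ l≤ ⟩
  (2 ℕ.* suc i) ℕ.^ 2 ℕ.+ (2 ℕ.* suc j) ℕ.^ 2       ≡⟨ sqsum-double (suc i) (suc j) ⟩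
  4 ℕ.* (suc i ℕ.^ 2 ℕ.+ suc j ℕ.^ 2)               ≤⟨ ℕ.*-monoʳ-≤ 4 h ⟩
  4 ℕ.* n ℕ.^ 2                                     ≡⟨ sq-double n ⟨
  (2 ℕ.* n) ℕ.^ 2                                   ∎
  where open ℕ.≤-Reasoning

inside-up : ∀ n i j k l → 2 ℕ.* i ℕ.< k → 2 ℕ.* j ℕ.< l →
            k ℕ.^ 2 ℕ.+ l ℕ.^ 2 ℕ.≤ (2 ℕ.* n) ℕ.^ 2 → i ℕ.^ 2 ℕ.+ j ℕ.^ 2 ℕ.< n ℕ.^ 2
inside-up n i j k l k> l> h = ℕ.*-cancelˡ-< 4 _ _ (begin-strict
  4 ℕ.* (i ℕ.^ 2 ℕ.+ j ℕ.^ 2)               ≡⟨ sqsum-double i j ⟨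
  (2 ℕ.* i) ℕ.^ 2 ℕ.+ (2 ℕ.* j) ℕ.^ 2       <⟨ ℕ.+-mono-<-≤ (ℕ.^-monoˡ-< 2 k>) (ℕ.^-monoˡ-≤ 2 (ℕ.<⇒≤ l>)) ⟩
  k ℕ.^ 2 ℕ.+ l ℕ.^ 2                       ≤⟨ h ⟩
  (2 ℕ.* n) ℕ.^ 2                           ≡⟨ sq-double n ⟩
  4 ℕ.* n ℕ.^ 2                             ∎)
  where open ℕ.≤-Reasoning

lower : ∀ n → 4 ℕ.* cellsInside n ℕ.≤ cellsInside (2 ℕ.* n)
lower n = begin
  4 ℕ.* ∑∑ n (inside n)                ≡⟨ ∑∑-* 4 n (inside n) ⟨
  ∑∑ n (λ i j → 4 ℕ.* inside n i j)    ≤⟨ ∑∑-mono n (λ i j → ℕ.≤-trans (ℕ.≤-reflexive (sym (4* (inside n i j))))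
      (ℕ.+-mono-≤ (ℕ.+-mono-≤ (sub i j (ev i) (ev j)) (sub i j (ev i) (od j)))
                  (ℕ.+-mono-≤ (sub i j (od i) (ev j)) (sub i j (od i) (od j))))) ⟩
  ∑∑ n (quad (inside (2 ℕ.* n)))       ≡⟨ ∑∑-double n (inside (2 ℕ.* n)) ⟨
  ∑∑ (2 ℕ.* n) (inside (2 ℕ.* n))      ∎
  where
  open ℕ.≤-Reasoning
  ev : ∀ i → suc (2 ℕ.* i) ℕ.≤ 2 ℕ.* suc i
  ev i = ℕ.≤-trans (ℕ.n≤1+n _) (ℕ.≤-reflexive (double-suc i))
  od : ∀ i → suc (suc (2 ℕ.* i)) ℕ.≤ 2 ℕ.* suc i
  od i = ℕ.≤-reflexive (double-suc i)
  sub : ∀ i j {k l} → suc k ℕ.≤ 2 ℕ.* suc i → suc l ℕ.≤ 2 ℕ.* suc j →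
        inside n i j ℕ.≤ inside (2 ℕ.* n) k l
  sub i j {k} {l} k≤ l≤ = ⟦⟧-mono (_ ℕ.≤? _) (_ ℕ.≤? _) (inside-down n i j (suc k) (suc l) k≤ l≤)

meets≤ : ∀ n → ∑∑ n (meets n) ℕ.≤ cellsInside n ℕ.+ 2 ℕ.* n
meets≤ n = begin
  ∑< n (row n)                                 ≤⟨ ℕ.m≤m+n _ _ ⟩
  ∑< (suc n) (row n)                           ≡⟨ ∑-head n (row n) ⟩
  row n 0 ℕ.+ ∑< n (λ i → row n (suc i))       ≤⟨ ℕ.+-mono-≤ (row≤ 0) (∑-mono n shifted) ⟩
  n ℕ.+ ∑< n (λ i → 1 ℕ.+ ∑< n (inside n i))   ≡⟨ cong (n ℕ.+_) (∑-+ n (λ _ → 1) _) ⟩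
  n ℕ.+ (∑< n (λ _ → 1) ℕ.+ cellsInside n)     ≡⟨ cong (λ m → n ℕ.+ (m ℕ.+ cellsInside n)) (∑-const n 1) ⟩
  n ℕ.+ (n ℕ.* 1 ℕ.+ cellsInside n)
    ≡⟨ solve 2 (λ n c → n :+ (n :* con 1 :+ c) := c :+ con 2 :* n) refl n (cellsInside n) ⟩
  cellsInside n ℕ.+ 2 ℕ.* n                    ∎
  where
  open ℕ.≤-Reasoning
  open ℕS using (solve; _:+_; _:*_; con; _:=_)
  row : ℕ → ℕ → ℕ
  row n i = ∑< n (meets n i)
  row≤ : ∀ i → row n i ℕ.≤ n
  row≤ i = ℕ.≤-trans (∑-mono n (λ j → ⟦⟧≤1 (_ ℕ.<? _)))
    (ℕ.≤-reflexive (trans (∑-const n 1) (ℕ.*-identityʳ n)))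
  shifted : ∀ i → row n (suc i) ℕ.≤ 1 ℕ.+ ∑< n (inside n i)
  shifted i = ℕ.≤-trans (ℕ.m≤m+n _ _) (ℕ.≤-trans (ℕ.≤-reflexive (∑-head n (meets n (suc i))))
    (ℕ.+-mono-≤ (⟦⟧≤1 (_ ℕ.<? _)) (∑-mono n λ j → ⟦⟧-mono (_ ℕ.<? _) (_ ℕ.≤? _) ℕ.<⇒≤)))

upper : ∀ n → cellsInside (2 ℕ.* n) ℕ.≤ 4 ℕ.* (cellsInside n ℕ.+ 2 ℕ.* n)
upper n = begin
  ∑∑ (2 ℕ.* n) (inside (2 ℕ.* n))      ≡⟨ ∑∑-double n (inside (2 ℕ.* n)) ⟩
  ∑∑ n (quad (inside (2 ℕ.* n)))       ≤⟨ ∑∑-mono n (λ i j → ℕ.≤-trans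
      (ℕ.+-mono-≤ (ℕ.+-mono-≤ (sub i j (ev i) (ev j)) (sub i j (ev i) (od j)))
                  (ℕ.+-mono-≤ (sub i j (od i) (ev j)) (sub i j (od i) (od j))))
      (ℕ.≤-reflexive (4* (meets n i j)))) ⟩
  ∑∑ n (λ i j → 4 ℕ.* meets n i j)     ≡⟨ ∑∑-* 4 n (meets n) ⟩
  4 ℕ.* ∑∑ n (meets n)                 ≤⟨ ℕ.*-monoʳ-≤ 4 (meets≤ n) ⟩
  4 ℕ.* (cellsInside n ℕ.+ 2 ℕ.* n)    ∎
  where
  open ℕ.≤-Reasoning
  ev : ∀ i → 2 ℕ.* i ℕ.≤ 2 ℕ.* i
  ev i = ℕ.≤-refl
  od : ∀ i → 2 ℕ.* i ℕ.≤ suc (2 ℕ.* i)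
  od i = ℕ.n≤1+n _
  sub : ∀ i j {k l} → 2 ℕ.* i ℕ.≤ k → 2 ℕ.* j ℕ.≤ l → inside (2 ℕ.* n) k l ℕ.≤ meets n i j
  sub i j {k} {l} k≥ l≥ = ⟦⟧-mono (_ ℕ.≤? _) (_ ℕ.<? _)
    (inside-up n i j (suc k) (suc l) (ℕ.s≤s k≥) (ℕ.s≤s l≥))

/-mono-≤ : ∀ a b c d .{{_ : ℕ.NonZero b}} .{{_ : ℕ.NonZero d}} →
           a ℕ.* d ℕ.≤ c ℕ.* b → + a ℚ./ b ℚ.≤ + c ℚ./ d
/-mono-≤ a (suc b) c (suc d) h = ℚ.toℚᵘ-cancel-≤ (begin
  ℚ.toℚᵘ (+ a ℚ./ suc b)  ≃⟨ ℚ.toℚᵘ-fromℚᵘ (mkℚᵘ (+ a) b) ⟩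
  mkℚᵘ (+ a) b            ≤⟨ ℚᵘ.*≤* (subst₂ ℤ._≤_ (ℤ.pos-* a (suc d)) (ℤ.pos-* c (suc b)) (ℤ.+≤+ h)) ⟩
  mkℚᵘ (+ c) d            ≃⟨ ℚᵘ.≃-sym (ℚ.toℚᵘ-fromℚᵘ (mkℚᵘ (+ c) d)) ⟩
  ℚ.toℚᵘ (+ c ℚ./ suc d)  ∎)
  where open ℚᵘ.≤-Reasoning

/-+-≤ : ∀ a b c d .{{_ : ℕ.NonZero b}} → (a ℕ.+ c) ℕ.* suc d ℕ.≤ a ℕ.* suc d ℕ.+ b →
        + (a ℕ.+ c) ℚ./ b ℚ.≤ + a ℚ./ b ℚ.+ + 1 ℚ./ suc d
/-+-≤ a (suc b) c d h = ℚ.toℚᵘ-cancel-≤ (begin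
  ℚ.toℚᵘ (+ (a ℕ.+ c) ℚ./ suc b)  ≃⟨ ℚ.toℚᵘ-fromℚᵘ (mkℚᵘ (+ (a ℕ.+ c)) b) ⟩
  mkℚᵘ (+ (a ℕ.+ c)) b            ≤⟨ ℚᵘ.*≤* (subst₂ ℤ._≤_ (ℤ.pos-* (a ℕ.+ c) _) rhs (ℤ.+≤+ h′)) ⟩
  mkℚᵘ (+ a) b ℚᵘ.+ mkℚᵘ (+ 1) d
    ≃⟨ ℚᵘ.≃-sym (ℚᵘ.+-cong (ℚ.toℚᵘ-fromℚᵘ (mkℚᵘ (+ a) b)) (ℚ.toℚᵘ-fromℚᵘ (mkℚᵘ (+ 1) d))) ⟩
  ℚ.toℚᵘ (+ a ℚ./ suc b) ℚᵘ.+ ℚ.toℚᵘ (+ 1 ℚ./ suc d)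
    ≃⟨ ℚᵘ.≃-sym (ℚ.toℚᵘ-homo-+ (+ a ℚ./ suc b) (+ 1 ℚ./ suc d)) ⟩
  ℚ.toℚᵘ (+ a ℚ./ suc b ℚ.+ + 1 ℚ./ suc d)  ∎)
  where
  open ℚᵘ.≤-Reasoning
  rhs : + ((a ℕ.* suc d ℕ.+ 1 ℕ.* suc b) ℕ.* suc b) ≡ (+ a ℤ.* + suc d ℤ.+ + 1 ℤ.* + suc b) ℤ.* + suc b
  rhs = trans (ℤ.pos-* (a ℕ.* suc d ℕ.+ 1 ℕ.* suc b) (suc b))
    (cong (ℤ._* + suc b) (trans (ℤ.pos-+ (a ℕ.* suc d) (1 ℕ.* suc b))
      (cong₂ ℤ._+_ (ℤ.pos-* a (suc d)) (ℤ.pos-* 1 (suc b)))))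
  h′ : (a ℕ.+ c) ℕ.* (suc b ℕ.* suc d) ℕ.≤ (a ℕ.* suc d ℕ.+ 1 ℕ.* suc b) ℕ.* suc b
  h′ = ℕ.≤-trans
    (ℕ.≤-reflexive (solve 3 (λ x b d → x :* (b :* d) := (x :* d) :* b) refl (a ℕ.+ c) (suc b) (suc d)))
    (ℕ.*-monoˡ-≤ (suc b) (ℕ.≤-trans h (ℕ.≤-reflexive
      (cong (a ℕ.* suc d ℕ.+_) (sym (ℕ.*-identityˡ (suc b)))))))
    where open ℕS using (solve; _:*_; _:=_)

4^≢0 : ∀ k → ℕ.NonZero (4 ℕ.^ k)
4^≢0 k = ℕ.m^n≢0 4 k

πlow πhigh : ℕ → ℚ
πlow k  = (+ (4 ℕ.* cellsInside (2 ℕ.^ k)) ℚ./ 4 ℕ.^ k) {{4^≢0 k}}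
πhigh k = (+ (4 ℕ.* cellsInside (2 ℕ.^ k) ℕ.+ 16 ℕ.* 2 ℕ.^ k) ℚ./ 4 ℕ.^ k) {{4^≢0 k}}

πlow-suc : ∀ k → πlow k ℚ.≤ πlow (suc k)
πlow-suc k = /-mono-≤ (4 ℕ.* c) (4 ℕ.^ k) (4 ℕ.* c′) (4 ℕ.^ suc k) {{4^≢0 k}} {{4^≢0 (suc k)}} (begin
  (4 ℕ.* c) ℕ.* (4 ℕ.* 4 ℕ.^ k)   ≡⟨ solve 2 (λ c p → (con 4 :* c) :* (con 4 :* p) := con 4 :* (con 4 :* c) :* p)
                                       refl c (4 ℕ.^ k) ⟩
  4 ℕ.* (4 ℕ.* c) ℕ.* 4 ℕ.^ k     ≤⟨ ℕ.*-monoˡ-≤ (4 ℕ.^ k) (ℕ.*-monoʳ-≤ 4 (lower (2 ℕ.^ k))) ⟩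
  4 ℕ.* c′ ℕ.* 4 ℕ.^ k            ∎)
  where
  open ℕ.≤-Reasoning
  open ℕS using (solve; _:*_; con; _:=_)
  c = cellsInside (2 ℕ.^ k)
  c′ = cellsInside (2 ℕ.^ suc k)

πhigh-suc : ∀ k → πhigh (suc k) ℚ.≤ πhigh k
πhigh-suc k = /-mono-≤ (4 ℕ.* c′ ℕ.+ 16 ℕ.* (2 ℕ.* n)) (4 ℕ.^ suc k) (4 ℕ.* c ℕ.+ 16 ℕ.* n) (4 ℕ.^ k) {{4^≢0 (suc k)}} {{4^≢0 k}} (begin
  (4 ℕ.* c′ ℕ.+ 16 ℕ.* (2 ℕ.* n)) ℕ.* p
    ≤⟨ ℕ.*-monoˡ-≤ p (ℕ.+-monoˡ-≤ _ (ℕ.*-monoʳ-≤ 4 (upper n))) ⟩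
  (4 ℕ.* (4 ℕ.* (c ℕ.+ 2 ℕ.* n)) ℕ.+ 16 ℕ.* (2 ℕ.* n)) ℕ.* p
    ≡⟨ solve 3 (λ c n p →
         (con 4 :* (con 4 :* (c :+ con 2 :* n)) :+ con 16 :* (con 2 :* n)) :* p :=
         (con 4 :* c :+ con 16 :* n) :* (con 4 :* p)) refl c n p ⟩
  (4 ℕ.* c ℕ.+ 16 ℕ.* n) ℕ.* (4 ℕ.* p) ∎)
  where
  open ℕ.≤-Reasoning
  open ℕS using (solve; _:+_; _:*_; con; _:=_)
  n = 2 ℕ.^ k
  p = 4 ℕ.^ k
  c = cellsInside n
  c′ = cellsInside (2 ℕ.* n)

πlow≤πhigh : ∀ k → πlow k ℚ.≤ πhigh k
πlow≤πhigh k = /-mono-≤ (4 ℕ.* c) (4 ℕ.^ k) (4 ℕ.* c ℕ.+ 16 ℕ.* 2 ℕ.^ k) (4 ℕ.^ k) {{4^≢0 k}} {{4^≢0 k}}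
  (ℕ.*-monoˡ-≤ (4 ℕ.^ k) (ℕ.m≤m+n (4 ℕ.* c) _))
  where c = cellsInside (2 ℕ.^ k)

1+n≤2^n : ∀ n → suc n ℕ.≤ 2 ℕ.^ n
1+n≤2^n zero    = ℕ.≤-refl
1+n≤2^n (suc n) = ℕ.+-mono-≤ (ℕ.≤-trans (ℕ.s≤s ℕ.z≤n) (1+n≤2^n n))
  (ℕ.≤-trans (1+n≤2^n n) (ℕ.m≤m+n _ 0))

πhigh-low : ∀ k → πhigh (4 ℕ.+ k) ℚ.≤ πlow (4 ℕ.+ k) ℚ.+ 1/suc k
πhigh-low k = subst (λ q → πhigh (4 ℕ.+ k) ℚ.≤ πlow (4 ℕ.+ k) ℚ.+ q)
  (ℚ.normalize-coprime (Coprime.1-coprimeTo (suc k)))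
  (/-+-≤ (4 ℕ.* c) (4 ℕ.^ K) (16 ℕ.* n) k {{4^≢0 K}} (begin
    (4 ℕ.* c ℕ.+ 16 ℕ.* n) ℕ.* suc k           ≡⟨ ℕ.*-distribʳ-+ (suc k) (4 ℕ.* c) (16 ℕ.* n) ⟩
    4 ℕ.* c ℕ.* suc k ℕ.+ 16 ℕ.* n ℕ.* suc k   ≤⟨ ℕ.+-monoʳ-≤ (4 ℕ.* c ℕ.* suc k) (begin
        16 ℕ.* n ℕ.* suc k                     ≤⟨ ℕ.*-monoʳ-≤ (16 ℕ.* n) (1+n≤2^n k) ⟩
        16 ℕ.* n ℕ.* 2 ℕ.^ k                   ≡⟨ solve 2 (λ n m → con 16 :* n :* m := n :* (con 16 :* m)) refl n (2 ℕ.^ k) ⟩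
        n ℕ.* (16 ℕ.* 2 ℕ.^ k)                 ≡⟨ cong (n ℕ.*_) (sym (ℕ.^-distribˡ-+-* 2 4 k)) ⟩
        n ℕ.* n                                ≡⟨ 2^k*2^k K ⟩
        4 ℕ.^ K                                ∎) ⟩
    4 ℕ.* c ℕ.* suc k ℕ.+ 4 ℕ.^ K              ∎))
  where
  open ℕ.≤-Reasoning
  open ℕS using (solve; _:*_; con; _:=_)
  K = 4 ℕ.+ k
  n = 2 ℕ.^ K
  c = cellsInside n

up : ∀ {f : ℕ → ℚ} → (∀ k → f k ℚ.≤ f (suc k)) → ∀ {m n} → m ℕ.≤′ n → f m ℚ.≤ f n
up h ℕ.≤′-refl         = ℚ.≤-refl
up h (ℕ.≤′-step m≤n)   = ℚ.≤-trans (up h m≤n) (h _)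

down : ∀ {f : ℕ → ℚ} → (∀ k → f (suc k) ℚ.≤ f k) → ∀ {m n} → m ℕ.≤′ n → f n ℚ.≤ f m
down h ℕ.≤′-refl       = ℚ.≤-refl
down h (ℕ.≤′-step m≤n) = ℚ.≤-trans (h _) (down h m≤n)

-- The area of the unit disk: by symmetry 4 times the area of the first quadrant part, which is
-- approximated from inside by the cells of side 2⁻ᵏ.
π : ℝ
π .approx = πlow
π .cauchy ε 0<ε =
  let K , h = 1/suc<ε ε 0<ε
      bound : ∀ m n → 4 ℕ.+ K ℕ.≤ m → 4 ℕ.+ K ℕ.≤ n → πlow m ℚ.- πlow n ℚ.< ε
      bound m n ≤m ≤n = ℚ.≤-<-trans (p≤q+r⇒p-q≤r {πlow m} {πlow n} (begin
        πlow m                        ≤⟨ πlow≤πhigh m ⟩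
        πhigh m                       ≤⟨ down πhigh-suc (ℕ.≤⇒≤′ ≤m) ⟩
        πhigh (4 ℕ.+ K)               ≤⟨ πhigh-low K ⟩
        πlow (4 ℕ.+ K) ℚ.+ 1/suc K    ≤⟨ ℚ.+-monoˡ-≤ (1/suc K) (up πlow-suc (ℕ.≤⇒≤′ ≤n)) ⟩
        πlow n ℚ.+ 1/suc K            ∎)) (h K ℕ.≤-refl)
  in 4 ℕ.+ K , λ m n ≤m ≤n → ∣p-q∣<r {πlow m} {πlow n} (bound m n ≤m ≤n) (bound n m ≤n ≤m)
  where open ℚ.≤-Reasoning

π-positive : Positive π
π-positive = 1ℚ , 0<1 , 1 , λ n 1≤n → up πlow-suc (ℕ.≤⇒≤′ 1≤n)

Positive⇒#0 : ∀ {x} → Positive x → x #0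
Positive⇒#0 {x} (δ , 0<δ , N , δ≤x) = δ , 0<δ , N , λ n N≤n → ℚ.≤-trans (δ≤x n N≤n) (p≤∣p∣ (approx x n))

fromℕ-positive : ∀ n .{{_ : ℕ.NonZero n}} → Positive (fromℕ n)
fromℕ-positive (suc n) = + suc n ℚ./ 1 ,
  ℚ.positive⁻¹ (+ suc n ℚ./ 1) {{ℚ.normalize-pos (suc n) 1}} , 0 , λ _ _ → ℚ.≤-refl

fromℕ+-positive : ∀ n {x} → Positive x → Positive (fromℕ n + x)
fromℕ+-positive n (δ , 0<δ , N , δ≤x) = δ , 0<δ , N , λ m N≤m →
  ℚ.≤-trans (δ≤x m N≤m) (q≤p+q (subst (0ℚ ℚ.≤_) (sym (ι≡ n)) (0≤ι n)))

*-positive : ∀ {x y} → Positive x → Positive y → Positive (x * y)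
*-positive {x} {y} (δ , 0<δ , M , δ≤x) (ε , 0<ε , N , ε≤y) =
  δ ℚ.* ε , pos-* 0<δ 0<ε , M ℕ.⊔ N , λ n ≤n →
    let δ≤ = δ≤x n (ℕ.m⊔n≤o⇒m≤o M N ≤n)
    in *-mono-≤ (ℚ.<⇒≤ 0<ε) (ℚ.≤-trans (ℚ.<⇒≤ 0<δ) δ≤) δ≤ (ε≤y n (ℕ.m⊔n≤o⇒n≤o M N ≤n))

√-positive : ∀ {x} → Positive x → Positive (√ x)
√-positive {x} (δ , 0<δ , M , δ≤x) =
  let N , h<η = 1/suc<ε η 0<η
  in η , 0<η , M ℕ.⊔ N , λ n ≤n →
    let _ , 0≤s , _ , x<tt = sqrtSpec (approx x n) n
    in bound (approx x n) ((√ x) .approx n) (1/suc n)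
         (δ≤x n (ℕ.m⊔n≤o⇒m≤o M N ≤n)) 0≤s (0<1/suc n) (h<η n (ℕ.m⊔n≤o⇒n≤o M N ≤n)) x<tt
  where
  open ℚ.≤-Reasoning
  μ = δ ℚ.⊓ 1ℚ
  η = half μ
  0<μ : 0ℚ ℚ.< μ
  0<μ with ℚ.⊓-sel δ 1ℚ
  ... | inj₁ eq = subst (0ℚ ℚ.<_) (sym eq) 0<δ
  ... | inj₂ eq = subst (0ℚ ℚ.<_) (sym eq) 0<1
  0<η = 0<half 0<μ
  bound : ∀ q s h → δ ℚ.≤ q → 0ℚ ℚ.≤ s → 0ℚ ℚ.< h → h ℚ.< η → q ℚ.⊔ 0ℚ ℚ.< sq (s ℚ.+ h) → η ℚ.≤ s
  bound q s h δ≤q 0≤s 0<h h<η q<tt with η ℚ.≤? s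
  ... | yes η≤s = η≤s
  ... | no  η≰s = contradiction (begin-strict
    q ℚ.⊔ 0ℚ         <⟨ q<tt ⟩
    sq (s ℚ.+ h)     ≤⟨ sq-mono (ℚ.+-mono-≤ 0≤s (ℚ.<⇒≤ 0<h)) s+h≤μ ⟩
    μ ℚ.* μ          ≤⟨ ℚ.*-monoˡ-≤-nonNeg μ {{ℚ.nonNegative (ℚ.<⇒≤ 0<μ)}} (ℚ.p⊓q≤q δ 1ℚ) ⟩
    μ ℚ.* 1ℚ         ≡⟨ ℚ.*-identityʳ μ ⟩
    μ                ≤⟨ ℚ.p⊓q≤p δ 1ℚ ⟩
    δ                ≤⟨ δ≤q ⟩
    q                ≤⟨ ℚ.p≤p⊔q q 0ℚ ⟩
    q ℚ.⊔ 0ℚ         ∎) (ℚ.<-irrefl refl)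
    where
    s+h≤μ : s ℚ.+ h ℚ.≤ μ
    s+h≤μ = subst (s ℚ.+ h ℚ.≤_) (half+half μ)
      (ℚ.+-mono-≤ (ℚ.<⇒≤ (ℚ.≰⇒> η≰s)) (ℚ.<⇒≤ h<η))

-- the recursion only reaches j ≥ 2, so ∸ is ordinary subtraction
c : (j : ℕ) .{{_ : ℕ.NonZero j}} → ℝ
c 1 = fromℕ 1
c j@(suc i@(suc _)) = fromℕ (4 ℕ.* j ℕ.∸ 5) + fromℕ 2 * √ c i

c-positive : ∀ j .{{_ : ℕ.NonZero j}} → Positive (c j)
c-positive 1 = fromℕ-positive 1
c-positive j@(suc i@(suc _)) =
  fromℕ+-positive (4 ℕ.* j ℕ.∸ 5) {fromℕ 2 * √ c i}
    (*-positive {fromℕ 2} {√ c i} (fromℕ-positive 2) (√-positive {c i} (c-positive i)))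

-- ∏c k = c 2 * ⋯ * c (k + 1)
∏c : ℕ → ℝ
∏c zero    = fromℕ 1
∏c (suc k) = ∏c k * c (suc (suc k))

∏c-positive : ∀ k → Positive (∏c k)
∏c-positive zero    = fromℕ-positive 1
∏c-positive (suc k) = *-positive {∏c k} {c (suc (suc k))} (∏c-positive k) (c-positive (suc (suc k)))

4π∏c-positive : ∀ k → Positive (fromℕ 4 * π * ∏c k)
4π∏c-positive k = *-positive {fromℕ 4 * π} {∏c k}
  (*-positive {fromℕ 4} {π} (fromℕ-positive 4) π-positive) (∏c-positive k)

infix 9 _^-3/2

_^-3/2 : (n : ℕ) .{{_ : ℕ.NonZero n}} → ℝ
n ^-3/2 = (fromℕ n * √ fromℕ n) ⁻¹[ Positive⇒#0 {fromℕ n * √ fromℕ n}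
  (*-positive {fromℕ n} {√ fromℕ n} (fromℕ-positive n) (√-positive {fromℕ n} (fromℕ-positive n))) ]

infix 4 _∼_

-- asymptotic equivalence a n / b n → 1; part of the claim is that b n is eventually
-- apart from zero, without which the quotient is not defined
_∼_ : (a b : (n : ℕ) .{{_ : ℕ.NonZero n}} → ℝ) → Set
a ∼ b = ∀ ε → 0ℚ ℚ.< ε → ∃ λ N → ∀ n .{{_ : ℕ.NonZero n}} → N ℕ.≤ n →
  Σ (b n #0) λ b#0 → ∣ a n ÷ b n [ b#0 ] - fromℕ 1 ∣ < fromℚ ε

data Motzkin : Set where
  leaf   : Motzkin
  unary  : Motzkin → Motzkin
  binary : Motzkin → Motzkin → Motzkin

size : Motzkin → ℕ
size leaf         = 1
size (unary t)    = 1 ℕ.+ size t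
size (binary l r) = 1 ℕ.+ (size l ℕ.+ size r)

-- the leaves of a tree, as paths from the root
data Leaf : Motzkin → Set where
  here  : Leaf leaf
  under : ∀ {t} → Leaf t → Leaf (unary t)
  left  : ∀ {l r} → Leaf l → Leaf (binary l r)
  right : ∀ {l r} → Leaf r → Leaf (binary l r)

-- the unary nodes on the path from the root to a leaf
data UnaryAbove : ∀ {t} → Leaf t → Set where
  root  : ∀ {t} {e : Leaf t} → UnaryAbove (under e)
  under : ∀ {t} {e : Leaf t} → UnaryAbove e → UnaryAbove (under e)
  left  : ∀ {l r} {e : Leaf l} → UnaryAbove e → UnaryAbove (left {l} {r} e)
  right : ∀ {l r} {e : Leaf r} → UnaryAbove e → UnaryAbove (right {l} {r} e)

-- the number of unary nodes on the path from the root to a leaf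
unaryDepth : ∀ {t} → Leaf t → ℕ
unaryDepth here      = 0
unaryDepth (under e) = suc (unaryDepth e)
unaryDepth (left e)  = unaryDepth e
unaryDepth (right e) = unaryDepth e

-- the number of unary nodes on the path from v to e, including v
unaryLength : ∀ {t} {e : Leaf t} → UnaryAbove e → ℕ
unaryLength (root {e = e}) = suc (unaryDepth e)
unaryLength (under v)      = unaryLength v
unaryLength (left v)       = unaryLength v
unaryLength (right v)      = unaryLength v

-- dependent functions (e : Leaf t) → P e, tabulated so that _≡_ on them is extensional
EachLeaf : (t : Motzkin) → (Leaf t → Set) → Set
EachLeaf leaf         P = P here
EachLeaf (unary t)    P = EachLeaf t (λ e → P (under e))
EachLeaf (binary l r) P = EachLeaf l (λ e → P (left e)) × EachLeaf r (λ e → P (right e))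

at : ∀ {t P} → EachLeaf t P → (e : Leaf t) → P e
at p         here      = p
at p         (under e) = at p e
at (p , _)   (left e)  = at p e
at (_ , p)   (right e) = at p e

record ClosedTerm : Set where
  constructor mkTerm
  field
    tree    : Motzkin
    binding : EachLeaf tree UnaryAbove

open ClosedTerm public

UnaryLengths≤ : ℕ → ClosedTerm → Set
UnaryLengths≤ k t = EachLeaf (tree t) λ e → unaryLength (at (binding t) e) ℕ.≤ k

BoundedTerm : (k n : ℕ) → Set
BoundedTerm k n = Σ ClosedTerm λ t → size (tree t) ≡ n × UnaryLengths≤ k t

{-# OPTIONS --safe #-}

-- Let T d = 2 z P^(d,k) with z = x/(1 + 2√k), so that T d = (T d² + q d)/2 with q d = 4 d z² + 2 z T (d + 1), and T k is
-- algebraic with radicand (1 - x)(1 + φ x), 0 ≤ φ < 1. All asymptotics are relative to the coefficients b of 1 - √(1 - x):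
-- u ~[ b ] κ means u n / b n → κ. The identity b ⊛ b = 2 b - x makes convolutions and Cauchy products exactly computable,
-- which replaces singularity analysis. If q ~ κ b and 1 - q(1) = s² > 0, then the solution t of t = (t² + q)/2 satisfies
-- n tₙ = (Θ q ⊛ 1/(1 - t))ₙ / 2, whence t ~ κ/(2 s) b; here s = √cⱼ/(1 + 2√k) at level d = k + 1 - j. Finally
-- b ~ n^(-3/2)/(2√π) is Wallis' product, proved for the area π of the disk by Wästlund's staircase argument.

module Submission where

open import Algebra.Bundles using (CommutativeSemiring; CommutativeRing)
import Algebra.Solver.Ring as RingSolver
import Algebra.Solver.Ring.AlmostCommutativeRing as ACR
import Algebra.Solver.Ring.NaturalCoefficients.Default as SemiringSolver
import Defs as D
open import Data.Fin.Base using (Fin)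
open import Data.Integer.Base as ℤ using (+_)
import Data.Integer.Properties as ℤ
open import Data.Maybe.Base using (Maybe; just; nothing)
open import Data.Nat.Base as ℕ using (ℕ; zero; suc; z≤n; s≤s; NonZero)
import Data.Nat.Induction as ℕ
import Data.Nat.Properties as ℕ
import Data.Nat.Solver as ℕ
open import Data.Product.Base using (∃; _×_; _,_; proj₁; proj₂)
open import Data.Rational.Base as ℚ using (ℚ; 0ℚ; 1ℚ; ½)
import Data.Rational.Properties as ℚ
import Data.Rational.Solver as ℚ
open import Data.Rational.Unnormalised.Base as ℚᵘ using (mkℚᵘ)
import Data.Rational.Unnormalised.Properties as ℚᵘ
open import Data.Sum.Base using (_⊎_; inj₁; inj₂)
open import Function.Base using (case_of_)
open import Function.Bundles using (_↔_)
open import Level using (0ℓ)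
open import Relation.Binary.Bundles using (Poset)
open import Relation.Binary.PropositionalEquality as ≡ using (_≡_; cong; cong₂; subst; subst₂)
import Relation.Binary.Reasoning.PartialOrder as PosetReasoning
open import Relation.Nullary using (¬_; yes; no; contradiction; Dec)
open D using (ℝ; BoundedTerm)

-- Singularity analysis would need continuation beyond the circle of convergence. Here only
-- coefficients are available, over constructive reals whose order is undecidable. The substitute is
-- domination by a multiple of `b`: it passes from q to the solution of the quadratic equation, and
-- it makes tails of convolutions and defects of Cauchy products small.
--
-- The delicate object is 1/(1 - t). Its coefficients are only bounded from above, by a renewal
-- argument with kernel q, whose sum is below 1. That suffices: in the differentiated equation the
-- leading coefficient of t depends on 1/(1 - t) only through its value at 1.
--
-- The singularity arises at level k and is then transmitted outward: at every outer level 1 - q(1)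
-- stays positive, and the leading coefficient τ is divided by √cⱼ. It starts as √(1 + φ), so τ² ∏
-- cⱼ = 1 + φ = 4√k/r with r = 1 + 2√k. Undoing T = 2 z P and inserting b gives r τ/(4√π) as the
-- constant, whose square is r √k/(4π ∏ cⱼ) = (2k + √k)/(4π ∏ cⱼ).

-- Formal power series over a commutative semiring.

module PowerSeries {c ℓ} (S : CommutativeSemiring c ℓ) where

  open CommutativeSemiring S
  open SemiringSolver S using (solve; _:=_; _:+_; _:*_; con)

  Seq : Set c
  Seq = ℕ → Carrier

  tl : Seq → Seq
  tl u n = u (suc n)

  ι : ℕ → Carrier
  ι zero    = 0#
  ι (suc n) = 1# + ι n

  infixl 7 _⊛_
  infixl 6 _⊕_
  infixr 8 _·_

  _⊕_ : Seq → Seq → Seq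
  (u ⊕ v) n = u n + v n

  _·_ : Carrier → Seq → Seq
  (x · u) n = x * u n

  -- Peeling off the constant coefficient of the second factor makes this a structural recursion
  -- without subtraction of indices. The bijections that count pairs of subtrees follow the same
  -- recursion.
  _⊛_ : Seq → Seq → Seq
  (u ⊛ v) zero    = u 0 * v 0
  (u ⊛ v) (suc n) = u (suc n) * v 0 + (u ⊛ tl v) n

  δ₀ : Seq
  δ₀ zero    = 1#
  δ₀ (suc _) = 0#

  ∑ : Seq → ℕ → Carrier
  ∑ u zero    = 0#
  ∑ u (suc n) = ∑ u n + u n

  lo hi : ℕ → Seq → Seq
  lo zero    u n       = 0#
  lo (suc K) u zero    = u 0
  lo (suc K) u (suc n) = lo K (tl u) n
  hi zero    u n       = u n
  hi (suc K) u zero    = 0#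
  hi (suc K) u (suc n) = hi K (tl u) n

  -- The Euler derivation x d/dx.
  Θ : Seq → Seq
  Θ u n = ι n * u n

  ⊛-local : ∀ {u u′ v v′} n → (∀ m → m ℕ.≤ n → u m ≈ u′ m) → (∀ m → m ℕ.≤ n → v m ≈ v′ m) →
            (u ⊛ v) n ≈ (u′ ⊛ v′) n
  ⊛-local zero    p q = *-cong (p 0 z≤n) (q 0 z≤n)
  ⊛-local (suc n) p q = +-cong (*-cong (p (suc n) ℕ.≤-refl) (q 0 z≤n))
    (⊛-local n (λ m m≤n → p m (ℕ.m≤n⇒m≤1+n m≤n)) (λ m m≤n → q (suc m) (s≤s m≤n)))

  ⊛-cong : ∀ {u u′ v v′} → (∀ n → u n ≈ u′ n) → (∀ n → v n ≈ v′ n) → ∀ n → (u ⊛ v) n ≈ (u′ ⊛ v′) n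
  ⊛-cong p q n = ⊛-local n (λ m _ → p m) (λ m _ → q m)

  ⊛-sucˡ : ∀ u v n → (u ⊛ v) (suc n) ≈ u 0 * v (suc n) + (tl u ⊛ v) n
  ⊛-sucˡ u v zero    = +-comm _ _
  ⊛-sucˡ u v (suc n) = trans (+-congˡ (⊛-sucˡ u (tl v) n))
    (solve 3 (λ a b c → a :+ (b :+ c) := b :+ (a :+ c)) refl _ _ _)

  ⊛-comm : ∀ u v n → (u ⊛ v) n ≈ (v ⊛ u) n
  ⊛-comm u v zero    = *-comm _ _
  ⊛-comm u v (suc n) = trans (+-cong (*-comm _ _) (⊛-comm u (tl v) n)) (sym (⊛-sucˡ v u n))

  ⊛-distribʳ : ∀ u u′ v n → ((u ⊕ u′) ⊛ v) n ≈ (u ⊛ v) n + (u′ ⊛ v) n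
  ⊛-distribʳ u u′ v zero    = distribʳ _ _ _
  ⊛-distribʳ u u′ v (suc n) = trans (+-cong (distribʳ _ _ _) (⊛-distribʳ u u′ (tl v) n))
    (solve 4 (λ a b c d → (a :+ b) :+ (c :+ d) := (a :+ c) :+ (b :+ d)) refl _ _ _ _)

  ⊛-distribˡ : ∀ u v v′ n → (u ⊛ (v ⊕ v′)) n ≈ (u ⊛ v) n + (u ⊛ v′) n
  ⊛-distribˡ u v v′ zero    = distribˡ _ _ _
  ⊛-distribˡ u v v′ (suc n) = trans (+-cong (distribˡ _ _ _) (⊛-distribˡ u (tl v) (tl v′) n))
    (solve 4 (λ a b c d → (a :+ b) :+ (c :+ d) := (a :+ c) :+ (b :+ d)) refl _ _ _ _)

  ·-⊛ : ∀ x u v n → ((x · u) ⊛ v) n ≈ x * (u ⊛ v) n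
  ·-⊛ x u v zero    = *-assoc _ _ _
  ·-⊛ x u v (suc n) = trans (+-cong (*-assoc _ _ _) (·-⊛ x u (tl v) n)) (sym (distribˡ _ _ _))

  ⊛-· : ∀ x u v n → (u ⊛ (x · v)) n ≈ x * (u ⊛ v) n
  ⊛-· x u v n = trans (⊛-comm u (x · v) n) (trans (·-⊛ x v u n) (*-congˡ (⊛-comm v u n)))

  ⊛-assoc : ∀ u v w n → ((u ⊛ v) ⊛ w) n ≈ (u ⊛ (v ⊛ w)) n
  ⊛-assoc u v w zero    = *-assoc _ _ _
  ⊛-assoc u v w (suc n) = trans (+-congˡ (⊛-assoc u v (tl w) n))
    (trans (solve 5 (λ a b c d e → (a :* b :+ d) :* c :+ e := a :* (b :* c) :+ (c :* d :+ e)) refl _ _ _ _ _)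
      (sym (+-congˡ (trans (⊛-cong {u} (λ _ → refl) (λ m → +-congʳ (*-comm (tl v m) (w 0))) n)
        (trans (⊛-distribˡ u (w 0 · tl v) (v ⊛ tl w) n) (+-congʳ (⊛-· (w 0) u (tl v) n)))))))

  ⊛-zeroʳ : ∀ u n → (u ⊛ (λ _ → 0#)) n ≈ 0#
  ⊛-zeroʳ u zero    = zeroʳ _
  ⊛-zeroʳ u (suc n) = trans (+-cong (zeroʳ _) (⊛-zeroʳ u n)) (+-identityˡ _)

  ⊛-identityʳ : ∀ u n → (u ⊛ δ₀) n ≈ u n
  ⊛-identityʳ u zero    = *-identityʳ _
  ⊛-identityʳ u (suc n) = trans (+-cong (*-identityʳ _) (⊛-zeroʳ u n)) (+-identityʳ _)

  ⊛-identityˡ : ∀ u n → (δ₀ ⊛ u) n ≈ u n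
  ⊛-identityˡ u n = trans (⊛-comm δ₀ u n) (⊛-identityʳ u n)

  Θ-⊛ : ∀ u v n → Θ (u ⊛ v) n ≈ (Θ u ⊛ v) n + (u ⊛ Θ v) n
  Θ-⊛ u v zero    = solve 2 (λ a b → con 0 :* (a :* b) := (con 0 :* a) :* b :+ a :* (con 0 :* b)) refl (u 0) (v 0)
  Θ-⊛ u v (suc n) = trans
    (solve 4 (λ i a b c → (con 1 :+ i) :* (a :* b :+ c) := (con 1 :+ i) :* a :* b :+ (c :+ i :* c)) refl (ι n) (u (suc n))
          (v 0) ((u ⊛ tl v) n))
    (trans (+-congˡ (+-congˡ (Θ-⊛ u (tl v) n)))
      (trans (solve 5 (λ a b c d e → a :+ (b :+ (c :+ d)) := (a :+ c) :+ (e :* con 0 :+ (b :+ d))) refl _ _ _ _ (u (suc n)))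
        (+-congˡ (+-cong (*-congˡ (sym (zeroˡ (v 0)))) (sym (trans
          (⊛-cong {u} (λ _ → refl) (λ m → trans (distribʳ _ _ _) (+-congʳ (*-identityˡ _))) n)
          (⊛-distribˡ u (tl v) (Θ (tl v)) n)))))))

  ∑-cong : ∀ {u v} → (∀ n → u n ≈ v n) → ∀ n → ∑ u n ≈ ∑ v n
  ∑-cong h zero    = refl
  ∑-cong h (suc n) = +-cong (∑-cong h n) (h n)

  ∑-⊕ : ∀ u v n → ∑ (u ⊕ v) n ≈ ∑ u n + ∑ v n
  ∑-⊕ u v zero    = sym (+-identityˡ _)
  ∑-⊕ u v (suc n) = trans (+-congʳ (∑-⊕ u v n))
    (solve 4 (λ a b c d → (a :+ b) :+ (c :+ d) := (a :+ c) :+ (b :+ d)) refl _ _ _ _)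

  ∑-· : ∀ x u n → ∑ (x · u) n ≈ x * ∑ u n
  ∑-· x u zero    = sym (zeroʳ x)
  ∑-· x u (suc n) = trans (+-congʳ (∑-· x u n)) (sym (distribˡ _ _ _))

  ∑-head : ∀ u n → ∑ u (suc n) ≈ u 0 + ∑ (tl u) n
  ∑-head u zero    = +-comm _ _
  ∑-head u (suc n) = trans (+-congʳ (∑-head u n)) (+-assoc _ _ _)

  -- the products u i * v j with i, j < n and i + j ≥ n
  corner : Seq → Seq → ℕ → Carrier
  corner u v zero    = 0#
  corner u v (suc n) = u n * ∑ (tl v) n + corner u (tl v) n

  -- This is the exact defect in multiplying partial sums: convergence of a Cauchy product becomes
  -- the statement that `corner` tends to 0.
  ∑-⊛ : ∀ u v n → ∑ u n * ∑ v n ≈ ∑ (u ⊛ v) n + corner u v n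
  ∑-⊛ u v zero    = solve 0 (con 0 :* con 0 := con 0 :+ con 0) refl
  ∑-⊛ u v (suc n) = trans (*-congˡ (∑-head v n))
    (trans (solve 4 (λ a b c d → (a :+ b) :* (c :+ d) := (a :+ b) :* c :+ (b :* d :+ a :* d)) refl (∑ u n) (u n) (v 0)
          (∑ (tl v) n))
      (trans (+-congˡ (+-congˡ (∑-⊛ u (tl v) n)))
        (trans (solve 4 (λ a b c d → a :+ (b :+ (c :+ d)) := (a :+ c) :+ (b :+ d)) refl _ _ _ _)
          (+-congʳ (sym (total u v n))))))
    where
    total : ∀ u v n → ∑ (u ⊛ v) (suc n) ≈ ∑ u (suc n) * v 0 + ∑ (u ⊛ tl v) n
    total u v zero    = solve 2 (λ a b → con 0 :+ a :* b := (con 0 :+ a) :* b :+ con 0) refl (u 0) (v 0)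
    total u v (suc n) = trans (+-congʳ (total u v n))
      (solve 5 (λ a b c d e → (a :* c :+ d) :+ (b :* c :+ e) := (a :+ b) :* c :+ (d :+ e)) refl
        (∑ u (suc n)) (u (suc n)) (v 0) (∑ (u ⊛ tl v) n) ((u ⊛ tl v) n))

  lo⊕hi : ∀ K u n → u n ≈ lo K u n + hi K u n
  lo⊕hi zero    u n       = sym (+-identityˡ _)
  lo⊕hi (suc K) u zero    = sym (+-identityʳ _)
  lo⊕hi (suc K) u (suc n) = lo⊕hi K (tl u) n

  lo-< : ∀ K u n → n ℕ.< K → lo K u n ≈ u n
  lo-< (suc K) u zero    _         = refl
  lo-< (suc K) u (suc n) (s≤s n<K) = lo-< K (tl u) n n<K

-- Constructive real numbers as an ordered ring with square roots.

module Reals where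

  private module ℚS = ℚ.+-*-Solver

  Eventually : (ℕ → Set) → Set
  Eventually P = ∃ λ N → ∀ n → N ℕ.≤ n → P n

  eventually₂ : ∀ {P Q R : ℕ → Set} → (∀ n → P n → Q n → R n) → Eventually P → Eventually Q → Eventually R
  eventually₂ h (M , p) (N , q) = M ℕ.⊔ N , λ n ≤n →
    h n (p n (ℕ.m⊔n≤o⇒m≤o M N ≤n)) (q n (ℕ.m⊔n≤o⇒n≤o M N ≤n))

  eventually₁ : ∀ {P R : ℕ → Set} → (∀ n → P n → R n) → Eventually P → Eventually R
  eventually₁ h (M , p) = M , λ n ≤n → h n (p n ≤n)

  always : ∀ {P : ℕ → Set} → (∀ n → P n) → Eventually P
  always p = 0 , λ n _ → p n

  -p≤∣p∣ : ∀ p → ℚ.- p ℚ.≤ ℚ.∣ p ∣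
  -p≤∣p∣ p = subst (ℚ.- p ℚ.≤_) (ℚ.∣-p∣≡∣p∣ p) (D.p≤∣p∣ (ℚ.- p))

  ∣p∣≤ : ∀ {p q} → p ℚ.≤ q → ℚ.- p ℚ.≤ q → ℚ.∣ p ∣ ℚ.≤ q
  ∣p∣≤ {p} {q} h₁ h₂ with ℚ.∣p∣≡p∨∣p∣≡-p p
  ... | inj₁ eq = subst (ℚ._≤ q) (≡.sym eq) h₁
  ... | inj₂ eq = subst (ℚ._≤ q) (≡.sym eq) h₂

  -- Dividing by B + 1 instead of B covers B = 0. This is how bounded factors are absorbed into an
  -- arbitrary ε.
  small : ∀ ε B → 0ℚ ℚ.< ε → 0ℚ ℚ.≤ B → ∃ λ δ → 0ℚ ℚ.< δ × B ℚ.* δ ℚ.≤ ε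
  small ε B 0<ε 0≤B = δ , 0<δ , (begin
    B ℚ.* δ  ≤⟨ ℚ.*-monoʳ-≤-nonNeg δ {{ℚ.nonNegative (ℚ.<⇒≤ 0<δ)}} {B} {B ℚ.+ 1ℚ} (D.p≤p+q {B} {1ℚ} (ℚ.<⇒≤ D.0<1)) ⟩
    (B ℚ.+ 1ℚ) ℚ.* δ ≡⟨ ≡.trans (ℚ.*-comm (B ℚ.+ 1ℚ) δ) (D.÷⁺-* ε 0<B+1) ⟩
    ε  ∎)
    where
    open ℚ.≤-Reasoning
    0<B+1 = ℚ.+-mono-≤-< 0≤B D.0<1
    δ = ε D.÷⁺ 0<B+1
    0<δ = D.÷⁺-pos 0<ε 0<B+1

  p≤p+ε : ∀ p {ε} → 0ℚ ℚ.< ε → p ℚ.≤ p ℚ.+ ε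
  p≤p+ε p {ε} 0<ε = D.p≤p+q {p} {ε} (ℚ.<⇒≤ 0<ε)

  halves : ∀ p ε → (p ℚ.+ D.half ε) ℚ.+ D.half ε ≡ p ℚ.+ ε
  halves p ε = ≡.trans (ℚ.+-assoc p (D.half ε) (D.half ε)) (cong (p ℚ.+_) (D.half+half ε))

  infix  4 _≤_ _≈_
  infixl 6 _+_ _-_
  infixl 7 _*_
  infix  8 -_
  infix  9 √_

  -- Opacity hides the approximating sequences, so that reals are handled through the laws of an
  -- ordered ring and not by unfolding.
  opaque
    Real : Set
    Real = ℝ

    approx : Real → ℕ → ℚ
    approx = D.approx

    -- The error ε makes the order independent of the representatives. Equality is a pair of such
    -- inequalities, so every equation is also an estimate.
    _≤_ : Real → Real → Set
    x ≤ y = ∀ ε → 0ℚ ℚ.< ε → Eventually λ n → approx x n ℚ.≤ approx y n ℚ.+ ε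

    _+_ _*_ : Real → Real → Real
    _+_ = D._+_
    _*_ = D._*_

    -_ ∣_∣ √_ : Real → Real
    -_ = D.-_
    ∣_∣ = D.∣_∣
    √_ = D.√_

    ⌜_⌝ : ℚ → Real
    ⌜_⌝ = D.fromℚ

    Positive : Real → Set
    Positive = D.Positive

  _≈_ : Real → Real → Set
  x ≈ y = x ≤ y × y ≤ x

  0# 1# : Real
  0# = ⌜ 0ℚ ⌝
  1# = ⌜ 1ℚ ⌝

  _-_ : Real → Real → Real
  x - y = x + - y

  opaque
    unfolding Real

    pointwise-≤ : ∀ x y → (∀ n → approx x n ℚ.≤ approx y n) → x ≤ y
    pointwise-≤ x y h ε 0<ε = always λ n → ℚ.≤-trans (h n) (p≤p+ε (approx y n) 0<ε)

    pointwise : ∀ x y → (∀ n → approx x n ≡ approx y n) → x ≈ y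
    pointwise x y h = pointwise-≤ x y (λ n → ℚ.≤-reflexive (h n)) , pointwise-≤ y x (λ n → ℚ.≤-reflexive (≡.sym (h n)))

    ≤-refl : ∀ {x} → x ≤ x
    ≤-refl {x} = pointwise-≤ x x λ n → ℚ.≤-refl

    ≤-trans : ∀ {x y z} → x ≤ y → y ≤ z → x ≤ z
    ≤-trans {x} {y} {z} h k ε 0<ε = eventually₂ (λ n p q → begin
      approx x n  ≤⟨ p ⟩
      approx y n ℚ.+ D.half ε  ≤⟨ ℚ.+-monoˡ-≤ (D.half ε) q ⟩
      (approx z n ℚ.+ D.half ε) ℚ.+ D.half ε  ≡⟨ halves (approx z n) ε ⟩
      approx z n ℚ.+ ε  ∎)
      (h (D.half ε) (D.0<half 0<ε)) (k (D.half ε) (D.0<half 0<ε))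
      where open ℚ.≤-Reasoning

    +-mono-≤ : ∀ {x y u v} → x ≤ y → u ≤ v → x + u ≤ y + v
    +-mono-≤ {x} {y} {u} {v} h k ε 0<ε = eventually₂ (λ n p q → begin
      approx x n ℚ.+ approx u n  ≤⟨ ℚ.+-mono-≤ p q ⟩
      (approx y n ℚ.+ D.half ε) ℚ.+ (approx v n ℚ.+ D.half ε)
        ≡⟨ solve 3 (λ y v h → (y :+ h) :+ (v :+ h) := (y :+ v) :+ (h :+ h)) ≡.refl (approx y n) (approx v n) (D.half ε) ⟩
      (approx y n ℚ.+ approx v n) ℚ.+ (D.half ε ℚ.+ D.half ε)  ≡⟨ cong ((approx y n ℚ.+ approx v n) ℚ.+_) (D.half+half ε) ⟩
      (approx y n ℚ.+ approx v n) ℚ.+ ε  ∎)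
      (h (D.half ε) (D.0<half 0<ε)) (k (D.half ε) (D.0<half 0<ε))
      where open ℚ.≤-Reasoning
            open ℚS using (solve; _:=_; _:+_)

    -‿anti-≤ : ∀ {x y} → x ≤ y → - y ≤ - x
    -‿anti-≤ {x} {y} h ε 0<ε = eventually₁ (λ n p → subst₂ ℚ._≤_
      (solve 2 (λ x y → x :+ (:- x :- y) := :- y) ≡.refl (approx x n) (approx y n))
      (solve 3 (λ x y e → (y :+ e) :+ (:- x :- y) := :- x :+ e) ≡.refl (approx x n) (approx y n) ε)
      (ℚ.+-monoˡ-≤ (ℚ.- approx x n ℚ.- approx y n) p)) (h ε 0<ε)
      where open ℚS using (solve; _:=_; _:+_; _:-_; :-_)

    ≈-close : ∀ {x y} → x ≈ y → ∀ ε → 0ℚ ℚ.< ε → Eventually λ n → ℚ.∣ approx x n ℚ.- approx y n ∣ ℚ.≤ ε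
    ≈-close {x} {y} (h , k) ε 0<ε = eventually₂ (λ n p q → ∣p∣≤
      (D.p≤q+r⇒p-q≤r {approx x n} {approx y n} p)
      (subst (ℚ._≤ ε) (ℚS.solve 2 (λ x y → y ℚS.:- x ℚS.:= ℚS.:- (x ℚS.:- y)) ≡.refl (approx x n) (approx y n))
        (D.p≤q+r⇒p-q≤r {approx y n} {approx x n} q))) (h ε 0<ε) (k ε 0<ε)

    *-congˡ-≤ : ∀ x y z → y ≈ z → x * y ≤ x * z
    *-congˡ-≤ x y z y≈z ε 0<ε =
      let B , 0≤B , K , b = D.bounded x
          δ , 0<δ , Bδ≤ε = small ε B 0<ε 0≤B
      in eventually₂ (λ n p q → D.p-q≤r⇒p≤q+r {approx x n ℚ.* approx y n} {approx x n ℚ.* approx z n} (begin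
        approx x n ℚ.* approx y n ℚ.- approx x n ℚ.* approx z n
          ≡⟨ solve 3 (λ x y z → x :* y :- x :* z := x :* (y :- z)) ≡.refl (approx x n) (approx y n) (approx z n) ⟩
        approx x n ℚ.* (approx y n ℚ.- approx z n)  ≤⟨ D.p≤∣p∣ (approx x n ℚ.* (approx y n ℚ.- approx z n)) ⟩
        ℚ.∣ approx x n ℚ.* (approx y n ℚ.- approx z n) ∣  ≡⟨ ℚ.∣p*q∣≡∣p∣*∣q∣ (approx x n) (approx y n ℚ.- approx z n) ⟩
        ℚ.∣ approx x n ∣ ℚ.* ℚ.∣ approx y n ℚ.- approx z n ∣ ≤⟨ D.*-mono-≤ {ℚ.∣ approx x n ∣} {B}
              {ℚ.∣ approx y n ℚ.- approx z n ∣} {δ} (ℚ.0≤∣p∣ (approx y n ℚ.- approx z n)) 0≤B p q ⟩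
        B ℚ.* δ  ≤⟨ Bδ≤ε ⟩
        ε  ∎))
        (K , b) (≈-close {y} {z} y≈z δ 0<δ)
      where open ℚ.≤-Reasoning
            open ℚS using (solve; _:=_; _:+_; _:-_; _:*_)

    *-congˡ : ∀ {x y z} → y ≈ z → x * y ≈ x * z
    *-congˡ {x} {y} {z} y≈z = *-congˡ-≤ x y z y≈z , *-congˡ-≤ x z y (proj₂ y≈z , proj₁ y≈z)

    +-assoc : ∀ x y z → (x + y) + z ≈ x + (y + z)
    +-assoc x y z = pointwise ((x + y) + z) (x + (y + z)) λ n → ℚ.+-assoc (approx x n) (approx y n) (approx z n)
    +-comm : ∀ x y → x + y ≈ y + x
    +-comm x y = pointwise (x + y) (y + x) λ n → ℚ.+-comm (approx x n) (approx y n)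
    +-identityˡ : ∀ x → 0# + x ≈ x
    +-identityˡ x = pointwise (0# + x) x λ n → ℚ.+-identityˡ (approx x n)
    +-inverseˡ : ∀ x → - x + x ≈ 0#
    +-inverseˡ x = pointwise (- x + x) 0# λ n → ℚ.+-inverseˡ (approx x n)
    *-assoc : ∀ x y z → (x * y) * z ≈ x * (y * z)
    *-assoc x y z = pointwise ((x * y) * z) (x * (y * z)) λ n → ℚ.*-assoc (approx x n) (approx y n) (approx z n)
    *-comm : ∀ x y → x * y ≈ y * x
    *-comm x y = pointwise (x * y) (y * x) λ n → ℚ.*-comm (approx x n) (approx y n)
    *-identityˡ : ∀ x → 1# * x ≈ x
    *-identityˡ x = pointwise (1# * x) x λ n → ℚ.*-identityˡ (approx x n)
    distribˡ : ∀ x y z → x * (y + z) ≈ x * y + x * z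
    distribˡ x y z = pointwise (x * (y + z)) (x * y + x * z) λ n → ℚ.*-distribˡ-+ (approx x n) (approx y n) (approx z n)

    ⌜⌝-+ : ∀ p q → ⌜ p ℚ.+ q ⌝ ≈ ⌜ p ⌝ + ⌜ q ⌝
    ⌜⌝-+ p q = pointwise ⌜ p ℚ.+ q ⌝ (⌜ p ⌝ + ⌜ q ⌝) λ n → ≡.refl
    ⌜⌝-* : ∀ p q → ⌜ p ℚ.* q ⌝ ≈ ⌜ p ⌝ * ⌜ q ⌝
    ⌜⌝-* p q = pointwise ⌜ p ℚ.* q ⌝ (⌜ p ⌝ * ⌜ q ⌝) λ n → ≡.refl
    ⌜⌝-neg : ∀ p → ⌜ ℚ.- p ⌝ ≈ - ⌜ p ⌝
    ⌜⌝-neg p = pointwise ⌜ ℚ.- p ⌝ (- ⌜ p ⌝) λ n → ≡.refl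
    ⌜⌝-mono : ∀ {p q} → p ℚ.≤ q → ⌜ p ⌝ ≤ ⌜ q ⌝
    ⌜⌝-mono {p} {q} p≤q = pointwise-≤ ⌜ p ⌝ ⌜ q ⌝ λ n → p≤q

    0≤∣x∣ : ∀ x → 0# ≤ ∣ x ∣
    0≤∣x∣ x = pointwise-≤ 0# ∣ x ∣ λ n → ℚ.0≤∣p∣ (approx x n)
    x≤∣x∣ : ∀ x → x ≤ ∣ x ∣
    x≤∣x∣ x = pointwise-≤ x ∣ x ∣ λ n → D.p≤∣p∣ (approx x n)
    -x≤∣x∣ : ∀ x → - x ≤ ∣ x ∣
    -x≤∣x∣ x = pointwise-≤ (- x) ∣ x ∣ λ n → -p≤∣p∣ (approx x n)
    ∣∣-lub : ∀ {x y} → x ≤ y → - x ≤ y → ∣ x ∣ ≤ y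
    ∣∣-lub {x} {y} h k ε 0<ε = eventually₂ (λ n → ∣p∣≤ {approx x n} {approx y n ℚ.+ ε}) (h ε 0<ε) (k ε 0<ε)
    ∣∣-* : ∀ x y → ∣ x * y ∣ ≈ ∣ x ∣ * ∣ y ∣
    ∣∣-* x y = pointwise ∣ x * y ∣ (∣ x ∣ * ∣ y ∣) λ n → ℚ.∣p*q∣≡∣p∣*∣q∣ (approx x n) (approx y n)

    ≤-closed : ∀ {x y} → (∀ ε → 0ℚ ℚ.< ε → x ≤ y + ⌜ ε ⌝) → x ≤ y
    ≤-closed {x} {y} h ε 0<ε = eventually₁ (λ n p → subst (approx x n ℚ.≤_)
      (halves (approx y n) ε) p)
      (h (D.half ε) (D.0<half 0<ε) (D.half ε) (D.0<half 0<ε))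

    archimedean : ∀ x → ∃ λ B → 0ℚ ℚ.≤ B × ∣ x ∣ ≤ ⌜ B ⌝
    archimedean x = let B , 0≤B , K , b = D.bounded x in
      B , 0≤B , λ ε 0<ε → eventually₁ (λ n p → ℚ.≤-trans p (p≤p+ε B 0<ε)) (K , b)

    0≤√ : ∀ x → 0# ≤ √ x
    0≤√ x = pointwise-≤ 0# (√ x) λ n → proj₁ (proj₂ (D.sqrtSpec (approx x n) n))

    -- A representative of 0 whose n-th term is the precision to which `sqrtSpec` finds the n-th
    -- term of a root. Adding it to a root makes the upper bound for the radicand hold termwise.
    1/suc→0 : ℝ
    1/suc→0 .D.approx = D.1/suc
    1/suc→0 .D.cauchy ε 0<ε = let N , h = D.1/suc<ε ε 0<ε in
      N , λ m n N≤m N≤n → D.∣p-q∣<r {D.1/suc m} {D.1/suc n} (below m n (h m N≤m)) (below n m (h n N≤n))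
      where
      below : ∀ m n → D.1/suc m ℚ.< ε → D.1/suc m ℚ.- D.1/suc n ℚ.< ε
      below m n = ℚ.≤-<-trans (D.p≤q+r⇒p-q≤r {D.1/suc m} {D.1/suc n} {D.1/suc m}
        (D.q≤p+q {D.1/suc n} {D.1/suc m} (ℚ.<⇒≤ (D.0<1/suc n))))

    infinitesimal : Real
    infinitesimal = 1/suc→0

    infinitesimal≈0 : infinitesimal ≈ 0#
    infinitesimal≈0 =
      (λ ε 0<ε → eventually₁ (λ n h → ℚ.≤-trans (ℚ.<⇒≤ h) (D.q≤p+q {0ℚ} {ε} ℚ.≤-refl)) (D.1/suc<ε ε 0<ε)) ,
      pointwise-≤ 0# infinitesimal (λ n → ℚ.<⇒≤ (D.0<1/suc n))

    √²-≤ : ∀ {x} → 0# ≤ x → √ x * √ x ≤ x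
    √²-≤ {x} 0≤x ε 0<ε = eventually₁ (λ n → below (approx x n) n) (0≤x ε 0<ε)
      where
      below : ∀ q n → 0ℚ ℚ.≤ q ℚ.+ ε → D.sq (proj₁ (D.sqrtSpec q n)) ℚ.≤ q ℚ.+ ε
      below q n p = ℚ.≤-trans (proj₁ (proj₂ (proj₂ (D.sqrtSpec q n)))) (ℚ.⊔-lub {q ℚ.+ ε} {q} {0ℚ} (p≤p+ε q 0<ε) p)

    √²-≥ : ∀ x → x ≤ (√ x + infinitesimal) * (√ x + infinitesimal)
    √²-≥ x = pointwise-≤ x ((√ x + infinitesimal) * (√ x + infinitesimal)) (λ n → above (approx x n) n)
      where
      above : ∀ q n → q ℚ.≤ D.sq (proj₁ (D.sqrtSpec q n) ℚ.+ D.1/suc n)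
      above q n = ℚ.≤-trans (ℚ.p≤p⊔q q 0ℚ) (ℚ.<⇒≤ (proj₂ (proj₂ (proj₂ (D.sqrtSpec q n)))))

    ⌜⌝-cancel-≤ : ∀ {p q} → ⌜ p ⌝ ≤ ⌜ q ⌝ → p ℚ.≤ q
    ⌜⌝-cancel-≤ {p} {q} h with p ℚ.≤? q
    ... | yes p≤q = p≤q
    ... | no p≰q = contradiction (ℚ.<-≤-trans (ℚ.+-monoʳ-< q half<) (subst (ℚ._≤ q ℚ.+ e) (≡.sym gap)
          (proj₂ (h e (D.0<half 0<d)) _ ℕ.≤-refl))) (ℚ.<-irrefl ≡.refl)
      where
      d e : ℚ
      d = p ℚ.- q
      e = D.half d
      0<d : 0ℚ ℚ.< d
      0<d = subst (ℚ._< d) (ℚ.+-inverseʳ q) (ℚ.+-monoˡ-< (ℚ.- q) (ℚ.≰⇒> p≰q))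
      half< : e ℚ.< d
      half< = subst₂ ℚ._<_ (ℚ.+-identityʳ e) (D.half+half d) (ℚ.+-monoʳ-< e (D.0<half 0<d))
      gap : q ℚ.+ d ≡ p
      gap = ℚS.solve 2 (λ p q → q ℚS.:+ (p ℚS.:- q) ℚS.:= p) ≡.refl p q

    -- Approximations of a nonnegative real may be negative, so the product cannot be estimated
    -- termwise. Replacing both factors by their absolute values repairs this.
    *-nonNeg : ∀ {x y} → 0# ≤ x → 0# ≤ y → 0# ≤ x * y
    *-nonNeg {x} {y} 0≤x 0≤y =
      ≤-trans {0#} {∣ x * y ∣} {x * y} (0≤∣x∣ (x * y)) (≤-trans {∣ x * y ∣} {∣ x ∣ * ∣ y ∣} {x * y} (proj₁ (∣∣-* x y))
      (≤-trans {∣ x ∣ * ∣ y ∣} {∣ x ∣ * y} {x * y} (proj₁ (*-congˡ {∣ x ∣} {∣ y ∣} {y} (abs {y} 0≤y)))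
      (≤-trans {∣ x ∣ * y} {y * ∣ x ∣} {x * y} (proj₁ (*-comm ∣ x ∣ y))
        (≤-trans {y * ∣ x ∣} {y * x} {x * y} (proj₁ (*-congˡ {y} {∣ x ∣} {x} (abs {x} 0≤x))) (proj₁ (*-comm y x))))))
      where
      abs : ∀ {x : Real} → 0# ≤ x → ∣ x ∣ ≈ x
      abs {x} 0≤x =
        (λ ε 0<ε → eventually₁ (λ n p → ∣p∣≤ {approx x n} {approx x n ℚ.+ ε} (p≤p+ε (approx x n) 0<ε)
          (neg-bound (approx x n) {ε} p)) (0≤x (D.half ε) (D.0<half 0<ε))) ,
        x≤∣x∣ x
        where
        open ℚ.≤-Reasoning
        open ℚS using (solve; _:=_; _:+_; _:-_; _:*_; :-_; con)
        neg-bound : ∀ x {ε} → 0ℚ ℚ.≤ x ℚ.+ D.half ε → ℚ.- x ℚ.≤ x ℚ.+ ε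
        neg-bound x {ε} p = begin
          ℚ.- x  ≡⟨ ℚ.+-identityʳ (ℚ.- x) ⟨
          ℚ.- x ℚ.+ (0ℚ ℚ.+ 0ℚ)  ≤⟨ ℚ.+-monoʳ-≤ (ℚ.- x) {0ℚ ℚ.+ 0ℚ} {(x ℚ.+ D.half ε) ℚ.+ (x ℚ.+ D.half ε)}
                (ℚ.+-mono-≤ {0ℚ} {x ℚ.+ D.half ε} {0ℚ} {x ℚ.+ D.half ε} p p) ⟩
          ℚ.- x ℚ.+ ((x ℚ.+ D.half ε) ℚ.+ (x ℚ.+ D.half ε))
            ≡⟨ solve 2 (λ x ε → :- x :+ ((x :+ con ½ :* ε) :+ (x :+ con ½ :* ε)) := x :+ ε) ≡.refl x ε ⟩
          x ℚ.+ ε  ∎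

  -- Positivity through a rational lower bound mentions no approximations, so witnesses can be built
  -- and used without unfolding the reals.
  Pos : Real → Set
  Pos x = ∃ λ q → 0ℚ ℚ.< q × ⌜ q ⌝ ≤ x

  opaque
    unfolding Real

    Pos⇒Positive : ∀ {x} → Pos x → Positive x
    Pos⇒Positive {x} (q , 0<q , q≤x) = let N , h = q≤x (D.half q) (D.0<half 0<q) in
      D.half q , D.0<half 0<q , N , λ n N≤n → subst₂ ℚ._≤_
        (cancel q) (ℚS.solve 2 (λ x h → (x ℚS.:+ h) ℚS.:- h ℚS.:= x) ≡.refl (approx x n) (D.half q))
              (ℚ.+-monoˡ-≤ (ℚ.- D.half q) (h n N≤n))
      where
      cancel : ∀ q → q ℚ.- D.half q ≡ D.half q
      cancel = ℚS.solve 1 (λ q → q ℚS.:- ℚS.con ½ ℚS.:* q ℚS.:= ℚS.con ½ ℚS.:* q) ≡.refl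

    Positive⇒Pos : ∀ {x} → Positive x → Pos x
    Positive⇒Pos {x} (δ , 0<δ , N , h) = δ , 0<δ , λ ε 0<ε → N , λ n N≤n → ℚ.≤-trans (h n N≤n) (p≤p+ε (approx x n) 0<ε)

    -- One approximation, exact to half of ε, decides between two overlapping alternatives, whereas
    -- comparison with 0 itself is undecidable. Together with `≤-closed` this proves an inequality
    -- by refuting that a difference is positive.
    dichotomy : ∀ x {ε} → 0ℚ ℚ.< ε → x ≤ ⌜ ε ⌝ ⊎ Pos x
    dichotomy x {ε} 0<ε with D.cauchy x (D.half ε) (D.0<half 0<ε)
    ... | N , h with approx x N ℚ.≤? D.half ε
    ...   | yes p = inj₁ λ η 0<η → N , λ n N≤n → ℚ.≤-trans (D.p-q≤r⇒p≤q+r {approx x n} {D.half ε}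
              (upper (approx x n) (approx x N) p (h n N N≤n ℕ.≤-refl))) (ℚ.≤-trans (ℚ.≤-reflexive (D.half+half ε)) (p≤p+ε ε 0<η))
      where
      upper : ∀ p q → q ℚ.≤ D.half ε → ℚ.∣ p ℚ.- q ∣ ℚ.< D.half ε → p ℚ.- D.half ε ℚ.≤ D.half ε
      upper p q q≤ close = ℚ.≤-trans (ℚ.+-monoʳ-≤ p (ℚ.neg-antimono-≤ q≤)) (ℚ.≤-trans (D.p≤∣p∣ (p ℚ.- q)) (ℚ.<⇒≤ close))
    ...   | no p = inj₂ (Positive⇒Pos {x} (gap , 0<gap , N , λ n N≤n → lower (approx x n) (h N n ℕ.≤-refl N≤n)))
      where
      gap : ℚ
      gap = approx x N ℚ.- D.half ε
      0<gap : 0ℚ ℚ.< gap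
      0<gap = subst (ℚ._< gap) (ℚ.+-inverseʳ (D.half ε)) (ℚ.+-monoˡ-< (ℚ.- D.half ε) (ℚ.≰⇒> p))
      lower : ∀ p → ℚ.∣ approx x N ℚ.- p ∣ ℚ.< D.half ε → gap ℚ.≤ p
      lower p close = D.p≤q+r⇒p-q≤r {approx x N} {D.half ε} {p} (subst (approx x N ℚ.≤_) (ℚ.+-comm p (D.half ε))
        (D.p-q≤r⇒p≤q+r {approx x N} {p} (ℚ.≤-trans (D.p≤∣p∣ (approx x N ℚ.- p)) (ℚ.<⇒≤ close))))

    inv : (x : Real) → Pos x → Real
    inv x px = x D.⁻¹[ D.Positive⇒#0 {x} (Pos⇒Positive {x} px) ]

    eventually-≈ : ∀ x y → Eventually (λ n → approx x n ≡ approx y n) → x ≈ y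
    eventually-≈ x y e = (λ ε 0<ε → eventually₁ (λ n eq → ℚ.≤-trans (ℚ.≤-reflexive eq) (p≤p+ε (approx y n) 0<ε)) e)
                   , (λ ε 0<ε → eventually₁ (λ n eq → ℚ.≤-trans (ℚ.≤-reflexive (≡.sym eq)) (p≤p+ε (approx x n) 0<ε)) e)

    inv-inverseˡ : ∀ x (p : Pos x) → inv x p * x ≈ 1#
    inv-inverseˡ x p =
      let δ , 0<δ , N , h = D.Positive⇒#0 {x} (Pos⇒Positive {x} p)
      in eventually-≈ (inv x p * x) 1# (N , λ n N≤n → D.inverse-* {approx x n} (ℚ.<-≤-trans 0<δ (h n N≤n)))

  ≤-reflexive : ∀ {x y} → x ≈ y → x ≤ y
  ≤-reflexive = proj₁

  commutativeRing : CommutativeRing 0ℓ 0ℓ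
  commutativeRing = record
    { Carrier = Real ; _≈_ = _≈_ ; _+_ = _+_ ; _*_ = _*_ ; -_ = -_ ; 0# = 0# ; 1# = 1#
    ; isCommutativeRing = record
      { isRing = record
        { +-isAbelianGroup = record
          { isGroup = record
            { isMonoid = record
              { isSemigroup = record
                { isMagma = record
                  { isEquivalence = record { refl = ≤-refl , ≤-refl ; sym = λ (h , k) → k , h ; trans = ≈-trans }
                  ; ∙-cong = λ (h , h′) (k , k′) → +-mono-≤ h k , +-mono-≤ h′ k′ }
                ; assoc = +-assoc }
              ; identity = +-identityˡ , λ x → ≈-trans (+-comm x 0#) (+-identityˡ x) }
            ; inverse = +-inverseˡ , λ x → ≈-trans (+-comm x (- x)) (+-inverseˡ x)
            ; ⁻¹-cong = λ (h , k) → -‿anti-≤ k , -‿anti-≤ h }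
          ; comm = +-comm }
        ; *-cong = λ {x} {y} {u} {v} h k → ≈-trans (*-congˡ k) (≈-trans (*-comm x v) (≈-trans (*-congˡ h) (*-comm v y)))
        ; *-assoc = *-assoc
        ; *-identity = *-identityˡ , λ x → ≈-trans (*-comm x 1#) (*-identityˡ x)
        ; distrib = distribˡ , λ x y z → ≈-trans (*-comm (y + z) x) (≈-trans (distribˡ x y z)
            (+-cong′ (*-comm x y) (*-comm x z))) }
      ; *-comm = *-comm } }
    where
    ≈-trans : ∀ {x y z} → x ≈ y → y ≈ z → x ≈ z
    ≈-trans (h , h′) (k , k′) = ≤-trans h k , ≤-trans k′ h′
    +-cong′ : ∀ {x y u v} → x ≈ y → u ≈ v → x + u ≈ y + v
    +-cong′ (h , h′) (k , k′) = +-mono-≤ h k , +-mono-≤ h′ k′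

  module ℛ = CommutativeRing commutativeRing

  poset : Poset 0ℓ 0ℓ 0ℓ
  poset = record
    { Carrier = Real ; _≈_ = _≈_ ; _≤_ = _≤_
    ; isPartialOrder = record
      { isPreorder = record { isEquivalence = ℛ.isEquivalence ; reflexive = ≤-reflexive ; trans = ≤-trans }
      ; antisym = _,_ } }

  module ≤-Reasoning = PosetReasoning poset

  private
    acr : ACR.AlmostCommutativeRing 0ℓ 0ℓ
    acr = ACR.fromCommutativeRing commutativeRing

    constants : ℚ.+-*-rawRing ACR.-Raw-AlmostCommutative⟶ acr
    constants = record { ⟦_⟧ = ⌜_⌝ ; +-homo = ⌜⌝-+ ; *-homo = ⌜⌝-* ; -‿homo = ⌜⌝-neg ; 0-homo = ℛ.refl ; 1-homo = ℛ.refl }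

    same : ∀ p q → Maybe (⌜ p ⌝ ≈ ⌜ q ⌝)
    same p q with p ℚ.≟ q
    ... | yes p≡q = just (ℛ.reflexive (cong ⌜_⌝ p≡q))
    ... | no _    = nothing

  module Solver = RingSolver ℚ.+-*-rawRing acr constants same

  open ℛ using () renaming (refl to ≈-refl; sym to ≈-sym; trans to ≈-trans) public
  open ℛ using (+-cong; +-congˡ; +-congʳ; *-cong; *-congʳ; -‿cong; +-identityʳ; *-identityʳ; zeroˡ; zeroʳ) public
  open ≤-Reasoning
  open Solver using (Polynomial; solve; _:=_; _:+_; _:-_; _:*_; :-_; con)

  :0 :1 :½ :4 : ∀ {n} → Polynomial n
  :0 = con 0ℚ
  :1 = con 1ℚ
  :½ = con ½
  :4 = (:1 :+ :1) :+ (:1 :+ :1)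

  ≤-by : ∀ {x y d} → 0# ≤ d → x + d ≈ y → x ≤ y
  ≤-by {x} {y} {d} 0≤d eq = begin
    x  ≈⟨ +-identityʳ x ⟨
    x + 0#  ≤⟨ +-mono-≤ ≤-refl 0≤d ⟩
    x + d  ≈⟨ eq ⟩
    y  ∎

  0≤y-x : ∀ {x y} → x ≤ y → 0# ≤ y - x
  0≤y-x {x} {y} x≤y = begin
    0#  ≈⟨ ℛ.-‿inverseʳ x ⟨
    x - x  ≤⟨ +-mono-≤ x≤y ≤-refl ⟩
    y - x  ∎

  *-monoˡ-≤ : ∀ {x y z} → 0# ≤ x → y ≤ z → x * y ≤ x * z
  *-monoˡ-≤ {x} {y} {z} 0≤x y≤z = ≤-by (*-nonNeg 0≤x (0≤y-x y≤z))
    (solve 3 (λ x y z → x :* y :+ x :* (z :- y) := x :* z) ≈-refl x y z)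

  *-monoʳ-≤ : ∀ {x y z} → 0# ≤ x → y ≤ z → y * x ≤ z * x
  *-monoʳ-≤ {x} {y} {z} 0≤x y≤z = begin
    y * x  ≈⟨ *-comm y x ⟩
    x * y  ≤⟨ *-monoˡ-≤ 0≤x y≤z ⟩
    x * z  ≈⟨ *-comm x z ⟩
    z * x  ∎

  *-mono-≤ : ∀ {x y u v} → 0# ≤ y → 0# ≤ u → x ≤ y → u ≤ v → x * u ≤ y * v
  *-mono-≤ 0≤y 0≤u x≤y u≤v = ≤-trans (*-monoʳ-≤ 0≤u x≤y) (*-monoˡ-≤ 0≤y u≤v)

  0≤⌜⌝ : ∀ {q} → 0ℚ ℚ.≤ q → 0# ≤ ⌜ q ⌝
  0≤⌜⌝ = ⌜⌝-mono

  0≤1 : 0# ≤ 1#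
  0≤1 = ⌜⌝-mono (ℚ.<⇒≤ D.0<1)

  +-nonNeg : ∀ {x y} → 0# ≤ x → 0# ≤ y → 0# ≤ x + y
  +-nonNeg {x} {y} 0≤x 0≤y = ≤-trans (≤-reflexive (≈-sym (+-identityʳ 0#))) (+-mono-≤ 0≤x 0≤y)

  Pos⇒0≤ : ∀ {x} → Pos x → 0# ≤ x
  Pos⇒0≤ (q , 0<q , q≤x) = ≤-trans (⌜⌝-mono (ℚ.<⇒≤ 0<q)) q≤x

  Pos-≤ : ∀ {x y} → Pos x → x ≤ y → Pos y
  Pos-≤ (q , 0<q , q≤x) x≤y = q , 0<q , ≤-trans q≤x x≤y

  Pos-⌜⌝ : ∀ {q} → 0ℚ ℚ.< q → Pos ⌜ q ⌝
  Pos-⌜⌝ {q} 0<q = q , 0<q , ≤-refl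

  Pos-* : ∀ {x y} → Pos x → Pos y → Pos (x * y)
  Pos-* {x} {y} px@(p , 0<p , p≤x) (q , 0<q , q≤y) = p ℚ.* q , D.pos-* 0<p 0<q ,
    ≤-trans (≤-reflexive (⌜⌝-* p q)) (*-mono-≤ (Pos⇒0≤ px) (0≤⌜⌝ (ℚ.<⇒≤ 0<q)) p≤x q≤y)

  Pos-+ : ∀ {x y} → Pos x → 0# ≤ y → Pos (x + y)
  Pos-+ {x} {y} px 0≤y = Pos-≤ px (≤-by 0≤y ≈-refl)

  Pos-irrefl : ∀ {x} → x ≤ 0# → ¬ Pos x
  Pos-irrefl x≤0 (q , 0<q , q≤x) = ℚ.<-irrefl ≡.refl (ℚ.<-≤-trans 0<q (⌜⌝-cancel-≤ (≤-trans q≤x x≤0)))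

  square-cancel-≤ : ∀ {x y} → 0# ≤ y → x * x ≤ y * y → x ≤ y
  square-cancel-≤ {x} {y} 0≤y xx≤yy = ≤-closed λ ε 0<ε → case dichotomy (x - y) 0<ε of λ where
    (inj₁ x-y≤ε) → ≤-by (0≤y-x x-y≤ε) (solve 3 (λ x y e → x :+ (e :- (x :- y)) := y :+ e) ≈-refl x y ⌜ ε ⌝)
    -- Positivity of x + y comes from that of x - y, by writing the sum as (x - y) + 2 y.
    (inj₂ pos)   → contradiction (Pos-* pos (Pos-+ pos (+-nonNeg 0≤y 0≤y))) (Pos-irrefl (begin
      (x - y) * ((x - y) + (y + y))  ≈⟨ solve 2 (λ x y → (x :- y) :* ((x :- y) :+ (y :+ y)) := x :* x :- y :* y) ≈-refl x y ⟩
      x * x - y * y  ≤⟨ +-mono-≤ xx≤yy ≤-refl ⟩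
      y * y - y * y  ≈⟨ ℛ.-‿inverseʳ _ ⟩
      0#  ∎))

  square-cancel : ∀ {x y} → 0# ≤ x → 0# ≤ y → x * x ≈ y * y → x ≈ y
  square-cancel 0≤x 0≤y eq = square-cancel-≤ 0≤y (proj₁ eq) , square-cancel-≤ 0≤x (proj₂ eq)

  √² : ∀ {x} → 0# ≤ x → √ x * √ x ≈ x
  √² {x} 0≤x = √²-≤ 0≤x , (begin
    x  ≤⟨ √²-≥ x ⟩
    (√ x + infinitesimal) * (√ x + infinitesimal)  ≈⟨ *-cong eq eq ⟩
    √ x * √ x  ∎)
    where
    eq : √ x + infinitesimal ≈ √ x
    eq = ≈-trans (+-congˡ infinitesimal≈0) (+-identityʳ (√ x))

  √-cong : ∀ {x y} → 0# ≤ x → x ≈ y → √ x ≈ √ y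
  √-cong {x} {y} 0≤x x≈y = square-cancel (0≤√ x) (0≤√ y)
    (≈-trans (√² 0≤x) (≈-trans x≈y (≈-sym (√² (≤-trans 0≤x (proj₁ x≈y))))))

  inv-inverseʳ : ∀ x (p : Pos x) → x * inv x p ≈ 1#
  inv-inverseʳ x p = ≈-trans (*-comm x (inv x p)) (inv-inverseˡ x p)

  *-cancelˡ-≤ : ∀ {x y z} → Pos x → x * y ≤ x * z → y ≤ z
  *-cancelˡ-≤ {x} {y} {z} px h = ≤-closed λ ε 0<ε → case dichotomy (y - z) 0<ε of λ where
    (inj₁ y-z≤ε) → ≤-by (0≤y-x y-z≤ε) (solve 3 (λ x y e → x :+ (e :- (x :- y)) := y :+ e) ≈-refl y z ⌜ ε ⌝)
    (inj₂ pos)   → contradiction (Pos-* px pos) (Pos-irrefl (begin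
      x * (y - z)  ≈⟨ solve 3 (λ x y z → x :* (y :- z) := x :* y :- x :* z) ≈-refl x y z ⟩
      x * y - x * z  ≤⟨ +-mono-≤ h ≤-refl ⟩
      x * z - x * z  ≈⟨ ℛ.-‿inverseʳ _ ⟩
      0#  ∎))

  inv-pos : ∀ x (p : Pos x) → Pos (inv x p)
  inv-pos x p =
    let B , 0≤B , x≤B = archimedean x
        0<B+1 = ℚ.+-mono-≤-< 0≤B D.0<1
        q = 1ℚ D.÷⁺ 0<B+1
        0<q = D.÷⁺-pos D.0<1 0<B+1
    in q , 0<q , *-cancelˡ-≤ p (begin
      x * ⌜ q ⌝  ≤⟨ *-monoʳ-≤ (0≤⌜⌝ (ℚ.<⇒≤ 0<q)) (≤-trans (x≤∣x∣ x) (≤-trans x≤B (⌜⌝-mono (p≤p+ε B D.0<1)))) ⟩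
      ⌜ B ℚ.+ 1ℚ ⌝ * ⌜ q ⌝  ≈⟨ ⌜⌝-* (B ℚ.+ 1ℚ) q ⟨
      ⌜ (B ℚ.+ 1ℚ) ℚ.* q ⌝  ≈⟨ ℛ.reflexive (cong ⌜_⌝ (≡.trans (ℚ.*-comm (B ℚ.+ 1ℚ) q) (D.÷⁺-* 1ℚ 0<B+1))) ⟩
      1#  ≈⟨ inv-inverseʳ x p ⟨
      x * inv x p  ∎)

  -- If B bounds √x, then x = √x · √x is at most (B + 1) √x, so x/(B + 1) is a positive lower bound.
  Pos-√ : ∀ {x} → Pos x → Pos (√ x)
  Pos-√ {x} px with archimedean (√ x)
  ... | B , 0≤B , √x≤B = Pos-≤ (Pos-* px (inv-pos _ PB)) (begin
    x * inv ⌜ B ℚ.+ 1ℚ ⌝ PB  ≈⟨ *-congʳ (√² (Pos⇒0≤ px)) ⟨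
    √ x * √ x * inv ⌜ B ℚ.+ 1ℚ ⌝ PB  ≤⟨ *-monoʳ-≤ (Pos⇒0≤ (inv-pos _ PB)) (*-monoˡ-≤ (0≤√ x)
         (≤-trans (x≤∣x∣ _) (≤-trans √x≤B (⌜⌝-mono (p≤p+ε B D.0<1))))) ⟩
    √ x * ⌜ B ℚ.+ 1ℚ ⌝ * inv ⌜ B ℚ.+ 1ℚ ⌝ PB  ≈⟨ ≈-trans (*-assoc _ _ _) (≈-trans (*-congˡ (inv-inverseʳ _ PB)) (*-identityʳ _)) ⟩
    √ x  ∎)
    where
    PB : Pos ⌜ B ℚ.+ 1ℚ ⌝
    PB = Pos-⌜⌝ (ℚ.+-mono-≤-< 0≤B D.0<1)

  ∣∣-cong : ∀ {x y} → x ≈ y → ∣ x ∣ ≈ ∣ y ∣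
  ∣∣-cong {x} {y} x≈y = le x≈y , le (≈-sym x≈y)
    where
    le : ∀ {x y} → x ≈ y → ∣ x ∣ ≤ ∣ y ∣
    le {x} {y} eq = ∣∣-lub (≤-trans (proj₁ eq) (x≤∣x∣ y)) (≤-trans (proj₁ (-‿cong eq)) (-x≤∣x∣ y))

  0≤x⇒∣x∣≈x : ∀ {x} → 0# ≤ x → ∣ x ∣ ≈ x
  0≤x⇒∣x∣≈x {x} 0≤x = ∣∣-lub ≤-refl (≤-by (+-nonNeg 0≤x 0≤x) (solve 1 (λ x → :- x :+ (x :+ x) := x) ≈-refl x)) , x≤∣x∣ x

  ∣∣-neg : ∀ x → ∣ - x ∣ ≈ ∣ x ∣
  ∣∣-neg x = ∣∣-lub (-x≤∣x∣ x) (≤-trans (≤-reflexive neg²) (x≤∣x∣ x)) ,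
             ∣∣-lub (≤-trans (≤-reflexive (≈-sym neg²)) (-x≤∣x∣ (- x))) (x≤∣x∣ (- x))
    where
    neg² : - - x ≈ x
    neg² = solve 1 (λ x → :- :- x := x) ≈-refl x

  ∣∣-+ : ∀ x y → ∣ x + y ∣ ≤ ∣ x ∣ + ∣ y ∣
  ∣∣-+ x y = ∣∣-lub (+-mono-≤ (x≤∣x∣ x) (x≤∣x∣ y))
    (≤-trans (≤-reflexive (solve 2 (λ x y → :- (x :+ y) := :- x :+ :- y) ≈-refl x y)) (+-mono-≤ (-x≤∣x∣ x) (-x≤∣x∣ y)))

  Pos-quotient : ∀ {x y ε} (p : Pos y) → 0ℚ ℚ.< ε → ∣ x - y ∣ ≤ ⌜ D.half ε ⌝ * y → Pos (⌜ ε ⌝ - ∣ x * inv y p - 1# ∣)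
  Pos-quotient {x} {y} {ε} p 0<ε h = D.half ε , D.0<half 0<ε , ≤-by (0≤y-x bound) (begin-equality
    ⌜ D.half ε ⌝ + (⌜ D.half ε ⌝ - ∣ x * inv y p - 1# ∣)  ≈⟨ +-assoc _ _ _ ⟨
    (⌜ D.half ε ⌝ + ⌜ D.half ε ⌝) - ∣ x * inv y p - 1# ∣  ≈⟨ +-congʳ (≈-trans (≈-sym (⌜⌝-+ _ _))
          (ℛ.reflexive (cong ⌜_⌝ (D.half+half ε)))) ⟩
    ⌜ ε ⌝ - ∣ x * inv y p - 1# ∣  ∎)
    where
    bound : ∣ x * inv y p - 1# ∣ ≤ ⌜ D.half ε ⌝
    bound = *-cancelˡ-≤ p (begin
      y * ∣ x * inv y p - 1# ∣  ≈⟨ *-congʳ (0≤x⇒∣x∣≈x (Pos⇒0≤ p)) ⟨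
      ∣ y ∣ * ∣ x * inv y p - 1# ∣  ≈⟨ ∣∣-* y _ ⟨
      ∣ y * (x * inv y p - 1#) ∣  ≈⟨ ∣∣-cong (≈-trans
          (solve 3 (λ x y i → y :* (x :* i :- :1) := x :* (i :* y) :- y) ≈-refl x y (inv y p))
          (+-congʳ (≈-trans (*-congˡ (inv-inverseˡ y p)) (*-identityʳ x)))) ⟩
      ∣ x - y ∣  ≤⟨ h ⟩
      ⌜ D.half ε ⌝ * y  ≈⟨ *-comm _ _ ⟩
      y * ⌜ D.half ε ⌝  ∎)

  opaque
    unfolding Real inv

    -- The identity, seen across the opaque boundary. The lemmas about it carry the operations of
    -- the theorem over to the opaque ones.
    real : ℝ → Real
    real x = x

    real-+ : ∀ x y → real (x D.+ y) ≈ real x + real y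
    real-+ x y = ≈-refl {x D.+ y}

    real-* : ∀ x y → real (x D.* y) ≈ real x * real y
    real-* x y = ≈-refl {x D.* y}

    real-√ : ∀ x → real (D.√ x) ≈ √ real x
    real-√ x = ≈-refl {D.√ x}

    real-fromℕ : ∀ n → real (D.fromℕ n) ≈ ⌜ D.ι n ⌝
    real-fromℕ n = ℛ.reflexive (cong D.fromℚ (D.ι≡ n))

    real-⁻¹ : ∀ x (p : x D.#0) → real (x D.⁻¹[ p ]) * real x ≈ 1#
    real-⁻¹ x (δ , 0<δ , N , h) = eventually-≈ ((x D.⁻¹[ δ , 0<δ , N , h ]) D.* x) 1#
      (N , λ n N≤n → D.inverse-* {D.approx x n} (ℚ.<-≤-trans 0<δ (h n N≤n)))

    real-Positive : ∀ x → D.Positive x → Pos (real x)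
    real-Positive x p = Positive⇒Pos {x} p

    ∼-intro : (a g : (n : ℕ) .{{_ : ℕ.NonZero n}} → ℝ) →
      (∀ ε → 0ℚ ℚ.< ε → ∃ λ N → ∀ n → N ℕ.≤ suc n → Pos (real (g (suc n))) × ∣ real (a (suc n)) - real (g (suc n)) ∣ ≤ ⌜ ε ⌝ *
            real (g (suc n))) →
      a D.∼ g
    ∼-intro a g h ε 0<ε = let N , p = h (D.half ε) (D.0<half 0<ε) in N , λ { (suc n) N≤n →
      let pos , close = p n N≤n in
      D.Positive⇒#0 {g (suc n)} (Pos⇒Positive {g (suc n)} pos) ,
      Pos⇒Positive {⌜ ε ⌝ - ∣ a (suc n) * inv (g (suc n)) pos - 1# ∣} (Pos-quotient {a (suc n)} {g (suc n)} {ε} pos 0<ε close) }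

-- Real power series and the coefficients of (1 - x)^(1/2) and (1 - x)^(-1/2).

module RealSeries where

  open Reals
  open PowerSeries ℛ.commutativeSemiring public
  open ≤-Reasoning
  open Solver using (solve; _:=_; _:+_; _:-_; _:*_; :-_)

  infix 4 _≋_ _≼_

  _≋_ _≼_ : Seq → Seq → Set
  u ≋ v = ∀ n → u n ≈ v n
  u ≼ v = ∀ n → u n ≤ v n

  O : Seq
  O n = 0#

  ⊖_ : Seq → Seq
  (⊖ u) n = - u n

  seriesRing : CommutativeRing 0ℓ 0ℓ
  seriesRing = record
    { Carrier = Seq ; _≈_ = _≋_ ; _+_ = _⊕_ ; _*_ = _⊛_ ; -_ = ⊖_ ; 0# = O ; 1# = δ₀
    ; isCommutativeRing = record
      { isRing = record
        { +-isAbelianGroup = record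
          { isGroup = record
            { isMonoid = record
              { isSemigroup = record
                { isMagma = record
                  { isEquivalence = record
                      { refl = λ n → ≈-refl ; sym = λ h n → ≈-sym (h n) ; trans = λ h k n → ≈-trans (h n) (k n) }
                  ; ∙-cong = λ h k n → +-cong (h n) (k n) }
                ; assoc = λ u v w n → +-assoc (u n) (v n) (w n) }
              ; identity = (λ u n → +-identityˡ (u n)) , λ u n → +-identityʳ (u n) }
            ; inverse = (λ u n → +-inverseˡ (u n)) , λ u n → ℛ.-‿inverseʳ (u n)
            ; ⁻¹-cong = λ h n → -‿cong (h n) }
          ; comm = λ u v n → +-comm (u n) (v n) }
        ; *-cong = ⊛-cong
        ; *-assoc = ⊛-assoc
        ; *-identity = ⊛-identityˡ , ⊛-identityʳ
        ; distrib = ⊛-distribˡ , λ u v w → ⊛-distribʳ v w u }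
      ; *-comm = ⊛-comm } }

  private
    acr : ACR.AlmostCommutativeRing 0ℓ 0ℓ
    acr = ACR.fromCommutativeRing seriesRing

    -- The constant 1 becomes `1# · δ₀`, which equals `δ₀` only up to `_≋_`; this explains the
    -- conversions `one`, `unit` and `unit₁` around uses of the solver.
    constant : ℚ → Seq
    constant q = ⌜ q ⌝ · δ₀

    constants : ℚ.+-*-rawRing ACR.-Raw-AlmostCommutative⟶ acr
    constants = record
      { ⟦_⟧    = constant
      ; +-homo = λ p q n → ≈-trans (*-congʳ (⌜⌝-+ p q)) (ℛ.distribʳ (δ₀ n) ⌜ p ⌝ ⌜ q ⌝)
      ; *-homo = λ p q n → ≈-trans (*-congʳ (⌜⌝-* p q)) (≈-trans (*-assoc ⌜ p ⌝ ⌜ q ⌝ (δ₀ n))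
          (≈-sym (≈-trans (·-⊛ ⌜ p ⌝ δ₀ (constant q) n) (*-congˡ (⊛-identityˡ (constant q) n)))))
      ; -‿homo = λ p n → ≈-trans (*-congʳ (⌜⌝-neg p)) (solve 2 (λ p d → (:- p) :* d := :- (p :* d)) ≈-refl ⌜ p ⌝ (δ₀ n))
      ; 0-homo = λ n → zeroˡ (δ₀ n)
      ; 1-homo = λ n → *-identityˡ (δ₀ n) }

    same : ∀ p q → Maybe (constant p ≋ constant q)
    same p q with p ℚ.≟ q
    ... | yes p≡q = just (λ n → ℛ.reflexive (cong (λ p → constant p n) p≡q))
    ... | no _    = nothing

  module SeriesSolver = RingSolver ℚ.+-*-rawRing acr constants same

  ≋-refl : ∀ {u} → u ≋ u
  ≋-refl n = ≈-refl

  ⊛-mono : ∀ {u u′ v v′} → O ≼ u → O ≼ v → u ≼ u′ → v ≼ v′ → u ⊛ v ≼ u′ ⊛ v′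
  ⊛-mono 0≤u 0≤v h k zero    = *-mono-≤ (≤-trans (0≤u 0) (h 0)) (0≤v 0) (h 0) (k 0)
  ⊛-mono 0≤u 0≤v h k (suc n) = +-mono-≤
    (*-mono-≤ (≤-trans (0≤u (suc n)) (h (suc n))) (0≤v 0) (h (suc n)) (k 0))
    (⊛-mono 0≤u (λ n → 0≤v (suc n)) h (λ n → k (suc n)) n)

  ⊛-nonNeg : ∀ {u v} → O ≼ u → O ≼ v → O ≼ u ⊛ v
  ⊛-nonNeg 0≤u 0≤v zero    = *-nonNeg (0≤u 0) (0≤v 0)
  ⊛-nonNeg 0≤u 0≤v (suc n) = +-nonNeg (*-nonNeg (0≤u (suc n)) (0≤v 0)) (⊛-nonNeg 0≤u (λ n → 0≤v (suc n)) n)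

  ∣⊛∣≤ : ∀ {u u′ v v′} → (∀ n → ∣ u n ∣ ≤ u′ n) → (∀ n → ∣ v n ∣ ≤ v′ n) → ∀ n → ∣ (u ⊛ v) n ∣ ≤ (u′ ⊛ v′) n
  ∣⊛∣≤ {u} {u′} {v} {v′} h k zero = ≤-trans (≤-reflexive (∣∣-* (u 0) (v 0)))
    (*-mono-≤ (≤-trans (0≤∣x∣ (u 0)) (h 0)) (0≤∣x∣ (v 0)) (h 0) (k 0))
  ∣⊛∣≤ {u} {u′} {v} {v′} h k (suc n) = ≤-trans (∣∣-+ (u (suc n) * v 0) ((u ⊛ tl v) n)) (+-mono-≤
    (≤-trans (≤-reflexive (∣∣-* (u (suc n)) (v 0)))
      (*-mono-≤ (≤-trans (0≤∣x∣ (u (suc n))) (h (suc n))) (0≤∣x∣ (v 0)) (h (suc n)) (k 0)))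
    (∣⊛∣≤ h (λ n → k (suc n)) n))

  ∑-mono : ∀ {u v} → u ≼ v → ∀ n → ∑ u n ≤ ∑ v n
  ∑-mono h zero    = ≤-refl
  ∑-mono h (suc n) = +-mono-≤ (∑-mono h n) (h n)

  ∑-nonNeg : ∀ {u} → O ≼ u → ∀ n → 0# ≤ ∑ u n
  ∑-nonNeg 0≤u zero    = ≤-refl
  ∑-nonNeg 0≤u (suc n) = +-nonNeg (∑-nonNeg 0≤u n) (0≤u n)

  ∣∑∣≤ : ∀ {u v} → (∀ n → ∣ u n ∣ ≤ v n) → ∀ n → ∣ ∑ u n ∣ ≤ ∑ v n
  ∣∑∣≤ h zero    = ≤-reflexive (0≤x⇒∣x∣≈x ≤-refl)
  ∣∑∣≤ {u} h (suc n) = ≤-trans (∣∣-+ (∑ u n) (u n)) (+-mono-≤ (∣∑∣≤ h n) (h n))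

  ∣corner∣≤ : ∀ {u u′ v v′} → (∀ n → ∣ u n ∣ ≤ u′ n) → (∀ n → ∣ v (suc n) ∣ ≤ v′ (suc n)) →
              ∀ n → ∣ corner u v n ∣ ≤ corner u′ v′ n
  ∣corner∣≤ h k zero = ≤-reflexive (0≤x⇒∣x∣≈x ≤-refl)
  ∣corner∣≤ {u} {u′} {v} {v′} h k (suc n) = ≤-trans (∣∣-+ (u n * ∑ (tl v) n) (corner u (tl v) n)) (+-mono-≤
    (≤-trans (≤-reflexive (∣∣-* (u n) (∑ (tl v) n)))
      (*-mono-≤ (≤-trans (0≤∣x∣ (u n)) (h n)) (0≤∣x∣ (∑ (tl v) n)) (h n) (∣∑∣≤ k n)))
    (∣corner∣≤ h (λ n → k (suc n)) n))

  ∑-⊖ : ∀ u n → ∑ (⊖ u) n ≈ - ∑ u n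
  ∑-⊖ u zero    = solve 0 (:0 := :- :0) ≈-refl
  ∑-⊖ u (suc n) = ≈-trans (+-congʳ (∑-⊖ u n)) (solve 2 (λ a b → :- a :- b := :- (a :+ b)) ≈-refl (∑ u n) (u n))

  ∑δ₀ : ∀ n → ∑ δ₀ (suc n) ≈ 1#
  ∑δ₀ zero    = +-identityˡ 1#
  ∑δ₀ (suc n) = ≈-trans (+-identityʳ _) (∑δ₀ n)

  0≤δ₀ : O ≼ δ₀
  0≤δ₀ zero    = 0≤1
  0≤δ₀ (suc n) = ≤-refl

  corner-· : ∀ x y u v n → corner (x · u) (y · v) n ≈ (x * y) * corner u v n
  corner-· x y u v zero    = ≈-sym (zeroʳ (x * y))
  corner-· x y u v (suc n) = ≈-trans (+-cong (*-congˡ (∑-· y (tl v) n)) (corner-· x y u (tl v) n))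
    (solve 5 (λ x y u s c → (x :* u) :* (y :* s) :+ (x :* y) :* c := (x :* y) :* (u :* s :+ c)) ≈-refl
      x y (u n) (∑ (tl v) n) (corner u (tl v) n))

  corner≥0 : ∀ {u v} → O ≼ u → O ≼ v → ∀ n → 0# ≤ corner u v n
  corner≥0 0≤u 0≤v zero    = ≤-refl
  corner≥0 0≤u 0≤v (suc n) = +-nonNeg (*-nonNeg (0≤u n) (∑-nonNeg (λ n → 0≤v (suc n)) n)) (corner≥0 0≤u (λ n → 0≤v (suc n)) n)

  lo-mono : ∀ K {u v} → u ≼ v → lo K u ≼ lo K v
  lo-mono zero    h n       = ≤-refl
  lo-mono (suc K) h zero    = h 0
  lo-mono (suc K) h (suc n) = lo-mono K (λ n → h (suc n)) n

  lo-nonNeg : ∀ K {u} → O ≼ u → O ≼ lo K u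
  lo-nonNeg zero    h n       = ≤-refl
  lo-nonNeg (suc K) h zero    = h 0
  lo-nonNeg (suc K) h (suc n) = lo-nonNeg K (λ n → h (suc n)) n

  lo-≼ : ∀ K {u} → O ≼ u → lo K u ≼ u
  lo-≼ zero    h n       = h n
  lo-≼ (suc K) h zero    = ≤-refl
  lo-≼ (suc K) h (suc n) = lo-≼ K (λ n → h (suc n)) n

  hi-mono : ∀ K {u v} → (∀ n → K ℕ.≤ n → u n ≤ v n) → hi K u ≼ hi K v
  hi-mono zero    h n       = h n z≤n
  hi-mono (suc K) h zero    = ≤-refl
  hi-mono (suc K) h (suc n) = hi-mono K (λ n K≤n → h (suc n) (s≤s K≤n)) n

  hi-nonNeg : ∀ K {u} → O ≼ u → O ≼ hi K u
  hi-nonNeg zero    h n       = h n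
  hi-nonNeg (suc K) h zero    = ≤-refl
  hi-nonNeg (suc K) h (suc n) = hi-nonNeg K (λ n → h (suc n)) n

  hi-≼ : ∀ K {u} → O ≼ u → hi K u ≼ u
  hi-≼ zero    h n       = ≤-refl
  hi-≼ (suc K) h zero    = h 0
  hi-≼ (suc K) h (suc n) = hi-≼ K (λ n → h (suc n)) n

  ∣hi∣≤ : ∀ K {u v} → (∀ n → K ℕ.≤ n → ∣ u n ∣ ≤ v n) → ∀ n → ∣ hi K u n ∣ ≤ hi K v n
  ∣hi∣≤ zero    h n       = h n z≤n
  ∣hi∣≤ (suc K) h zero    = ≤-reflexive (0≤x⇒∣x∣≈x ≤-refl)
  ∣hi∣≤ (suc K) h (suc n) = ∣hi∣≤ K (λ n K≤n → h (suc n) (s≤s K≤n)) n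

  hi-· : ∀ K x u → hi K (x · u) ≋ x · hi K u
  hi-· zero    x u n       = ≈-refl
  hi-· (suc K) x u zero    = ≈-sym (zeroʳ x)
  hi-· (suc K) x u (suc n) = hi-· K x (tl u) n

  ι≈ : ∀ n → ι n ≈ ⌜ D.ι n ⌝
  ι≈ zero    = ≈-refl
  ι≈ (suc n) = ≈-trans (+-congˡ (ι≈ n)) (≈-trans (+-comm 1# ⌜ D.ι n ⌝)
    (≈-trans (≈-sym (⌜⌝-+ (D.ι n) 1ℚ)) (ℛ.reflexive (cong ⌜_⌝ (≡.sym (D.ι-suc n))))))

  0≤ι : ∀ n → 0# ≤ ι n
  0≤ι zero    = ≤-refl
  0≤ι (suc n) = +-nonNeg 0≤1 (0≤ι n)

  Pos-ι : ∀ n → Pos (ι (suc n))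
  Pos-ι n = Pos-+ (Pos-⌜⌝ D.0<1) (0≤ι n)

  ι-mono : ∀ {m n} → m ℕ.≤ n → ι m ≤ ι n
  ι-mono {n = n} z≤n = 0≤ι n
  ι-mono (s≤s m≤n)   = +-mono-≤ ≤-refl (ι-mono m≤n)

  ν : ℕ → Real
  ν n = ⌜ D.1/suc n ⌝

  Pos-ν : ∀ n → Pos (ν n)
  Pos-ν n = Pos-⌜⌝ (D.0<1/suc n)

  ν-inverse : ∀ n → ν n * ι (suc n) ≈ 1#
  ν-inverse n = ≈-trans (*-congˡ {ν n} (ι≈ (suc n))) (≈-trans (≈-sym (⌜⌝-* (D.1/suc n) (D.ι (suc n))))
    (ℛ.reflexive (cong ⌜_⌝ (ℚ.*-inverseˡ (D.ι (suc n))))))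

  ½# : Real
  ½# = ⌜ ½ ⌝

  four : Real
  four = (1# + 1#) + (1# + 1#)

  Pos-four : Pos four
  Pos-four = Pos-+ (Pos-+ (Pos-⌜⌝ D.0<1) 0≤1) (+-nonNeg 0≤1 0≤1)

  -- The ratio is (2n + 1)/(2n + 2). The values are kept rational because the staircase argument
  -- must compare their partial sums with grid points.
  wℚ : ℕ → ℚ
  wℚ zero    = 1ℚ
  wℚ (suc n) = wℚ n ℚ.* (½ ℚ.* ((D.ι n ℚ.+ D.ι (suc n)) ℚ.* D.1/suc n))

  -- the coefficients of 1/√(1 - x), i.e. the central binomial coefficients divided by 4ⁿ
  w : Seq
  w n = ⌜ wℚ n ⌝

  w-suc : ∀ n → w (suc n) ≈ w n * (½# * ((ι n + ι (suc n)) * ν n))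
  w-suc n = ≈-trans (⌜⌝-* (wℚ n) _) (*-congˡ (≈-trans (⌜⌝-* ½ _) (*-congˡ (≈-trans (⌜⌝-* _ (D.1/suc n))
    (*-congʳ (≈-trans (⌜⌝-+ (D.ι n) (D.ι (suc n))) (+-cong (≈-sym (ι≈ n)) (≈-sym (ι≈ (suc n)))))))) ))

  w-rec : ∀ n → ι (suc n) * w (suc n) ≈ ½# * (ι n + ι (suc n)) * w n
  w-rec n = begin-equality
    ι (suc n) * w (suc n)  ≈⟨ *-congˡ (w-suc n) ⟩
    ι (suc n) * (w n * (½# * ((ι n + ι (suc n)) * ν n)))
      ≈⟨ solve 4 (λ i j w v → j :* (w :* (:½ :* ((i :+ j) :* v))) := (v :* j) :* (:½ :* (i :+ j) :* w)) ≈-refl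
           (ι n) (ι (suc n)) (w n) (ν n) ⟩
    (ν n * ι (suc n)) * (½# * (ι n + ι (suc n)) * w n)  ≈⟨ *-congʳ (ν-inverse n) ⟩
    1# * (½# * (ι n + ι (suc n)) * w n)  ≈⟨ *-identityˡ _ ⟩
    ½# * (ι n + ι (suc n)) * w n  ∎

  Pos-½ : Pos ½#
  Pos-½ = Pos-⌜⌝ (ℚ.positive⁻¹ ½)

  Pos-w : ∀ n → Pos (w n)
  Pos-w zero    = Pos-⌜⌝ D.0<1
  Pos-w (suc n) = Pos-≤ (Pos-* (Pos-w n) (Pos-* Pos-½ (Pos-* (Pos-≤ (Pos-ι n) (≤-by (0≤ι n) (+-comm _ _))) (Pos-ν n))))
    (≤-reflexive (≈-sym (w-suc n)))

  0≤w : O ≼ w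
  0≤w n = Pos⇒0≤ (Pos-w n)

  -- the coefficients of 1 - √(1 - x)
  b : Seq
  b zero    = 0#
  b (suc n) = ½# * (w n * ν n)

  Pos-b : ∀ n → Pos (b (suc n))
  Pos-b n = Pos-* Pos-½ (Pos-* (Pos-w n) (Pos-ν n))

  0≤b : O ≼ b
  0≤b zero    = ≤-refl
  0≤b (suc n) = Pos⇒0≤ (Pos-b n)

  ιb : ∀ n → ι (suc n) * b (suc n) ≈ ½# * w n
  ιb n = ≈-trans (solve 3 (λ i w v → i :* (:½ :* (w :* v)) := (v :* i) :* (:½ :* w)) ≈-refl (ι (suc n)) (w n) (ν n))
    (≈-trans (*-congʳ (ν-inverse n)) (*-identityˡ _))

  ι-cancel : ∀ n {x y} → ι (suc n) * x ≈ ι (suc n) * y → x ≈ y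
  ι-cancel n eq = *-cancelˡ-≤ (Pos-ι n) (proj₁ eq) , *-cancelˡ-≤ (Pos-ι n) (proj₂ eq)

  -- Coefficientwise, this is √(1 - x) = (1 - x) · 1/√(1 - x).
  w-diff : ∀ n → w (suc n) + b (suc n) ≈ w n
  w-diff n = ι-cancel n (begin-equality
    ι (suc n) * (w (suc n) + b (suc n))  ≈⟨ distribˡ _ _ _ ⟩
    ι (suc n) * w (suc n) + ι (suc n) * b (suc n)  ≈⟨ +-cong (w-rec n) (ιb n) ⟩
    ½# * (ι n + (1# + ι n)) * w n + ½# * w n
      ≈⟨ solve 2 (λ i w → :½ :* (i :+ (:1 :+ i)) :* w :+ :½ :* w := (:1 :+ i) :* w) ≈-refl (ι n) (w n) ⟩
    ι (suc n) * w n  ∎)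

  -- By telescoping of `w-diff`, the remainder of the series of `b` is exactly `w`. All later bounds
  -- on tails come from here.
  ∑b : ∀ n → ∑ b (suc n) + w n ≈ 1#
  ∑b zero    = solve 0 (:0 :+ :0 :+ :1 := :1) ≈-refl
  ∑b (suc n) = ≈-trans (+-assoc _ _ _) (≈-trans (+-congˡ (≈-trans (+-comm _ _) (w-diff n))) (∑b n))

  w≤1 : ∀ n → w n ≤ 1#
  w≤1 n = ≤-by (∑-nonNeg 0≤b (suc n)) (≈-trans (+-comm _ _) (∑b n))

  ∑b≤1 : ∀ n → ∑ b n ≤ 1#
  ∑b≤1 n = ≤-by (+-nonNeg (0≤b n) (0≤w n)) (≈-trans (≈-sym (+-assoc _ _ _)) (∑b n))

  -- If y = (1 - x)^(-e) then y ⊛ y = (1 - x)^(-2e); both powers are characterized by their recurrence.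
  square-rec : ∀ e y → (∀ n → ι (suc n) * y (suc n) ≈ (ι n + e) * y n) →
               ∀ n → ι (suc n) * (y ⊛ y) (suc n) ≈ (ι n + (e + e)) * (y ⊛ y) n
  square-rec e y rec n = begin-equality
    Θ (y ⊛ y) (suc n)  ≈⟨ double (suc n) ⟩
    (Θ y ⊛ y) (suc n) + (Θ y ⊛ y) (suc n)  ≈⟨ +-cong step step ⟩
    ((Θ y ⊛ y) n + e * (y ⊛ y) n) + ((Θ y ⊛ y) n + e * (y ⊛ y) n)
      ≈⟨ solve 3 (λ a e f → (a :+ e :* f) :+ (a :+ e :* f) := (a :+ a) :+ (e :+ e) :* f) ≈-refl ((Θ y ⊛ y) n) e ((y ⊛ y) n) ⟩
    ((Θ y ⊛ y) n + (Θ y ⊛ y) n) + (e + e) * (y ⊛ y) n  ≈⟨ +-congʳ (double n) ⟨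
    ι n * (y ⊛ y) n + (e + e) * (y ⊛ y) n  ≈⟨ ℛ.distribʳ _ _ _ ⟨
    (ι n + (e + e)) * (y ⊛ y) n  ∎
    where
    double : ∀ n → Θ (y ⊛ y) n ≈ (Θ y ⊛ y) n + (Θ y ⊛ y) n
    double n = ≈-trans (Θ-⊛ y y n) (+-congˡ (⊛-comm y (Θ y) n))
    step : (Θ y ⊛ y) (suc n) ≈ (Θ y ⊛ y) n + e * (y ⊛ y) n
    step = begin-equality
      (Θ y ⊛ y) (suc n)  ≈⟨ ⊛-sucˡ (Θ y) y n ⟩
      (0# * y 0) * y (suc n) + (tl (Θ y) ⊛ y) n ≈⟨ solve 3 (λ a b c → (:0 :* a) :* b :+ c := c) ≈-refl (y 0) (y (suc n)) _ ⟩
      (tl (Θ y) ⊛ y) n  ≈⟨ ⊛-cong {v = y} (λ m → ≈-trans (rec m) (ℛ.distribʳ _ _ _)) (λ m → ≈-refl) n ⟩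
      ((Θ y ⊕ e · y) ⊛ y) n  ≈⟨ ⊛-distribʳ (Θ y) (e · y) y n ⟩
      (Θ y ⊛ y) n + ((e · y) ⊛ y) n  ≈⟨ +-congˡ (·-⊛ e y y n) ⟩
      (Θ y ⊛ y) n + e * (y ⊛ y) n  ∎

  w⊛w : ∀ n → (w ⊛ w) n ≈ 1#
  w⊛w zero    = *-identityˡ 1#
  w⊛w (suc n) = ι-cancel n (≈-trans (square-rec ½# w rec n) (≈-trans (*-congˡ (w⊛w n))
    (*-congʳ (solve 1 (λ i → i :+ (:½ :+ :½) := :1 :+ i) ≈-refl (ι n)))))
    where
    rec : ∀ n → ι (suc n) * w (suc n) ≈ (ι n + ½#) * w n
    rec n = ≈-trans (w-rec n) (*-congʳ (solve 1 (λ i → :½ :* (i :+ (:1 :+ i)) := i :+ :½) ≈-refl (ι n)))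

  X : Seq
  X zero          = 0#
  X (suc zero)    = 1#
  X (suc (suc n)) = 0#

  √1-x : Seq
  √1-x = δ₀ ⊕ ⊖ b

  √1-x-rec : ∀ n → ι (suc n) * √1-x (suc n) ≈ (ι n + - ½#) * √1-x n
  √1-x-rec zero    = ≈-trans (solve 2 (λ j b → j :* (:0 :- b) := :- (j :* b)) ≈-refl (ι 1) (b 1)) (≈-trans (-‿cong (ιb 0))
    (solve 0 (:- (:½ :* :1) := (:0 :- :½) :* (:1 :- :0)) ≈-refl))
  √1-x-rec (suc n) = begin-equality
    ι (2 ℕ.+ n) * (0# - b (2 ℕ.+ n))  ≈⟨ solve 2 (λ j b → j :* (:0 :- b) := :- (j :* b)) ≈-refl (ι (2 ℕ.+ n)) (b (2 ℕ.+ n)) ⟩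
    - (ι (2 ℕ.+ n) * b (2 ℕ.+ n))  ≈⟨ -‿cong (ιb (suc n)) ⟩
    - (½# * w (suc n))  ≈⟨ -‿cong (*-congˡ (solve 2 (λ w b → w := (w :+ b) :- b) ≈-refl (w (suc n)) (b (suc n)))) ⟩
    - (½# * ((w (suc n) + b (suc n)) - b (suc n)))  ≈⟨ -‿cong (*-congˡ (+-congʳ (w-diff n))) ⟩
    - (½# * (w n - b (suc n)))  ≈⟨ solve 2 (λ w b → :- (:½ :* (w :- b)) := :- (:½ :* w) :+ :½ :* b) ≈-refl (w n) (b (suc n)) ⟩
    - (½# * w n) + ½# * b (suc n)  ≈⟨ +-congʳ (-‿cong (≈-sym (ιb n))) ⟩
    - (ι (suc n) * b (suc n)) + ½# * b (suc n)
      ≈⟨ solve 2 (λ j b → :- (j :* b) :+ :½ :* b := (j :- :½) :* (:0 :- b)) ≈-refl (ι (suc n)) (b (suc n)) ⟩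
    (ι (suc n) - ½#) * (0# - b (suc n))  ∎

  √1-x² : √1-x ⊛ √1-x ≋ δ₀ ⊕ ⊖ X
  √1-x² zero          = solve 0 ((:1 :- :0) :* (:1 :- :0) := :1 :- :0) ≈-refl
  √1-x² (suc zero)    = ι-cancel 0 (≈-trans (square-rec (- ½#) √1-x √1-x-rec 0) (≈-trans (*-congˡ (√1-x² 0))
    (solve 0 ((:0 :+ (:- :½ :+ :- :½)) :* (:1 :- :0) := (:1 :+ :0) :* (:0 :- :1)) ≈-refl)))
  -- The factor n - 1 of the recurrence vanishes at n = 1, which kills the coefficient of x²; all
  -- later ones then vanish by induction.
  √1-x² (suc (suc zero)) = ι-cancel 1 (≈-trans (square-rec (- ½#) √1-x √1-x-rec 1)
    (solve 2 (λ f i → ((:1 :+ :0) :+ (:- :½ :+ :- :½)) :* f := i :* (:0 :- :0)) ≈-refl ((√1-x ⊛ √1-x) 1) (ι 2)))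
  √1-x² (suc (suc (suc n))) = ι-cancel (2 ℕ.+ n) (≈-trans (square-rec (- ½#) √1-x √1-x-rec (2 ℕ.+ n))
        (≈-trans (*-congˡ (√1-x² (suc (suc n))))
    (solve 2 (λ i j → (i :+ (:- :½ :+ :- :½)) :* (:0 :- :0) := j :* (:0 :- :0)) ≈-refl (ι (2 ℕ.+ n)) (ι (3 ℕ.+ n)))))

  b⊛b : b ⊛ b ⊕ X ≋ b ⊕ b
  b⊛b n = ≈-trans
    (SeriesSolver.solve 2 (λ b x → b SeriesSolver.:* b SeriesSolver.:+ x SeriesSolver.:=
      (SeriesSolver.con 1ℚ SeriesSolver.:- b) SeriesSolver.:* (SeriesSolver.con 1ℚ SeriesSolver.:- b)
        SeriesSolver.:+ (b SeriesSolver.:+ b) SeriesSolver.:- SeriesSolver.con 1ℚ SeriesSolver.:+ x) ≋-refl b X n)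
    (≈-trans (+-congʳ (+-congʳ (+-congʳ (≈-trans (⊛-cong one one n) (√1-x² n)))))
      (solve 3 (λ d x b → d :- x :+ b :- :1 :* d :+ x := b) ≈-refl (δ₀ n) (X n) (b n + b n)))
    where
    one : (1# · δ₀) ⊕ ⊖ b ≋ √1-x
    one n = +-congʳ (*-identityˡ (δ₀ n))

  0≤X : O ≼ X
  0≤X zero          = ≤-refl
  0≤X (suc zero)    = 0≤1
  0≤X (suc (suc n)) = ≤-refl

  b⊛b≼ : b ⊛ b ≼ b ⊕ b
  b⊛b≼ n = ≤-by (0≤X n) (b⊛b n)

  Θ-nonNeg : ∀ {u} → O ≼ u → O ≼ Θ u
  Θ-nonNeg 0≤u n = *-nonNeg (0≤ι n) (0≤u n)

  -- Half the derivative of b ⊛ b = 2 b - x.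
  Θb⊛b : Θ b ⊛ b ⊕ ½# · X ≋ Θ b
  Θb⊛b n = begin-equality
    (Θ b ⊛ b) n + ½# * X n
      ≈⟨ solve 2 (λ t x → t :+ :½ :* x := :½ :* ((t :+ t) :+ x)) ≈-refl ((Θ b ⊛ b) n) (X n) ⟩
    ½# * (((Θ b ⊛ b) n + (Θ b ⊛ b) n) + X n)
      ≈⟨ *-congˡ (+-cong (≈-trans (+-congˡ (⊛-comm (Θ b) b n)) (≈-sym (Θ-⊛ b b n))) (ΘX n)) ⟩
    ½# * (ι n * (b ⊛ b) n + ι n * X n)  ≈⟨ *-congˡ (distribˡ _ _ _) ⟨
    ½# * (ι n * ((b ⊛ b) n + X n))  ≈⟨ *-congˡ (*-congˡ (b⊛b n)) ⟩
    ½# * (ι n * (b n + b n))  ≈⟨ solve 2 (λ i b → :½ :* (i :* (b :+ b)) := i :* b) ≈-refl (ι n) (b n) ⟩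
    ι n * b n  ∎
    where
    ΘX : ∀ n → X n ≈ ι n * X n
    ΘX zero          = ≈-sym (zeroʳ _)
    ΘX (suc zero)    = solve 0 (:1 := (:1 :+ :0) :* :1) ≈-refl
    ΘX (suc (suc n)) = ≈-sym (zeroʳ _)

  ∑X : ∀ n → ∑ X (suc (suc n)) ≈ 1#
  ∑X zero    = solve 0 (:0 :+ :0 :+ :1 := :1) ≈-refl
  ∑X (suc n) = ≈-trans (+-identityʳ _) (∑X n)

  -- Summing b ⊛ b = 2 b - x turns the defect into (1 - ∑ b)², the square of the remainder `w`. The
  -- index starts at 2, where the partial sums of `X` have reached 1.
  corner-b : ∀ n → corner b b (suc (suc n)) ≈ w (suc n) * w (suc n)
  corner-b n = begin-equality
    corner b b N
      ≈⟨ solve 3 (λ c e x → c := (e :+ c) :- (e :+ x) :+ x) ≈-refl (corner b b N) (∑ (b ⊛ b) N) 1# ⟩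
    (∑ (b ⊛ b) N + corner b b N) - (∑ (b ⊛ b) N + 1#) + 1#
      ≈⟨ +-congʳ (+-cong (≈-sym (∑-⊛ b b N)) (-‿cong (≈-trans (+-congˡ (≈-sym (∑X n)))
           (≈-trans (≈-sym (∑-⊕ (b ⊛ b) X N)) (≈-trans (∑-cong b⊛b N) (∑-⊕ b b N)))))) ⟩
    ∑ b N * ∑ b N - (∑ b N + ∑ b N) + 1#
      ≈⟨ solve 1 (λ s → s :* s :- (s :+ s) :+ :1 := (:1 :- s) :* (:1 :- s)) ≈-refl (∑ b N) ⟩
    (1# - ∑ b N) * (1# - ∑ b N)  ≈⟨ *-cong 1-∑ 1-∑ ⟩
    w (suc n) * w (suc n)  ∎
    where
    N = suc (suc n)
    1-∑ : 1# - ∑ b N ≈ w (suc n)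
    1-∑ = ≈-trans (+-congʳ (≈-sym (∑b (suc n)))) (solve 2 (λ s w → (s :+ w) :- s := w) ≈-refl (∑ b N) (w (suc n)))

  w-antitone : ∀ {m n} → m ℕ.≤′ n → w n ≤ w m
  w-antitone ℕ.≤′-refl = ≤-refl
  w-antitone (ℕ.≤′-step {n} m≤n) = ≤-trans (≤-by (0≤b (suc n)) (w-diff n)) (w-antitone m≤n)

  ⊛-lower : ∀ {x y u v} n → 0# ≤ x → 0# ≤ y → (∀ m → m ℕ.≤ n → x ≤ u m) → (∀ m → m ℕ.≤ n → y ≤ v m) →
            ι (suc n) * (x * y) ≤ (u ⊛ v) n
  ⊛-lower {x} {y} zero 0≤x 0≤y h k = ≤-trans (≤-reflexive (solve 1 (λ a → (:1 :+ :0) :* a := a) ≈-refl (x * y)))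
    (*-mono-≤ (≤-trans 0≤x (h 0 z≤n)) 0≤y (h 0 z≤n) (k 0 z≤n))
  ⊛-lower {x} {y} (suc n) 0≤x 0≤y h k = ≤-trans
    (≤-reflexive (solve 2 (λ i a → (:1 :+ i) :* a := a :+ i :* a) ≈-refl (ι (suc n)) (x * y)))
    (+-mono-≤ (*-mono-≤ (≤-trans 0≤x (h (suc n) ℕ.≤-refl)) 0≤y (h (suc n) ℕ.≤-refl) (k 0 z≤n))
      (⊛-lower n 0≤x 0≤y (λ m m≤n → h m (ℕ.m≤n⇒m≤1+n m≤n)) (λ m m≤n → k (suc m) (s≤s m≤n))))

  -- Since `w` decreases, each of the n + 1 products in (w ⊛ w) n = 1 is at least (w n)². This bound
  -- is the source of w → 0.
  w²-bound : ∀ n → ι (suc n) * (w n * w n) ≤ 1#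
  w²-bound n = ≤-trans (⊛-lower n (0≤w n) (0≤w n) (λ m m≤n → w-antitone (ℕ.≤⇒≤′ m≤n)) (λ m m≤n → w-antitone (ℕ.≤⇒≤′ m≤n)))
    (≤-reflexive (w⊛w n))

  ι-large : ∀ x ε → 0ℚ ℚ.< ε → Eventually λ n → x ≤ ι n * ⌜ ε ⌝
  ι-large x ε 0<ε =
    let B , 0≤B , x≤B = archimedean x
        N , B/ε<N = D.<-ι (B D.÷⁺ 0<ε)
    in N , λ n N≤n → begin
      x  ≤⟨ ≤-trans (x≤∣x∣ x) x≤B ⟩
      ⌜ B ⌝  ≈⟨ ℛ.reflexive (cong ⌜_⌝ (≡.sym (D.÷⁺-* B 0<ε))) ⟩
      ⌜ (B D.÷⁺ 0<ε) ℚ.* ε ⌝  ≈⟨ ⌜⌝-* (B D.÷⁺ 0<ε) ε ⟩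
      ⌜ B D.÷⁺ 0<ε ⌝ * ⌜ ε ⌝  ≤⟨ *-monoʳ-≤ (0≤⌜⌝ (ℚ.<⇒≤ 0<ε)) (⌜⌝-mono (ℚ.<⇒≤ B/ε<N)) ⟩
      ⌜ D.ι N ⌝ * ⌜ ε ⌝  ≈⟨ *-congʳ (ι≈ N) ⟨
      ι N * ⌜ ε ⌝  ≤⟨ *-monoʳ-≤ (0≤⌜⌝ (ℚ.<⇒≤ 0<ε)) (ι-mono N≤n) ⟩
      ι n * ⌜ ε ⌝  ∎

  w→0 : ∀ ε → 0ℚ ℚ.< ε → Eventually λ n → w n ≤ ⌜ ε ⌝
  w→0 ε 0<ε = eventually₁ (λ n h → square-cancel-≤ (0≤⌜⌝ (ℚ.<⇒≤ 0<ε)) (*-cancelˡ-≤ (Pos-ι n) (begin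
      ι (suc n) * (w n * w n)  ≤⟨ w²-bound n ⟩
      1#  ≤⟨ h ⟩
      ι n * ⌜ ε ℚ.* ε ⌝  ≤⟨ *-monoʳ-≤ (0≤⌜⌝ (ℚ.<⇒≤ 0<εε)) (ι-mono (ℕ.n≤1+n n)) ⟩
      ι (suc n) * ⌜ ε ℚ.* ε ⌝  ≈⟨ *-congˡ (⌜⌝-* ε ε) ⟩
      ι (suc n) * (⌜ ε ⌝ * ⌜ ε ⌝)  ∎)))
    (ι-large 1# (ε ℚ.* ε) 0<εε)
    where
    0<εε = D.pos-* 0<ε 0<ε

-- Calculus of coefficient asymptotics.

module Asymptotics where

  open Reals
  open RealSeries
  open ≤-Reasoning
  open Solver using (solve; _:=_; _:+_; _:-_; _:*_; :-_)

  infix 4 _~[_]_ _⟶_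

  -- Measuring the error by a multiple of c, and not by a quotient, admits c 0 = 0 as for `b`, and
  -- gives κ = 0 the meaning of negligible.
  record _~[_]_ (u c : Seq) (κ : Real) : Set where
    constructor mk~
    field close : ∀ ε → 0ℚ ℚ.< ε → Eventually λ n → ∣ u n - κ * c n ∣ ≤ ⌜ ε ⌝ * c n

  open _~[_]_ public

  𝟙 : Seq
  𝟙 _ = 1#

  -- Convergence is the case of constant c, so one calculus serves partial sums and coefficients
  -- alike.
  _⟶_ : Seq → Real → Set
  u ⟶ l = u ~[ 𝟙 ] l

  ∣-∣-bound : ∀ {x y z a} → ∣ x ∣ ≤ y → x ≈ z - a → z ≤ a + y
  ∣-∣-bound {x} {y} {z} {a} h eq = ≤-by (0≤y-x (≤-trans (x≤∣x∣ x) h))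
    (≈-trans (+-congˡ (+-congˡ (-‿cong eq))) (solve 3 (λ z a y → z :+ (y :- (z :- a)) := a :+ y) ≈-refl z a y))

  0≤⇒≤ : ∀ {q} → 0ℚ ℚ.< q → 0# ≤ ⌜ q ⌝
  0≤⇒≤ 0<q = 0≤⌜⌝ (ℚ.<⇒≤ 0<q)

  half-sum : ∀ ε c → ⌜ D.half ε ⌝ * c + ⌜ D.half ε ⌝ * c ≈ ⌜ ε ⌝ * c
  half-sum ε c = ≈-trans (+-cong (*-congʳ (⌜⌝-* ½ ε)) (*-congʳ (⌜⌝-* ½ ε)))
    (solve 2 (λ e c → :½ :* e :* c :+ :½ :* e :* c := e :* c) ≈-refl ⌜ ε ⌝ c)

  ∣∣-tri : ∀ {x y z a a′} → x ≈ y + z → ∣ y ∣ ≤ a → ∣ z ∣ ≤ a′ → ∣ x ∣ ≤ a + a′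
  ∣∣-tri {x} {y} {z} eq h k = ≤-trans (≤-reflexive (∣∣-cong eq)) (≤-trans (∣∣-+ y z) (+-mono-≤ h k))

  ∣∣-*-≤ : ∀ {x y a a′} → ∣ x ∣ ≤ a → ∣ y ∣ ≤ a′ → ∣ x * y ∣ ≤ a * a′
  ∣∣-*-≤ {x} {y} h k = ≤-trans (≤-reflexive (∣∣-* x y)) (*-mono-≤ (≤-trans (0≤∣x∣ x) h) (0≤∣x∣ y) h k)

  ~-cong∞ : ∀ {u v c κ λ′} → Eventually (λ n → u n ≈ v n) → κ ≈ λ′ → u ~[ c ] κ → v ~[ c ] λ′
  ~-cong∞ {u} {v} {c} {κ} {λ′} e κ≈ (mk~ h) = mk~ λ ε 0<ε → eventually₂
    (λ n eq p → ≤-trans (≤-reflexive (∣∣-cong (+-cong (≈-sym eq) (-‿cong (*-congʳ (≈-sym κ≈)))))) p) e (h ε 0<ε)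

  ~-cong : ∀ {u v c κ λ′} → u ≋ v → κ ≈ λ′ → u ~[ c ] κ → v ~[ c ] λ′
  ~-cong e = ~-cong∞ (always e)

  module _ {c : Seq} (0≤c : O ≼ c) where

    ~-≈ : ∀ {u κ} → u ≋ κ · c → u ~[ c ] κ
    ~-≈ {u} {κ} eq = mk~ λ ε 0<ε → always λ n → ≤-trans
      (≤-reflexive (≈-trans (∣∣-cong (≈-trans (+-congʳ (eq n)) (ℛ.-‿inverseʳ _))) (0≤x⇒∣x∣≈x ≤-refl)))
      (*-nonNeg (0≤⇒≤ 0<ε) (0≤c n))

    ~-zero : ∀ {u} → Eventually (λ n → u n ≈ 0#) → u ~[ c ] 0#
    ~-zero {u} e = ~-cong∞ {v = u} (eventually₁ (λ n → ≈-sym) e) ≈-refl (~-≈ {λ _ → 0#} (λ n → ≈-sym (zeroˡ (c n))))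

    ~-⊕ : ∀ {u v κ λ′} → u ~[ c ] κ → v ~[ c ] λ′ → u ⊕ v ~[ c ] κ + λ′
    ~-⊕ {u} {v} {κ} {λ′} (mk~ h) (mk~ k) = mk~ λ ε 0<ε → eventually₂
      (λ n p q → ≤-trans (∣∣-tri
        (solve 5 (λ u v k l c → (u :+ v) :- (k :+ l) :* c := (u :- k :* c) :+ (v :- l :* c)) ≈-refl (u n) (v n) κ λ′ (c n)) p q)
        (≤-reflexive (half-sum ε (c n))))
      (h (D.half ε) (D.0<half 0<ε)) (k (D.half ε) (D.0<half 0<ε))

    ~-big : ∀ {u κ} B → 0ℚ ℚ.≤ B → (∀ ε → 0ℚ ℚ.< ε → Eventually λ n → ∣ u n - κ * c n ∣ ≤ ⌜ B ⌝ * (⌜ ε ⌝ * c n)) → u ~[ c ] κ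
    ~-big B 0≤B h = mk~ λ ε 0<ε →
      let δ , 0<δ , Bδ≤ε = small ε B 0<ε 0≤B
      in eventually₁ (λ n p → ≤-trans p (≤-trans (≤-reflexive (≈-trans (≈-sym (*-assoc _ _ _)) (*-congʳ (≈-sym (⌜⌝-* B δ)))))
           (*-monoʳ-≤ (0≤c n) (⌜⌝-mono Bδ≤ε)))) (h δ 0<δ)

    ~-· : ∀ {u κ} x → u ~[ c ] κ → x · u ~[ c ] x * κ
    ~-· {u} {κ} x (mk~ h) = let B , 0≤B , x≤B = archimedean x in ~-big B 0≤B λ ε 0<ε → eventually₁
      (λ n p → ≤-trans (≤-reflexive (∣∣-cong (solve 4 (λ x u k c → x :* u :- x :* k :* c := x :* (u :- k :* c)) ≈-refl x (u n)
            κ (c n))))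
        (∣∣-*-≤ x≤B p)) (h ε 0<ε)

    ~-⊖ : ∀ {u v κ λ′} → u ~[ c ] κ → v ~[ c ] λ′ → u ⊕ ⊖ v ~[ c ] κ - λ′
    ~-⊖ {u} {v} {κ} {λ′} h k = ~-cong (λ n → +-congˡ (minus (v n))) (+-congˡ (minus λ′)) (~-⊕ h (~-· (- 1#) k))
      where
      minus : ∀ x → - 1# * x ≈ - x
      minus x = solve 1 (λ x → :- :1 :* x := :- x) ≈-refl x

    ~-upper : ∀ {u κ} → u ~[ c ] κ → ∀ ε → 0ℚ ℚ.< ε → Eventually λ n → u n ≤ (κ + ⌜ ε ⌝) * c n
    ~-upper {u} {κ} (mk~ h) ε 0<ε = eventually₁ (λ n p → ≤-trans (∣-∣-bound p ≈-refl)
          (≤-reflexive (≈-sym (ℛ.distribʳ _ _ _)))) (h ε 0<ε)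

    -- This is the exchange of limits. In its uses v is u with one factor truncated, so that v has
    -- known asymptotics and the truncation error is small relative to c.
    ~-approx : ∀ {u κ} B → 0ℚ ℚ.≤ B → (∀ ε → 0ℚ ℚ.< ε → ∃ λ v → ∃ λ λ′ → v ~[ c ] λ′ × ∣ λ′ - κ ∣ ≤ ⌜ B ⌝ * ⌜ ε ⌝ ×
               Eventually (λ n → ∣ u n - v n ∣ ≤ ⌜ B ⌝ * (⌜ ε ⌝ * c n))) → u ~[ c ] κ
    ~-approx {u} {κ} B 0≤B h = ~-big (B ℚ.+ (B ℚ.+ 1ℚ)) (ℚ.+-mono-≤ 0≤B (ℚ.+-mono-≤ 0≤B (ℚ.<⇒≤ D.0<1))) λ ε 0<ε →
      let v , λ′ , mk~ v~ , λ≈κ , near = h ε 0<ε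
      in eventually₂ (λ n p q → ≤-trans
           (∣∣-tri {y = u n - v n} {z = (v n - λ′ * c n) + (λ′ - κ) * c n}
             (solve 5 (λ u v l k c → u :- k :* c := (u :- v) :+ ((v :- l :* c) :+ (l :- k) :* c)) ≈-refl (u n) (v n) λ′ κ (c n)) p
             (∣∣-tri ≈-refl q (∣∣-*-≤ λ≈κ (≤-reflexive (0≤x⇒∣x∣≈x (0≤c n))))))
           (≤-reflexive (≈-trans (solve 3 (λ b e c → b :* (e :* c) :+ (e :* c :+ b :* e :* c) := (b :+ (b :+ :1)) :* (e :* c))
                 ≈-refl ⌜ B ⌝ ⌜ ε ⌝ (c n))
             (*-congʳ (≈-trans (+-congˡ (≈-sym (⌜⌝-+ B 1ℚ))) (≈-sym (⌜⌝-+ B (B ℚ.+ 1ℚ))))))))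
         near (v~ ε 0<ε)

  sh : Seq → Seq
  sh u zero    = 0#
  sh u (suc n) = u n

  -- Consecutive coefficients have ratio tending to 1, so multiplication by x does not change
  -- asymptotics relative to c.
  Regular : Seq → Set
  Regular c = sh c ~[ c ] 1#

  module _ {c : Seq} (0≤c : O ≼ c) (regular : Regular c) where

    ~-sh : ∀ {u κ} → u ~[ c ] κ → sh u ~[ c ] κ
    ~-sh {u} {κ} (mk~ h) = ~-cong split (≈-trans (+-identityˡ _) (*-identityʳ κ)) (~-⊕ 0≤c rest (~-· 0≤c κ regular))
      where
      r : Seq
      r n = u n - κ * c n
      split : sh r ⊕ κ · sh c ≋ sh u
      split zero    = solve 1 (λ k → :0 :+ k :* :0 := :0) ≈-refl κ
      split (suc n) = solve 3 (λ u k c → (u :- k :* c) :+ k :* c := u) ≈-refl (u n) κ (c n)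
      sh≤2 : Eventually λ n → sh c n ≤ (1# + 1#) * c n
      sh≤2 = ~-upper 0≤c regular 1ℚ D.0<1
      rest : sh r ~[ c ] 0#
      rest = ~-big 0≤c (1ℚ ℚ.+ 1ℚ) (ℚ.+-mono-≤ (ℚ.<⇒≤ D.0<1) (ℚ.<⇒≤ D.0<1)) λ ε 0<ε →
        let N , p = h ε 0<ε
        in eventually₂ {P = λ n → ∣ sh r n ∣ ≤ ⌜ ε ⌝ * sh c n}
             (λ n p q → ≤-trans (≤-reflexive (∣∣-cong (solve 2 (λ r c → r :- :0 :* c := r) ≈-refl (sh r n) (c n))))
               (≤-trans p (≤-trans (*-monoˡ-≤ (0≤⇒≤ 0<ε) q) (≤-reflexive
                 (≈-trans (solve 2 (λ e c → e :* ((:1 :+ :1) :* c) := (:1 :+ :1) :* (e :* c)) ≈-refl ⌜ ε ⌝ (c n))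
                       (*-congʳ (≈-sym (⌜⌝-+ 1ℚ 1ℚ))))))))
             (suc N , λ { (suc n) (s≤s N≤n) → p n N≤n }) sh≤2

    -- A polynomial factor adds up shifted copies of u. Regularity makes the shifts invisible, so
    -- only the value of the polynomial at 1 remains.
    ~-⊛-lo : ∀ {u κ} → u ~[ c ] κ → ∀ K v → u ⊛ lo K v ~[ c ] κ * ∑ v K
    ~-⊛-lo {u} {κ} h zero    v = ~-cong (λ n → ≈-refl) (≈-sym (zeroʳ κ)) (~-zero 0≤c {u ⊛ lo 0 v} (always (λ n → ⊛-zeroʳ u n)))
    ~-⊛-lo {u} {κ} h (suc K) v = ~-cong step (≈-trans (solve 3 (λ a k s → a :* k :+ k :* s := k :* (a :+ s)) ≈-refl (v 0) κ
          (∑ (tl v) K)) (*-congˡ (≈-sym (∑-head v K))))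
      (~-⊕ 0≤c (~-· 0≤c (v 0) h) (~-sh (~-⊛-lo h K (tl v))))
      where
      step : v 0 · u ⊕ sh (u ⊛ lo K (tl v)) ≋ u ⊛ lo (suc K) v
      step zero    = ≈-trans (+-identityʳ _) (*-comm (v 0) (u 0))
      step (suc n) = +-congʳ (*-comm (v 0) (u (suc n)))

  ratio-regular : ∀ c D → O ≼ c → Pos D → (∀ n → ι n * ∣ c (suc n) - c (suc (suc n)) ∣ ≤ D * c (suc (suc n))) → Regular c
  ratio-regular c D 0≤c D>0 h = mk~ λ ε 0<ε →
    let N , p = ι-large D ε 0<ε
    in suc (suc (suc N)) , λ { (suc (suc n@(suc m))) (s≤s (s≤s N<n)) → ≤-trans
      (≤-reflexive (∣∣-cong (+-congˡ (-‿cong (*-identityˡ (c (suc (suc n))))))))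
      (*-cancelˡ-≤ (Pos-ι m) (begin
        ι n * ∣ c (suc n) - c (suc (suc n)) ∣  ≤⟨ h n ⟩
        D * c (suc (suc n))  ≤⟨ *-monoʳ-≤ (0≤c (suc (suc n))) (p n (ℕ.<⇒≤ N<n)) ⟩
        ι n * ⌜ ε ⌝ * c (suc (suc n))  ≈⟨ *-assoc _ _ _ ⟩
        ι n * (⌜ ε ⌝ * c (suc (suc n)))  ∎)) }

  b-ratio : ∀ n → (ι (suc n) - ½#) * b (suc n) ≈ ι (suc (suc n)) * b (suc (suc n))
  b-ratio n = ≈-trans (solve 2 (λ j b → (j :- :½) :* b := :- ((j :+ :- :½) :* (:0 :- b))) ≈-refl (ι (suc n)) (b (suc n)))
    (≈-trans (-‿cong (≈-sym (√1-x-rec (suc n))))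
      (solve 2 (λ j b → :- (j :* (:0 :- b)) := j :* b) ≈-refl (ι (suc (suc n))) (b (suc (suc n)))))

  b-regular : Regular b
  b-regular = ratio-regular b (1# + 1# + 1#) 0≤b (Pos-+ (Pos-+ (Pos-⌜⌝ D.0<1) 0≤1) 0≤1) bound
    where
    diff : ∀ n → (ι n + ½#) * (b (suc n) - b (suc (suc n))) ≈ (1# + ½#) * b (suc (suc n))
    diff n = ≈-trans (solve 3 (λ i x y → (i :+ :½) :* (x :- y) := ((:1 :+ i) :- :½) :* x :- (i :+ :½) :* y) ≈-refl (ι n)
          (b (suc n)) (b (suc (suc n))))
      (≈-trans (+-congʳ (b-ratio n))
        (solve 2 (λ i y → (:1 :+ (:1 :+ i)) :* y :- (i :+ :½) :* y := (:1 :+ :½) :* y) ≈-refl (ι n) (b (suc (suc n)))))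
    Pos-ι+½ : ∀ n → Pos (ι n + ½#)
    Pos-ι+½ n = Pos-≤ (Pos-+ Pos-½ (0≤ι n)) (≤-reflexive (+-comm _ _))
    decreasing : ∀ n → 0# ≤ b (suc n) - b (suc (suc n))
    decreasing n = *-cancelˡ-≤ (Pos-ι+½ n) (begin
      (ι n + ½#) * 0#  ≈⟨ zeroʳ _ ⟩
      0#  ≤⟨ *-nonNeg (+-nonNeg 0≤1 (Pos⇒0≤ Pos-½)) (0≤b (suc (suc n))) ⟩
      (1# + ½#) * b (suc (suc n))  ≈⟨ diff n ⟨
      (ι n + ½#) * (b (suc n) - b (suc (suc n)))  ∎)
    bound : ∀ n → ι n * ∣ b (suc n) - b (suc (suc n)) ∣ ≤ (1# + 1# + 1#) * b (suc (suc n))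
    bound n = begin
      ι n * ∣ b (suc n) - b (suc (suc n)) ∣  ≈⟨ *-congˡ (0≤x⇒∣x∣≈x (decreasing n)) ⟩
      ι n * (b (suc n) - b (suc (suc n)))  ≤⟨ *-monoʳ-≤ (decreasing n) (≤-by (Pos⇒0≤ Pos-½) ≈-refl) ⟩
      (ι n + ½#) * (b (suc n) - b (suc (suc n)))  ≈⟨ diff n ⟩
      (1# + ½#) * b (suc (suc n))  ≤⟨ ≤-by (*-nonNeg (+-nonNeg 0≤1 (Pos⇒0≤ Pos-½)) (0≤b (suc (suc n))))
           (solve 1 (λ y → (:1 :+ :½) :* y :+ (:1 :+ :½) :* y := (:1 :+ :1 :+ :1) :* y) ≈-refl (b (suc (suc n)))) ⟩
      (1# + 1# + 1#) * b (suc (suc n))  ∎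

  0≤Θb : O ≼ Θ b
  0≤Θb = Θ-nonNeg 0≤b

  Θb-regular : Regular (Θ b)
  Θb-regular = ratio-regular (Θ b) 1# 0≤Θb (Pos-⌜⌝ D.0<1) bound
    where
    diff : ∀ n → Θ b (suc n) - Θ b (suc (suc n)) ≈ ½# * b (suc n)
    diff n = ≈-trans (+-cong (ιb n) (-‿cong (ιb (suc n)))) (≈-trans (+-congʳ (*-congˡ (≈-sym (w-diff n))))
      (solve 2 (λ x y → :½ :* (x :+ y) :- :½ :* x := :½ :* y) ≈-refl (w (suc n)) (b (suc n))))
    bound : ∀ n → ι n * ∣ Θ b (suc n) - Θ b (suc (suc n)) ∣ ≤ 1# * Θ b (suc (suc n))
    bound n = begin
      ι n * ∣ Θ b (suc n) - Θ b (suc (suc n)) ∣  ≈⟨ *-congˡ (≈-trans (∣∣-cong (diff n))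
            (0≤x⇒∣x∣≈x (*-nonNeg (Pos⇒0≤ Pos-½) (0≤b (suc n))))) ⟩
      ι n * (½# * b (suc n))  ≤⟨ ≤-by (*-nonNeg (+-nonNeg (0≤ι n) 0≤1) (*-nonNeg (Pos⇒0≤ Pos-½) (0≤b (suc n))))
           (solve 2 (λ i b → i :* (:½ :* b) :+ (i :+ :1) :* (:½ :* b) := (i :+ :½) :* b) ≈-refl (ι n) (b (suc n))) ⟩
      (ι n + ½#) * b (suc n)  ≈⟨ *-congʳ (solve 1 (λ i → i :+ :½ := (:1 :+ i) :- :½) ≈-refl (ι n)) ⟩
      (ι (suc n) - ½#) * b (suc n)  ≈⟨ b-ratio n ⟩
      Θ b (suc (suc n))  ≈⟨ *-identityˡ _ ⟨
      1# * Θ b (suc (suc n))  ∎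

  0≤𝟙 : O ≼ 𝟙
  0≤𝟙 _ = 0≤1

  ~-Θ : ∀ {u c κ} → u ~[ c ] κ → Θ u ~[ Θ c ] κ
  ~-Θ {u} {c} {κ} (mk~ h) = mk~ λ ε 0<ε → eventually₁ (λ n p → begin
      ∣ ι n * u n - κ * (ι n * c n) ∣  ≈⟨ ∣∣-cong (solve 4 (λ i u k c → i :* u :- k :* (i :* c) := i :* (u :- k :* c)) ≈-refl
            (ι n) (u n) κ (c n)) ⟩
      ∣ ι n * (u n - κ * c n) ∣  ≈⟨ ≈-trans (∣∣-* (ι n) _) (*-congʳ (0≤x⇒∣x∣≈x (0≤ι n))) ⟩
      ι n * ∣ u n - κ * c n ∣  ≤⟨ *-monoˡ-≤ (0≤ι n) p ⟩
      ι n * (⌜ ε ⌝ * c n)  ≈⟨ solve 3 (λ i e c → i :* (e :* c) := e :* (i :* c)) ≈-refl (ι n) ⌜ ε ⌝ (c n) ⟩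
      ⌜ ε ⌝ * (ι n * c n)  ∎) (h ε 0<ε)

  Θ-~ : ∀ {u c κ} → Θ u ~[ Θ c ] κ → u ~[ c ] κ
  Θ-~ {u} {c} {κ} (mk~ h) = mk~ λ ε 0<ε → let N , p = h ε 0<ε in suc N , λ { n@(suc m) N<n → *-cancelˡ-≤ (Pos-ι m) (begin
      ι n * ∣ u n - κ * c n ∣  ≈⟨ ≈-trans (∣∣-* (ι n) _) (*-congʳ (0≤x⇒∣x∣≈x (0≤ι n))) ⟨
      ∣ ι n * (u n - κ * c n) ∣  ≈⟨ ∣∣-cong (solve 4 (λ i u k c → i :* u :- k :* (i :* c) := i :* (u :- k :* c)) ≈-refl (ι n)
            (u n) κ (c n)) ⟨
      ∣ ι n * u n - κ * (ι n * c n) ∣  ≤⟨ p n (ℕ.<⇒≤ N<n) ⟩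
      ⌜ ε ⌝ * (ι n * c n)  ≈⟨ solve 3 (λ i e c → i :* (e :* c) := e :* (i :* c)) ≈-refl (ι n) ⌜ ε ⌝ (c n) ⟨
      ι n * (⌜ ε ⌝ * c n)  ∎) }

-- Transfer through the quadratic equation t = (t² + q)/2.

module TransferTheorem where

  open Reals
  open RealSeries
  open Asymptotics
  open ≤-Reasoning
  open Solver using (solve; _:=_; _:+_; _:-_; _:*_; :-_)
  private module S = SeriesSolver

  ∑-up : ∀ {u} → O ≼ u → ∀ {m n} → m ℕ.≤′ n → ∑ u m ≤ ∑ u n
  ∑-up 0≤u ℕ.≤′-refl               = ≤-refl
  ∑-up {u} 0≤u (ℕ.≤′-step {n} m≤n) = ≤-trans (∑-up {u} 0≤u m≤n) (≤-by (0≤u n) ≈-refl)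

  ∑≤limit : ∀ {u l} → O ≼ u → ∑ u ⟶ l → ∀ n → ∑ u n ≤ l
  ∑≤limit {u} {l} 0≤u h n = ≤-closed λ ε 0<ε → let N , p = ~-upper {c = 𝟙} 0≤𝟙 {∑ u} {l} h ε 0<ε in
    ≤-trans (∑-up {u} 0≤u (ℕ.≤⇒≤′ (ℕ.m≤m⊔n n N))) (≤-trans (p (n ℕ.⊔ N) (ℕ.m≤n⊔m n N)) (≤-reflexive (*-identityʳ _)))

  ⟶-* : ∀ {u v : Seq} {l} B → 0ℚ ℚ.≤ B → u ⟶ l → (∀ n → ∣ v n ∣ ≤ ⌜ B ⌝) → (λ n → (u n - l) * v n) ⟶ 0#
  ⟶-* {u} {v} {l} B 0≤B (mk~ h) v≤B = ~-big 0≤𝟙 B 0≤B λ ε 0<ε → eventually₁ (λ n p → begin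
      ∣ (u n - l) * v n - 0# * 1# ∣  ≈⟨ ∣∣-cong (solve 3 (λ u l v → (u :- l) :* v :- :0 :* :1 := v :* (u :- l :* :1)) ≈-refl
            (u n) l (v n)) ⟩
      ∣ v n * (u n - l * 1#) ∣  ≤⟨ ∣∣-*-≤ (v≤B n) p ⟩
      ⌜ B ⌝ * (⌜ ε ⌝ * 1#)  ∎) (h ε 0<ε)

  ⟶-cancel : ∀ {u x l} → Pos x → (λ n → x * u n) ⟶ x * l → u ⟶ l
  ⟶-cancel {u} {x} {l} px h = ~-cong (λ n → cancel (u n)) (cancel l) (~-· 0≤𝟙 (inv x px) h)
    where
    cancel : ∀ y → inv x px * (x * y) ≈ y
    cancel y = ≈-trans (≈-sym (*-assoc _ _ _)) (≈-trans (*-congʳ (inv-inverseˡ x px)) (*-identityˡ y))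

  -- Since s ≤ s + u n, s times the error of u is at most the error of its square. The limit of a
  -- root thus needs no continuity of √.
  square-limit : ∀ {u s} → (∀ n → 0# ≤ u n) → Pos s → (λ n → u n * u n) ⟶ s * s → u ⟶ s
  square-limit {u} {s} 0≤u ps (mk~ h) = ⟶-cancel ps (mk~ λ ε 0<ε → eventually₁ (λ n p → begin
      ∣ s * u n - s * s * 1# ∣  ≈⟨ ∣∣-cong (solve 2 (λ s u → s :* u :- s :* s :* :1 := s :* (u :- s)) ≈-refl s (u n)) ⟩
      ∣ s * (u n - s) ∣  ≈⟨ ≈-trans (∣∣-* s _) (*-congʳ (0≤x⇒∣x∣≈x (Pos⇒0≤ ps))) ⟩
      s * ∣ u n - s ∣  ≤⟨ *-monoʳ-≤ (0≤∣x∣ _) (≤-by (0≤u n) ≈-refl) ⟩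
      (s + u n) * ∣ u n - s ∣  ≈⟨ *-congʳ (0≤x⇒∣x∣≈x (+-nonNeg (Pos⇒0≤ ps) (0≤u n))) ⟨
      ∣ s + u n ∣ * ∣ u n - s ∣  ≈⟨ ∣∣-* _ _ ⟨
      ∣ (s + u n) * (u n - s) ∣  ≈⟨ ∣∣-cong (solve 2 (λ s u → (s :+ u) :* (u :- s) := u :* u :- s :* s :* :1) ≈-refl s (u n)) ⟩
      ∣ u n * u n - s * s * 1# ∣  ≤⟨ p ⟩
      ⌜ ε ⌝ * 1#  ∎) (h ε 0<ε))

  w-small : ∀ {u} x → (∀ n → ∣ u (suc n) ∣ ≤ x * w n) → u ⟶ 0#
  w-small {u} x h = let B , 0≤B , x≤B = archimedean x in ~-big 0≤𝟙 B 0≤B λ ε 0<ε →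
    let N , p = w→0 ε 0<ε
    in suc N , λ { (suc n) (s≤s N≤n) → begin
      ∣ u (suc n) - 0# * 1# ∣  ≈⟨ ∣∣-cong (solve 1 (λ u → u :- :0 :* :1 := u) ≈-refl (u (suc n))) ⟩
      ∣ u (suc n) ∣  ≤⟨ h n ⟩
      x * w n  ≤⟨ *-mono-≤ (0≤⌜⌝ 0≤B) (0≤w n) (≤-trans (x≤∣x∣ x) x≤B) (p n N≤n) ⟩
      ⌜ B ⌝ * ⌜ ε ⌝  ≈⟨ *-congˡ (*-identityʳ _) ⟨
      ⌜ B ⌝ * (⌜ ε ⌝ * 1#)  ∎ }

  -- By `corner-b` the corner of b with itself is at most `w`, and corners are monotone. The bound
  -- on v starts at index 1 because corners do not involve v 0; this admits v = 1/(1 - t), whose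
  -- constant term is 1 while b 0 = 0.
  corner→0 : ∀ {u v} x y → 0# ≤ x → 0# ≤ y → (∀ n → ∣ u n ∣ ≤ x * b n) → (∀ n → ∣ v (suc n) ∣ ≤ y * b (suc n)) → corner u v ⟶ 0#
  corner→0 {u} {v} x y 0≤x 0≤y u≤ v≤ = w-small (x * y) bound
    where
    bound : ∀ n → ∣ corner u v (suc n) ∣ ≤ x * y * w n
    bound n = begin
      ∣ corner u v (suc n) ∣  ≤⟨ ∣corner∣≤ {u} {x · b} {v} {y · b} u≤ v≤ (suc n) ⟩
      corner (x · b) (y · b) (suc n)  ≈⟨ corner-· x y b b (suc n) ⟩
      x * y * corner b b (suc n)  ≤⟨ *-monoˡ-≤ (*-nonNeg 0≤x 0≤y) (corner≤w n) ⟩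
      x * y * w n  ∎
      where
      corner≤w : ∀ n → corner b b (suc n) ≤ w n
      corner≤w zero    = ≤-trans (≤-reflexive (solve 0 (:0 :* :0 :+ :0 := :0) ≈-refl)) (0≤w 0)
      corner≤w (suc n) = begin
        corner b b (suc (suc n))  ≈⟨ corner-b n ⟩
        w (suc n) * w (suc n)  ≤⟨ *-monoˡ-≤ (0≤w (suc n)) (w≤1 (suc n)) ⟩
        w (suc n) * 1#  ≈⟨ *-identityʳ _ ⟩
        w (suc n)  ∎

  one : (λ _ → 1#) ⟶ 1#
  one = ~-≈ 0≤𝟙 (λ n → ≈-sym (*-identityʳ 1#))

  ∑b⟶1 : ∑ b ⟶ 1#
  ∑b⟶1 = ~-cong (λ n → solve 1 (λ s → :1 :- (:1 :- s) := s) ≈-refl (∑ b n)) (solve 0 (:1 :- :0 := :1) ≈-refl)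
    (~-⊖ 0≤𝟙 one (w-small {λ n → 1# - ∑ b n} 1# λ n → ≤-reflexive
      (≈-trans (∣∣-cong (≈-trans (+-congʳ (≈-sym (∑b n))) (solve 2 (λ s w → (s :+ w) :- s := w) ≈-refl (∑ b (suc n)) (w n))))
        (≈-trans (0≤x⇒∣x∣≈x (0≤w n)) (≈-sym (*-identityˡ (w n)))))))

  ⊛-local₀ : ∀ {t u v} → t 0 ≈ 0# → ∀ n → (∀ m → m ℕ.< n → u m ≈ v m) → (t ⊛ u) n ≈ (t ⊛ v) n
  ⊛-local₀ t₀ zero    h = ≈-trans (*-congʳ t₀) (≈-trans (zeroˡ _) (≈-sym (≈-trans (*-congʳ t₀) (zeroˡ _))))
  ⊛-local₀ {t} {u} {v} t₀ (suc n) h = ≈-trans (⊛-sucˡ t u n) (≈-trans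
    (+-cong (≈-trans (*-congʳ t₀) (≈-trans (zeroˡ _) (≈-sym (≈-trans (*-congʳ t₀) (zeroˡ _)))))
      (⊛-local n (λ m _ → ≈-refl) (λ m m≤n → h m (s≤s m≤n))))
    (≈-sym (⊛-sucˡ t v n)))

  module GeometricSeries (t : Seq) (t₀ : t 0 ≈ 0#) where

    -- Iterates of u ↦ 1 + t u. As t 0 = 0, each step fixes one more coefficient, so the diagonal is
    -- a fixed point.
    partial : ℕ → Seq
    partial zero    = O
    partial (suc n) = δ₀ ⊕ t ⊛ partial n

    -- 1/(1 - t)
    g : Seq
    g n = partial (suc n) n

    stable : ∀ n m → m ℕ.< n → partial n m ≈ partial (suc n) m
    stable (suc n) m (s≤s m≤n) = +-congˡ (⊛-local₀ t₀ m (λ j j<m → stable n j (ℕ.<-≤-trans j<m m≤n)))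

    partial≈g : ∀ {n m} → suc m ℕ.≤′ n → partial n m ≈ g m
    partial≈g ℕ.≤′-refl = ≈-refl
    partial≈g {suc n} {m} (ℕ.≤′-step m<n) = ≈-trans (≈-sym (stable n m (ℕ.≤′⇒≤ m<n))) (partial≈g m<n)

    g-eq : g ≋ δ₀ ⊕ t ⊛ g
    g-eq n = +-congˡ (⊛-local₀ t₀ n (λ m m<n → partial≈g (ℕ.≤⇒≤′ m<n)))

    0≤partial : O ≼ t → ∀ n → O ≼ partial n
    0≤partial 0≤t zero    m = ≤-refl
    0≤partial 0≤t (suc n) m = +-nonNeg (0≤δ₀ m) (⊛-nonNeg 0≤t (0≤partial 0≤t n) m)

    0≤g : O ≼ t → O ≼ g
    0≤g 0≤t n = 0≤partial 0≤t (suc n) n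

  lo-zero : ∀ K u n → K ℕ.≤ n → lo K u n ≈ 0#
  lo-zero zero    u n       _         = ≈-refl
  lo-zero (suc K) u (suc n) (s≤s K≤n) = lo-zero K (tl u) n K≤n

  lo~0 : ∀ K u → lo K u ~[ b ] 0#
  lo~0 K u = ~-zero 0≤b (K , lo-zero K u)

  b~1 : b ~[ b ] 1#
  b~1 = ~-≈ 0≤b (λ n → ≈-sym (*-identityˡ (b n)))

  b⊛lo : ∀ K v → b ⊛ lo K v ~[ b ] ∑ v K
  b⊛lo K v = ~-cong (λ n → ≈-refl) (*-identityˡ _) (~-⊛-lo 0≤b b-regular b~1 K v)

  b⊛b~2 : b ⊛ b ~[ b ] 1# + 1#
  b⊛b~2 = ~-cong∞ (2 , eq) ≈-refl (~-⊕ 0≤b b~1 b~1)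
    where
    eq : ∀ n → 2 ℕ.≤ n → b n + b n ≈ (b ⊛ b) n
    eq (suc zero)    (s≤s ())
    eq (suc (suc n)) _ = ≈-trans (≈-sym (b⊛b (suc (suc n)))) (+-identityʳ _)

  -- Expanding (b - lo K b)² leaves twice a remainder of the series of b. Products of two large
  -- indices therefore contribute little to b ⊛ b, the property on which the renewal bound rests.
  hi⊛hi : ∀ K → hi K b ⊛ hi K b ~[ b ] (1# + 1#) - (∑ b K + ∑ b K)
  hi⊛hi K = ~-cong eq (+-identityʳ _) (~-⊕ 0≤b (~-⊖ 0≤b b⊛b~2 (~-⊕ 0≤b (b⊛lo K b) (b⊛lo K b)))
      (~-cong (λ n → ≈-refl) (zeroˡ _) (~-⊛-lo 0≤b b-regular (lo~0 K b) K b)))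
    where
    eq : (b ⊛ b ⊕ ⊖ (b ⊛ lo K b ⊕ b ⊛ lo K b)) ⊕ lo K b ⊛ lo K b ≋ hi K b ⊛ hi K b
    eq n = ≈-trans
      (S.solve 2 (λ b l → (b S.:* b S.:- (b S.:* l S.:+ b S.:* l)) S.:+ l S.:* l S.:= (b S.:- l) S.:* (b S.:- l)) ≋-refl b
            (lo K b) n)
      (⊛-cong minus minus n)
      where
      minus : b ⊕ ⊖ lo K b ≋ hi K b
      minus m = ≈-trans (+-congʳ (lo⊕hi K b m)) (solve 2 (λ l h → (l :+ h) :- l := h) ≈-refl (lo K b m) (hi K b m))

  -- The start of the renewal induction. The constant accumulates the quotients y n / b n, which
  -- avoids a maximum of reals; y 0 = 0 is needed because b 0 = 0.
  bounded-below : ∀ {y} → O ≼ y → y 0 ≈ 0# → ∀ N → ∃ λ M → 0# ≤ M × (∀ n → n ℕ.< N → y n ≤ M * b n)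
  bounded-below 0≤y y₀ zero = 0# , ≤-refl , λ n ()
  bounded-below {y} 0≤y y₀ (suc zero) = 0# , ≤-refl , λ { zero _ → ≤-reflexive (≈-trans y₀ (≈-sym (zeroˡ _))) ; (suc n) (s≤s ()) }
  bounded-below {y} 0≤y y₀ (suc (suc N)) =
    let M , 0≤M , h = bounded-below 0≤y y₀ (suc N)
        pb = Pos-b N
        x = y (suc N) * inv (b (suc N)) pb
        0≤x = *-nonNeg (0≤y (suc N)) (Pos⇒0≤ (inv-pos _ pb))
        x*b : x * b (suc N) ≈ y (suc N)
        x*b = ≈-trans (*-assoc _ _ _) (≈-trans (*-congˡ (inv-inverseˡ _ pb)) (*-identityʳ _))
    in M + x , +-nonNeg 0≤M 0≤x , λ n n<2+N → case≤ M x 0≤M 0≤x h x*b n (ℕ.m≤n⇒m<n∨m≡n (ℕ.≤-pred n<2+N))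
    where
    case≤ : ∀ M x → 0# ≤ M → 0# ≤ x → (∀ n → n ℕ.< suc N → y n ≤ M * b n) → x * b (suc N) ≈ y (suc N) →
            ∀ n → n ℕ.< suc N ⊎ n ≡ suc N → y n ≤ (M + x) * b n
    case≤ M x 0≤M 0≤x h eq n (inj₁ n<) = ≤-trans (h n n<) (*-monoʳ-≤ (0≤b n) (≤-by 0≤x ≈-refl))
    case≤ M x 0≤M 0≤x h eq .(suc N) (inj₂ ≡.refl) = ≤-trans (≤-reflexive (≈-sym eq))
          (*-monoʳ-≤ (0≤b (suc N)) (≤-by 0≤M (+-comm x M)))

  -- Renewal theorem, upper bound: only the extreme parts of q ⊛ y matter, because the middle part hi K b ⊛ hi K b is
  -- at most a small multiple of b.
  renewal : ∀ {q y} C θ → 0# ≤ C → O ≼ q → q 0 ≈ 0# → q ≼ C · b → O ≼ y → y 0 ≈ 0# → y ≼ q ⊕ q ⊛ y →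
            (∀ n → ∑ q n ≤ θ) → Pos (1# - θ) → ∃ λ M → 0# ≤ M × y ≼ M · b
  renewal {q} {y} C θ 0≤C 0≤q q₀ q≤ 0≤y y₀ y≤ ∑q≤θ (p , 0<p , p≤1-θ) =
    let B , 0≤B , C≤B = archimedean C
        δ , 0<δ , Bδ≤η = small η B 0<η 0≤B
        -- The tails from K + 1 on then have a product asymptotic to 2 w K times b, at most δ times
        -- b.
        K , wK≤ = w→0 (D.half δ) (D.0<half 0<δ)
        N , main = eventually₂ (λ n → _,_) (~-upper 0≤b (b⊛lo (suc K) q) η 0<η) (eventually₂ (λ n → _,_)
          (~-upper 0≤b (b⊛lo (suc K) y) 1ℚ D.0<1) (~-upper 0≤b (hi⊛hi (suc K)) δ 0<δ))
        M₀ , 0≤M₀ , below = bounded-below 0≤y y₀ N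
        -- `E` collects the contributions without a factor M: q n itself, and the products of q with
        -- early coefficients of y. M is then chosen with E ≤ M η.
        E = C + C * (∑ y (suc K) + 1#)
        0≤E = +-nonNeg 0≤C (*-nonNeg 0≤C (+-nonNeg (∑-nonNeg 0≤y (suc K)) 0≤1))
        η⁻¹ = inv ⌜ η ⌝ (Pos-⌜⌝ 0<η)
        0≤Eη⁻¹ = *-nonNeg 0≤E (Pos⇒0≤ (inv-pos _ (Pos-⌜⌝ 0<η)))
        M = M₀ + E * η⁻¹
        0≤M = +-nonNeg 0≤M₀ 0≤Eη⁻¹
        E≤Mη : E ≤ M * ⌜ η ⌝
        E≤Mη = ≤-by (*-nonNeg 0≤M₀ (0≤⇒≤ 0<η)) (≈-trans (+-congʳ (≈-sym
              (≈-trans (*-assoc _ _ _) (≈-trans (*-congˡ (inv-inverseˡ _ _)) (*-identityʳ E)))))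
          (solve 3 (λ m e h → e :* h :+ m :* h := (m :+ e) :* h) ≈-refl M₀ (E * η⁻¹) ⌜ η ⌝))
        μ≤ : (1# + 1#) - (∑ b (suc K) + ∑ b (suc K)) ≤ ⌜ δ ⌝
        μ≤ = begin
          (1# + 1#) - (∑ b (suc K) + ∑ b (suc K))
            ≈⟨ +-congʳ (+-cong (≈-sym (∑b K)) (≈-sym (∑b K))) ⟩
          ((∑ b (suc K) + w K) + (∑ b (suc K) + w K)) - (∑ b (suc K) + ∑ b (suc K))
            ≈⟨ solve 2 (λ s w → ((s :+ w) :+ (s :+ w)) :- (s :+ s) := w :+ w) ≈-refl (∑ b (suc K)) (w K) ⟩
          w K + w K  ≤⟨ +-mono-≤ (wK≤ K ℕ.≤-refl) (wK≤ K ℕ.≤-refl) ⟩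
          ⌜ D.half δ ⌝ + ⌜ D.half δ ⌝  ≈⟨ ⌜⌝-+ _ _ ⟨
          ⌜ D.half δ ℚ.+ D.half δ ⌝  ≈⟨ ℛ.reflexive (cong ⌜_⌝ (D.half+half δ)) ⟩
          ⌜ δ ⌝  ∎
        Cδ≤η : C * ⌜ δ ⌝ ≤ ⌜ η ⌝
        Cδ≤η = ≤-trans (*-monoʳ-≤ (0≤⇒≤ 0<δ) (≤-trans (x≤∣x∣ C) C≤B)) (≤-trans (≤-reflexive (≈-sym (⌜⌝-* B δ))) (⌜⌝-mono Bδ≤η))
    in M , 0≤M , ℕ.<-rec (λ n → y n ≤ M * b n) λ n ih → case-split n N M K δ 0≤M (≤-by 0≤Eη⁻¹ ≈-refl) below
          (λ N≤n → main n N≤n) E≤Mη μ≤ Cδ≤η (λ m m<n → ih m<n)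
    where
    -- The gap 1 - θ is at least p = 4 η. One η pays for `E`, one for the limit error in the early
    -- part of q, and two for the product of the tails.
    η : ℚ
    η = D.half (D.half p)
    0<η : 0ℚ ℚ.< η
    0<η = D.0<half (D.0<half 0<p)
    θ+4η≤1 : θ + (⌜ η ⌝ + ⌜ η ⌝ + (⌜ η ⌝ + ⌜ η ⌝)) ≤ 1#
    θ+4η≤1 = begin
      θ + (⌜ η ⌝ + ⌜ η ⌝ + (⌜ η ⌝ + ⌜ η ⌝))  ≈⟨ +-congˡ (≈-trans (+-cong 2η 2η)
            (≈-trans (≈-sym (⌜⌝-+ _ _)) (ℛ.reflexive (cong ⌜_⌝ (D.half+half p))))) ⟩
      θ + ⌜ p ⌝  ≤⟨ +-mono-≤ ≤-refl p≤1-θ ⟩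
      θ + (1# - θ)  ≈⟨ solve 1 (λ t → t :+ (:1 :- t) := :1) ≈-refl θ ⟩
      1#  ∎
      where
      2η : ⌜ η ⌝ + ⌜ η ⌝ ≈ ⌜ D.half p ⌝
      2η = ≈-trans (≈-sym (⌜⌝-+ η η)) (ℛ.reflexive (cong ⌜_⌝ (D.half+half (D.half p))))
    step : ∀ n M K → 0# ≤ M → (∀ m → m ℕ.< n → y m ≤ M * b m) →
           (q ⊛ y) n ≤ M * (b ⊛ lo K q) n + C * (b ⊛ lo K y) n + C * (M * (hi K b ⊛ hi K b) n)
    step n M K 0≤M ih = begin
      -- As q 0 = 0, only y below n matters. Truncating y at n makes the induction hypothesis a
      -- bound on all coefficients.
      (q ⊛ y) n  ≈⟨ ⊛-local₀ q₀ n (λ m m<n → ≈-sym (lo-< n y m m<n)) ⟩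
      (q ⊛ z) n  ≈⟨ ⊛-cong {v = z} (lo⊕hi K q) (λ m → ≈-refl) n ⟩
      ((lo K q ⊕ hi K q) ⊛ z) n  ≈⟨ ⊛-distribʳ (lo K q) (hi K q) z n ⟩
      (lo K q ⊛ z) n + (hi K q ⊛ z) n  ≈⟨ +-congˡ (≈-trans (⊛-cong {hi K q} (λ m → ≈-refl) (lo⊕hi K z) n)
            (⊛-distribˡ (hi K q) (lo K z) (hi K z) n)) ⟩
      (lo K q ⊛ z) n + ((hi K q ⊛ lo K z) n + (hi K q ⊛ hi K z) n)
        ≤⟨ +-mono-≤ (⊛-mono (lo-nonNeg K 0≤q) 0≤z (λ m → ≤-refl) z≤ n) (+-mono-≤
             (⊛-mono (hi-nonNeg K 0≤q) (lo-nonNeg K 0≤z) (λ m → ≤-trans (hi-≼ K 0≤q m) (q≤ m)) (lo-mono K (lo-≼ n 0≤y)) n)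
             (⊛-mono (hi-nonNeg K 0≤q) (hi-nonNeg K 0≤z) (λ m → ≤-trans (hi-mono K (λ j _ → q≤ j) m) (≤-reflexive (hi-· K C b m)))
               (λ m → ≤-trans (hi-mono K (λ j _ → z≤ j) m) (≤-reflexive (hi-· K M b m))) n)) ⟩
      (lo K q ⊛ (M · b)) n + (((C · b) ⊛ lo K y) n + ((C · hi K b) ⊛ (M · hi K b)) n)
        ≈⟨ +-cong (≈-trans (⊛-· M (lo K q) b n) (*-congˡ (⊛-comm (lo K q) b n)))
             (+-cong (·-⊛ C b (lo K y) n) (≈-trans (·-⊛ C (hi K b) (M · hi K b) n) (*-congˡ (⊛-· M (hi K b) (hi K b) n)))) ⟩
      M * (b ⊛ lo K q) n + (C * (b ⊛ lo K y) n + C * (M * (hi K b ⊛ hi K b) n))  ≈⟨ +-assoc _ _ _ ⟨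
      M * (b ⊛ lo K q) n + C * (b ⊛ lo K y) n + C * (M * (hi K b ⊛ hi K b) n)  ∎
      where
      z : Seq
      z = lo n y
      0≤z = lo-nonNeg n 0≤y
      z≤ : z ≼ M · b
      z≤ m with m ℕ.<? n
      ... | yes m<n = ≤-trans (≤-reflexive (lo-< n y m m<n)) (ih m m<n)
      ... | no  m≮n = ≤-trans (≤-reflexive (lo-zero n y m (ℕ.≮⇒≥ m≮n))) (*-nonNeg 0≤M (0≤b m))
    case-split : ∀ n N M K δ → 0# ≤ M → ∀ {M₀ μ} → M₀ ≤ M → (∀ m → m ℕ.< N → y m ≤ M₀ * b m) → 
      (N ℕ.≤ n → (b ⊛ lo (suc K) q) n ≤ (∑ q (suc K) + ⌜ η ⌝) * b n × (b ⊛ lo (suc K) y) n ≤ (∑ y (suc K) + ⌜ 1ℚ ⌝) * b n ×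
                  (hi (suc K) b ⊛ hi (suc K) b) n ≤ (μ + ⌜ δ ⌝) * b n) →
      C + C * (∑ y (suc K) + 1#) ≤ M * ⌜ η ⌝ → μ ≤ ⌜ δ ⌝ → C * ⌜ δ ⌝ ≤ ⌜ η ⌝ → (∀ m → m ℕ.< n → y m ≤ M * b m) → y n ≤ M * b n
    case-split n N M K δ 0≤M {M₀} {μ} M₀≤M below main E≤Mη μ≤δ Cδ≤η ih with n ℕ.<? N
    ... | yes n<N = ≤-trans (below n n<N) (*-monoʳ-≤ (0≤b n) M₀≤M)
    ... | no  n≮N = let b₁ , b₂ , b₃ = main (ℕ.≮⇒≥ n≮N) in begin
      y n  ≤⟨ y≤ n ⟩
      q n + (q ⊛ y) n  ≤⟨ +-mono-≤ (q≤ n) (step n M (suc K) 0≤M ih) ⟩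
      C * b n + (M * (b ⊛ lo (suc K) q) n + C * (b ⊛ lo (suc K) y) n + C * (M * (hi (suc K) b ⊛ hi (suc K) b) n))
        ≤⟨ +-mono-≤ ≤-refl (+-mono-≤ (+-mono-≤ (*-monoˡ-≤ 0≤M b₁) (*-monoˡ-≤ 0≤C b₂)) (*-monoˡ-≤ 0≤C (*-monoˡ-≤ 0≤M b₃))) ⟩
      C * b n + (M * ((σ + h) * b n) + C * ((τ + 1#) * b n) + C * (M * ((μ + ⌜ δ ⌝) * b n)))
        ≤⟨ ≤-by (*-nonNeg (+-nonNeg (+-nonNeg (0≤y-x E≤Mη) (*-nonNeg 0≤M (0≤y-x θ+4η≤1)))
                   (+-nonNeg (*-nonNeg 0≤M (0≤y-x (∑q≤θ (suc K)))) (*-nonNeg 0≤M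
                         (+-nonNeg (0≤y-x Cδ≤η) (+-nonNeg (0≤y-x Cδ≤η) (*-nonNeg 0≤C (0≤y-x μ≤δ))))))) (0≤b n))
             (solve 9 (λ C M σ h τ μ δ θ b →
                (C :* b :+ (M :* ((σ :+ h) :* b) :+ C :* ((τ :+ :1) :* b) :+ C :* (M :* ((μ :+ δ) :* b)))) :+
                (((M :* h :- (C :+ C :* (τ :+ :1))) :+ M :* (:1 :- (θ :+ (h :+ h :+ (h :+ h))))) :+
                  (M :* (θ :- σ) :+ M :* ((h :- C :* δ) :+ ((h :- C :* δ) :+ C :* (δ :- μ))))) :* b := M :* b)
                ≈-refl C M σ h τ μ ⌜ δ ⌝ θ (b n)) ⟩
      M * b n  ∎
      where
      σ = ∑ q (suc K)
      τ = ∑ y (suc K)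
      h = ⌜ η ⌝

  -- The transfer step. With g = 1/(1 - t), the equation t = (t ⊛ t + q)/2 gives g = 1 - t + q ⊛ g and Θ t = (Θ q ⊛ g)/2:
  -- the first bounds g by the renewal lemma, and the second then expresses t linearly through q.
  module Transfer (q t : Seq) (κ s C : Real) (0≤C : 0# ≤ C) (0≤q : O ≼ q) (q₀ : q 0 ≈ 0#) (q≤ : q ≼ C · b)
    (q~ : q ~[ b ] κ) (Pos-s : Pos s) (∑q : ∑ q ⟶ 1# - s * s)
    (0≤t : O ≼ t) (t₀ : t 0 ≈ 0#) (t-eq : t ≋ ½# · (t ⊛ t ⊕ q)) where

    open GeometricSeries t t₀

    q-eq : q ≋ t ⊕ t ⊕ ⊖ (t ⊛ t)
    q-eq n = ≈-sym (≈-trans (+-congʳ (+-cong (t-eq n) (t-eq n)))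
      (solve 2 (λ f q → (:½ :* (f :+ q) :+ :½ :* (f :+ q)) :- f := q) ≈-refl ((t ⊛ t) n) (q n)))

    y : Seq
    y = t ⊛ g

    0≤y : O ≼ y
    0≤y = ⊛-nonNeg 0≤t (0≤g 0≤t)

    y₀ : y 0 ≈ 0#
    y₀ = ≈-trans (*-congʳ t₀) (zeroˡ (g 0))

    t⊛y : t ⊛ y ≋ y ⊕ ⊖ t
    t⊛y n = ≈-trans (solve 2 (λ a t → a := (t :+ a) :- t) ≈-refl ((t ⊛ y) n) (t n)) (+-congʳ (≈-sym (begin-equality
      (t ⊛ g) n  ≈⟨ ⊛-cong {t} ≋-refl g-eq n ⟩
      (t ⊛ (δ₀ ⊕ t ⊛ g)) n  ≈⟨ ⊛-distribˡ t δ₀ y n ⟩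
      (t ⊛ δ₀) n + (t ⊛ y) n  ≈⟨ +-congʳ (⊛-identityʳ t n) ⟩
      t n + (t ⊛ y) n  ∎)))

    -- From q = t + t (1 - t) follows q g = t g + t. Since t is nonnegative, y satisfies a renewal
    -- inequality whose kernel is q, already dominated by b, and not the still unknown t.
    q⊛y : q ⊕ q ⊛ y ≋ y ⊕ t
    q⊛y n = begin-equality
      q n + (q ⊛ y) n  ≈⟨ +-cong (q-eq n) (⊛-cong {v = y} q-eq ≋-refl n) ⟩
      (t ⊕ t ⊕ ⊖ (t ⊛ t)) n + ((t ⊕ t ⊕ ⊖ (t ⊛ t)) ⊛ y) n
        ≈⟨ +-congˡ (S.solve 2 (λ t y → (t S.:+ t S.:- t S.:* t) S.:* y S.:= (t S.:* y S.:+ t S.:* y) S.:- t S.:* (t S.:* y))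
              ≋-refl t y n) ⟩
      (t ⊕ t ⊕ ⊖ (t ⊛ t)) n + ((t ⊛ y ⊕ t ⊛ y) n - (t ⊛ (t ⊛ y)) n)
        ≈⟨ +-congˡ (+-cong (+-cong (t⊛y n) (t⊛y n)) (-‿cong (≈-trans (⊛-cong {t} ≋-refl t⊛y n)
             (≈-trans (S.solve 2 (λ t y → t S.:* (y S.:- t) S.:= t S.:* y S.:- t S.:* t) ≋-refl t y n) (+-congʳ (t⊛y n)))))) ⟩
      (t n + t n - (t ⊛ t) n) + ((y n - t n + (y n - t n)) - (y n - t n - (t ⊛ t) n))
        ≈⟨ solve 3 (λ t y f → (t :+ t :- f) :+ ((y :- t :+ (y :- t)) :- (y :- t :- f)) := y :+ t) ≈-refl (t n) (y n) ((t ⊛ t) n) ⟩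
      y n + t n  ∎

    ∑q≤ : ∀ n → ∑ q n ≤ 1# - s * s
    ∑q≤ = ∑≤limit 0≤q ∑q

    y-bound : ∃ λ M → 0# ≤ M × y ≼ M · b
    y-bound = renewal C (1# - s * s) 0≤C 0≤q q₀ q≤ 0≤y y₀ (λ n → ≤-by (0≤t n) (≈-sym (q⊛y n))) ∑q≤
      (Pos-≤ (Pos-* Pos-s Pos-s) (≤-reflexive (solve 1 (λ a → a := :1 :- (:1 :- a)) ≈-refl (s * s))))

    M : Real
    M = proj₁ y-bound
    0≤M = proj₁ (proj₂ y-bound)
    y≤ = proj₂ (proj₂ y-bound)

    Θt : Θ t ≋ ½# · (Θ q ⊛ g)
    Θt n = begin-equality
      Θ t n  ≈⟨ ⊛-identityʳ (Θ t) n ⟨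
      (Θ t ⊛ δ₀) n  ≈⟨ ⊛-cong {Θ t} ≋-refl δ≈ n ⟩
      (Θ t ⊛ (g ⊕ ⊖ (t ⊛ g))) n
        ≈⟨ S.solve 3 (λ d t g → d S.:* (g S.:- t S.:* g) S.:= (d S.:- d S.:* t) S.:* g) ≋-refl (Θ t) t g n ⟩
      ((Θ t ⊕ ⊖ (Θ t ⊛ t)) ⊛ g) n  ≈⟨ ⊛-cong {v = g} halve ≋-refl n ⟩
      ((½# · Θ q) ⊛ g) n  ≈⟨ ·-⊛ ½# (Θ q) g n ⟩
      ½# * (Θ q ⊛ g) n  ∎
      where
      δ≈ : δ₀ ≋ g ⊕ ⊖ (t ⊛ g)
      δ≈ m = ≈-trans (solve 2 (λ d y → d := (d :+ y) :- y) ≈-refl (δ₀ m) ((t ⊛ g) m)) (+-congʳ (≈-sym (g-eq m)))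
      halve : Θ t ⊕ ⊖ (Θ t ⊛ t) ≋ ½# · Θ q
      halve m = begin-equality
        Θ t m - (Θ t ⊛ t) m
          ≈⟨ solve 2 (λ a f → a :- f := :½ :* ((a :+ a) :- (f :+ f))) ≈-refl (Θ t m) ((Θ t ⊛ t) m) ⟩
        ½# * ((Θ t m + Θ t m) - ((Θ t ⊛ t) m + (Θ t ⊛ t) m))
          ≈⟨ *-congˡ (+-congˡ (-‿cong (≈-trans (+-congˡ (⊛-comm (Θ t) t m)) (≈-sym (Θ-⊛ t t m))))) ⟩
        ½# * ((Θ t m + Θ t m) - ι m * (t ⊛ t) m)
          ≈⟨ solve 3 (λ i t f → :½ :* ((i :* t :+ i :* t) :- i :* f) := :½ :* (i :* (t :+ t :- f))) ≈-refl (ι m) (t m)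
                ((t ⊛ t) m) ⟩
        ½# * (ι m * (t m + t m - (t ⊛ t) m))  ≈⟨ *-congˡ (*-congˡ (≈-sym (q-eq m))) ⟩
        ½# * (ι m * q m)  ∎

    0≤Θq : O ≼ Θ q
    0≤Θq = Θ-nonNeg 0≤q

    Θq≤ : Θ q ≼ C · Θ b
    Θq≤ n = ≤-trans (*-monoˡ-≤ (0≤ι n) (q≤ n)) (≤-reflexive (solve 3 (λ i c b → i :* (c :* b) := c :* (i :* b)) ≈-refl (ι n) C
          (b n)))

    C′ : Real
    C′ = ½# * (C * (1# + M))

    0≤C′ : 0# ≤ C′
    0≤C′ = *-nonNeg (Pos⇒0≤ Pos-½) (*-nonNeg 0≤C (+-nonNeg 0≤1 0≤M))

    -- An upper bound on g is enough: 1 + M b multiplies C Θ b, and Θ b ⊛ b is at most Θ b.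
    Θt≤ : Θ t ≼ C′ · Θ b
    Θt≤ n = begin
      Θ t n  ≈⟨ Θt n ⟩
      ½# * (Θ q ⊛ g) n  ≤⟨ *-monoˡ-≤ (Pos⇒0≤ Pos-½) (⊛-mono 0≤Θq (0≤g 0≤t) Θq≤ g≤ n) ⟩
      ½# * ((C · Θ b) ⊛ (δ₀ ⊕ M · b)) n  ≈⟨ *-congˡ (≈-trans (·-⊛ C (Θ b) (δ₀ ⊕ M · b) n) (*-congˡ
           (≈-trans (⊛-distribˡ (Θ b) δ₀ (M · b) n) (+-cong (⊛-identityʳ (Θ b) n) (⊛-· M (Θ b) b n))))) ⟩
      ½# * (C * (Θ b n + M * (Θ b ⊛ b) n))  ≤⟨ *-monoˡ-≤ (Pos⇒0≤ Pos-½) (*-monoˡ-≤ 0≤C (+-mono-≤ ≤-refl (*-monoˡ-≤ 0≤M Θb⊛b≼))) ⟩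
      ½# * (C * (Θ b n + M * Θ b n))
        ≈⟨ solve 3 (λ c m b → :½ :* (c :* (b :+ m :* b)) := :½ :* (c :* (:1 :+ m)) :* b) ≈-refl C M (Θ b n) ⟩
      C′ * Θ b n  ∎
      where
      g≤ : g ≼ δ₀ ⊕ M · b
      g≤ m = ≤-trans (≤-reflexive (g-eq m)) (+-mono-≤ ≤-refl (y≤ m))
      Θb⊛b≼ : (Θ b ⊛ b) n ≤ Θ b n
      Θb⊛b≼ = ≤-by (*-nonNeg (Pos⇒0≤ Pos-½) (0≤X n)) (Θb⊛b n)

    t≤ : t ≼ C′ · b
    t≤ zero    = ≤-reflexive (≈-trans t₀ (≈-sym (zeroʳ C′)))
    t≤ (suc n) = *-cancelˡ-≤ (Pos-ι n) (≤-trans (Θt≤ (suc n))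
      (≤-reflexive (solve 3 (λ i c b → c :* (i :* b) := i :* (c :* b)) ≈-refl (ι (suc n)) C′ (b (suc n)))))

    ∣∣≤ : ∀ {u v} → O ≼ u → u ≼ v → ∀ n → ∣ u n ∣ ≤ v n
    ∣∣≤ 0≤u h n = ≤-trans (≤-reflexive (0≤x⇒∣x∣≈x (0≤u n))) (h n)

    -- induction on n: 2 T(n+1) ≤ 1 + T(n+1) T(n) for the partial sums T
    ∑t≤1 : ∀ n → ∑ t n ≤ 1#
    ∑t≤1 zero    = 0≤1
    ∑t≤1 (suc n) = begin
      T  ≤⟨ ≤-by (*-nonNeg (∑-nonNeg 0≤t (suc n)) (0≤y-x (∑t≤1 n)))
                                   (solve 2 (λ t u → t :+ t :* (:1 :- u) := t :+ t :- t :* u) ≈-refl T (∑ t n)) ⟩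
      T + T - T * ∑ t n  ≈⟨ +-congʳ 2T ⟩
      ∑ (t ⊛ t) (suc n) + ∑ q (suc n) - T * ∑ t n
        ≤⟨ +-mono-≤ (+-mono-≤ conv≤ (≤-trans (∑q≤ (suc n)) (≤-by (*-nonNeg (Pos⇒0≤ Pos-s) (Pos⇒0≤ Pos-s))
              (solve 1 (λ a → :1 :- a :+ a := :1) ≈-refl (s * s))))) ≤-refl ⟩
      T * ∑ t n + 1# - T * ∑ t n  ≈⟨ solve 1 (λ a → a :+ :1 :- a := :1) ≈-refl (T * ∑ t n) ⟩
      1#  ∎
      where
      T = ∑ t (suc n)
      2T : T + T ≈ ∑ (t ⊛ t) (suc n) + ∑ q (suc n)
      2T = ≈-trans (≈-sym (∑-⊕ t t (suc n))) (≈-trans (∑-cong (λ m → ≈-trans (+-cong (t-eq m) (t-eq m))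
        (solve 2 (λ f q → :½ :* (f :+ q) :+ :½ :* (f :+ q) := f :+ q) ≈-refl ((t ⊛ t) m) (q m))) (suc n)) (∑-⊕ (t ⊛ t) q (suc n)))
      conv≤ : ∑ (t ⊛ t) (suc n) ≤ T * ∑ t n
      conv≤ = begin
        ∑ (t ⊛ t) (suc n)  ≈⟨ ∑-head (t ⊛ t) n ⟩
        t 0 * t 0 + ∑ (tl (t ⊛ t)) n  ≈⟨ ≈-trans (+-congʳ (≈-trans (*-congʳ t₀) (zeroˡ (t 0)))) (+-identityˡ _) ⟩
        ∑ (tl (t ⊛ t)) n  ≈⟨ ∑-cong (λ m → ≈-trans (⊛-sucˡ t t m) (≈-trans (+-congʳ (≈-trans (*-congʳ t₀) (zeroˡ _)))
              (+-identityˡ _))) n ⟩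
        ∑ (tl t ⊛ t) n  ≤⟨ ≤-by (corner≥0 (λ m → 0≤t (suc m)) 0≤t n) (≈-sym (∑-⊛ (tl t) t n)) ⟩
        ∑ (tl t) n * ∑ t n  ≈⟨ *-congʳ (≈-trans (∑-head t n) (≈-trans (+-congʳ t₀) (+-identityˡ _))) ⟨
        T * ∑ t n  ∎

    1-∑t : Seq
    1-∑t n = 1# - ∑ t n

    -- Summing 1 - q = (1 - t)² shows that (1 - ∑ t)² differs from 1 - ∑ q by a corner, which tends
    -- to 0; `∑t≤1` selects the nonnegative root.
    1-∑t⟶s : 1-∑t ⟶ s
    1-∑t⟶s = square-limit (λ n → 0≤y-x (∑t≤1 n)) Pos-s (~-cong squares
      (solve 1 (λ a → :1 :* :1 :- (:1 :- a) :+ :0 := a) ≈-refl (s * s))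
      (~-⊕ 0≤𝟙 (~-⊖ 0≤𝟙 (~-≈ 0≤𝟙 {λ _ → 1#} (λ n → solve 0 (:1 := (:1 :* :1) :* :1) ≈-refl)) ∑q)
        (corner→0 {t} {t} C′ C′ 0≤C′ 0≤C′ (∣∣≤ 0≤t t≤) (λ n → ∣∣≤ 0≤t t≤ (suc n)))))
      where
      squares : ∀ n → 1# - ∑ q n + corner t t n ≈ (1# - ∑ t n) * (1# - ∑ t n)
      squares n = ≈-trans (+-congʳ (+-congˡ (-‿cong (≈-trans (∑-cong q-eq n)
          (≈-trans (∑-⊕ (t ⊕ t) (⊖ (t ⊛ t)) n) (+-cong (∑-⊕ t t n) (∑-⊖ (t ⊛ t) n)))))))
        (≈-trans (solve 3 (λ t f c → :1 :- (t :+ t :- f) :+ c := :1 :- (t :+ t) :+ (f :+ c)) ≈-refl (∑ t n) (∑ (t ⊛ t) n)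
              (corner t t n))
          (≈-trans (+-congˡ (≈-sym (∑-⊛ t t n))) (solve 1 (λ t → :1 :- (t :+ t) :+ t :* t := (:1 :- t) :* (:1 :- t)) ≈-refl
                (∑ t n))))

    ∑t : ∑ t ⟶ 1# - s
    ∑t = ~-cong (λ n → solve 1 (λ t → :1 :- (:1 :- t) := t) ≈-refl (∑ t n)) ≈-refl
      (~-⊖ 0≤𝟙 one 1-∑t⟶s)

    g≤ : ∀ n → g (suc n) ≤ M * b (suc n)
    g≤ n = ≤-trans (≤-reflexive (≈-trans (g-eq (suc n)) (+-identityˡ _))) (y≤ (suc n))

    ∑g≤ : ∀ n → ∑ g n ≤ 1# + M
    ∑g≤ n = begin
      ∑ g n  ≤⟨ ∑-mono (λ m → ≤-trans (≤-reflexive (g-eq m)) (+-mono-≤ ≤-refl (y≤ m))) n ⟩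
      ∑ (δ₀ ⊕ M · b) n  ≈⟨ ≈-trans (∑-⊕ δ₀ (M · b) n) (+-congˡ (∑-· M b n)) ⟩
      ∑ δ₀ n + M * ∑ b n  ≤⟨ +-mono-≤ (∑δ₀≤1 n) (≤-trans (*-monoˡ-≤ 0≤M (∑b≤1 n)) (≤-reflexive (*-identityʳ M))) ⟩
      1# + M  ∎
      where
      ∑δ₀≤1 : ∀ n → ∑ δ₀ n ≤ 1#
      ∑δ₀≤1 zero    = 0≤1
      ∑δ₀≤1 (suc n) = ≤-reflexive (∑δ₀ n)

    -- The product of the partial sums of 1 - t and g is 1 up to a corner, and the first factor
    -- tends to s.
    ∑g : ∑ g ⟶ inv s Pos-s
    ∑g = ⟶-cancel Pos-s (~-cong∞ (1 , eq) limit
      (~-⊖ 0≤𝟙 (~-⊖ 0≤𝟙 one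
          (corner→0 {t} {g} C′ M 0≤C′ 0≤M (∣∣≤ 0≤t t≤) (λ n → ∣∣≤ (λ m → 0≤g 0≤t (suc m)) g≤ n)))
        (⟶-* {1-∑t} {∑ g} (proj₁ B) (proj₁ (proj₂ B)) 1-∑t⟶s (λ n → ≤-trans (≤-reflexive (0≤x⇒∣x∣≈x (∑-nonNeg (0≤g 0≤t) n)))
          (≤-trans (∑g≤ n) (≤-trans (x≤∣x∣ _) (proj₂ (proj₂ B))))))))
      where
      B = archimedean (1# + M)
      limit : 1# - 0# - 0# ≈ s * inv s Pos-s
      limit = ≈-trans (solve 0 (:1 :- :0 :- :0 := :1) ≈-refl) (≈-sym (inv-inverseʳ s Pos-s))
      eq : ∀ n → 1 ℕ.≤ n → (1# - corner t g n) - (1# - ∑ t n - s) * ∑ g n ≈ s * ∑ g n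
      eq (suc n) _ = begin-equality
        (1# - k) - (1# - T - s) * G  ≈⟨ solve 4 (λ k t g s → (:1 :- k) :- (:1 :- t :- s) :* g := :1 :- k :- g :+ t :* g :+ s
              :* g) ≈-refl k T G s ⟩
        1# - k - G + T * G + s * G  ≈⟨ +-congʳ (+-cong (+-congˡ (-‿cong G≈)) (∑-⊛ t g (suc n))) ⟩
        1# - k - (1# + ∑ y (suc n)) + (∑ y (suc n) + k) + s * G
          ≈⟨ solve 3 (λ k y a → :1 :- k :- (:1 :+ y) :+ (y :+ k) :+ a := a) ≈-refl k (∑ y (suc n)) (s * G) ⟩
        s * G  ∎
        where
        k = corner t g (suc n)
        T = ∑ t (suc n)
        G = ∑ g (suc n)
        G≈ : G ≈ 1# + ∑ y (suc n)
        G≈ = ≈-trans (∑-cong g-eq (suc n)) (≈-trans (∑-⊕ δ₀ y (suc n)) (+-congʳ (∑δ₀ n)))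

    Θb~1 : Θ b ~[ Θ b ] 1#
    Θb~1 = ~-≈ 0≤Θb (λ n → ≈-sym (*-identityˡ (Θ b n)))

    Θb⊛hi : ∀ K → Θ b ⊛ hi K b ~[ Θ b ] 1# - ∑ b K
    Θb⊛hi K = ~-cong∞ (2 , eq) (+-congˡ (-‿cong (*-identityˡ _))) (~-⊖ 0≤Θb Θb~1 (~-⊛-lo 0≤Θb Θb-regular Θb~1 K b))
      where
      eq : ∀ n → 2 ℕ.≤ n → Θ b n - (Θ b ⊛ lo K b) n ≈ (Θ b ⊛ hi K b) n
      eq (suc zero)      (s≤s ())
      eq n@(suc (suc _)) _ = begin-equality
        Θ b n - (Θ b ⊛ lo K b) n  ≈⟨ +-congʳ (≈-trans (≈-sym (≈-trans (+-congˡ (zeroʳ ½#)) (+-identityʳ _))) (Θb⊛b n)) ⟨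
        (Θ b ⊛ b) n - (Θ b ⊛ lo K b) n  ≈⟨ +-congʳ (≈-trans (⊛-cong {Θ b} ≋-refl (lo⊕hi K b) n)
              (⊛-distribˡ (Θ b) (lo K b) (hi K b) n)) ⟩
        (Θ b ⊛ lo K b) n + (Θ b ⊛ hi K b) n - (Θ b ⊛ lo K b) n  ≈⟨ solve 2 (λ l h → l :+ h :- l := h) ≈-refl _ _ ⟩
        (Θ b ⊛ hi K b) n  ∎

    -- Truncating g gives exact asymptotics with factor ∑ g (suc K), which tends to 1/s. The rest is
    -- dominated by C M times Θ b ⊛ hi (suc K) b, whose leading coefficient is C M w K.
    Θq⊛g : Θ q ⊛ g ~[ Θ b ] κ * inv s Pos-s
    Θq⊛g =
      let B₁ , 0≤B₁ , κ≤ = archimedean κ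
          B₂ , 0≤B₂ , CM≤ = archimedean (C * M)
          B = B₁ ℚ.+ (B₂ ℚ.+ B₂)
          0≤2B₂ = ℚ.+-mono-≤ 0≤B₂ 0≤B₂
          B≈ : ⌜ B ⌝ ≈ ⌜ B₁ ⌝ + (⌜ B₂ ⌝ + ⌜ B₂ ⌝)
          B≈ = ≈-trans (⌜⌝-+ B₁ (B₂ ℚ.+ B₂)) (+-congˡ (⌜⌝-+ B₂ B₂))
      in ~-approx 0≤Θb B (ℚ.+-mono-≤ 0≤B₁ 0≤2B₂) λ ε 0<ε →
        let K , p = eventually₂ (λ n → _,_) (w→0 ε 0<ε) (close ∑g ε 0<ε)
            wK≤ = proj₁ (p K ℕ.≤-refl)
            ∑g≈ = proj₂ (p (suc K) (ℕ.n≤1+n K))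
        in Θ q ⊛ lo (suc K) g , κ * ∑ g (suc K) , ~-⊛-lo 0≤Θb Θb-regular (~-Θ q~) (suc K) g ,
           (begin
             ∣ κ * ∑ g (suc K) - κ * inv s Pos-s ∣
               ≈⟨ ∣∣-cong (solve 3 (λ k g i → k :* g :- k :* i := k :* (g :- i :* :1)) ≈-refl κ (∑ g (suc K)) (inv s Pos-s)) ⟩
             ∣ κ * (∑ g (suc K) - inv s Pos-s * 1#) ∣  ≤⟨ ∣∣-*-≤ κ≤ ∑g≈ ⟩
             ⌜ B₁ ⌝ * (⌜ ε ⌝ * 1#)  ≈⟨ *-congˡ (*-identityʳ _) ⟩
             ⌜ B₁ ⌝ * ⌜ ε ⌝  ≤⟨ *-monoʳ-≤ (0≤⇒≤ 0<ε) (≤-by (+-nonNeg (0≤⌜⌝ 0≤B₂) (0≤⌜⌝ 0≤B₂)) (≈-sym B≈)) ⟩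
             ⌜ B ⌝ * ⌜ ε ⌝  ∎) ,
           eventually₁ (λ n h → begin
             ∣ (Θ q ⊛ g) n - (Θ q ⊛ lo (suc K) g) n ∣
               ≈⟨ ∣∣-cong (≈-trans (+-congʳ (≈-trans (⊛-cong {Θ q} ≋-refl (lo⊕hi (suc K) g) n)
                     (⊛-distribˡ (Θ q) (lo (suc K) g) (hi (suc K) g) n)))
                    (solve 2 (λ l h → l :+ h :- l := h) ≈-refl _ _)) ⟩
             ∣ (Θ q ⊛ hi (suc K) g) n ∣
               ≤⟨ ∣⊛∣≤ {Θ q} {C · Θ b} {hi (suc K) g} {M · hi (suc K) b} (∣∣≤ 0≤Θq Θq≤)
                     (∣∣≤ (hi-nonNeg (suc K) (0≤g 0≤t)) (hi-g K)) n ⟩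
             ((C · Θ b) ⊛ (M · hi (suc K) b)) n
               ≈⟨ ≈-trans (·-⊛ C (Θ b) (M · hi (suc K) b) n) (≈-trans (*-congˡ (⊛-· M (Θ b) (hi (suc K) b) n))
                     (≈-sym (*-assoc _ _ _))) ⟩
             C * M * (Θ b ⊛ hi (suc K) b) n
               ≤⟨ *-mono-≤ (0≤⌜⌝ 0≤B₂) (⊛-nonNeg 0≤Θb (hi-nonNeg (suc K) 0≤b) n) (≤-trans (x≤∣x∣ _) CM≤) h ⟩
             ⌜ B₂ ⌝ * ((1# - ∑ b (suc K) + ⌜ ε ⌝) * Θ b n)
               ≤⟨ *-monoˡ-≤ (0≤⌜⌝ 0≤B₂) (*-monoʳ-≤ (0≤Θb n) (+-mono-≤ (≤-trans (≤-reflexive (1-∑b K)) wK≤) ≤-refl)) ⟩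
             ⌜ B₂ ⌝ * ((⌜ ε ⌝ + ⌜ ε ⌝) * Θ b n)
               ≤⟨ ≤-by (*-nonNeg (0≤⌜⌝ 0≤B₁) (*-nonNeg (0≤⇒≤ 0<ε) (0≤Θb n)))
                    (≈-trans (solve 4 (λ x y e c → y :* ((e :+ e) :* c) :+ x :* (e :* c) := (x :+ (y :+ y)) :* (e :* c))
                          ≈-refl ⌜ B₁ ⌝ ⌜ B₂ ⌝ ⌜ ε ⌝ (Θ b n)) (*-congʳ (≈-sym B≈))) ⟩
             ⌜ B ⌝ * (⌜ ε ⌝ * Θ b n)  ∎)
             (~-upper 0≤Θb (Θb⊛hi (suc K)) ε 0<ε)
      where
      1-∑b : ∀ K → 1# - ∑ b (suc K) ≈ w K
      1-∑b K = ≈-trans (+-congʳ (≈-sym (∑b K))) (solve 2 (λ s w → (s :+ w) :- s := w) ≈-refl (∑ b (suc K)) (w K))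
      hi-g : ∀ K → hi (suc K) g ≼ M · hi (suc K) b
      hi-g K n = ≤-trans (hi-mono (suc K) {g} {M · b} (λ { (suc m) _ → g≤ m }) n) (≤-reflexive (hi-· (suc K) M b n))

    t~ : t ~[ b ] ½# * (κ * inv s Pos-s)
    t~ = Θ-~ (~-cong (λ n → ≈-sym (Θt n)) ≈-refl (~-· 0≤Θb ½# Θq⊛g))

-- Wallis' product for the area of the disk.

module WallisProduct where

  open D using (∑<; ⟦_⟧; cellsInside; inside; meets)
  open Reals
  open RealSeries
  open Asymptotics
  open ≤-Reasoning
  open Solver using (solve; _:=_; _:+_; _:-_; _:*_; :-_)

  ∑-mono-< : ∀ {u v} n → (∀ i → i ℕ.< n → u i ≤ v i) → ∑ u n ≤ ∑ v n
  ∑-mono-< zero    h = ≤-refl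
  ∑-mono-< (suc n) h = +-mono-≤ (∑-mono-< n (λ i i<n → h i (ℕ.m≤n⇒m≤1+n i<n))) (h n ℕ.≤-refl)

  telescope : ∀ (u : Seq) n → ∑ (λ i → u (suc i) - u i) n ≈ u n - u 0
  telescope u zero    = ≈-sym (ℛ.-‿inverseʳ (u 0))
  telescope u (suc n) = ≈-trans (+-congʳ (telescope u n)) (solve 3 (λ a b c → (b :- a) :+ (c :- b) := c :- a) ≈-refl (u 0)
        (u n) (u (suc n)))

  -- Comparison of areas under step functions with different partitions: f i lives on
  -- [x i , x (i+1)] and g j on [y j , y (j+1)]. The comparability of vertices is an assumption
  -- because the order of reals is undecidable, and f ≤ g is asked wherever two closed intervals
  -- touch.
  module StepFunctions (x y f g : Seq) (m l : ℕ)
    (x₀ : x 0 ≈ 0#) (y₀ : y 0 ≈ 0#) (x↑ : ∀ i → x i ≤ x (suc i)) (y↑ : ∀ j → y j ≤ y (suc j))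
    (total : ∀ i j → x i ≤ y j ⊎ y j ≤ x i) (x≤y : x m ≤ y l) (0≤g : O ≼ g)
    (f≤g : ∀ i j → i ℕ.< m → j ℕ.< l → x i ≤ y (suc j) → y j ≤ x (suc i) → f i ≤ g j) where

    min : ℕ → ℕ → Real
    min i j with total i j
    ... | inj₁ _ = x i
    ... | inj₂ _ = y j

    min≤x : ∀ i j → min i j ≤ x i
    min≤x i j with total i j
    ... | inj₁ _ = ≤-refl
    ... | inj₂ h = h

    min≤y : ∀ i j → min i j ≤ y j
    min≤y i j with total i j
    ... | inj₁ h = h
    ... | inj₂ _ = ≤-refl

    min-glb : ∀ i j {z} → z ≤ x i → z ≤ y j → z ≤ min i j
    min-glb i j h k with total i j
    ... | inj₁ _ = h
    ... | inj₂ _ = k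

    min≈x : ∀ i j → x i ≤ y j → min i j ≈ x i
    min≈x i j h = min≤x i j , min-glb i j ≤-refl h

    min≈y : ∀ i j → y j ≤ x i → min i j ≈ y j
    min≈y i j h = min≤y i j , min-glb i j h ≤-refl

    -- the length of [x i , x (i+1)] ∩ [y j , y (j+1)]
    common : ℕ → ℕ → Real
    common i j = (min (suc i) (suc j) - min i (suc j)) - (min (suc i) j - min i j)

    -- The mixed difference of a minimum is nonnegative; which of x i and y j is smaller decides how
    -- to pair its four terms into two nonnegative differences.
    0≤common : ∀ i j → 0# ≤ common i j
    0≤common i j with total i j
    ... | inj₁ h = ≤-trans (+-nonNeg
            (0≤y-x (min-glb (suc i) (suc j) (min≤x (suc i) j) (≤-trans (min≤y (suc i) j) (y↑ j))))
            (0≤y-x (min≤x i (suc j))))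
          (≤-reflexive (solve 4 (λ a b c d → (a :- c) :+ (d :- b) := (a :- b) :- (c :- d)) ≈-refl
            (min (suc i) (suc j)) (min i (suc j)) (min (suc i) j) (x i)))
    ... | inj₂ h = ≤-trans (+-nonNeg
            (0≤y-x (min-glb (suc i) (suc j) (≤-trans (min≤x i (suc j)) (x↑ i)) (min≤y i (suc j))))
            (0≤y-x (min≤y (suc i) j)))
          (≤-reflexive (solve 4 (λ a b c d → (a :- b) :+ (d :- c) := (a :- b) :- (c :- d)) ≈-refl
            (min (suc i) (suc j)) (min i (suc j)) (min (suc i) j) (y j)))

    f*common≤ : ∀ i j → i ℕ.< m → j ℕ.< l → f i * common i j ≤ g j * common i j
    f*common≤ i j i<m j<l = go (total (suc i) j) (total i (suc j))
      where
      null : common i j ≈ 0# → f i * common i j ≤ g j * common i j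
      null eq = ≤-reflexive (≈-trans (*-congˡ eq) (≈-trans (zeroʳ _) (≈-sym (≈-trans (*-congˡ eq) (zeroʳ _)))))
      go : x (suc i) ≤ y j ⊎ y j ≤ x (suc i) → x i ≤ y (suc j) ⊎ y (suc j) ≤ x i → f i * common i j ≤ g j * common i j
      go (inj₁ h) _ = null (≈-trans (+-cong (+-cong (min≈x (suc i) (suc j) (≤-trans h (y↑ j)))
            (-‿cong (min≈x i (suc j) (≤-trans (x↑ i) (≤-trans h (y↑ j))))))
        (-‿cong (+-cong (min≈x (suc i) j h) (-‿cong (min≈x i j (≤-trans (x↑ i) h)))))) (ℛ.-‿inverseʳ _))
      go (inj₂ h) (inj₁ h′) = *-monoʳ-≤ (0≤common i j) (f≤g i j i<m j<l h′ h)
      go (inj₂ h) (inj₂ h′) = null (≈-trans (+-cong (+-cong (min≈y (suc i) (suc j) (≤-trans h′ (x↑ i)))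
            (-‿cong (min≈y i (suc j) h′)))
        (-‿cong (+-cong (min≈y (suc i) j h) (-‿cong (min≈y i j (≤-trans (y↑ j) h′))))))
        (solve 2 (λ a b → (a :- a) :- (b :- b) := :0) ≈-refl (y (suc j)) (y j)))

    0≤x : ∀ i → 0# ≤ x i
    0≤x zero    = ≤-reflexive (≈-sym x₀)
    0≤x (suc i) = ≤-trans (0≤x i) (x↑ i)

    0≤y : ∀ j → 0# ≤ y j
    0≤y zero    = ≤-reflexive (≈-sym y₀)
    0≤y (suc j) = ≤-trans (0≤y j) (y↑ j)

    x≤yₗ : ∀ {i} → i ℕ.≤′ m → x i ≤ y l
    x≤yₗ i≤m = ≤-trans (up i≤m) x≤y
      where
      up : ∀ {i k} → i ℕ.≤′ k → x i ≤ x k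
      up ℕ.≤′-refl       = ≤-refl
      up (ℕ.≤′-step i≤k) = ≤-trans (up i≤k) (x↑ _)

    ∑common : ∀ i → i ℕ.< m → ∑ (common i) l ≈ x (suc i) - x i
    ∑common i i<m = begin-equality
      ∑ (common i) l  ≈⟨ telescope (λ j → min (suc i) j - min i j) l ⟩
      (min (suc i) l - min i l) - (min (suc i) 0 - min i 0)
        ≈⟨ +-cong (+-cong (min≈x (suc i) l (x≤yₗ (ℕ.≤⇒≤′ i<m))) (-‿cong (min≈x i l (x≤yₗ (ℕ.≤⇒≤′ (ℕ.<⇒≤ i<m))))))
             (-‿cong (+-cong (zero-min (suc i)) (-‿cong (zero-min i)))) ⟩
      (x (suc i) - x i) - (0# - 0#)  ≈⟨ solve 1 (λ a → a :- (:0 :- :0) := a) ≈-refl (x (suc i) - x i) ⟩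
      x (suc i) - x i  ∎
      where
      zero-min : ∀ i → min i 0 ≈ 0#
      zero-min i = ≈-trans (min≈y i 0 (≤-trans (≤-reflexive y₀) (0≤x i))) y₀

    -- Induction on the strips of f: `min k (suc j) - min k j` is the length of [0 , x k] ∩
    -- [y j , y (j+1)], so the right side is the area under g above [0 , x k].
    area≤ : ∀ k → k ℕ.≤ m → ∑ (λ i → f i * (x (suc i) - x i)) k ≤ ∑ (λ j → g j * (min k (suc j) - min k j)) l
    area≤ zero k≤m = ≤-reflexive (≈-sym (≈-trans (∑-cong (λ j → ≈-trans
          (*-congˡ (≈-trans (+-cong (min₀ (suc j)) (-‿cong (min₀ j))) (ℛ.-‿inverseʳ 0#))) (zeroʳ (g j))) l) (zeros l)))
      where
      min₀ : ∀ j → min 0 j ≈ 0#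
      min₀ j = ≈-trans (min≈x 0 j (≤-trans (≤-reflexive x₀) (0≤y j))) x₀
      zeros : ∀ l → ∑ (λ _ → 0#) l ≈ 0#
      zeros zero    = ≈-refl
      zeros (suc l) = ≈-trans (+-identityʳ _) (zeros l)
    area≤ (suc k) k<m = begin
      ∑ (λ i → f i * (x (suc i) - x i)) k + f k * (x (suc k) - x k)
        ≤⟨ +-mono-≤ (area≤ k (ℕ.<⇒≤ k<m)) (≤-trans (≤-reflexive (≈-trans (*-congˡ (≈-sym (∑common k k<m)))
              (≈-sym (∑-· (f k) (common k) l))))
             (∑-mono-< l (λ j j<l → f*common≤ k j k<m j<l))) ⟩
      ∑ (λ j → g j * (min k (suc j) - min k j)) l + ∑ (λ j → g j * common k j) l
        ≈⟨ ∑-⊕ _ _ l ⟨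
      ∑ (λ j → g j * (min k (suc j) - min k j) + g j * common k j) l
        ≈⟨ ∑-cong (λ j → solve 5 (λ g a b c d → g :* (b :- d) :+ g :* ((a :- b) :- (c :- d)) := g :* (a :- c)) ≈-refl
             (g j) (min (suc k) (suc j)) (min k (suc j)) (min (suc k) j) (min k j)) l ⟩
      ∑ (λ j → g j * (min (suc k) (suc j) - min (suc k) j)) l  ∎

    comparison : ∑ (λ i → f i * (x (suc i) - x i)) m ≤ ∑ (λ j → g j * (y (suc j) - y j)) l
    comparison = ≤-trans (area≤ m ℕ.≤-refl) (∑-mono (λ j → *-monoˡ-≤ (0≤g j) (lipschitz j)) l)
      where
      lipschitz : ∀ j → min m (suc j) - min m j ≤ y (suc j) - y j
      lipschitz j with total m j
      ... | inj₁ h = ≤-by (+-nonNeg (0≤y-x (min≤x m (suc j))) (0≤y-x (y↑ j)))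
              (solve 4 (λ a x y y′ → (a :- x) :+ ((x :- a) :+ (y′ :- y)) := y′ :- y) ≈-refl (min m (suc j)) (x m) (y j)
                    (y (suc j)))
      ... | inj₂ h = +-mono-≤ (min≤y m (suc j)) ≤-refl

  -- The vertices of staircase and grid are rational, which supplies the comparisons assumed by
  -- `StepFunctions`.
  Rational : Real → Set
  Rational x = ∃ λ q → x ≈ ⌜ q ⌝

  Rational-+ : ∀ {x y} → Rational x → Rational y → Rational (x + y)
  Rational-+ (p , x≈p) (q , y≈q) = p ℚ.+ q , ≈-trans (+-cong x≈p y≈q) (≈-sym (⌜⌝-+ p q))

  Rational-* : ∀ {x y} → Rational x → Rational y → Rational (x * y)
  Rational-* (p , x≈p) (q , y≈q) = p ℚ.* q , ≈-trans (*-cong x≈p y≈q) (≈-sym (⌜⌝-* p q))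

  Rational-total : ∀ {x y} → Rational x → Rational y → x ≤ y ⊎ y ≤ x
  Rational-total (p , x≈p) (q , y≈q) with ℚ.≤-total p q
  ... | inj₁ p≤q = inj₁ (≤-trans (proj₁ x≈p) (≤-trans (⌜⌝-mono p≤q) (proj₂ y≈q)))
  ... | inj₂ q≤p = inj₂ (≤-trans (proj₁ y≈q) (≤-trans (⌜⌝-mono q≤p) (proj₂ x≈p)))

  ι-+ : ∀ m n → ι (m ℕ.+ n) ≈ ι m + ι n
  ι-+ zero    n = ≈-sym (+-identityˡ _)
  ι-+ (suc m) n = ≈-trans (+-congˡ (ι-+ m n)) (≈-sym (+-assoc _ _ _))

  ι-* : ∀ m n → ι (m ℕ.* n) ≈ ι m * ι n
  ι-* zero    n = ≈-sym (zeroˡ _)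
  ι-* (suc m) n = ≈-trans (ι-+ n (m ℕ.* n)) (≈-trans (+-congˡ (ι-* m n))
        (solve 2 (λ m n → n :+ m :* n := (:1 :+ m) :* n) ≈-refl (ι m) (ι n)))

  ι-² : ∀ n → ι (n ℕ.^ 2) ≈ ι n * ι n
  ι-² n = ≈-trans (ℛ.reflexive (cong (λ m → ι (n ℕ.* m)) (ℕ.*-identityʳ n))) (ι-* n n)

  ι-∑ : ∀ n u → ι (∑< n u) ≈ ∑ (λ i → ι (u i)) n
  ι-∑ zero    u = ≈-refl
  ι-∑ (suc n) u = ≈-trans (ι-+ (∑< n u) (u n)) (+-congʳ (ι-∑ n u))

  -- For a downward closed predicate the count is the height of a column of cells: the predicate
  -- holds just below that height, and fails at it unless the column is full.
  module _ {P : ℕ → Set} (P? : ∀ j → Dec (P j)) (P↓ : ∀ j → P (suc j) → P j) where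

    count-all : ∀ n → P n → ∑< n (λ j → ⟦ P? j ⟧) ≡ n
    count-all zero    p = ≡.refl
    count-all (suc n) p with P? n
    ... | yes q = ≡.trans (cong (ℕ._+ 1) (count-all n q)) (ℕ.+-comm n 1)
    ... | no ¬q = contradiction (P↓ n p) ¬q

    count-last : ∀ n {c} → ∑< n (λ j → ⟦ P? j ⟧) ≡ suc c → P c
    count-last (suc n) eq with P? n
    ... | yes p = subst P (ℕ.suc-injective (≡.trans (≡.sym (≡.trans (cong (ℕ._+ 1) (count-all n p)) (ℕ.+-comm n 1))) eq)) p
    ... | no _  = count-last n (≡.trans (≡.sym (ℕ.+-identityʳ _)) eq)

    count-next : ∀ n → ∑< n (λ j → ⟦ P? j ⟧) ≡ n ⊎ ¬ P (∑< n (λ j → ⟦ P? j ⟧))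
    count-next zero = inj₁ ≡.refl
    count-next (suc n) with P? n
    ... | yes p = inj₁ (≡.trans (cong (ℕ._+ 1) (count-all n p)) (ℕ.+-comm n 1))
    ... | no ¬p with count-next n
    ...   | inj₁ eq = inj₂ λ p → ¬p (subst P (≡.trans (ℕ.+-identityʳ _) eq) p)
    ...   | inj₂ ¬q = inj₂ λ p → ¬q (subst P (ℕ.+-identityʳ _) p)

  s : Seq
  s = ∑ w

  s≈ : ∀ n → s n ≈ (ι n + ι n) * w n
  s≈ zero    = solve 0 (:0 := (:0 :+ :0) :* :1) ≈-refl
  s≈ (suc n) = begin-equality
    s n + w n  ≈⟨ +-congʳ (s≈ n) ⟩
    (ι n + ι n) * w n + w n
      ≈⟨ solve 2 (λ i w → (i :+ i) :* w :+ w := :½ :* (i :+ (:1 :+ i)) :* w :+ :½ :* (i :+ (:1 :+ i)) :* w) ≈-refl (ι n) (w n) ⟩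
    ½# * (ι n + ι (suc n)) * w n + ½# * (ι n + ι (suc n)) * w n  ≈⟨ +-cong (w-rec n) (w-rec n) ⟨
    ι (suc n) * w (suc n) + ι (suc n) * w (suc n)  ≈⟨ ℛ.distribʳ _ _ _ ⟨
    (ι (suc n) + ι (suc n)) * w (suc n)  ∎

  s↑ : ∀ n → s n ≤ s (suc n)
  s↑ n = ≤-by (0≤w n) ≈-refl

  0≤s : O ≼ s
  0≤s = ∑-nonNeg 0≤w

  Rational-s : ∀ n → Rational (s n)
  Rational-s zero    = 0ℚ , ≈-refl
  Rational-s (suc n) = Rational-+ (Rational-s n) (wℚ n , ≈-refl)

  w⊛s : ∀ n → (w ⊛ s) n ≈ ι n
  w⊛s zero    = zeroʳ _
  w⊛s (suc n) = ≈-trans (+-cong (zeroʳ _) (⊛-distribˡ w s w n)) (≈-trans (+-identityˡ _)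
    (≈-trans (+-cong (w⊛s n) (w⊛w n)) (+-comm _ _)))

  ⊛-∑ : ∀ u v n → (u ⊛ v) n ≈ ∑ (λ i → u i * v (n ℕ.∸ i)) (suc n)
  ⊛-∑ u v zero    = ≈-sym (+-identityˡ _)
  ⊛-∑ u v (suc n) = ≈-trans (⊛-sucˡ u v n) (≈-trans (+-congˡ (⊛-∑ (tl u) v n))
        (≈-sym (∑-head (λ i → u i * v (suc n ℕ.∸ i)) (suc n))))

  -- The left side is the area of the rectangles [s i , s (i+1)] × [0 , s (n - i)], that is (w ⊛ s)
  -- n, a sum of n coefficients of w ⊛ w, each equal to 1.
  staircase : ∀ n → ∑ (λ i → s (n ℕ.∸ i) * (s (suc i) - s i)) n ≈ ι n
  staircase n = begin-equality
    ∑ (λ i → s (n ℕ.∸ i) * (s (suc i) - s i)) n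
      ≈⟨ ∑-cong (λ i → solve 3 (λ a b c → a :* ((b :+ c) :- b) := c :* a) ≈-refl (s (n ℕ.∸ i)) (s i) (w i)) n ⟩
    ∑ (λ i → w i * s (n ℕ.∸ i)) n
      ≈⟨ ≈-trans (+-congˡ (≈-trans (*-congˡ (ℛ.reflexive (cong s (ℕ.n∸n≡0 n)))) (zeroʳ (w n)))) (+-identityʳ _) ⟨
    ∑ (λ i → w i * s (n ℕ.∸ i)) (suc n)  ≈⟨ ⊛-∑ w s n ⟨
    (w ⊛ s) n  ≈⟨ w⊛s n ⟩
    ι n  ∎

  -- This sequence increases while `nw²⁺` decreases, the two classical one-sided Wallis products.
  -- Their monotonicity places the corners of the staircase relative to circles.
  nw² : Seq
  nw² n = ι n * (w n * w n)

  nw²↑ : ∀ {m n} → m ℕ.≤′ n → nw² m ≤ nw² n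
  nw²↑ ℕ.≤′-refl = ≤-refl
  nw²↑ (ℕ.≤′-step {n} m≤n) = ≤-trans (nw²↑ m≤n) (*-cancelˡ-≤ (Pos-ι n) (begin
    ι (suc n) * (ι n * (w n * w n))
      ≤⟨ ≤-by (*-nonNeg (Pos⇒0≤ (Pos-* Pos-½ Pos-½)) (*-nonNeg (0≤w n) (0≤w n)))
           (solve 2 (λ i w → (:1 :+ i) :* (i :* (w :* w)) :+ (:½ :* :½) :* (w :* w) :=
             (:½ :* (i :+ (:1 :+ i)) :* w) :* (:½ :* (i :+ (:1 :+ i)) :* w)) ≈-refl (ι n) (w n)) ⟩
    (½# * (ι n + ι (suc n)) * w n) * (½# * (ι n + ι (suc n)) * w n)  ≈⟨ *-cong (w-rec n) (w-rec n) ⟨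
    (ι (suc n) * w (suc n)) * (ι (suc n) * w (suc n))
      ≈⟨ solve 2 (λ i w → (i :* w) :* (i :* w) := i :* (i :* (w :* w))) ≈-refl (ι (suc n)) (w (suc n)) ⟩
    ι (suc n) * nw² (suc n)  ∎))

  nw²⁺ : Seq
  nw²⁺ n = (ι n + ½#) * (w n * w n)

  nw²⁺↓ : ∀ {m n} → m ℕ.≤′ n → nw²⁺ n ≤ nw²⁺ m
  nw²⁺↓ ℕ.≤′-refl = ≤-refl
  nw²⁺↓ (ℕ.≤′-step {n} m≤n) = ≤-trans (*-cancelˡ-≤ (Pos-* (Pos-ι n) (Pos-ι n)) (begin
    (ι (suc n) * ι (suc n)) * nw²⁺ (suc n)
      ≈⟨ solve 2 (λ i w → (i :* i) :* ((i :+ :½) :* (w :* w)) := (i :+ :½) :* ((i :* w) :* (i :* w))) ≈-refl (ι (suc n))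
            (w (suc n)) ⟩
    (ι (suc n) + ½#) * ((ι (suc n) * w (suc n)) * (ι (suc n) * w (suc n)))  ≈⟨ *-congˡ (*-cong (w-rec n) (w-rec n)) ⟩
    (ι (suc n) + ½#) * ((½# * (ι n + ι (suc n)) * w n) * (½# * (ι n + ι (suc n)) * w n))
      ≤⟨ ≤-by (*-nonNeg (Pos⇒0≤ (Pos-* Pos-½ Pos-½)) (*-nonNeg (+-nonNeg (0≤ι n) (Pos⇒0≤ Pos-½)) (*-nonNeg (0≤w n) (0≤w n))))
           (solve 2 (λ i w → (:1 :+ i :+ :½) :* ((:½ :* (i :+ (:1 :+ i)) :* w) :* (:½ :* (i :+ (:1 :+ i)) :* w)) :+
               (:½ :* :½) :* ((i :+ :½) :* (w :* w)) :=
             ((:1 :+ i) :* (:1 :+ i)) :* ((i :+ :½) :* (w :* w))) ≈-refl (ι n) (w n)) ⟩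
    (ι (suc n) * ι (suc n)) * nw²⁺ n  ∎)) (nw²⁺↓ m≤n)

  nw²≤nw²⁺ : ∀ {m n} → m ℕ.≤ n → nw² n ≤ nw²⁺ m
  nw²≤nw²⁺ {m} {n} m≤n = ≤-trans (*-monoʳ-≤ (*-nonNeg (0≤w n) (0≤w n)) (≤-by (Pos⇒0≤ Pos-½) ≈-refl)) (nw²⁺↓ (ℕ.≤⇒≤′ m≤n))

  s²≈ : ∀ n → s n * s n ≈ four * (ι n * nw² n)
  s²≈ n = ≈-trans (*-cong (s≈ n) (s≈ n))
    (solve 2 (λ i w → ((i :+ i) :* w) :* ((i :+ i) :* w) := :4 :* (i :* (i :* (w :* w)))) ≈-refl (ι n) (w n))

  s²-suc≈ : ∀ n → s (suc n) * s (suc n) ≈ four * ((ι n + ½#) * nw²⁺ n)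
  s²-suc≈ n = ≈-trans (*-cong eq eq)
    (solve 2 (λ i w → ((i :+ i :+ :1) :* w) :* ((i :+ i :+ :1) :* w) :=
      :4 :* ((i :+ :½) :* ((i :+ :½) :* (w :* w)))) ≈-refl (ι n) (w n))
    where
    eq : s (suc n) ≈ (ι n + ι n + 1#) * w n
    eq = ≈-trans (+-congʳ (s≈ n)) (solve 2 (λ i w → (i :+ i) :* w :+ w := (i :+ i :+ :1) :* w) ≈-refl (ι n) (w n))

  -- By s² = 4 n · nw² with nw² increasing, s² is superadditive. Hence the protruding corners (s i ,
  -- s j) of the staircase of n - 1, where i + j = n, lie in the disk of radius s n.
  s²-upper : ∀ i j {n} → i ℕ.+ j ≡ n → s i * s i + s j * s j ≤ s n * s n
  s²-upper i j ≡.refl = begin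
    s i * s i + s j * s j  ≈⟨ +-cong (s²≈ i) (s²≈ j) ⟩
    four * (ι i * nw² i) + four * (ι j * nw² j)
      ≤⟨ +-mono-≤ (mono i (ℕ.m≤m+n i j)) (mono j (ℕ.m≤n+m j i)) ⟩
    four * (ι i * nw² (i ℕ.+ j)) + four * (ι j * nw² (i ℕ.+ j))
      ≈⟨ solve 4 (λ f a b c → f :* (a :* c) :+ f :* (b :* c) := f :* ((a :+ b) :* c)) ≈-refl four (ι i) (ι j) (nw² (i ℕ.+ j)) ⟩
    four * ((ι i + ι j) * nw² (i ℕ.+ j))  ≈⟨ *-congˡ (*-congʳ (ι-+ i j)) ⟨
    four * (ι (i ℕ.+ j) * nw² (i ℕ.+ j))  ≈⟨ s²≈ (i ℕ.+ j) ⟨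
    s (i ℕ.+ j) * s (i ℕ.+ j)  ∎
    where
    mono : ∀ i {n} → i ℕ.≤ n → four * (ι i * nw² i) ≤ four * (ι i * nw² n)
    mono i i≤n = *-monoˡ-≤ (Pos⇒0≤ Pos-four) (*-monoˡ-≤ (0≤ι i) (nw²↑ (ℕ.≤⇒≤′ i≤n)))

  -- Splitting n = (i - ½) + (j - ½) and bounding nw² n by the decreasing sequence gives this. Hence
  -- the reentrant corners (s i , s j) of the staircase of n + 1 lie outside or on the circle of
  -- radius s n.
  s²-lower : ∀ i j {n} → i ℕ.+ j ≡ suc n → s n * s n ≤ s i * s i + s j * s j
  s²-lower zero .(suc n) {n} ≡.refl = ≤-trans (*-mono-≤ (0≤s (suc n)) (0≤s n) (s↑ n) (s↑ n))
        (≤-reflexive (solve 1 (λ a → a := :0 :* :0 :+ a) ≈-refl _))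
  s²-lower (suc i) zero {n} eq with ℕ.suc-injective (≡.trans (≡.sym (ℕ.+-identityʳ (suc i))) eq)
  ... | ≡.refl = ≤-trans (*-mono-≤ (0≤s (suc i)) (0≤s i) (s↑ i) (s↑ i))
        (≤-reflexive (solve 1 (λ a → a := a :+ :0 :* :0) ≈-refl _))
  s²-lower (suc i) (suc j) {n} eq = begin
    s n * s n  ≈⟨ s²≈ n ⟩
    four * (ι n * nw² n)  ≈⟨ *-congˡ (*-congʳ (≈-trans (ℛ.reflexive (cong ι n≡)) (+-congˡ (ι-+ i j)))) ⟩
    four * ((1# + (ι i + ι j)) * nw² n)
      ≈⟨ solve 4 (λ f i j x → f :* ((:1 :+ (i :+ j)) :* x) := f :* ((i :+ :½) :* x) :+ f :* ((j :+ :½) :* x)) ≈-refl four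
            (ι i) (ι j) (nw² n) ⟩
    four * ((ι i + ½#) * nw² n) + four * ((ι j + ½#) * nw² n)
      ≤⟨ +-mono-≤ (mono i (ℕ.≤-trans (ℕ.m≤m+n i j) (ℕ.≤-trans (ℕ.n≤1+n _) (ℕ.≤-reflexive (≡.sym n≡)))))
           (mono j (ℕ.≤-trans (ℕ.m≤n+m j i) (ℕ.≤-trans (ℕ.n≤1+n _) (ℕ.≤-reflexive (≡.sym n≡))))) ⟩
    four * ((ι i + ½#) * nw²⁺ i) + four * ((ι j + ½#) * nw²⁺ j)  ≈⟨ +-cong (s²-suc≈ i) (s²-suc≈ j) ⟨
    s (suc i) * s (suc i) + s (suc j) * s (suc j)  ∎
    where
    n≡ : n ≡ suc (i ℕ.+ j)
    n≡ = ≡.trans (≡.sym (ℕ.suc-injective eq)) (ℕ.+-suc i j)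
    mono : ∀ i {n} → i ℕ.≤ n → four * ((ι i + ½#) * nw² n) ≤ four * ((ι i + ½#) * nw²⁺ i)
    mono i i≤n = *-monoˡ-≤ (Pos⇒0≤ Pos-four) (*-monoˡ-≤ (+-nonNeg (0≤ι i) (Pos⇒0≤ Pos-½)) (nw²≤nw²⁺ i≤n))

  -- The cells of side h = R/N, where N = suc N′, tile the square of side R.
  module Grid (R : Real) (0≤R : 0# ≤ R) (Rational-R : Rational R) (N′ : ℕ) where

    N : ℕ
    N = suc N′

    h : Real
    h = R * ν N′

    0≤h : 0# ≤ h
    0≤h = *-nonNeg 0≤R (Pos⇒0≤ (Pos-ν N′))

    grid : Seq
    grid i = ι i * h

    Nh≈R : grid N ≈ R
    Nh≈R = ≈-trans (solve 3 (λ n r v → n :* (r :* v) := (v :* n) :* r) ≈-refl (ι N) R (ν N′))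
          (≈-trans (*-congʳ (ν-inverse N′)) (*-identityˡ R))

    grid₀ : grid 0 ≈ 0#
    grid₀ = zeroˡ h

    grid↑ : ∀ i → grid i ≤ grid (suc i)
    grid↑ i = *-monoʳ-≤ 0≤h (ι-mono (ℕ.n≤1+n i))

    Rational-grid : ∀ i → Rational (grid i)
    Rational-grid i = Rational-* (D.ι i , ι≈ i) (Rational-* Rational-R (D.1/suc N′ , ≈-refl))

    0≤grid : O ≼ grid
    0≤grid i = *-nonNeg (0≤ι i) 0≤h

    grid-area : ∀ (u : ℕ → ℕ) → ∑ (λ i → grid (u i) * (grid (suc i) - grid i)) N ≈ h * h * ι (∑< N u)
    grid-area u = ≈-trans (∑-cong (λ i → solve 3 (λ u i h → (u :* h) :* ((:1 :+ i) :* h :- i :* h) := (h :* h) :* u) ≈-refl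
          (ι (u i)) (ι i) h) N)
      (≈-trans (∑-· (h * h) (λ i → ι (u i)) N) (*-congˡ (≈-sym (ι-∑ N u))))

    grid² : ∀ i j → grid i * grid i + grid j * grid j ≈ h * h * ι (i ℕ.^ 2 ℕ.+ j ℕ.^ 2)
    grid² i j = ≈-trans (solve 3 (λ i j h → (i :* h) :* (i :* h) :+ (j :* h) :* (j :* h) := h :* h :* (i :* i :+ j :* j))
          ≈-refl (ι i) (ι j) h)
      (*-congˡ (≈-sym (≈-trans (ι-+ (i ℕ.^ 2) (j ℕ.^ 2)) (+-cong (ι-² i) (ι-² j)))))

    R²≈ : R * R ≈ h * h * ι (N ℕ.^ 2)
    R²≈ = ≈-trans (≈-sym (*-cong Nh≈R Nh≈R)) (≈-trans (solve 2 (λ n h → (n :* h) :* (n :* h) := h :* h :* (n :* n)) ≈-refl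
          (ι N) h) (*-congˡ (≈-sym (ι-² N))))

    inside-disk : ∀ i j → i ℕ.^ 2 ℕ.+ j ℕ.^ 2 ℕ.≤ N ℕ.^ 2 → grid i * grid i + grid j * grid j ≤ R * R
    inside-disk i j le = ≤-trans (≤-reflexive (grid² i j)) (≤-trans (*-monoˡ-≤ (*-nonNeg 0≤h 0≤h) (ι-mono le))
          (≤-reflexive (≈-sym R²≈)))

    outside-disk : ∀ i j → N ℕ.^ 2 ℕ.≤ i ℕ.^ 2 ℕ.+ j ℕ.^ 2 → R * R ≤ grid i * grid i + grid j * grid j
    outside-disk i j le = ≤-trans (≤-reflexive R²≈) (≤-trans (*-monoˡ-≤ (*-nonNeg 0≤h 0≤h) (ι-mono le))
          (≤-reflexive (≈-sym (grid² i j))))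

  -- The reentrant corners of the staircase of n + 1 are not inside the disk of radius s n, so the
  -- staircase covers the quarter disk and with it every cell inside.
  cells≤staircase : ∀ n N′ → let open Grid (s n) (0≤s n) (Rational-s n) N′ in h * h * ι (cellsInside (suc N′)) ≤ ι (suc n)
  cells≤staircase n N′ = begin
    h * h * ι (∑< N Y)  ≈⟨ grid-area Y ⟨
    ∑ (λ i → grid (Y i) * (grid (suc i) - grid i)) N  ≤⟨ comparison ⟩
    ∑ (λ j → s (suc n ℕ.∸ j) * (s (suc j) - s j)) (suc n)  ≈⟨ staircase (suc n) ⟩
    ι (suc n)  ∎
    where
    open Grid (s n) (0≤s n) (Rational-s n) N′
    Y : ℕ → ℕ
    Y i = ∑< N (inside N i)
    height : ∀ i c → (∀ {c′} → c ≡ suc c′ → suc i ℕ.^ 2 ℕ.+ suc c′ ℕ.^ 2 ℕ.≤ N ℕ.^ 2) →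
             ∀ j → j ℕ.< suc n → s j ≤ grid (suc i) → grid c ≤ s (suc n ℕ.∸ j)
    height i zero    _    j j< _ = ≤-trans (≤-reflexive grid₀) (0≤s (suc n ℕ.∸ j))
    height i (suc c) fits j j< sj≤ = square-cancel-≤ (0≤s k) (≤-by (+-nonNeg (0≤y-x (s²-lower j k {n} (ℕ.m+[n∸m]≡n (ℕ.<⇒≤ j<))))
        (+-nonNeg (0≤y-x (inside-disk (suc i) (suc c) (fits ≡.refl))) (0≤y-x (*-mono-≤ (0≤grid (suc i)) (0≤s j) sj≤ sj≤))))
      (solve 5 (λ S g j k c → c :+ ((j :+ k :- S) :+ ((S :- (g :+ c)) :+ (g :- j))) := k) ≈-refl
        (s n * s n) (grid (suc i) * grid (suc i)) (s j * s j) (s k * s k) (grid (suc c) * grid (suc c))))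
      where k = suc n ℕ.∸ j
    open StepFunctions grid s (λ i → grid (Y i)) (λ j → s (suc n ℕ.∸ j)) N (suc n) grid₀ ≈-refl grid↑ s↑
      (λ i j → Rational-total (Rational-grid i) (Rational-s j)) (≤-trans (≤-reflexive Nh≈R) (s↑ n)) (λ j → 0≤s (suc n ℕ.∸ j))
      (λ i j _ j< _ → height i (Y i) (count-last (λ j → suc i ℕ.^ 2 ℕ.+ suc j ℕ.^ 2 ℕ.≤? N ℕ.^ 2)
        (λ j → ℕ.≤-trans (ℕ.+-monoʳ-≤ (suc i ℕ.^ 2) (ℕ.^-monoˡ-≤ 2 (ℕ.n≤1+n (suc j))))) N) j j<)

  -- The protruding corners lie in the disk of radius s (n + 1), so the cells meeting that disk
  -- cover the staircase. Each column of such cells is either full or ends outside the disk;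
  -- `D.meets≤` then counts the excess over the cells inside.
  staircase≤cells : ∀ n N′ → let open Grid (s (suc n)) (0≤s (suc n)) (Rational-s (suc n)) N′ in
                    ι n ≤ h * h * ι (cellsInside (suc N′) ℕ.+ 2 ℕ.* suc N′)
  staircase≤cells n N′ = begin
    ι n  ≈⟨ staircase n ⟨
    ∑ (λ j → s (n ℕ.∸ j) * (s (suc j) - s j)) n  ≤⟨ comparison ⟩
    ∑ (λ i → grid (Z i) * (grid (suc i) - grid i)) N  ≈⟨ grid-area Z ⟩
    h * h * ι (∑< N Z)  ≤⟨ *-monoˡ-≤ (*-nonNeg 0≤h 0≤h) (ι-mono (D.meets≤ N)) ⟩
    h * h * ι (cellsInside N ℕ.+ 2 ℕ.* N)  ∎
    where
    open Grid (s (suc n)) (0≤s (suc n)) (Rational-s (suc n)) N′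
    Z : ℕ → ℕ
    Z i = ∑< N (meets N i)
    far : ∀ i → N ℕ.^ 2 ℕ.≤ i ℕ.^ 2 ℕ.+ Z i ℕ.^ 2
    far i with count-next (λ j → i ℕ.^ 2 ℕ.+ j ℕ.^ 2 ℕ.<? N ℕ.^ 2)
      (λ j → ℕ.≤-<-trans (ℕ.+-monoʳ-≤ (i ℕ.^ 2) (ℕ.^-monoˡ-≤ 2 (ℕ.n≤1+n j)))) N
    ... | inj₁ eq = ℕ.≤-trans (ℕ.≤-reflexive (cong (ℕ._^ 2) (≡.sym eq))) (ℕ.m≤n+m (Z i ℕ.^ 2) (i ℕ.^ 2))
    ... | inj₂ ¬< = ℕ.≮⇒≥ ¬<
    height : ∀ j i → j ℕ.< n → grid i ≤ s (suc j) → s (n ℕ.∸ j) ≤ grid (Z i)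
    height j i j<n gi≤ = square-cancel-≤ (0≤grid (Z i)) (≤-by (+-nonNeg
          (0≤y-x (s²-upper (suc j) k {suc n} (cong suc (ℕ.m+[n∸m]≡n (ℕ.<⇒≤ j<n)))))
        (+-nonNeg (0≤y-x (outside-disk i (Z i) (far i))) (0≤y-x (*-mono-≤ (0≤s (suc j)) (0≤grid i) gi≤ gi≤))))
      (solve 5 (λ S g j k c → k :+ ((S :- (j :+ k)) :+ ((g :+ c :- S) :+ (j :- g))) := c) ≈-refl
        (s (suc n) * s (suc n)) (grid i * grid i) (s (suc j) * s (suc j)) (s k * s k) (grid (Z i) * grid (Z i))))
      where k = n ℕ.∸ j
    open StepFunctions s grid (λ j → s (n ℕ.∸ j)) (λ i → grid (Z i)) n N ≈-refl grid₀ s↑ grid↑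
      (λ j i → Rational-total (Rational-s j) (Rational-grid i)) (≤-trans (s↑ n) (≤-reflexive (≈-sym Nh≈R))) (λ i → 0≤grid (Z i))
      (λ j i j<n _ _ gi≤ → height j i j<n gi≤)

  fraction-* : ∀ a d .{{_ : ℕ.NonZero d}} → ⌜ + a ℚ./ d ⌝ * ι d ≈ ι a
  fraction-* a d@(suc d′) = ≈-trans (*-congˡ (ι≈ d)) (≈-trans (≈-sym (⌜⌝-* (+ a ℚ./ d) (D.ι d)))
    (≈-trans (ℛ.reflexive (cong ⌜_⌝ rational)) (≈-sym (ι≈ a))))
    where
    rational : + a ℚ./ d ℚ.* D.ι d ≡ D.ι a
    rational = ℚ.toℚᵘ-injective (ℚᵘ.≃-trans (ℚ.toℚᵘ-homo-* (+ a ℚ./ d) (D.ι d))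
      (ℚᵘ.≃-trans (ℚᵘ.*-congʳ {mkℚᵘ (+ d) 0} (ℚ.toℚᵘ-fromℚᵘ (mkℚᵘ (+ a) d′)))
        (ℚᵘ.*≡* (≡.trans (ℤ.*-identityʳ _) (cong (+ a ℤ.*_) (cong +_ (≡.sym (ℕ.*-identityʳ d))))))))

  π : Real
  π = real D.π

  0≤π : 0# ≤ π
  0≤π = Pos⇒0≤ (real-Positive D.π D.π-positive)

  opaque
    unfolding real

    πlow≤π : ∀ k → ⌜ D.πlow k ⌝ ≤ π
    πlow≤π k ε 0<ε = k , λ n k≤n → ℚ.≤-trans (D.up D.πlow-suc (ℕ.≤⇒≤′ k≤n)) (p≤p+ε (D.πlow n) 0<ε)

    π≤πhigh : ∀ k → π ≤ ⌜ D.πhigh k ⌝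
    π≤πhigh k ε 0<ε = k , λ n k≤n → ℚ.≤-trans (ℚ.≤-trans (D.πlow≤πhigh n) (D.down D.πhigh-suc (ℕ.≤⇒≤′ k≤n)))
          (p≤p+ε (D.πhigh k) 0<ε)

  module _ (k : ℕ) where

    private
      N′ : ℕ
      N′ = ℕ.pred (2 ℕ.^ k)
      N≡ : suc N′ ≡ 2 ℕ.^ k
      N≡ = ℕ.suc-pred (2 ℕ.^ k) {{ℕ.m^n≢0 2 k}}
      N : ℕ
      N = suc N′
      C : ℕ
      C = cellsInside N
      ι4^k : ι (4 ℕ.^ k) ≈ ι N * ι N
      ι4^k = ≈-trans (ℛ.reflexive (cong ι (≡.trans (≡.sym (D.2^k*2^k k)) (≡.cong₂ ℕ._*_ (≡.sym N≡) (≡.sym N≡))))) (ι-* N N)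
      ι4C : ι (4 ℕ.* cellsInside (2 ℕ.^ k)) ≈ four * ι C
      ι4C = ≈-trans (ℛ.reflexive (cong (λ N → ι (4 ℕ.* cellsInside N)) (≡.sym N≡))) (≈-trans (ι-* 4 C)
        (*-congʳ (solve 0 (:1 :+ (:1 :+ (:1 :+ (:1 :+ :0))) := :4) ≈-refl)))
      πlow-N : ⌜ D.πlow k ⌝ * (ι N * ι N) ≈ four * ι C
      πlow-N = ≈-trans (*-congˡ (≈-sym ι4^k)) (≈-trans (fraction-* (4 ℕ.* cellsInside (2 ℕ.^ k)) (4 ℕ.^ k) {{D.4^≢0 k}}) ι4C)
      πhigh-N : ⌜ D.πhigh k ⌝ * (ι N * ι N) ≈ four * ι C + four * four * ι N
      πhigh-N = ≈-trans (*-congˡ (≈-sym ι4^k)) (≈-trans (fraction-* (4 ℕ.* cellsInside (2 ℕ.^ k) ℕ.+ 16 ℕ.* 2 ℕ.^ k) (4 ℕ.^ k)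
            {{D.4^≢0 k}})
        (≈-trans (ι-+ (4 ℕ.* cellsInside (2 ℕ.^ k)) (16 ℕ.* 2 ℕ.^ k)) (+-cong ι4C
          (≈-trans (ι-* 16 (2 ℕ.^ k)) (*-cong (≈-trans (ι-* 4 4) (*-cong ι4 ι4)) (ℛ.reflexive (cong ι (≡.sym N≡))))))))
        where
        ι4 : ι 4 ≈ four
        ι4 = solve 0 (:1 :+ (:1 :+ (:1 :+ (:1 :+ :0))) := :4) ≈-refl
      scaled : ∀ R c → ι N * ι N * (R * ν N′ * (R * ν N′) * c) ≈ R * R * c
      scaled R c = ≈-trans (solve 4 (λ n r v c → n :* n :* (r :* v :* (r :* v) :* c) := (v :* n) :*
            ((v :* n) :* (r :* r :* c))) ≈-refl (ι N) R (ν N′) c)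
        (≈-trans (*-cong (ν-inverse N′) (≈-trans (*-congʳ (ν-inverse N′)) (*-identityˡ _))) (*-identityˡ _))
      Pos-N² : Pos (ι N * ι N)
      Pos-N² = Pos-* (Pos-ι N′) (Pos-ι N′)

    -- With N = 2^k, `πhigh` exceeds four times the cell count over N² by 16/N. At radius s n this
    -- costs 16 (s n)²/N, which the hypothesis bounds by ε.
    disk≤ : ∀ n {ε} → four * four * (s n * s n) ≤ ι N * ε → π * (s n * s n) ≤ four * ι (suc n) + ε
    disk≤ n {ε} small = *-cancelˡ-≤ Pos-N² (begin
      ι N * ι N * (π * S)  ≤⟨ *-monoˡ-≤ (Pos⇒0≤ Pos-N²) (*-monoʳ-≤ 0≤S (π≤πhigh k)) ⟩
      ι N * ι N * (⌜ D.πhigh k ⌝ * S)  ≈⟨ solve 3 (λ a p s → a :* (p :* s) := (p :* a) :* s) ≈-refl (ι N * ι N) ⌜ D.πhigh k ⌝ S ⟩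
      ⌜ D.πhigh k ⌝ * (ι N * ι N) * S  ≈⟨ *-congʳ πhigh-N ⟩
      (four * ι C + four * four * ι N) * S
        ≈⟨ solve 4 (λ f c n s → (f :* c :+ f :* f :* n) :* s := f :* (s :* c) :+ n :* (f :* f :* s)) ≈-refl four (ι C) (ι N) S ⟩
      four * (S * ι C) + ι N * (four * four * S)
        ≤⟨ +-mono-≤ (*-monoˡ-≤ (Pos⇒0≤ Pos-four) (≤-trans (≤-reflexive (≈-sym (scaled (s n) (ι C))))
             (*-monoˡ-≤ (Pos⇒0≤ Pos-N²) (cells≤staircase n N′)))) (*-monoˡ-≤ (0≤ι N) small) ⟩
      four * (ι N * ι N * ι (suc n)) + ι N * (ι N * ε)
        ≈⟨ solve 4 (λ f n i e → f :* (n :* n :* i) :+ n :* (n :* e) := n :* n :* (f :* i :+ e)) ≈-refl four (ι N) (ι (suc n)) ε ⟩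
      ι N * ι N * (four * ι (suc n) + ε)  ∎)
      where
      S = s n * s n
      0≤S = *-nonNeg (0≤s n) (0≤s n)

    disk≥ : ∀ n {ε} → four * four * (s (suc n) * s (suc n)) ≤ ι N * ε → four * ι n ≤ π * (s (suc n) * s (suc n)) + ε
    disk≥ n {ε} small = *-cancelˡ-≤ Pos-N² (begin
      ι N * ι N * (four * ι n)  ≈⟨ solve 3 (λ a f i → a :* (f :* i) := f :* (a :* i)) ≈-refl (ι N * ι N) four (ι n) ⟩
      four * (ι N * ι N * ι n)
        ≤⟨ *-monoˡ-≤ (Pos⇒0≤ Pos-four) (≤-trans (*-monoˡ-≤ (Pos⇒0≤ Pos-N²) (staircase≤cells n N′))
              (≤-reflexive (scaled (s (suc n)) _))) ⟩
      four * (S * ι (C ℕ.+ 2 ℕ.* N))  ≈⟨ *-congˡ (*-congˡ (≈-trans (ι-+ C (2 ℕ.* N)) (+-congˡ (ι-* 2 N)))) ⟩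
      four * (S * (ι C + ι 2 * ι N))
        ≤⟨ ≤-by (*-nonNeg (*-nonNeg (Pos⇒0≤ Pos-four) 0≤S) (+-nonNeg (0≤ι N) (0≤ι N)))
             (solve 3 (λ s c n → let f = :4 in
               f :* (s :* (c :+ (:1 :+ (:1 :+ :0)) :* n)) :+ f :* s :* (n :+ n) := f :* c :* s :+ n :* (f :* f :* s)) ≈-refl S
                     (ι C) (ι N)) ⟩
      four * ι C * S + ι N * (four * four * S)  ≤⟨ +-mono-≤ (*-monoʳ-≤ 0≤S (≤-reflexive (≈-sym πlow-N)))
            (*-monoˡ-≤ (0≤ι N) small) ⟩
      ⌜ D.πlow k ⌝ * (ι N * ι N) * S + ι N * (ι N * ε)
        ≤⟨ +-mono-≤ (*-monoʳ-≤ 0≤S (*-monoʳ-≤ (Pos⇒0≤ Pos-N²) (πlow≤π k))) ≤-refl ⟩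
      π * (ι N * ι N) * S + ι N * (ι N * ε)
        ≈⟨ solve 4 (λ p n s e → p :* (n :* n) :* s :+ n :* (n :* e) := n :* n :* (p :* s :+ e)) ≈-refl π (ι N) S ε ⟩
      ι N * ι N * (π * S + ε)  ∎)
      where
      S = s (suc n) * s (suc n)
      0≤S = *-nonNeg (0≤s (suc n)) (0≤s (suc n))

    k≤N : k ℕ.≤ N
    k≤N = ℕ.≤-trans (ℕ.≤-trans (ℕ.n≤1+n k) (D.1+n≤2^n k)) (ℕ.≤-reflexive (≡.sym N≡))

  fine : ∀ x ε → 0ℚ ℚ.< ε → ∃ λ k → x ≤ ι (suc (ℕ.pred (2 ℕ.^ k))) * ⌜ ε ⌝
  fine x ε 0<ε = let k , h = ι-large x ε 0<ε in k , h _ (k≤N k)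

  πs²≤ : ∀ n → π * (s n * s n) ≤ four * ι (suc n)
  πs²≤ n = ≤-closed λ ε 0<ε → let k , small = fine (four * four * (s n * s n)) ε 0<ε in disk≤ k n small

  ≤πs² : ∀ n → four * ι n ≤ π * (s (suc n) * s (suc n))
  ≤πs² n = ≤-closed λ ε 0<ε → let k , small = fine (four * four * (s (suc n) * s (suc n))) ε 0<ε in disk≥ k n small

  -- As π (s n)²/4 = n · π nw² n, the two disk bounds put this quantity within 1 of n; division by n
  -- leaves an error of at most 1/n.
  wallis : (λ n → π * nw² n) ⟶ 1#
  wallis = mk~ λ ε 0<ε → let N , p = ι-large 1# ε 0<ε in suc N , λ { n@(suc m) N<n → *-cancelˡ-≤ (Pos-ι m) (begin
      ι n * ∣ π * nw² n - 1# * 1# ∣  ≈⟨ ≈-trans (∣∣-* (ι n) _) (*-congʳ (0≤x⇒∣x∣≈x (0≤ι n))) ⟨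
      ∣ ι n * (π * nw² n - 1# * 1#) ∣  ≤⟨ ∣∣-lub (upper n) (lower m) ⟩
      1#  ≤⟨ p n (ℕ.<⇒≤ N<n) ⟩
      ι n * ⌜ ε ⌝  ≈⟨ *-congˡ (*-identityʳ _) ⟨
      ι n * (⌜ ε ⌝ * 1#)  ∎) }
    where
    four-π : ∀ n → π * (s n * s n) ≈ four * (ι n * (π * nw² n))
    four-π n = ≈-trans (*-congˡ (s²≈ n)) (solve 4 (λ p f i x → p :* (f :* (i :* x)) := f :* (i :* (p :* x))) ≈-refl π four
          (ι n) (nw² n))
    upper : ∀ n → ι n * (π * nw² n - 1# * 1#) ≤ 1#
    upper n = ≤-by (0≤y-x (*-cancelˡ-≤ Pos-four (≤-trans (≤-reflexive (≈-sym (four-π n))) (πs²≤ n))))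
      (solve 2 (λ i x → i :* (x :- :1 :* :1) :+ (:1 :+ i :- i :* x) := :1) ≈-refl (ι n) (π * nw² n))
    lower : ∀ m → - (ι (suc m) * (π * nw² (suc m) - 1# * 1#)) ≤ 1#
    lower m = ≤-by (0≤y-x (*-cancelˡ-≤ Pos-four (≤-trans (≤πs² m) (≤-reflexive (four-π (suc m))))))
      (solve 2 (λ i x → :- ((:1 :+ i) :* (x :- :1 :* :1)) :+ ((:1 :+ i) :* x :- i) := :1) ≈-refl (ι m) (π * nw² (suc m)))

-- Counting bounded terms by recurrences.

module Counting where

  open import Data.Empty using (⊥-elim)
  open import Data.Fin.Base as Fin using (Fin; toℕ; fromℕ<)
  import Data.Fin.Permutation as Perm
  import Data.Fin.Properties as Fin
  open import Data.Nat.Base as ℕ using (ℕ; zero; suc; _⊓_; z≤n; s≤s)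
  import Data.Nat.Induction as ℕ
  import Data.Nat.Properties as ℕ
  open import Data.Product.Base using (Σ; ∃; _×_; _,_; proj₁; proj₂)
  open import Data.Product.Function.NonDependent.Propositional using (_×-↔_)
  open import Data.Sum.Base using (_⊎_; inj₁; inj₂)
  open import Data.Sum.Function.Propositional using (_⊎-↔_)
  open import Defs using (Motzkin; leaf; unary; binary; size; Leaf; here; under; left; right; UnaryAbove; root; unaryDepth;
        unaryLength; EachLeaf; at; ClosedTerm; mkTerm; BoundedTerm)
  open import Function.Base using (_∘_)
  open import Function.Bundles using (_↔_; Inverse; mk↔ₛ′)
  open import Function.Properties.Inverse using (↔-refl; ↔-sym; ↔-trans)
  open import Relation.Binary.PropositionalEquality using (_≡_; refl; sym; trans; cong; subst)
  open import Relation.Nullary using (yes; no)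

  open Inverse
  module ℕSeries = PowerSeries ℕ.+-*-commutativeSemiring
  open ℕSeries using (_⊛_; tl)

  Σ-cong : ∀ {A : Set} {P Q : A → Set} → (∀ x → P x ↔ Q x) → Σ A P ↔ Σ A Q
  Σ-cong h = mk↔ₛ′ (λ (x , p) → x , to (h x) p) (λ (x , q) → x , from (h x) q)
    (λ (x , q) → cong (x ,_) (strictlyInverseˡ (h x) q)) (λ (x , p) → cong (x ,_) (strictlyInverseʳ (h x) p))

  EachLeaf-cong : ∀ t {P Q : Leaf t → Set} → (∀ e → P e ↔ Q e) → EachLeaf t P ↔ EachLeaf t Q
  EachLeaf-cong leaf         h = h here
  EachLeaf-cong (unary t)    h = EachLeaf-cong t (λ e → h (under e))
  EachLeaf-cong (binary l r) h = EachLeaf-cong l (λ e → h (left e)) ×-↔ EachLeaf-cong r (λ e → h (right e))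

  EachLeaf-Σ : ∀ t {P : Leaf t → Set} {Q : ∀ e → P e → Set} →
               Σ (EachLeaf t P) (λ b → EachLeaf t λ e → Q e (at b e)) ↔ EachLeaf t (λ e → Σ (P e) (Q e))
  EachLeaf-Σ leaf      = ↔-refl
  EachLeaf-Σ (unary t) = EachLeaf-Σ t
  EachLeaf-Σ (binary l r) = ↔-trans
    (mk↔ₛ′ (λ ((a , b) , (p , q)) → (a , p) , (b , q)) (λ ((a , p) , (b , q)) → (a , b) , (p , q)) (λ _ → refl) (λ _ → refl))
    (EachLeaf-Σ l ×-↔ EachLeaf-Σ r)

  unaryLength-bounds : ∀ {t} {e : Leaf t} (v : UnaryAbove e) → ∃ λ m → unaryLength v ≡ suc m × m ℕ.< unaryDepth e
  unaryLength-bounds (root {e = e}) = unaryDepth e , refl , ℕ.≤-refl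
  unaryLength-bounds (under v) = let m , eq , m< = unaryLength-bounds v in m , eq , ℕ.m≤n⇒m≤1+n m<
  unaryLength-bounds (left v)  = unaryLength-bounds v
  unaryLength-bounds (right v) = unaryLength-bounds v

  unaryLength-injective : ∀ {t} {e : Leaf t} (v v′ : UnaryAbove e) → unaryLength v ≡ unaryLength v′ → v ≡ v′
  unaryLength-injective root root eq = refl
  unaryLength-injective (root {e = e}) (under v) eq = let m , eq′ , m< = unaryLength-bounds v in
    ⊥-elim (ℕ.<⇒≢ m< (ℕ.suc-injective (trans (sym eq′) (sym eq))))
  unaryLength-injective (under v) (root {e = e}) eq = let m , eq′ , m< = unaryLength-bounds v in
    ⊥-elim (ℕ.<⇒≢ m< (ℕ.suc-injective (trans (sym eq′) eq)))
  unaryLength-injective (under v) (under v′) eq = cong under (unaryLength-injective v v′ eq)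
  unaryLength-injective (left v) (left v′) eq   = cong left (unaryLength-injective v v′ eq)
  unaryLength-injective (right v) (right v′) eq = cong right (unaryLength-injective v v′ eq)

  node : ∀ {t} (e : Leaf t) m → m ℕ.< unaryDepth e → ∃ λ (v : UnaryAbove e) → unaryLength v ≡ suc m
  node (under e) m m< with ℕ.m≤n⇒m<n∨m≡n (ℕ.≤-pred m<)
  ... | inj₁ m<d  = let v , eq = node e m m<d in under v , eq
  ... | inj₂ refl = root , refl
  node (left e) m m<  = let v , eq = node e m m< in left v , eq
  node (right e) m m< = let v , eq = node e m m< in right v , eq

  -- A unary node above a leaf is determined by its unary length, and every value from 1 to the
  -- unary depth occurs. Subtracting 1 gives the index.
  bindings : ∀ k {t} (e : Leaf t) → Σ (UnaryAbove e) (λ v → unaryLength v ℕ.≤ k) ↔ Fin (unaryDepth e ⊓ k)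
  bindings k e = mk↔ₛ′ f f⁻¹ f∘f⁻¹ f⁻¹∘f
    where
    f : Σ (UnaryAbove e) (λ v → unaryLength v ℕ.≤ k) → Fin (unaryDepth e ⊓ k)
    f (v , v≤k) = let m , eq , m<d = unaryLength-bounds v in
      fromℕ< (ℕ.⊓-pres-m< m<d (subst (ℕ._≤ k) eq v≤k))
    f⁻¹ : Fin (unaryDepth e ⊓ k) → Σ (UnaryAbove e) (λ v → unaryLength v ℕ.≤ k)
    f⁻¹ i = let v , eq = node e (toℕ i) (ℕ.<-≤-trans (Fin.toℕ<n i) (ℕ.m⊓n≤m _ k)) in
      v , subst (ℕ._≤ k) (sym eq) (ℕ.<-≤-trans (Fin.toℕ<n i) (ℕ.m⊓n≤n _ k))
    toℕ-f : ∀ p → suc (toℕ (f p)) ≡ unaryLength (proj₁ p)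
    toℕ-f (v , v≤k) = let m , eq , m<d = unaryLength-bounds v in
      trans (cong suc (Fin.toℕ-fromℕ< (ℕ.⊓-pres-m< m<d (subst (ℕ._≤ k) eq v≤k)))) (sym eq)
    length-f⁻¹ : ∀ i → unaryLength (proj₁ (f⁻¹ i)) ≡ suc (toℕ i)
    length-f⁻¹ i = proj₂ (node e (toℕ i) _)
    f∘f⁻¹ : ∀ i → f (f⁻¹ i) ≡ i
    f∘f⁻¹ i = Fin.toℕ-injective (ℕ.suc-injective (trans (toℕ-f (f⁻¹ i)) (length-f⁻¹ i)))
    f⁻¹∘f : ∀ p → f⁻¹ (f p) ≡ p
    f⁻¹∘f p@(v , v≤k) = pair (unaryLength-injective (proj₁ (f⁻¹ (f p))) v (trans (length-f⁻¹ (f p)) (toℕ-f p)))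
      where
      pair : ∀ {q : Σ (UnaryAbove e) (λ v → unaryLength v ℕ.≤ k)} → proj₁ q ≡ v → q ≡ (v , v≤k)
      pair {_ , le} refl = cong (v ,_) (ℕ.≤-irrelevant le v≤k)

  -- Trees of size n below d further unary nodes; a leaf may be bound by the k nearest unary nodes above it.
  Choices : (k d : ℕ) (t : Motzkin) → Set
  Choices k d t = EachLeaf t λ e → Fin ((d ℕ.+ unaryDepth e) ⊓ k)

  Trees : (k d n : ℕ) → Set
  Trees k d n = Σ Motzkin λ t → size t ≡ n × Choices k d t

  BoundedTerm↔Trees : ∀ k n → BoundedTerm k n ↔ Trees k 0 n
  BoundedTerm↔Trees k n = ↔-trans
    (mk↔ₛ′ (λ (mkTerm t b , eq , h) → t , eq , (b , h)) (λ (t , eq , (b , h)) → mkTerm t b , eq , h) (λ _ → refl) (λ _ → refl))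
    (Σ-cong λ t → ↔-refl ×-↔ ↔-trans (EachLeaf-Σ t) (EachLeaf-cong t (bindings k)))

  Fin-cong : ∀ {m n} → m ≡ n → Fin m ↔ Fin n
  Fin-cong refl = ↔-refl

  Conv : (A B : ℕ → Set) → ℕ → Set
  Conv A B n = Σ ℕ λ i → Σ ℕ λ j → i ℕ.+ j ≡ n × A i × B j

  Conv-zero : ∀ A B → (A 0 × B 0) ↔ Conv A B 0
  Conv-zero A B = mk↔ₛ′ (λ (a , b) → 0 , 0 , refl , a , b) f⁻¹ (λ { (zero , .0 , refl , a , b) → refl }) (λ (a , b) → refl)
    where
    f⁻¹ : Conv A B 0 → A 0 × B 0
    f⁻¹ (zero , .0 , refl , a , b) = a , b

  -- Splitting on whether the second size is 0 matches the recursion of `_⊛_`.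
  Conv-suc : ∀ A B n → ((A (suc n) × B 0) ⊎ Conv A (B ∘ suc) n) ↔ Conv A B (suc n)
  Conv-suc A B n = mk↔ₛ′ f f⁻¹ f∘f⁻¹ f⁻¹∘f
    where
    f : (A (suc n) × B 0) ⊎ Conv A (B ∘ suc) n → Conv A B (suc n)
    f (inj₁ (a , b))              = suc n , 0 , ℕ.+-identityʳ (suc n) , a , b
    f (inj₂ (i , j , eq , a , b)) = i , suc j , trans (ℕ.+-suc i j) (cong suc eq) , a , b
    f⁻¹ : Conv A B (suc n) → (A (suc n) × B 0) ⊎ Conv A (B ∘ suc) n
    f⁻¹ (i , zero , eq , a , b)  = inj₁ (subst A (trans (sym (ℕ.+-identityʳ i)) eq) a , b)
    f⁻¹ (i , suc j , eq , a , b) = inj₂ (i , j , ℕ.suc-injective (trans (sym (ℕ.+-suc i j)) eq) , a , b)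
    subst-zero : ∀ i m (eq : i ℕ.+ 0 ≡ m) (eq′ : m ℕ.+ 0 ≡ m) (p : i ≡ m) a b →
                 _≡_ {A = Conv A B m} (m , 0 , eq′ , subst A p a , b) (i , 0 , eq , a , b)
    subst-zero i .i eq eq′ refl a b = cong (λ e → i , 0 , e , a , b) (ℕ.≡-irrelevant eq′ eq)
    f∘f⁻¹ : ∀ x → f (f⁻¹ x) ≡ x
    f∘f⁻¹ (i , zero , eq , a , b)  = subst-zero i (suc n) eq _ _ a b
    f∘f⁻¹ (i , suc j , eq , a , b) = cong (λ e → i , suc j , e , a , b) (ℕ.≡-irrelevant _ eq)
    f⁻¹∘f : ∀ x → f⁻¹ (f x) ≡ x
    f⁻¹∘f (inj₁ (a , b)) = cong (λ p → inj₁ (subst A p a , b)) (ℕ.≡-irrelevant _ refl)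
    f⁻¹∘f (inj₂ (i , j , eq , a , b)) = cong (λ e → inj₂ (i , j , e , a , b)) (ℕ.≡-irrelevant _ eq)

  Fin-⊛ : ∀ {a b A B} n → (∀ i → i ℕ.≤ n → Fin (a i) ↔ A i) → (∀ j → j ℕ.≤ n → Fin (b j) ↔ B j) → Fin ((a ⊛ b) n) ↔ Conv A B n
  Fin-⊛ {A = A} {B} zero h k = ↔-trans Fin.*↔× (↔-trans (h 0 z≤n ×-↔ k 0 z≤n) (Conv-zero A B))
  Fin-⊛ {A = A} {B} (suc n) h k = ↔-trans Fin.+↔⊎ (↔-trans
    (↔-trans Fin.*↔× (h (suc n) ℕ.≤-refl ×-↔ k 0 z≤n) ⊎-↔
      Fin-⊛ n (λ i i≤n → h i (ℕ.m≤n⇒m≤1+n i≤n)) (λ j j≤n → k (suc j) (s≤s j≤n))) (Conv-suc A B n))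

  module _ (k : ℕ) where

    leaves : ℕ → ℕ → ℕ
    leaves d zero    = d ⊓ k
    leaves d (suc _) = 0

    Fin-leaves : ∀ d m → Fin (leaves d m) ↔ (1 ≡ suc m × Choices k d leaf)
    Fin-leaves d zero    = ↔-trans (Fin-cong (cong (_⊓ k) (sym (ℕ.+-identityʳ d))))
      (mk↔ₛ′ (refl ,_) (λ { (refl , c) → c }) (λ { (refl , c) → refl }) (λ _ → refl))
    Fin-leaves d (suc m) = mk↔ₛ′ (λ ()) (λ ()) (λ ()) (λ ())

    split : ∀ d m → ((1 ≡ suc m × Choices k d leaf) ⊎ (Trees k (suc d) m ⊎ Conv (Trees k d) (Trees k d) m)) ↔ Trees k d (suc m)
    split d m = ↔-trans (↔-refl ⊎-↔ (Σ-cong (λ t → ↔-refl ×-↔ EachLeaf-cong t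
          (λ e → Fin-cong (cong (_⊓ k) (sym (ℕ.+-suc d (unaryDepth e)))))) ⊎-↔ ↔-refl))
      (mk↔ₛ′ f f⁻¹ f∘f⁻¹ f⁻¹∘f)
      where
      f : (1 ≡ suc m × Choices k d leaf) ⊎ ((Σ Motzkin λ t → size t ≡ m × Choices k d (unary t)) ⊎ Conv (Trees k d)
            (Trees k d) m) → Trees k d (suc m)
      f (inj₁ (eq , c))                 = leaf , eq , c
      f (inj₂ (inj₁ (t , refl , c)))    = unary t , refl , c
      f (inj₂ (inj₂ (_ , _ , refl , (l , refl , c) , (r , refl , c′)))) = binary l r , refl , (c , c′)
      f⁻¹ : Trees k d (suc m) → (1 ≡ suc m × Choices k d leaf) ⊎ ((Σ Motzkin λ t → size t ≡ m × Choices k d (unary t)) ⊎ Conv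
            (Trees k d) (Trees k d) m)
      f⁻¹ (leaf , eq , c)                = inj₁ (eq , c)
      f⁻¹ (unary t , refl , c)           = inj₂ (inj₁ (t , refl , c))
      f⁻¹ (binary l r , refl , (c , c′)) = inj₂ (inj₂ (size l , size r , refl , (l , refl , c) , (r , refl , c′)))
      f∘f⁻¹ : ∀ x → f (f⁻¹ x) ≡ x
      f∘f⁻¹ (leaf , eq , c)                = refl
      f∘f⁻¹ (unary t , refl , c)           = refl
      f∘f⁻¹ (binary l r , refl , (c , c′)) = refl
      f⁻¹∘f : ∀ x → f⁻¹ (f x) ≡ x
      f⁻¹∘f (inj₁ (eq , c))                 = refl
      f⁻¹∘f (inj₂ (inj₁ (t , refl , c)))    = refl
      f⁻¹∘f (inj₂ (inj₂ (_ , _ , refl , (l , refl , c) , (r , refl , c′)))) = refl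

    no-trees : ∀ d → Fin 0 ↔ Trees k d 0
    no-trees d = mk↔ₛ′ (λ ()) (λ { (leaf , () , _) ; (unary _ , () , _) ; (binary _ _ , () , _) })
      (λ { (leaf , () , _) ; (unary _ , () , _) ; (binary _ _ , () , _) }) (λ ())

    -- All depths are treated at once, because removing a unary root decreases the size but
    -- increases the depth.
    Finite : ℕ → Set
    Finite n = ∀ d → ∃ λ c → Fin c ↔ Trees k d n

    finite : ∀ n → Finite n
    finite = ℕ.<-rec Finite step
      where
      step : ∀ n → (∀ {m} → m ℕ.< n → Finite m) → Finite n
      step zero    rec d = 0 , no-trees d
      step (suc m) rec d = _ , ↔-trans (↔-trans Fin.+↔⊎ (Fin-leaves d m ⊎-↔ ↔-trans Fin.+↔⊎ (proj₂ (rec ℕ.≤-refl (suc d)) ⊎-↔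
        Fin-⊛ {a} {a} m bij bij))) (split d m)
        where
        -- Recursive counts are available only up to size m; beyond that the default is 0, and
        -- `Fin-⊛` asks for bijections only up to m.
        a : ℕ → ℕ
        a i with i ℕ.≤? m
        ... | yes i≤m = proj₁ (rec (s≤s i≤m) d)
        ... | no  _   = 0
        bij : ∀ i → i ℕ.≤ m → Fin (a i) ↔ Trees k d i
        bij i i≤m with i ℕ.≤? m
        ... | yes i≤m′ = proj₂ (rec (s≤s i≤m′) d)
        ... | no  i≰m  = ⊥-elim (i≰m i≤m)

    count : ℕ → ℕ → ℕ
    count d n = proj₁ (finite n d)

    Fin-count : ∀ d n → Fin (count d n) ↔ Trees k d n
    Fin-count d n = proj₂ (finite n d)

    unique : ∀ {m n} {A : Set} → Fin m ↔ A → Fin n ↔ A → m ≡ n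
    unique h h′ = Perm.↔⇒≡ (↔-trans h (↔-sym h′))

    count-zero : ∀ d → count d 0 ≡ 0
    count-zero d = unique (Fin-count d 0) (no-trees d)

    -- The recurrence comes from uniqueness of cardinality, so the well-founded recursion that
    -- defines the counts need not be unfolded.
    count-suc : ∀ d m → count d (suc m) ≡ leaves d m ℕ.+ (count (suc d) m ℕ.+ (count d ⊛ count d) m)
    count-suc d m = unique (Fin-count d (suc m)) (↔-trans (↔-trans Fin.+↔⊎ (Fin-leaves d m ⊎-↔
      ↔-trans Fin.+↔⊎ (Fin-count (suc d) m ⊎-↔ Fin-⊛ m (λ i _ → Fin-count d i) (λ i _ → Fin-count d i)))) (split d m))

    -- From depth k on every leaf has exactly k choices. This closes the system of equations: level
    -- k refers only to itself.
    count-stable : ∀ n → count (suc k) n ≡ count k n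
    count-stable n = unique (Fin-count (suc k) n) (↔-trans (Fin-count k n) (Σ-cong λ t → ↔-refl ×-↔ EachLeaf-cong t λ e →
      Fin-cong (trans (ℕ.m≥n⇒m⊓n≡n (ℕ.m≤m+n k _)) (sym (ℕ.m≥n⇒m⊓n≡n (ℕ.≤-trans (ℕ.n≤1+n k) (ℕ.m≤m+n (suc k) _)))))))

    count-terms : ∀ {c} n → Fin c ↔ BoundedTerm k n → c ≡ count 0 n
    count-terms n h = unique h (↔-trans (Fin-count 0 n) (↔-sym (BoundedTerm↔Trees k n)))

-- Rescaling, shifting and uniqueness for series.

module Scaling where

  open Reals
  open RealSeries
  open Asymptotics
  open TransferTheorem
  open WallisProduct using (ι-+; ι-*)
  open Counting using (module ℕSeries)
  open ≤-Reasoning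
  open Solver using (solve; _:=_; _:+_; _:-_; _:*_; :-_)
  private module S = SeriesSolver

  pow : Real → ℕ → Real
  pow x zero    = 1#
  pow x (suc n) = x * pow x n

  Pos-pow : ∀ {x} → Pos x → ∀ n → Pos (pow x n)
  Pos-pow px zero    = Pos-⌜⌝ D.0<1
  Pos-pow px (suc n) = Pos-* px (Pos-pow px n)

  pow-inverse : ∀ {x y} → x * y ≈ 1# → ∀ n → pow x n * pow y n ≈ 1#
  pow-inverse eq zero    = *-identityˡ 1#
  pow-inverse {x} {y} eq (suc n) = ≈-trans (solve 4 (λ x y a b → (x :* a) :* (y :* b) := (x :* y) :* (a :* b)) ≈-refl x y
        (pow x n) (pow y n))
    (≈-trans (*-cong eq (pow-inverse eq n)) (*-identityˡ 1#))

  scale : Real → Seq → Seq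
  scale x u n = pow x n * u n

  scale-⊛ : ∀ x u v → scale x (u ⊛ v) ≋ scale x u ⊛ scale x v
  scale-⊛ x u v zero    = solve 2 (λ a b → :1 :* (a :* b) := (:1 :* a) :* (:1 :* b)) ≈-refl (u 0) (v 0)
  scale-⊛ x u v (suc n) = begin-equality
    x * pow x n * (u (suc n) * v 0 + (u ⊛ tl v) n)
      ≈⟨ solve 5 (λ x p a b c → x :* p :* (a :* b :+ c) := (x :* p :* a) :* (:1 :* b) :+ x :* (p :* c)) ≈-refl x (pow x n)
            (u (suc n)) (v 0) ((u ⊛ tl v) n) ⟩
    x * pow x n * u (suc n) * (1# * v 0) + x * (pow x n * (u ⊛ tl v) n)
      ≈⟨ +-congˡ (*-congˡ (scale-⊛ x u (tl v) n)) ⟩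
    x * pow x n * u (suc n) * (1# * v 0) + x * (scale x u ⊛ scale x (tl v)) n
      ≈⟨ +-congˡ (≈-trans (⊛-cong {scale x u} ≋-refl (λ m → *-assoc x (pow x m) (v (suc m))) n)
            (⊛-· x (scale x u) (scale x (tl v)) n)) ⟨
    x * pow x n * u (suc n) * (1# * v 0) + (scale x u ⊛ tl (scale x v)) n  ∎

  sh-⊛ : ∀ x v → (x · X) ⊛ v ≋ x · sh v
  sh-⊛ x v n = ≈-trans (·-⊛ x X v n) (*-congˡ (X⊛ n))
    where
    X⊛ : X ⊛ v ≋ sh v
    X⊛ zero    = zeroˡ (v 0)
    X⊛ (suc n) = ≈-trans (⊛-sucˡ X v n) (≈-trans (+-cong (zeroˡ _)
      (≈-trans (⊛-cong {tl X} {δ₀} {v} (λ { zero → ≈-refl ; (suc m) → ≈-refl }) ≋-refl n) (⊛-identityˡ v n))) (+-identityˡ (v n)))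

  ι-⊛ : ∀ (a c : ℕ → ℕ) n → ι (ℕSeries._⊛_ a c n) ≈ ((λ i → ι (a i)) ⊛ (λ i → ι (c i))) n
  ι-⊛ a c zero    = ι-* (a 0) (c 0)
  ι-⊛ a c (suc n) = ≈-trans (ι-+ (a (suc n) ℕ.* c 0) _) (+-cong (ι-* (a (suc n)) (c 0)) (ι-⊛ a (λ i → c (suc i)) n))

  -- With vanishing constant terms, a coefficient of F ⊛ F and of the shifted series involves only
  -- earlier coefficients of F, so the equation determines F recursively.
  quadratic-unique : ∀ {x G F F′} → F 0 ≈ 0# → F′ 0 ≈ 0# → F ≋ ½# · (F ⊛ F) ⊕ G ⊕ x · sh F → F′ ≋ ½# · (F′ ⊛ F′) ⊕ G ⊕ x · sh
        F′ → F ≋ F′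
  quadratic-unique {x} {G} {F} {F′} F₀ F′₀ eq eq′ n = below n n ℕ.≤-refl
    where
    square : ∀ {F} → F 0 ≈ 0# → ∀ n → (F ⊛ F) (suc (suc n)) ≈ (tl F ⊛ tl F) n
    square {F} F₀ n = ≈-trans (⊛-sucˡ F F (suc n)) (≈-trans (+-cong (≈-trans (*-congʳ F₀) (zeroˡ _))
      (≈-trans (+-congʳ (≈-trans (*-congˡ F₀) (zeroʳ _))) (+-identityˡ _))) (+-identityˡ _))
    below : ∀ n m → m ℕ.≤ n → F m ≈ F′ m
    below n zero m≤n = ≈-trans F₀ (≈-sym F′₀)
    below (suc n) (suc zero) m≤n = ≈-trans (eq 1) (≈-trans (+-cong (+-congʳ (*-congˡ
      (+-cong (≈-trans (*-congˡ F₀) (≈-trans (zeroʳ _) (≈-sym (≈-trans (*-congˡ F′₀) (zeroʳ _)))))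
        (≈-trans (*-congʳ F₀) (≈-trans (zeroˡ _) (≈-sym (≈-trans (*-congʳ F′₀) (zeroˡ _))))))))
              (*-congˡ (≈-trans F₀ (≈-sym F′₀)))) (≈-sym (eq′ 1)))
    below (suc n) (suc (suc m)) (s≤s m<n) = ≈-trans (eq (suc (suc m))) (≈-trans (+-cong (+-congʳ (*-congˡ
      (≈-trans (square F₀ m) (≈-trans (⊛-local {tl F} {tl F′} m step step) (≈-sym (square F′₀ m))))))
            (*-congˡ (below n (suc m) m<n))) (≈-sym (eq′ (suc (suc m)))))
      where
      step : ∀ j → j ℕ.≤ m → F (suc j) ≈ F′ (suc j)
      step j j≤m = below n (suc j) (ℕ.≤-trans (s≤s j≤m) m<n)

  𝟙-regular : Regular 𝟙
  𝟙-regular = ~-cong∞ (1 , λ { (suc n) _ → ≈-refl }) ≈-refl (~-≈ 0≤𝟙 {𝟙} (λ n → ≈-sym (*-identityʳ 1#)))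

  ∑-sh : ∀ u n → ∑ (sh u) n ≈ sh (∑ u) n
  ∑-sh u zero          = ≈-refl
  ∑-sh u (suc zero)    = +-identityˡ 0#
  ∑-sh u (suc (suc n)) = +-congʳ (∑-sh u (suc n))

  ∑-sh⟶ : ∀ {u l} → ∑ u ⟶ l → ∑ (sh u) ⟶ l
  ∑-sh⟶ {u} h = ~-cong (λ n → ≈-sym (∑-sh u n)) ≈-refl (~-sh 0≤𝟙 𝟙-regular h)

  -- For n ≥ 1 the ratio b n / b (n+1) is (n + 1)/(n - ½), largest at n = 1 where it equals 4. This
  -- lets domination by b survive a shift.
  b-step : ∀ n → b n ≤ four * b (suc n)
  b-step zero    = *-nonNeg (Pos⇒0≤ Pos-four) (0≤b 1)
  b-step (suc n) = *-cancelˡ-≤ (Pos-ι (suc n)) (begin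
    ι (2 ℕ.+ n) * b (suc n)
      ≤⟨ ≤-by (*-nonNeg (+-nonNeg (0≤ι n) (+-nonNeg (0≤ι n) (0≤ι n))) (0≤b (suc n)))
           (solve 2 (λ i b → (:1 :+ (:1 :+ i)) :* b :+ (i :+ (i :+ i)) :* b :=
             :4 :* (((:1 :+ i) :- :½) :* b)) ≈-refl (ι n) (b (suc n))) ⟩
    four * ((ι (suc n) - ½#) * b (suc n))  ≈⟨ *-congˡ (b-ratio n) ⟩
    four * (ι (2 ℕ.+ n) * b (2 ℕ.+ n))  ≈⟨ solve 3 (λ f i b → f :* (i :* b) := i :* (f :* b)) ≈-refl four (ι (2 ℕ.+ n))
          (b (2 ℕ.+ n)) ⟩
    ι (2 ℕ.+ n) * (four * b (2 ℕ.+ n))  ∎)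

  sh-≤ : ∀ {u C} → 0# ≤ C → u ≼ C · b → sh u ≼ (C * four) · b
  sh-≤ {u} {C} 0≤C h zero    = ≤-reflexive (≈-sym (zeroʳ _))
  sh-≤ {u} {C} 0≤C h (suc n) = ≤-trans (h n) (≤-trans (*-monoˡ-≤ 0≤C (b-step n))
        (≤-reflexive (≈-sym (*-assoc C four (b (suc n))))))

  X≤ : X ≼ (1# + 1#) · b
  X≤ zero          = ≤-reflexive (≈-sym (zeroʳ _))
  X≤ (suc zero)    = ≤-reflexive (≈-sym (≈-trans (*-congˡ {1# + 1#} b₁) (solve 0 ((:1 :+ :1) :* :½ := :1) ≈-refl)))
    where
    b₁ : b 1 ≈ ½#
    b₁ = ≈-trans (≈-sym (≈-trans (*-congʳ (+-identityʳ 1#)) (*-identityˡ (b 1)))) (≈-trans (ιb 0) (*-identityʳ ½#))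
  X≤ (suc (suc n)) = *-nonNeg (+-nonNeg 0≤1 0≤1) (0≤b (suc (suc n)))

  sh-nonNeg : ∀ {u} → O ≼ u → O ≼ sh u
  sh-nonNeg 0≤u zero    = ≤-refl
  sh-nonNeg 0≤u (suc n) = 0≤u n

  sh-cong : ∀ {u v} → u ≋ v → sh u ≋ sh v
  sh-cong h zero    = ≈-refl
  sh-cong h (suc n) = h n

  shX~0 : sh X ~[ b ] 0#
  shX~0 = ~-zero 0≤b (3 , λ { (suc (suc (suc n))) _ → ≈-refl ; (suc (suc zero)) (s≤s (s≤s ())) ; (suc zero) (s≤s ()) })

  ∑X⟶1 : ∑ X ⟶ 1#
  ∑X⟶1 = ~-cong∞ (2 , λ { (suc (suc n)) _ → ≈-sym (∑X n) ; (suc zero) (s≤s ()) }) ≈-refl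
        (~-≈ 0≤𝟙 {𝟙} (λ n → ≈-sym (*-identityʳ 1#)))

  ½⊛ : ∀ v → (⌜ ½ ⌝ · δ₀) ⊛ v ≋ ½# · v
  ½⊛ v n = ≈-trans (·-⊛ ½# δ₀ v n) (*-congˡ (⊛-identityˡ v n))

-- Asymptotics level by level, from the innermost outward.

module Levels (k : ℕ) (1≤k : 1 ℕ.≤ k) where

  open Reals
  open RealSeries
  open Asymptotics
  open TransferTheorem
  open Scaling
  open WallisProduct using (ι-+; ι-*; π; 0≤π; nw²; wallis)
  open Counting
  open ≤-Reasoning
  open Solver using (solve; _:=_; _:+_; _:-_; _:*_; :-_)
  private module S = SeriesSolver

  -- The radicand (1 - z)² - 4 k z² factors as (1 - r z) (1 + (2σ - 1) z). Its positive root is ρ =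
  -- 1/r, and z = ρ x turns the factors into 1 - x and 1 + φ x.
  σ r ρ φ : Real
  σ = √ ι k
  r = 1# + (1# + 1#) * σ

  0≤σ : 0# ≤ σ
  0≤σ = 0≤√ (ι k)

  σ² : σ * σ ≈ ι k
  σ² = √² (0≤ι k)

  1≤σ : 1# ≤ σ
  1≤σ = square-cancel-≤ 0≤σ (≤-trans (≤-reflexive (solve 0 (:1 :* :1 := :1 :+ :0) ≈-refl))
        (≤-trans (ι-mono 1≤k) (≤-reflexive (≈-sym σ²))))

  Pos-r : Pos r
  Pos-r = Pos-+ (Pos-⌜⌝ D.0<1) (*-nonNeg (+-nonNeg 0≤1 0≤1) 0≤σ)

  ρ = inv r Pos-r
  φ = ((1# + 1#) * σ - 1#) * ρ

  Pos-ρ : Pos ρ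
  Pos-ρ = inv-pos r Pos-r

  0≤ρ : 0# ≤ ρ
  0≤ρ = Pos⇒0≤ Pos-ρ

  ρr : ρ * r ≈ 1#
  ρr = inv-inverseˡ r Pos-r

  0≤φ : 0# ≤ φ
  0≤φ = *-nonNeg (≤-trans (0≤y-x 1≤σ) (≤-by 0≤σ (solve 1 (λ s → (s :- :1) :+ s := (:1 :+ :1) :* s :- :1) ≈-refl σ))) 0≤ρ

  φ+2ρ : φ + (ρ + ρ) ≈ 1#
  φ+2ρ = ≈-trans (solve 2 (λ s p → ((:1 :+ :1) :* s :- :1) :* p :+ (p :+ p) := p :* (:1 :+ (:1 :+ :1) :* s)) ≈-refl σ ρ) ρr

  -- φ = (4k - 1) ρ², written without subtraction
  φ-ρ² : φ + ρ * ρ ≈ four * (ι k * (ρ * ρ))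
  φ-ρ² = begin-equality
    φ + ρ * ρ  ≈⟨ +-congʳ (≈-trans (≈-sym (*-identityʳ φ)) (*-congˡ (≈-sym ρr))) ⟩
    φ * (ρ * r) + ρ * ρ
      ≈⟨ solve 2 (λ s p → ((:1 :+ :1) :* s :- :1) :* p :* (p :* (:1 :+ (:1 :+ :1) :* s)) :+ p :* p :=
           :4 :* ((s :* s) :* (p :* p))) ≈-refl σ ρ ⟩
    four * (σ * σ * (ρ * ρ))  ≈⟨ *-congˡ (*-congʳ σ²) ⟩
    four * (ι k * (ρ * ρ))  ∎

  1+φ : 1# + φ ≈ four * (σ * ρ)
  1+φ = ≈-trans (+-congʳ (≈-sym ρr)) (solve 2 (λ s p → p :* (:1 :+ (:1 :+ :1) :* s) :+ ((:1 :+ :1) :* s :- :1) :* p :=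
    :4 :* (s :* p)) ≈-refl σ ρ)

  z : Seq
  z = ρ · X

  -- U d is the generating function P^(d,k) of the terms below d unary nodes, in the variable x = z/ρ.
  U D T q : ℕ → Seq
  U d = scale ρ (λ n → ι (count k d n))
  D d = ι d · δ₀
  T d = z ⊛ U d ⊕ z ⊛ U d
  q d = (four * (ι d * (ρ * ρ))) · sh X ⊕ (ρ + ρ) · sh (T (suc d))

  U-eq : ∀ d → d ℕ.≤ k → U d ≋ z ⊛ (D d ⊕ (U (suc d) ⊕ U d ⊛ U d))
  U-eq d d≤k n = ≈-trans (pointwise-eq n) (≈-sym (sh-⊛ ρ _ n))
    where
    pointwise-eq : U d ≋ ρ · sh (D d ⊕ (U (suc d) ⊕ U d ⊛ U d))
    pointwise-eq zero    = ≈-trans (*-congˡ {1#} (ℛ.reflexive (cong ι (count-zero k d)))) (≈-trans (zeroʳ 1#) (≈-sym (zeroʳ ρ)))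
    pointwise-eq (suc n) = begin-equality
      ρ * p * ι (count k d (suc n))
        ≈⟨ *-congˡ (≈-trans (ℛ.reflexive (cong ι (count-suc k d n))) (≈-trans (ι-+ (leaves k d n) _)
              (+-congˡ (ι-+ (count k (suc d) n) _)))) ⟩
      ρ * p * (ι (leaves k d n) + (ι (count k (suc d) n) + ι ((count k d ℕSeries.⊛ count k d) n)))
        ≈⟨ solve 5 (λ x p a c e → x :* p :* (a :+ (c :+ e)) := x :* (p :* a :+ (p :* c :+ p :* e))) ≈-refl ρ p _ _ _ ⟩
      ρ * (p * ι (leaves k d n) + (U (suc d) n + p * ι ((count k d ℕSeries.⊛ count k d) n)))
        ≈⟨ *-congˡ (+-cong (leaf n) (+-congˡ (≈-trans (*-congˡ (ι-⊛ (count k d) (count k d) n)) (scale-⊛ ρ _ _ n)))) ⟩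
      ρ * (D d n + (U (suc d) n + (U d ⊛ U d) n))  ∎
      where
      p = pow ρ n
      leaf : ∀ n → pow ρ n * ι (leaves k d n) ≈ D d n
      leaf zero    = ≈-trans (*-comm 1# _) (*-congʳ (ℛ.reflexive (cong ι (ℕ.m≤n⇒m⊓n≡m d≤k))))
      leaf (suc n) = ≈-trans (zeroʳ _) (≈-sym (zeroʳ _))

  q≋ : ∀ d → q d ≋ (D d ⊕ D d ⊕ (D d ⊕ D d)) ⊛ (z ⊛ z) ⊕ (z ⊛ T (suc d) ⊕ z ⊛ T (suc d))
  q≋ d n = +-cong (≈-sym (begin-equality
      ((D d ⊕ D d ⊕ (D d ⊕ D d)) ⊛ (z ⊛ z)) n  ≈⟨ ⊛-cong {v = z ⊛ z} (λ m → solve 2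
            (λ i e → i :* e :+ i :* e :+ (i :* e :+ i :* e) :=
           :4 :* i :* e) ≈-refl (ι d) (δ₀ m)) (λ m → ≈-refl) n ⟩
      (((four * ι d) · δ₀) ⊛ (z ⊛ z)) n  ≈⟨ ≈-trans (·-⊛ (four * ι d) δ₀ (z ⊛ z) n) (*-congˡ (⊛-identityˡ (z ⊛ z) n)) ⟩
      four * ι d * (z ⊛ z) n  ≈⟨ *-congˡ (sh-⊛ ρ z n) ⟩
      four * ι d * (ρ * sh z n)  ≈⟨ *-congˡ (*-congˡ (sh-· n)) ⟩
      four * ι d * (ρ * (ρ * sh X n))  ≈⟨ solve 4 (λ f i p x → f :* i :* (p :* (p :* x)) := f :* (i :* (p :* p)) :* x) ≈-refl
            four (ι d) ρ (sh X n) ⟩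
      four * (ι d * (ρ * ρ)) * sh X n  ∎))
    (≈-trans (ℛ.distribʳ _ _ _) (≈-sym (+-cong (sh-⊛ ρ (T (suc d)) n) (sh-⊛ ρ (T (suc d)) n))))
    where
    sh-· : ∀ n → sh z n ≈ ρ * sh X n
    sh-· zero    = ≈-sym (zeroʳ ρ)
    sh-· (suc n) = ≈-refl

  T-eq : ∀ d → d ℕ.≤ k → T d ≋ ½# · (T d ⊛ T d ⊕ q d)
  T-eq d d≤k n = begin-equality
    T d n  ≈⟨ +-cong (⊛-cong {z} ≋-refl (U-eq d d≤k) n) (⊛-cong {z} ≋-refl (U-eq d d≤k) n) ⟩
    (z ⊛ (z ⊛ V) ⊕ z ⊛ (z ⊛ V)) n
      ≈⟨ S.solve 4 (λ z D U′ U → let W = z S.:* (z S.:* (D S.:+ (U′ S.:+ U S.:* U))) ; t = z S.:* U S.:+ z S.:* U ; t′ = z S.:* U′ S.:+ z S.:* U′ in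
           W S.:+ W S.:= S.con ½ S.:* (t S.:* t S.:+ ((D S.:+ D S.:+ (D S.:+ D)) S.:* (z S.:* z) S.:+
                 (z S.:* t′ S.:+ z S.:* t′)))) ≋-refl z (D d) (U (suc d)) (U d) n ⟩
    ((⌜ ½ ⌝ · δ₀) ⊛ (T d ⊛ T d ⊕ ((D d ⊕ D d ⊕ (D d ⊕ D d)) ⊛ (z ⊛ z) ⊕ (z ⊛ T (suc d) ⊕ z ⊛ T (suc d))))) n  ≈⟨ ½⊛ _ n ⟩
    ½# * ((T d ⊛ T d) n + ((D d ⊕ D d ⊕ (D d ⊕ D d)) ⊛ (z ⊛ z) ⊕ (z ⊛ T (suc d) ⊕ z ⊛ T (suc d))) n)  ≈⟨ *-congˡ
          (+-congˡ (q≋ d n)) ⟨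
    ½# * ((T d ⊛ T d) n + q d n)  ∎
    where
    V = D d ⊕ (U (suc d) ⊕ U d ⊛ U d)

  φ≤1 : φ ≤ 1#
  φ≤1 = ≤-by (+-nonNeg 0≤ρ 0≤ρ) φ+2ρ

  pow≥0 : ∀ n → 0# ≤ pow φ n
  pow≥0 zero    = 0≤1
  pow≥0 (suc n) = *-nonNeg 0≤φ (pow≥0 n)

  pow↓ : ∀ {m n} → m ℕ.≤′ n → pow φ n ≤ pow φ m
  pow↓ ℕ.≤′-refl = ≤-refl
  pow↓ (ℕ.≤′-step {n} m≤n) = ≤-trans (*-monoʳ-≤ (pow≥0 n) φ≤1) (≤-trans (≤-reflexive (*-identityˡ _)) (pow↓ m≤n))

  pow≤1 : ∀ n → pow φ n ≤ 1#
  pow≤1 n = pow↓ (ℕ.≤⇒≤′ (z≤n {n}))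

  -- Each of the n terms of (1 - φ) (1 + φ + ⋯ + φ^(n-1)) = 1 - φ^n is at least (1 - φ) φ^n, and 1 -
  -- φ = 2 ρ. The resulting decay 1/n already suffices for `pow→0`.
  pow-bound : ∀ n → ι n * pow φ n * (ρ + ρ) + pow φ n ≤ 1#
  pow-bound zero    = ≤-reflexive (solve 1 (λ p → :0 :* :1 :* (p :+ p) :+ :1 := :1) ≈-refl ρ)
  pow-bound (suc n) = begin
    (1# + ι n) * (φ * pow φ n) * (ρ + ρ) + φ * pow φ n
      ≈⟨ solve 4 (λ i f a p → (:1 :+ i) :* (f :* a) :* (p :+ p) :+ f :* a := f :* (i :* a :* (p :+ p) :+ a) :+ f :* a :*
            (p :+ p)) ≈-refl (ι n) φ (pow φ n) ρ ⟩
    φ * (ι n * pow φ n * (ρ + ρ) + pow φ n) + pow φ (suc n) * (ρ + ρ)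
      ≤⟨ +-mono-≤ (*-monoˡ-≤ 0≤φ (pow-bound n)) (*-monoʳ-≤ (+-nonNeg 0≤ρ 0≤ρ) (pow≤1 (suc n))) ⟩
    φ * 1# + 1# * (ρ + ρ)  ≈⟨ ≈-trans (+-cong (*-identityʳ φ) (*-identityˡ _)) φ+2ρ ⟩
    1#  ∎

  pow→0 : ∀ ε → 0ℚ ℚ.< ε → Eventually λ n → pow φ n ≤ ⌜ ε ⌝
  pow→0 ε 0<ε =
    let P2ρ = Pos-+ Pos-ρ 0≤ρ
        N , p = ι-large (inv (ρ + ρ) P2ρ) ε 0<ε
    in suc N , λ { n@(suc m) N<n → *-cancelˡ-≤ (Pos-ι m) (≤-trans (*-cancelˡ-≤ P2ρ (begin
         (ρ + ρ) * (ι n * pow φ n)  ≤⟨ ≤-by (pow≥0 n) (+-congʳ (*-comm _ _)) ⟩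
         ι n * pow φ n * (ρ + ρ) + pow φ n  ≤⟨ pow-bound n ⟩
         1#  ≈⟨ inv-inverseʳ _ P2ρ ⟨
         (ρ + ρ) * inv (ρ + ρ) P2ρ  ∎)) (p n (ℕ.<⇒≤ N<n))) }

  -- 1 - √(1 + φ x)
  H : Seq
  H = scale (- φ) b

  ∣H∣≤ : ∀ n → ∣ H n ∣ ≤ pow φ n * b n
  ∣H∣≤ n = ≤-reflexive (≈-trans (∣∣-* (pow (- φ) n) (b n)) (*-cong (∣pow∣ n) (0≤x⇒∣x∣≈x (0≤b n))))
    where
    ∣pow∣ : ∀ n → ∣ pow (- φ) n ∣ ≈ pow φ n
    ∣pow∣ zero    = 0≤x⇒∣x∣≈x 0≤1
    ∣pow∣ (suc n) = ≈-trans (∣∣-* (- φ) _) (*-cong (≈-trans (∣∣-neg φ) (0≤x⇒∣x∣≈x 0≤φ)) (∣pow∣ n))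

  ∣H∣≤b : ∀ n → ∣ H n ∣ ≤ b n
  ∣H∣≤b n = ≤-trans (∣H∣≤ n) (≤-trans (*-monoʳ-≤ (0≤b n) (pow≤1 n)) (≤-reflexive (*-identityˡ _)))

  -- The identity for b ⊛ b after the substitution of -φ x for x.
  H⊛H : H ⊛ H ≋ H ⊕ H ⊕ φ · X
  H⊛H n = begin-equality
    (H ⊛ H) n  ≈⟨ scale-⊛ (- φ) b b n ⟨
    pow (- φ) n * (b ⊛ b) n  ≈⟨ *-congˡ (≈-trans (solve 2 (λ f x → f := f :+ x :- x) ≈-refl ((b ⊛ b) n) (X n))
          (+-congʳ (b⊛b n))) ⟩
    pow (- φ) n * (b n + b n - X n)  ≈⟨ solve 3 (λ p b x → p :* (b :+ b :- x) := p :* b :+ p :* b :- p :* x) ≈-refl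
          (pow (- φ) n) (b n) (X n) ⟩
    H n + H n - pow (- φ) n * X n  ≈⟨ +-congˡ (scaleX n) ⟩
    H n + H n + φ * X n  ∎
    where
    scaleX : ∀ n → - (pow (- φ) n * X n) ≈ φ * X n
    scaleX zero          = solve 1 (λ f → :- (:1 :* :0) := f :* :0) ≈-refl φ
    scaleX (suc zero)    = solve 1 (λ f → :- (:- f :* :1 :* :1) := f :* :1) ≈-refl φ
    scaleX (suc (suc n)) = solve 2 (λ p f → :- (p :* :0) := f :* :0) ≈-refl (pow (- φ) (suc (suc n))) φ

  ω : Real
  ω = √ (1# + φ)

  0≤1+φ : 0# ≤ 1# + φ
  0≤1+φ = +-nonNeg 0≤1 0≤φ

  ω² : ω * ω ≈ 1# + φ
  ω² = √² 0≤1+φ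

  Pos-ω : Pos ω
  Pos-ω = Pos-≤ (Pos-⌜⌝ D.0<1) (square-cancel-≤ (0≤√ _) (≤-trans (≤-by 0≤φ (+-congʳ (*-identityˡ 1#))) (≤-reflexive (≈-sym ω²))))

  ∑H≤1 : ∀ n → ∣ ∑ H n ∣ ≤ 1#
  ∑H≤1 n = ≤-trans (∣∑∣≤ ∣H∣≤b n) (∑b≤1 n)

  1b : ∀ n → b n ≤ 1# * b n
  1b n = ≤-reflexive (≈-sym (*-identityˡ (b n)))

  ∣b∣≤ : ∀ n → ∣ b n ∣ ≤ 1# * b n
  ∣b∣≤ n = ≤-trans (≤-reflexive (0≤x⇒∣x∣≈x (0≤b n))) (1b n)

  -- The square of 1 - H is 1 + φ x; at x = 1 its value is 1 + φ, up to a corner that tends to 0.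
  1-∑H⟶ω : (λ n → 1# - ∑ H n) ⟶ ω
  1-∑H⟶ω = square-limit (λ n → 0≤y-x (≤-trans (x≤∣x∣ _) (∑H≤1 n))) Pos-ω (~-cong squares
      (≈-trans (solve 1 (λ f → :1 :+ f :* :1 :+ :0 := :1 :+ f) ≈-refl φ) (≈-sym ω²))
      (~-⊕ 0≤𝟙 (~-⊕ 0≤𝟙 one (~-· 0≤𝟙 φ ∑X⟶1))
        (corner→0 {H} {H} 1# 1# 0≤1 0≤1 (λ n → ≤-trans (∣H∣≤b n) (1b n)) (λ n → ≤-trans (∣H∣≤b (suc n)) (1b (suc n))))))
    where
    squares : ∀ n → 1# + φ * ∑ X n + corner H H n ≈ (1# - ∑ H n) * (1# - ∑ H n)
    squares n = ≈-sym (begin-equality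
      (1# - h) * (1# - h)  ≈⟨ solve 1 (λ h → (:1 :- h) :* (:1 :- h) := :1 :- (h :+ h) :+ h :* h) ≈-refl h ⟩
      1# - (h + h) + h * h  ≈⟨ +-congˡ (∑-⊛ H H n) ⟩
      1# - (h + h) + (∑ (H ⊛ H) n + corner H H n)  ≈⟨ +-congˡ (+-congʳ
            (≈-trans (∑-cong H⊛H n) (≈-trans (∑-⊕ (H ⊕ H) (φ · X) n) (+-cong (∑-⊕ H H n) (∑-· φ X n))))) ⟩
      1# - (h + h) + ((h + h + φ * ∑ X n) + corner H H n)
        ≈⟨ solve 3 (λ h f c → :1 :- (h :+ h) :+ ((h :+ h :+ f) :+ c) := :1 :+ f :+ c) ≈-refl h (φ * ∑ X n) (corner H H n) ⟩
      1# + φ * ∑ X n + corner H H n  ∎)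
      where h = ∑ H n

  ∑H⟶ : ∑ H ⟶ 1# - ω
  ∑H⟶ = ~-cong (λ n → solve 1 (λ h → :1 :- (:1 :- h) := h) ≈-refl (∑ H n)) ≈-refl (~-⊖ 0≤𝟙 one 1-∑H⟶ω)

  H~0 : H ~[ b ] 0#
  H~0 = mk~ λ ε 0<ε → eventually₁ (λ n p → ≤-trans (≤-reflexive (∣∣-cong
        (solve 2 (λ h b → h :- :0 :* b := h) ≈-refl (H n) (b n))))
    (≤-trans (∣H∣≤ n) (*-monoʳ-≤ (0≤b n) p))) (pow→0 ε 0<ε)

  -- The coefficients of H are negligible against b, and the tail of H beyond K is at most φ^K times
  -- that of b. So the product with b behaves like b times the value of H at 1.
  b⊛H~ : b ⊛ H ~[ b ] 1# - ω
  b⊛H~ = ~-approx 0≤b (1ℚ ℚ.+ 1ℚ) (ℚ.+-mono-≤ (ℚ.<⇒≤ D.0<1) (ℚ.<⇒≤ D.0<1)) λ ε 0<ε →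
    let K , p = eventually₂ (λ n → _,_) (pow→0 ε 0<ε) (close ∑H⟶ ε 0<ε)
        small , near = p K ℕ.≤-refl
    in b ⊛ lo K H , ∑ H K , b⊛lo K H ,
       (begin
         ∣ ∑ H K - (1# - ω) ∣  ≈⟨ ∣∣-cong (+-congˡ (-‿cong (*-identityʳ _))) ⟨
         ∣ ∑ H K - (1# - ω) * 1# ∣  ≤⟨ near ⟩
         ⌜ ε ⌝ * 1#  ≈⟨ *-comm _ _ ⟩
         1# * ⌜ ε ⌝  ≤⟨ *-monoʳ-≤ (0≤⇒≤ 0<ε) (⌜⌝-mono (p≤p+ε 1ℚ D.0<1)) ⟩
         ⌜ 1ℚ ℚ.+ 1ℚ ⌝ * ⌜ ε ⌝  ∎) ,
       always (λ n → begin
         ∣ (b ⊛ H) n - (b ⊛ lo K H) n ∣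
           ≈⟨ ∣∣-cong (≈-trans (+-congʳ (≈-trans (⊛-cong {b} ≋-refl (lo⊕hi K H) n) (⊛-distribˡ b (lo K H) (hi K H) n)))
                (solve 2 (λ l h → l :+ h :- l := h) ≈-refl _ _)) ⟩
         ∣ (b ⊛ hi K H) n ∣
           ≤⟨ ∣⊛∣≤ {b} {b} {hi K H} {⌜ ε ⌝ · hi K b} (λ m → ≤-reflexive (0≤x⇒∣x∣≈x (0≤b m)))
                (λ m → ≤-trans (∣hi∣≤ K {H} {⌜ ε ⌝ · b} (λ j K≤j → ≤-trans (∣H∣≤ j)
                      (*-monoʳ-≤ (0≤b j) (≤-trans (pow↓ (ℕ.≤⇒≤′ K≤j)) small))) m)
                  (≤-reflexive (hi-· K ⌜ ε ⌝ b m))) n ⟩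
         (b ⊛ (⌜ ε ⌝ · hi K b)) n  ≈⟨ ⊛-· ⌜ ε ⌝ b (hi K b) n ⟩
         ⌜ ε ⌝ * (b ⊛ hi K b) n  ≤⟨ *-monoˡ-≤ (0≤⇒≤ 0<ε) (≤-trans (⊛-mono 0≤b (hi-nonNeg K 0≤b) (λ m → ≤-refl) (hi-≼ K 0≤b) n)
               (b⊛b≼ n)) ⟩
         ⌜ ε ⌝ * (b n + b n)
           ≈⟨ solve 2 (λ e b → e :* (b :+ b) := (:1 :+ :1) :* (e :* b)) ≈-refl ⌜ ε ⌝ (b n) ⟩
         (1# + 1#) * (⌜ ε ⌝ * b n)  ≈⟨ *-congʳ (⌜⌝-+ 1ℚ 1ℚ) ⟨
         ⌜ 1ℚ ℚ.+ 1ℚ ⌝ * (⌜ ε ⌝ * b n)  ∎)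

  z⊛z : z ⊛ z ≋ (ρ * ρ) · sh X
  z⊛z n = ≈-trans (sh-⊛ ρ z n) (≈-trans (*-congˡ (sh-z n)) (≈-sym (*-assoc _ _ _)))
    where
    sh-z : ∀ n → sh z n ≈ ρ * sh X n
    sh-z zero    = ≈-sym (zeroʳ ρ)
    sh-z (suc n) = ≈-refl

  -- The square root in the closed form of the innermost level, as the product of √(1 - x) and √(1 +
  -- φ x).
  S : Seq
  S = √1-x ⊛ (δ₀ ⊕ ⊖ H)

  -- (1 - X) (1 + φ X) = (1 - z)² - 4 k z²
  S² : ∀ n → (((δ₀ ⊕ ⊖ z) ⊛ (δ₀ ⊕ ⊖ z)) ⊕ ⊖ (S ⊛ S)) n ≈ four * (ι k * (ρ * ρ)) * sh X n
  S² n = begin-equality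
    ((δ₀ ⊕ ⊖ z) ⊛ (δ₀ ⊕ ⊖ z)) n - (S ⊛ S) n
      ≈⟨ +-cong (expand z n) (-‿cong (S.solve 2 (λ y h → (y S.:* h) S.:* (y S.:* h) S.:= (y S.:* y) S.:* (h S.:* h)) ≋-refl
            √1-x (δ₀ ⊕ ⊖ H) n)) ⟩
    (δ₀ n - (z n + z n) + (z ⊛ z) n) - ((√1-x ⊛ √1-x) ⊛ ((δ₀ ⊕ ⊖ H) ⊛ (δ₀ ⊕ ⊖ H))) n
      ≈⟨ +-cong (+-congˡ (z⊛z n)) (-‿cong (≈-trans (⊛-cong √1-x² √1+φx² n) (product n))) ⟩
    (δ₀ n - (ρ * X n + ρ * X n) + ρ * ρ * sh X n) - (δ₀ n + φ * X n - (X n + φ * sh X n))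
      ≈⟨ solve 5 (λ d x y p f → (d :- (p :* x :+ p :* x) :+ p :* p :* y) :- (d :+ f :* x :- (x :+ f :* y)) :=
           (:1 :- (f :+ (p :+ p))) :* x :+ (f :+ p :* p) :* y) ≈-refl (δ₀ n) (X n) (sh X n) ρ φ ⟩
    (1# - (φ + (ρ + ρ))) * X n + (φ + ρ * ρ) * sh X n
      ≈⟨ +-cong (≈-trans (*-congʳ (≈-trans (+-congˡ (-‿cong φ+2ρ)) (ℛ.-‿inverseʳ 1#))) (zeroˡ _)) (*-congʳ φ-ρ²) ⟩
    0# + four * (ι k * (ρ * ρ)) * sh X n  ≈⟨ +-identityˡ _ ⟩
    four * (ι k * (ρ * ρ)) * sh X n  ∎
    where
    unit : ∀ u → (1# · δ₀) ⊕ ⊖ u ≋ δ₀ ⊕ ⊖ u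
    unit u m = +-congʳ (*-identityˡ (δ₀ m))
    expand : ∀ u n → ((δ₀ ⊕ ⊖ u) ⊛ (δ₀ ⊕ ⊖ u)) n ≈ δ₀ n - (u n + u n) + (u ⊛ u) n
    expand u n = ≈-trans (≈-sym (⊛-cong (unit u) (unit u) n)) (≈-trans
      (S.solve 1 (λ u → (S.con 1ℚ S.:- u) S.:* (S.con 1ℚ S.:- u) S.:= S.con 1ℚ S.:- (u S.:+ u) S.:+ u S.:* u) ≋-refl u n)
      (+-congʳ (+-congʳ (*-identityˡ (δ₀ n)))))
    √1+φx² : (δ₀ ⊕ ⊖ H) ⊛ (δ₀ ⊕ ⊖ H) ≋ δ₀ ⊕ φ · X
    √1+φx² m = ≈-trans (expand H m) (≈-trans (+-congˡ (H⊛H m)) (solve 3 (λ d h x → d :- (h :+ h) :+ (h :+ h :+ x) := d :+ x)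
          ≈-refl (δ₀ m) (H m) (φ * X m)))
    product : (δ₀ ⊕ ⊖ X) ⊛ (δ₀ ⊕ φ · X) ≋ (δ₀ ⊕ φ · X) ⊕ ⊖ (X ⊕ φ · sh X)
    product m = ≈-trans (S.solve 3 (λ d x f → (d S.:- x) S.:* f S.:= d S.:* f S.:- x S.:* f) ≋-refl δ₀ X (δ₀ ⊕ φ · X) m)
      (+-cong (⊛-identityˡ _ m) (-‿cong (≈-trans (⊛-distribˡ X δ₀ (φ · X) m)
        (+-cong (⊛-identityʳ X m) (≈-trans (⊛-· φ X X m) (*-congˡ (≈-trans
              (⊛-cong {X} {1# · X} {X} (λ j → ≈-sym (*-identityˡ (X j))) ≋-refl m)
          (≈-trans (sh-⊛ 1# X m) (*-identityˡ _)))))))))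

  -- By `count-stable` the equation of level k contains only T k, and the closed form satisfies the
  -- same equation with the same constant term 0.
  T-closed : T k ≋ δ₀ ⊕ ⊖ z ⊕ ⊖ S
  T-closed = quadratic-unique {ρ} {½# · ((four * (ι k * (ρ * ρ))) · sh X)} T₀ F₀ T-eq′ F-eq
    where
    F : Seq
    F = δ₀ ⊕ ⊖ z ⊕ ⊖ S
    T₀ : T k 0 ≈ 0#
    T₀ = solve 2 (λ p u → (p :* :0) :* u :+ (p :* :0) :* u := :0) ≈-refl ρ (U k 0)
    F₀ : F 0 ≈ 0#
    F₀ = solve 1 (λ p → :1 :- p :* :0 :- (:1 :- :0) :* (:1 :- :1 :* :0) := :0) ≈-refl ρ
    T-stable : T (suc k) ≋ T k
    T-stable n = +-cong (⊛-cong {z} ≋-refl U-stable n) (⊛-cong {z} ≋-refl U-stable n)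
      where
      U-stable : U (suc k) ≋ U k
      U-stable m = *-congˡ (ℛ.reflexive (cong ι (count-stable k m)))
    T-eq′ : T k ≋ ½# · (T k ⊛ T k) ⊕ ½# · ((four * (ι k * (ρ * ρ))) · sh X) ⊕ ρ · sh (T k)
    T-eq′ n = ≈-trans (T-eq k ℕ.≤-refl n) (≈-trans (*-congˡ (+-congˡ (+-congˡ (*-congˡ (sh-cong T-stable n)))))
      (solve 4 (λ f g p t → :½ :* (f :+ (g :+ (p :+ p) :* t)) := :½ :* f :+ :½ :* g :+ p :* t) ≈-refl
        ((T k ⊛ T k) n) (four * (ι k * (ρ * ρ)) * sh X n) ρ (sh (T k) n)))
    F-eq : F ≋ ½# · (F ⊛ F) ⊕ ½# · ((four * (ι k * (ρ * ρ))) · sh X) ⊕ ρ · sh F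
    F-eq n = begin-equality
      F n  ≈⟨ unit n ⟨
      F¹ n
        ≈⟨ S.solve 2 (λ z s → let f = S.con 1ℚ S.:- z S.:- s in f S.:=
             S.con ½ S.:* (f S.:* f) S.:+ S.con ½ S.:* ((S.con 1ℚ S.:- z) S.:* (S.con 1ℚ S.:- z) S.:- s S.:* s) S.:+ z S.:* f)
                   ≋-refl z S n ⟩
      ((⌜ ½ ⌝ · δ₀) ⊛ (F¹ ⊛ F¹)) n + ((⌜ ½ ⌝ · δ₀) ⊛ (((1# · δ₀ ⊕ ⊖ z) ⊛ (1# · δ₀ ⊕ ⊖ z)) ⊕ ⊖ (S ⊛ S))) n + (z ⊛ F¹) n
        ≈⟨ +-cong (+-cong (≈-trans (½⊛ _ n) (*-congˡ (⊛-cong unit unit n)))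
             (≈-trans (½⊛ _ n) (*-congˡ (≈-trans (+-congʳ (⊛-cong unit₁ unit₁ n)) (S² n)))))
             (≈-trans (⊛-cong {z} ≋-refl unit n) (sh-⊛ ρ F n)) ⟩
      ½# * (F ⊛ F) n + ½# * (four * (ι k * (ρ * ρ)) * sh X n) + ρ * sh F n  ∎
      where
      F¹ : Seq
      F¹ = 1# · δ₀ ⊕ ⊖ z ⊕ ⊖ S
      unit₁ : 1# · δ₀ ⊕ ⊖ z ≋ δ₀ ⊕ ⊖ z
      unit₁ m = +-congʳ (*-identityˡ (δ₀ m))
      unit : F¹ ≋ F
      unit m = +-congʳ (unit₁ m)

  T-base : T k ≋ b ⊕ H ⊕ ⊖ (b ⊛ H) ⊕ ⊖ z
  T-base n = ≈-trans (T-closed n) (≈-trans (+-congˡ (-‿cong (begin-equality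
      (√1-x ⊛ (δ₀ ⊕ ⊖ H)) n  ≈⟨ S.solve 3 (λ d b h → (d S.:- b) S.:* (d S.:- h) S.:= d S.:* (d S.:- h) S.:- b S.:* d S.:+ b
            S.:* h) ≋-refl δ₀ b H n ⟩
      (δ₀ ⊛ (δ₀ ⊕ ⊖ H)) n - (b ⊛ δ₀) n + (b ⊛ H) n ≈⟨ +-congʳ (+-cong (⊛-identityˡ _ n) (-‿cong (⊛-identityʳ b n))) ⟩
      (δ₀ n - H n) - b n + (b ⊛ H) n  ∎)))
    (solve 5 (λ d z h b f → d :- z :- (d :- h :- b :+ f) := b :+ h :- f :- z) ≈-refl (δ₀ n) (z n) (H n) (b n) ((b ⊛ H) n)))

  0≤z : O ≼ z
  0≤z n = *-nonNeg 0≤ρ (0≤X n)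

  0≤T : ∀ d → O ≼ T d
  0≤T d n = +-nonNeg (⊛-nonNeg 0≤z 0≤U n) (⊛-nonNeg 0≤z 0≤U n)
    where
    0≤U : O ≼ U d
    0≤U m = *-nonNeg (Pos⇒0≤ (Pos-pow Pos-ρ m)) (0≤ι (count k d m))

  -- the constants c₁, c₂, … of the theorem and the products c₂ ⋯ cᵢ₊₁
  cs : ℕ → Real
  cs zero    = 1#
  cs (suc i) = ι (4 ℕ.* (2 ℕ.+ i) ℕ.∸ 5) + (1# + 1#) * √ cs i

  ∏cs : ℕ → Real
  ∏cs zero    = 1#
  ∏cs (suc i) = ∏cs i * cs (suc i)

  cs-suc : ∀ i → cs (suc i) ≈ four * (1# + ι i) - 1# + (1# + 1#) * √ cs i
  cs-suc i = +-congʳ (≈-trans (ℛ.reflexive (cong ι nat)) (≈-trans (ι-+ 3 (4 ℕ.* i)) (≈-trans (+-congˡ (ι-* 4 i))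
    (solve 1 (λ i → :1 :+ (:1 :+ (:1 :+ :0)) :+ (:1 :+ (:1 :+ (:1 :+ (:1 :+ :0)))) :* i :=
      :4 :* (:1 :+ i) :- :1) ≈-refl (ι i)))))
    where
    nat : 4 ℕ.* (2 ℕ.+ i) ℕ.∸ 5 ≡ 3 ℕ.+ 4 ℕ.* i
    nat = cong (ℕ._∸ 5) (ℕ.+-*-Solver.solve 1 (λ i → ℕ.+-*-Solver.con 4 ℕ.+-*-Solver.:* (ℕ.+-*-Solver.con 2 ℕ.+-*-Solver.:+ i)
      ℕ.+-*-Solver.:= ℕ.+-*-Solver.con 8 ℕ.+-*-Solver.:+ ℕ.+-*-Solver.con 4 ℕ.+-*-Solver.:* i) ≡.refl i)

  Pos-cs : ∀ i → Pos (cs i)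
  Pos-cs zero    = Pos-⌜⌝ D.0<1
  Pos-cs (suc i) = Pos-≤ (Pos-+ (Pos-+ (Pos-⌜⌝ D.0<1) (+-nonNeg (+-nonNeg 0≤1 0≤1) (*-nonNeg (Pos⇒0≤ Pos-four) (0≤ι i))))
      (*-nonNeg (+-nonNeg 0≤1 0≤1) (0≤√ (cs i))))
    (≤-reflexive (≈-trans (+-congʳ (solve 1 (λ i → :1 :+ (:1 :+ :1 :+ :4 :* i) :=
      :4 :* (:1 :+ i) :- :1) ≈-refl (ι i))) (≈-sym (cs-suc i))))

  Pos-∏cs : ∀ i → Pos (∏cs i)
  Pos-∏cs zero    = Pos-⌜⌝ D.0<1
  Pos-∏cs (suc i) = Pos-* (Pos-∏cs i) (Pos-cs (suc i))

  -- The invariant carried outward. The leading coefficient is recorded through its square times the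
  -- product p, so that one more constant enters by plain multiplication.
  record Asymptotic (t : Seq) (s p : Real) : Set where
    field
      C τ   : Real
      0≤C   : 0# ≤ C
      t≤    : t ≼ C · b
      ∑t    : ∑ t ⟶ 1# - s
      Pos-τ : Pos τ
      τ²    : τ * τ * p ≈ 1# + φ
      t~    : t ~[ b ] τ

  base : Asymptotic (T k) (ρ * √ cs 0) (∏cs 0)
  base = record
    -- Here b, H and b ⊛ H contribute at most 1, 1 and 2 times b, and the remaining term -z is not
    -- positive.
    { C = four ; τ = ω ; 0≤C = Pos⇒0≤ Pos-four ; t≤ = bound ; ∑t = total
    ; Pos-τ = Pos-ω ; τ² = ≈-trans (*-identityʳ _) ω² ; t~ = limit }
    where
    bound : T k ≼ four · b
    bound n = begin
      T k n  ≈⟨ T-base n ⟩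
      b n + H n - (b ⊛ H) n - z n
        ≤⟨ +-mono-≤ (+-mono-≤ (+-mono-≤ ≤-refl (≤-trans (x≤∣x∣ _) (∣H∣≤b n)))
             (≤-trans (-x≤∣x∣ _) (≤-trans (∣⊛∣≤ {b} {b} {H} {b} (λ m → ≤-reflexive (0≤x⇒∣x∣≈x (0≤b m))) ∣H∣≤b n) (b⊛b≼ n))))
             (≤-trans (-‿anti-≤ (0≤z n)) (≤-reflexive (solve 0 (:- :0 := :0) ≈-refl))) ⟩
      b n + b n + (b n + b n) + 0#  ≈⟨ solve 1 (λ b → b :+ b :+ (b :+ b) :+ :0 := :4 :* b) ≈-refl (b n) ⟩
      four * b n  ∎
    X~0 : X ~[ b ] 0#
    X~0 = ~-zero 0≤b (2 , λ { (suc (suc n)) _ → ≈-refl ; (suc zero) (s≤s ()) })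
    limit : T k ~[ b ] ω
    limit = ~-cong (λ n → ≈-sym (T-base n)) (solve 2 (λ w p → :1 :+ :0 :- (:1 :- w) :- p :* :0 := w) ≈-refl ω ρ)
      (~-⊖ 0≤b (~-⊖ 0≤b (~-⊕ 0≤b b~1 H~0) b⊛H~) (~-· 0≤b ρ X~0))
    √1 : √ 1# ≈ 1#
    √1 = square-cancel (0≤√ 1#) 0≤1 (≈-trans (√² 0≤1) (≈-sym (*-identityʳ 1#)))
    total : ∑ (T k) ⟶ 1# - ρ * √ 1#
    total = ~-cong (λ n → ≈-sym (sums n))
      (≈-trans (solve 1 (λ p → :1 :+ :0 :+ :0 :- p :* :1 := :1 :- p :* :1) ≈-refl ρ) (+-congˡ (-‿cong (*-congˡ (≈-sym √1)))))
      (~-⊖ 0≤𝟙 (~-⊕ 0≤𝟙 (~-⊕ 0≤𝟙 one (⟶-* {∑ b} {λ n → 1# - ∑ H n} (1ℚ ℚ.+ 1ℚ) (ℚ.+-mono-≤ (ℚ.<⇒≤ D.0<1) (ℚ.<⇒≤ D.0<1)) ∑b⟶1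
            bounded))
        (corner→0 {b} {H} 1# 1# 0≤1 0≤1 ∣b∣≤ (λ n → ≤-trans (∣H∣≤b (suc n)) (1b (suc n))))) (~-· 0≤𝟙 ρ ∑X⟶1))
      where
      bounded : ∀ n → ∣ 1# - ∑ H n ∣ ≤ ⌜ 1ℚ ℚ.+ 1ℚ ⌝
      bounded n = ≤-trans (∣∣-tri ≈-refl (≤-reflexive (0≤x⇒∣x∣≈x 0≤1)) (≤-trans (≤-reflexive (∣∣-neg (∑ H n))) (∑H≤1 n)))
            (≤-reflexive (≈-sym (⌜⌝-+ 1ℚ 1ℚ)))
      -- Arranged around the factor `∑ b n - 1#`, which tends to 0: the singular factor √(1 - x)
      -- vanishes at x = 1, and 1 - ρ remains.
      sums : ∀ n → ∑ (T k) n ≈ 1# + (∑ b n - 1#) * (1# - ∑ H n) + corner b H n - ρ * ∑ X n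
      sums n = begin-equality
        ∑ (T k) n  ≈⟨ ∑-cong T-base n ⟩
        ∑ (b ⊕ H ⊕ ⊖ (b ⊛ H) ⊕ ⊖ z) n
          ≈⟨ ≈-trans (∑-⊕ (b ⊕ H ⊕ ⊖ (b ⊛ H)) (⊖ z) n) (+-cong (≈-trans (∑-⊕ (b ⊕ H) (⊖ (b ⊛ H)) n)
                (+-cong (∑-⊕ b H n) (∑-⊖ (b ⊛ H) n)))
               (≈-trans (∑-⊖ z n) (-‿cong (∑-· ρ X n)))) ⟩
        ∑ b n + ∑ H n - ∑ (b ⊛ H) n - ρ * ∑ X n
          ≈⟨ solve 4 (λ a f c x → a :- f :- x := a :- (f :+ c) :+ c :- x) ≈-refl (∑ b n + ∑ H n) (∑ (b ⊛ H) n) (corner b H n)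
                (ρ * ∑ X n) ⟩
        ∑ b n + ∑ H n - (∑ (b ⊛ H) n + corner b H n) + corner b H n - ρ * ∑ X n
          ≈⟨ +-congʳ (+-congʳ (+-congˡ (-‿cong (∑-⊛ b H n)))) ⟨
        ∑ b n + ∑ H n - ∑ b n * ∑ H n + corner b H n - ρ * ∑ X n
          ≈⟨ solve 4 (λ b h c x → b :+ h :- b :* h :+ c :- x := :1 :+ (b :- :1) :* (:1 :- h) :+ c :- x) ≈-refl (∑ b n) (∑ H n)
                (corner b H n) (ρ * ∑ X n) ⟩
        1# + (∑ b n - 1#) * (1# - ∑ H n) + corner b H n - ρ * ∑ X n  ∎

  -- The hypotheses of `Transfer` for q d come from the next deeper level, since shifts preserve
  -- domination, sums and leading coefficients, while the term with z² is negligible.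
  step : ∀ i d → d ℕ.+ suc i ≡ k → Asymptotic (T (suc d)) (ρ * √ cs i) (∏cs i) → Asymptotic (T d) (ρ * √ cs (suc i)) (∏cs (suc i))
  step i d d+i≡k level = record
    { C = C′ ; τ = τ′ ; 0≤C = 0≤C′ ; t≤ = Tr.t≤ ; ∑t = Tr.∑t
    ; Pos-τ = Pos-* Pos-½ (Pos-* (Pos-* (Pos-+ Pos-ρ 0≤ρ) A.Pos-τ) (inv-pos s Pos-s)) ; τ² = τ′² ; t~ = Tr.t~ }
    where
    module A = Asymptotic level
    d≤k : d ℕ.≤ k
    d≤k = ℕ.≤-trans (ℕ.m≤m+n d (suc i)) (ℕ.≤-reflexive d+i≡k)
    s κ K x : Real
    s = ρ * √ cs (suc i)
    κ = (ρ + ρ) * A.τ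
    x = four * (ι d * (ρ * ρ))
    K = x * ((1# + 1#) * four) + (ρ + ρ) * (A.C * four)
    Pos-s : Pos s
    Pos-s = Pos-* Pos-ρ (Pos-√ (Pos-cs (suc i)))
    0≤x : 0# ≤ x
    0≤x = *-nonNeg (Pos⇒0≤ Pos-four) (*-nonNeg (0≤ι d) (*-nonNeg 0≤ρ 0≤ρ))
    0≤2ρ : 0# ≤ ρ + ρ
    0≤2ρ = +-nonNeg 0≤ρ 0≤ρ
    0≤K : 0# ≤ K
    0≤K = +-nonNeg (*-nonNeg 0≤x (*-nonNeg (+-nonNeg 0≤1 0≤1) (Pos⇒0≤ Pos-four)))
          (*-nonNeg 0≤2ρ (*-nonNeg A.0≤C (Pos⇒0≤ Pos-four)))
    0≤q : O ≼ q d
    0≤q n = +-nonNeg (*-nonNeg 0≤x (sh-nonNeg 0≤X n)) (*-nonNeg 0≤2ρ (sh-nonNeg (0≤T (suc d)) n))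
    q₀ : q d 0 ≈ 0#
    q₀ = ≈-trans (+-cong (zeroʳ x) (zeroʳ (ρ + ρ))) (+-identityʳ 0#)
    q≤ : q d ≼ K · b
    q≤ n = ≤-trans (+-mono-≤ (*-monoˡ-≤ 0≤x (sh-≤ (+-nonNeg 0≤1 0≤1) X≤ n)) (*-monoˡ-≤ 0≤2ρ (sh-≤ A.0≤C A.t≤ n)))
      (≤-reflexive (solve 5 (λ x y p q b → x :* (y :* b) :+ p :* (q :* b) := (x :* y :+ p :* q) :* b) ≈-refl x
            ((1# + 1#) * four) (ρ + ρ) (A.C * four) (b n)))
    q~ : q d ~[ b ] κ
    q~ = ~-cong (λ n → ≈-refl) (≈-trans (+-congʳ (zeroʳ x)) (+-identityˡ κ))
      (~-⊕ 0≤b (~-· 0≤b x shX~0) (~-· 0≤b (ρ + ρ) (~-sh 0≤b b-regular A.t~)))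
    -- Here the recursion for the constants originates. Substituting 1 = φ + 2ρ = 4 k ρ² - ρ² + 2ρ
    -- with k = d + 1 + i into 1 - q(1) cancels d and leaves ρ² (4 (i + 1) - 1 + 2 √ cs i).
    s² : x * 1# + (ρ + ρ) * (1# - ρ * √ cs i) ≈ 1# - s * s
    s² = ≈-sym (begin-equality
      1# - ρ * √ cs (suc i) * (ρ * √ cs (suc i))
        ≈⟨ +-congˡ (-‿cong (≈-trans (solve 2 (λ p c → p :* c :* (p :* c) := p :* p :* (c :* c)) ≈-refl ρ (√ cs (suc i)))
             (*-congˡ (≈-trans (√² (Pos⇒0≤ (Pos-cs (suc i)))) (cs-suc i))))) ⟩
      1# - ρ * ρ * (four * (1# + ι i) - 1# + (1# + 1#) * √ cs i)
        ≈⟨ +-congʳ φ-eq ⟨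
      four * ((ι d + (1# + ι i)) * (ρ * ρ)) - ρ * ρ + (ρ + ρ) - ρ * ρ * (four * (1# + ι i) - 1# + (1# + 1#) * √ cs i)
        ≈⟨ solve 4 (λ d i p c → let f = :4 in
             f :* ((d :+ (:1 :+ i)) :* (p :* p)) :- p :* p :+ (p :+ p) :- p :* p :* (f :* (:1 :+ i) :- :1 :+ (:1 :+ :1) :* c) :=
             f :* (d :* (p :* p)) :* :1 :+ (p :+ p) :* (:1 :- p :* c)) ≈-refl (ι d) (ι i) ρ (√ cs i) ⟩
      x * 1# + (ρ + ρ) * (1# - ρ * √ cs i)  ∎)
      where
      φ-eq : four * ((ι d + (1# + ι i)) * (ρ * ρ)) - ρ * ρ + (ρ + ρ) ≈ 1#
      φ-eq = ≈-trans (+-congʳ (≈-trans (+-congʳ (≈-trans (*-congˡ (*-congʳ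
            (≈-trans (≈-sym (ι-+ d (suc i))) (ℛ.reflexive (cong ι d+i≡k))))) (≈-sym φ-ρ²)))
        (solve 2 (λ f a → f :+ a :- a := f) ≈-refl φ (ρ * ρ)))) φ+2ρ
    ∑q : ∑ (q d) ⟶ 1# - s * s
    ∑q = ~-cong (λ n → ≈-sym (≈-trans (∑-⊕ (x · sh X) ((ρ + ρ) · sh (T (suc d))) n)
          (+-cong (∑-· x (sh X) n) (∑-· (ρ + ρ) (sh (T (suc d))) n)))) s²
      (~-⊕ 0≤𝟙 (~-· 0≤𝟙 x (∑-sh⟶ ∑X⟶1)) (~-· 0≤𝟙 (ρ + ρ) (∑-sh⟶ A.∑t)))
    T₀ : T d 0 ≈ 0#
    T₀ = solve 2 (λ p u → (p :* :0) :* u :+ (p :* :0) :* u := :0) ≈-refl ρ (U d 0)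
    module Tr = TransferTheorem.Transfer (q d) (T d) κ s K 0≤K 0≤q q₀ q≤ q~ Pos-s ∑q (0≤T d) T₀ (T-eq d d≤k)
    open Tr using (C′; 0≤C′)
    -- Since κ = 2 ρ τ and s = ρ √ cs (suc i), this is τ / √ cs (suc i).
    τ′ : Real
    τ′ = ½# * (κ * inv s Pos-s)
    τ′² : τ′ * τ′ * (∏cs i * cs (suc i)) ≈ 1# + φ
    τ′² = begin-equality
      τ′ * τ′ * (∏cs i * cs (suc i))  ≈⟨ *-congˡ (*-congˡ (√² (Pos⇒0≤ (Pos-cs (suc i))))) ⟨
      τ′ * τ′ * (∏cs i * (√ cs (suc i) * √ cs (suc i)))
        ≈⟨ solve 5 (λ p t v y c → :½ :* ((p :+ p) :* t :* v) :* (:½ :* ((p :+ p) :* t :* v)) :* (y :* (c :* c)) :=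
             (t :* t :* y) :* ((v :* (p :* c)) :* (v :* (p :* c)))) ≈-refl ρ A.τ (inv s Pos-s) (∏cs i) (√ cs (suc i)) ⟩
      A.τ * A.τ * ∏cs i * ((inv s Pos-s * s) * (inv s Pos-s * s))
        ≈⟨ *-congˡ (≈-trans (*-cong (inv-inverseˡ s Pos-s) (inv-inverseˡ s Pos-s)) (*-identityˡ 1#)) ⟩
      A.τ * A.τ * ∏cs i * 1#  ≈⟨ ≈-trans (*-identityʳ _) A.τ² ⟩
      1# + φ  ∎

  levels : ∀ i d → d ℕ.+ i ≡ k → Asymptotic (T d) (ρ * √ cs i) (∏cs i)
  levels zero    d eq = subst (λ d → Asymptotic (T d) (ρ * √ cs 0) (∏cs 0)) (≡.trans (≡.sym eq) (ℕ.+-identityʳ d)) base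
  levels (suc i) d eq = step i d eq (levels i (suc d) (≡.trans (≡.sym (ℕ.+-suc d i)) eq))

  n√n : ℕ → Real
  n√n n = ι n * √ ι n

  -- The ratio of 2 b (n + 1) = w n / (n + 1) to n^(-3/2) / √π.
  e : Seq
  e n = w n * ν n * n√n n * √ π

  0≤ν : ∀ n → 0# ≤ ν n
  0≤ν n = Pos⇒0≤ (Pos-ν n)

  ν≤1 : ∀ n → ν n ≤ 1#
  ν≤1 n = ≤-trans (≤-by (*-nonNeg (0≤ν n) (0≤ι n)) (solve 2 (λ v i → v :+ v :* i := v :* (:1 :+ i)) ≈-refl (ν n) (ι n)))
        (≤-reflexive (ν-inverse n))

  ν⟶0 : ν ⟶ 0#
  ν⟶0 = mk~ λ ε 0<ε → eventually₁ (λ n p → *-cancelˡ-≤ (Pos-ι n) (begin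
      ι (suc n) * ∣ ν n - 0# * 1# ∣  ≈⟨ *-congˡ (≈-trans (∣∣-cong (solve 1 (λ v → v :- :0 :* :1 := v) ≈-refl (ν n)))
            (0≤x⇒∣x∣≈x (0≤ν n))) ⟩
      ι (suc n) * ν n  ≈⟨ ≈-trans (*-comm _ _) (ν-inverse n) ⟩
      1#  ≤⟨ p ⟩
      ι n * ⌜ ε ⌝  ≤⟨ *-monoʳ-≤ (0≤⇒≤ 0<ε) (ι-mono (ℕ.n≤1+n n)) ⟩
      ι (suc n) * ⌜ ε ⌝  ≈⟨ *-congˡ (*-identityʳ _) ⟨
      ι (suc n) * (⌜ ε ⌝ * 1#)  ∎)) (ι-large 1# ε 0<ε)

  nν : Seq
  nν n = ι n * ν n

  nν≈ : ∀ n → nν n ≈ 1# - ν n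
  nν≈ n = ≈-trans (solve 2 (λ i v → i :* v := v :* (:1 :+ i) :- v) ≈-refl (ι n) (ν n)) (+-congʳ (ν-inverse n))

  nν² : (λ n → nν n * nν n) ⟶ 1#
  nν² = ~-cong (λ n → ≈-trans (solve 1 (λ v → (v :- :0) :* (v :- :1 :- :1) :+ :1 := (:1 :- v) :* (:1 :- v)) ≈-refl (ν n))
      (*-cong (≈-sym (nν≈ n)) (≈-sym (nν≈ n)))) (+-identityˡ 1#)
    (~-⊕ 0≤𝟙 (⟶-* {ν} {λ n → ν n - 1# - 1#} (1ℚ ℚ.+ 1ℚ) (ℚ.+-mono-≤ (ℚ.<⇒≤ D.0<1) (ℚ.<⇒≤ D.0<1)) ν⟶0 bounded) one)
    where
    two : ⌜ 1ℚ ℚ.+ 1ℚ ⌝ ≈ 1# + 1#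
    two = ⌜⌝-+ 1ℚ 1ℚ
    bounded : ∀ n → ∣ ν n - 1# - 1# ∣ ≤ ⌜ 1ℚ ℚ.+ 1ℚ ⌝
    bounded n = ≤-trans (∣∣-lub
        (≤-by (+-nonNeg (0≤y-x (ν≤1 n)) (+-nonNeg 0≤1 (+-nonNeg 0≤1 0≤1)))
              (solve 1 (λ v → v :- :1 :- :1 :+ ((:1 :- v) :+ (:1 :+ (:1 :+ :1))) := :1 :+ :1) ≈-refl (ν n)))
        (≤-by (0≤ν n) (solve 1 (λ v → :- (v :- :1 :- :1) :+ v := :1 :+ :1) ≈-refl (ν n))))
      (≤-reflexive (≈-sym two))

  -- The square of e n is π nw² n times (n/(n + 1))², so Wallis' product applies and `square-limit`
  -- removes the square.
  e⟶1 : e ⟶ 1#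
  e⟶1 = square-limit (λ n → *-nonNeg (*-nonNeg (*-nonNeg (0≤w n) (0≤ν n)) (*-nonNeg (0≤ι n) (0≤√ (ι n)))) (0≤√ π)) (Pos-⌜⌝ D.0<1)
    (~-cong squares (≈-trans (+-identityˡ 1#) (≈-sym (*-identityˡ 1#)))
      (~-⊕ 0≤𝟙 (⟶-* {λ n → π * nw² n} {λ n → nν n * nν n} 1ℚ (ℚ.<⇒≤ D.0<1) wallis bounded) nν²))
    where
    nν≤1 : ∀ n → nν n ≤ 1#
    nν≤1 n = ≤-trans (≤-reflexive (nν≈ n)) (≤-by (0≤ν n) (solve 1 (λ v → :1 :- v :+ v := :1) ≈-refl (ν n)))
    0≤nν : ∀ n → 0# ≤ nν n
    0≤nν n = *-nonNeg (0≤ι n) (0≤ν n)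
    bounded : ∀ n → ∣ nν n * nν n ∣ ≤ 1#
    bounded n = ≤-trans (∣∣-*-≤ {a = 1#} {1#} (∣nν∣ n) (∣nν∣ n)) (≤-reflexive (*-identityˡ 1#))
      where
      ∣nν∣ : ∀ n → ∣ nν n ∣ ≤ 1#
      ∣nν∣ n = ≤-trans (≤-reflexive (0≤x⇒∣x∣≈x (0≤nν n))) (nν≤1 n)
    squares : ∀ n → (π * nw² n - 1#) * (nν n * nν n) + nν n * nν n ≈ e n * e n
    squares n = ≈-sym (begin-equality
      e n * e n
        ≈⟨ solve 5 (λ w v i s p → (w :* v :* (i :* s) :* p) :* (w :* v :* (i :* s) :* p) := (w :* v :* i) :* (w :* v :* i) :*
              (s :* s) :* (p :* p)) ≈-refl (w n) (ν n) (ι n) (√ ι n) (√ π) ⟩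
      (w n * ν n * ι n) * (w n * ν n * ι n) * (√ ι n * √ ι n) * (√ π * √ π)  ≈⟨ *-cong (*-congˡ (√² (0≤ι n))) (√² 0≤π) ⟩
      (w n * ν n * ι n) * (w n * ν n * ι n) * ι n * π
        ≈⟨ solve 4 (λ w v i p → (w :* v :* i) :* (w :* v :* i) :* i :* p := (p :* (i :* (w :* w)) :- :1) :*
              ((i :* v) :* (i :* v)) :+ (i :* v) :* (i :* v)) ≈-refl (w n) (ν n) (ι n) π ⟩
      (π * nw² n - 1#) * (nν n * nν n) + nν n * nν n  ∎)

  open Asymptotic (levels k 0 ≡.refl)

  terms : Seq
  terms n = ι (count k 0 n)

  -- The constant and the power n^(-3/2) enter only through the equations they satisfy, which keeps
  -- the roots and inverses of the theorem out of the estimate.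
  module _ (κ : Real) (y : Seq) (Pos-κ : Pos κ) (κ² : κ * κ * (four * π * ∏cs k) ≈ (1# + 1#) * ι k + σ)
    (y-eq : ∀ n → y (suc n) * n√n (suc n) ≈ 1#) where

    -- `G` is the claimed equivalent. `E` is the weight that turns T 0 ~ τ b into an estimate of the
    -- counts; the index n + 1 and the factor ½ undo T = 2 z P.
    G E : Seq
    G n = κ * y n * pow r n
    E n = ½# * (pow r n * r) * b (suc n)

    Pos-n√n : ∀ n → Pos (n√n (suc n))
    Pos-n√n n = Pos-* (Pos-ι n) (Pos-√ (Pos-ι n))

    Pos-y : ∀ n → Pos (y (suc n))
    Pos-y n = Pos-≤ (inv-pos _ px) (≤-reflexive (begin-equality
      inv (n√n (suc n)) px  ≈⟨ *-identityˡ _ ⟨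
      1# * inv (n√n (suc n)) px  ≈⟨ *-congʳ (y-eq n) ⟨
      y (suc n) * n√n (suc n) * inv (n√n (suc n)) px  ≈⟨ ≈-trans (*-assoc _ _ _)
            (≈-trans (*-congˡ (inv-inverseʳ _ px)) (*-identityʳ _)) ⟩
      y (suc n)  ∎))
      where px = Pos-n√n n

    Pos-G : ∀ n → Pos (G (suc n))
    Pos-G n = Pos-* (Pos-* Pos-κ (Pos-y n)) (Pos-pow Pos-r (suc n))

    -- Both sides are nonnegative, and their squares times 4 ∏ c both equal r σ = 2k + √k, by τ² ∏ c
    -- = 1 + φ = 4 σ ρ.
    κ√π : κ * √ π ≈ ½# * (½# * (r * τ))
    κ√π = square-cancel (*-nonNeg (Pos⇒0≤ Pos-κ) (0≤√ π)) (*-nonNeg (Pos⇒0≤ Pos-½)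
          (*-nonNeg (Pos⇒0≤ Pos-½) (*-nonNeg (Pos⇒0≤ Pos-r) (Pos⇒0≤ Pos-τ))))
        (*-cancelˡ-≤ Pos-4∏ (proj₁ eq) , *-cancelˡ-≤ Pos-4∏ (proj₂ eq))
      where
      Pos-4∏ : Pos (four * ∏cs k)
      Pos-4∏ = Pos-* Pos-four (Pos-∏cs k)
      eq : four * ∏cs k * (κ * √ π * (κ * √ π)) ≈ four * ∏cs k * (½# * (½# * (r * τ)) * (½# * (½# * (r * τ))))
      eq = begin-equality
        four * ∏cs k * (κ * √ π * (κ * √ π))
          ≈⟨ solve 4 (λ f c x p → f :* c :* (x :* p :* (x :* p)) := x :* x :* (f :* (p :* p) :* c)) ≈-refl four (∏cs k) κ (√ π) ⟩
        κ * κ * (four * (√ π * √ π) * ∏cs k)  ≈⟨ *-congˡ (*-congʳ (*-congˡ (√² 0≤π))) ⟩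
        κ * κ * (four * π * ∏cs k)  ≈⟨ κ² ⟩
        (1# + 1#) * ι k + σ  ≈⟨ +-congʳ (*-congˡ (≈-sym σ²)) ⟩
        (1# + 1#) * (σ * σ) + σ  ≈⟨ solve 1 (λ s → (:1 :+ :1) :* (s :* s) :+ s := (:1 :+ (:1 :+ :1) :* s) :* s :* :1) ≈-refl σ ⟩
        r * σ * 1#  ≈⟨ *-congˡ ρr ⟨
        r * σ * (ρ * r)
          ≈⟨ solve 3 (λ r s p → r :* s :* (p :* r) := :½ :* :½ :* (r :* r) :* (:4 :* (s :* p))) ≈-refl r σ ρ ⟩
        ½# * ½# * (r * r) * (four * (σ * ρ))  ≈⟨ *-congˡ (≈-trans τ² 1+φ) ⟨
        ½# * ½# * (r * r) * (τ * τ * ∏cs k)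
          ≈⟨ solve 3 (λ r t c → :½ :* :½ :* (r :* r) :* (t :* t :* c) :=
               :4 :* c :* (:½ :* (:½ :* (r :* t)) :* (:½ :* (:½ :* (r :* t))))) ≈-refl r τ (∏cs k) ⟩
        four * ∏cs k * (½# * (½# * (r * τ)) * (½# * (½# * (r * τ))))  ∎

    τE : ∀ n → τ * E (suc n) ≈ G (suc n) * e (suc n)
    τE m = begin-equality
      τ * (½# * (pow r n * r) * (½# * (w n * ν n)))
        ≈⟨ solve 5 (λ t p r w v → t :* (:½ :* (p :* r) :* (:½ :* (w :* v))) := :½ :* (:½ :* (r :* t)) :*
              (p :* (w :* v) :* :1)) ≈-refl τ (pow r n) r (w n) (ν n) ⟩
      ½# * (½# * (r * τ)) * (pow r n * (w n * ν n) * 1#)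
        ≈⟨ *-cong (≈-sym κ√π) (*-congˡ (≈-sym (y-eq m))) ⟩
      κ * √ π * (pow r n * (w n * ν n) * (y n * n√n n))
        ≈⟨ solve 7 (λ k s p w v y a → k :* s :* (p :* (w :* v) :* (y :* a)) := k :* y :* p :* (w :* v :* a :* s)) ≈-refl κ
              (√ π) (pow r n) (w n) (ν n) (y n) (n√n n) ⟩
      G n * e n  ∎
      where n = suc m

    terms≈ : ∀ n → terms n ≈ ½# * (pow r n * r) * T 0 (suc n)
    terms≈ n = ≈-sym (begin-equality
      ½# * (pow r n * r) * T 0 (suc n)
        ≈⟨ *-congˡ (+-cong (sh-⊛ ρ (U 0) (suc n)) (sh-⊛ ρ (U 0) (suc n))) ⟩
      ½# * (pow r n * r) * (ρ * (pow ρ n * terms n) + ρ * (pow ρ n * terms n))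
        ≈⟨ solve 5 (λ a r p c t → :½ :* (a :* r) :* (p :* (c :* t) :+ p :* (c :* t)) := (p :* r) :* ((c :* a) :* t)) ≈-refl
              (pow r n) r ρ (pow ρ n) (terms n) ⟩
      (ρ * r) * ((pow ρ n * pow r n) * terms n)  ≈⟨ *-cong ρr (*-congʳ (pow-inverse ρr n)) ⟩
      1# * (1# * terms n)  ≈⟨ ≈-trans (*-identityˡ _) (*-identityˡ _) ⟩
      terms n  ∎)

    estimate : ∀ ε → 0ℚ ℚ.< ε → ∃ λ N → ∀ n → N ℕ.≤ suc n → Pos (G (suc n)) × ∣ terms (suc n) - G (suc n) ∣ ≤ ⌜ ε ⌝ * G (suc n)
    estimate ε 0<ε =
      let t₀ , 0<t₀ , t₀≤τ = Pos-τ
          -- The error of T costs 2 δ and that of `e` costs δ, together at most 4 δ = ε.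
          δ = D.half (D.half ε)
          0<δ = D.0<half (D.0<half 0<ε)
          -- The rational t₀ is a lower bound of τ, so an error of t₀ δ in T is at most δ relative
          -- to τ b.
          N₁ , p = close t~ (t₀ ℚ.* δ) (D.pos-* 0<t₀ 0<δ)
          N₂ , q = eventually₂ (λ n → _,_) (close e⟶1 δ 0<δ) (~-upper 0≤𝟙 e⟶1 1ℚ D.0<1)
      in N₁ ℕ.⊔ N₂ , λ m ≤n →
        let n = suc m
            e≈1 , e≤2 = q n (ℕ.m⊔n≤o⇒n≤o N₁ N₂ ≤n)
            a = ½# * (pow r n * r)
            0≤a = *-nonNeg (Pos⇒0≤ Pos-½) (Pos⇒0≤ (Pos-* (Pos-pow Pos-r n) Pos-r))
            0≤E = *-nonNeg 0≤a (0≤b (suc n))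
            0≤G = Pos⇒0≤ (Pos-G m)
        in Pos-G m , (begin
          ∣ terms n - G n ∣
            ≤⟨ ∣∣-tri {y = a * (T 0 (suc n) - τ * b (suc n))} {z = G n * (e n - 1# * 1#)}
                 (≈-trans (+-congʳ (terms≈ n)) (≈-trans (solve 5 (λ a t s b g → a :* t :- g := a :* (t :- s :* b) :+
                       (s :* (a :* b) :- g)) ≈-refl a (T 0 (suc n)) τ (b (suc n)) (G n))
                   (+-congˡ (≈-trans (+-congʳ (τE m)) (solve 2 (λ g e → g :* e :- g := g :* (e :- :1 :* :1)) ≈-refl (G n)
                         (e n))))))
                 (∣∣-*-≤ (≤-reflexive (0≤x⇒∣x∣≈x 0≤a)) (p (suc n) (ℕ.≤-trans (ℕ.m⊔n≤o⇒m≤o N₁ N₂ ≤n) (ℕ.n≤1+n n))))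
                 (∣∣-*-≤ (≤-reflexive (0≤x⇒∣x∣≈x 0≤G)) e≈1) ⟩
          a * (⌜ t₀ ℚ.* δ ⌝ * b (suc n)) + G n * (⌜ δ ⌝ * 1#)
            ≈⟨ +-cong (≈-trans (*-congˡ (*-congʳ (⌜⌝-* t₀ δ))) (solve 4
                  (λ a t d b → a :* (t :* d :* b) := d :* (t :* (a :* b))) ≈-refl a ⌜ t₀ ⌝ ⌜ δ ⌝ (b (suc n))))
                  (*-congˡ (*-identityʳ _)) ⟩
          ⌜ δ ⌝ * (⌜ t₀ ⌝ * E n) + G n * ⌜ δ ⌝
            ≤⟨ +-mono-≤ (*-monoˡ-≤ (0≤⇒≤ 0<δ) (*-monoʳ-≤ 0≤E t₀≤τ)) ≤-refl ⟩
          ⌜ δ ⌝ * (τ * E n) + G n * ⌜ δ ⌝  ≈⟨ +-congʳ (*-congˡ (τE m)) ⟩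
          ⌜ δ ⌝ * (G n * e n) + G n * ⌜ δ ⌝
            ≤⟨ +-mono-≤ (*-monoˡ-≤ (0≤⇒≤ 0<δ) (*-monoˡ-≤ 0≤G (≤-trans e≤2 (≤-reflexive (*-identityʳ _))))) ≤-refl ⟩
          ⌜ δ ⌝ * (G n * (1# + 1#)) + G n * ⌜ δ ⌝
            ≤⟨ ≤-by (*-nonNeg (0≤⇒≤ 0<δ) 0≤G) (solve 2 (λ d g → d :* (g :* (:1 :+ :1)) :+ g :* d :+ d :* g :=
                  (d :+ d :+ (d :+ d)) :* g) ≈-refl ⌜ δ ⌝ (G n)) ⟩
          (⌜ δ ⌝ + ⌜ δ ⌝ + (⌜ δ ⌝ + ⌜ δ ⌝)) * G n  ≈⟨ *-congʳ 4δ ⟩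
          ⌜ ε ⌝ * G n  ∎)
      where
      halves′ : ∀ q → ⌜ D.half q ⌝ + ⌜ D.half q ⌝ ≈ ⌜ q ⌝
      halves′ q = ≈-trans (≈-sym (⌜⌝-+ _ _)) (ℛ.reflexive (cong ⌜_⌝ (D.half+half q)))
      4δ : ⌜ D.half (D.half ε) ⌝ + ⌜ D.half (D.half ε) ⌝ + (⌜ D.half (D.half ε) ⌝ + ⌜ D.half (D.half ε) ⌝) ≈ ⌜ ε ⌝
      4δ = ≈-trans (+-cong (halves′ (D.half ε)) (halves′ (D.half ε))) (halves′ ε)

-- Translation into the reals and constants of the theorem.

module Translation where

  open Reals
  open RealSeries
  open Asymptotics
  open Scaling using (pow)
  open WallisProduct using (π)
  open Counting
  open ≤-Reasoning
  open Solver using (solve; _:=_; _:+_; _:-_; _:*_; :-_)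

  real-ι : ∀ n → real (D.fromℕ n) ≈ ι n
  real-ι n = ≈-trans (real-fromℕ n) (≈-sym (ι≈ n))

  real-1 : real (D.fromℕ 1) ≈ 1#
  real-1 = ≈-trans (real-ι 1) (+-identityʳ 1#)

  real-2 : real (D.fromℕ 2) ≈ 1# + 1#
  real-2 = ≈-trans (real-ι 2) (+-congˡ (+-identityʳ 1#))

  real-4 : real (D.fromℕ 4) ≈ four
  real-4 = ≈-trans (real-ι 4) (solve 0 (:1 :+ (:1 :+ (:1 :+ (:1 :+ :0))) := :4) ≈-refl)

  real-√ι : ∀ n → real (D.√ D.fromℕ n) ≈ √ ι n
  real-√ι n = ≈-trans (real-√ (D.fromℕ n)) (≈-sym (√-cong (0≤ι n) (≈-sym (real-ι n))))

  real-^ : ∀ x {y} → real x ≈ y → ∀ n → real (x D.^ n) ≈ pow y n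
  real-^ x eq zero    = real-1
  real-^ x eq (suc n) = ≈-trans (real-* x (x D.^ n)) (*-cong eq (real-^ x eq n))

  real-÷ : ∀ x y (p : y D.#0) → real (x D.÷ y [ p ]) * real y ≈ real x
  real-÷ x y p = ≈-trans (*-congʳ (real-* x (y D.⁻¹[ p ]))) (≈-trans (*-assoc _ _ _)
        (≈-trans (*-congˡ (real-⁻¹ y p)) (*-identityʳ _)))

  module _ (k : ℕ) (1≤k : 1 ℕ.≤ k) where

    open Levels k 1≤k using (σ; r; cs; ∏cs; Pos-cs; Pos-∏cs; estimate; n√n)

    real-c : ∀ i → real (D.c (suc i)) ≈ cs i
    real-c zero    = real-1
    real-c (suc i) = ≈-trans (real-+ (D.fromℕ (4 ℕ.* suc (suc i) ℕ.∸ 5)) (D.fromℕ 2 D.* D.√ D.c (suc i)))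
      (+-cong (real-ι (4 ℕ.* suc (suc i) ℕ.∸ 5)) (≈-trans (real-* (D.fromℕ 2) (D.√ D.c (suc i)))
        (*-cong real-2 (≈-trans (real-√ (D.c (suc i))) (≈-sym (√-cong (Pos⇒0≤ (Pos-cs i)) (≈-sym (real-c i))))))))

    real-∏c : ∀ i → real (D.∏c i) ≈ ∏cs i
    real-∏c zero    = real-1
    real-∏c (suc i) = ≈-trans (real-* (D.∏c i) (D.c (suc (suc i)))) (*-cong (real-∏c i) (real-c (suc i)))

    -- Multiplying by the denominator removes the inverse, and with it the dependence on the proof
    -- of apartness.
    radicand : ∀ p → real ((D.fromℕ 2 D.* D.fromℕ k D.+ D.√ D.fromℕ k) D.÷ D.fromℕ 4 D.* D.π D.* D.∏c k [ p ]) *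
          (four * π * ∏cs k)
               ≈ (1# + 1#) * ι k + σ
    radicand p = ≈-trans (*-congˡ (≈-sym (≈-trans (real-* (D.fromℕ 4 D.* D.π) (D.∏c k))
          (*-cong (≈-trans (real-* (D.fromℕ 4) D.π) (*-congʳ real-4)) (real-∏c k)))))
      (≈-trans (real-÷ (D.fromℕ 2 D.* D.fromℕ k D.+ D.√ D.fromℕ k) (D.fromℕ 4 D.* D.π D.* D.∏c k) p)
            (≈-trans (real-+ (D.fromℕ 2 D.* D.fromℕ k) (D.√ D.fromℕ k))
        (+-cong (≈-trans (real-* (D.fromℕ 2) (D.fromℕ k)) (*-cong real-2 (real-ι k))) (real-√ι k))))

    asymptotics : (g : ℕ → ℕ) → (∀ n → Fin (g n) ↔ BoundedTerm k n) → ∀ p →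
      (λ n → D.fromℕ (g n)) D.∼
      (λ n → D.√ ((D.fromℕ 2 D.* D.fromℕ k D.+ D.√ D.fromℕ k) D.÷ D.fromℕ 4 D.* D.π D.* D.∏c k [ p ])
             D.* n D.^-3/2 D.* (D.fromℕ 1 D.+ D.fromℕ 2 D.* D.√ D.fromℕ k) D.^ n)
    asymptotics g bij p = ∼-intro (λ n → D.fromℕ (g n)) G′ λ ε 0<ε →
      let N , bound = estimate κ y Pos-κ κ² y-eq ε 0<ε in N , λ n N≤n →
        let pos , near = bound n N≤n
            G≈ = real-G n
        in Pos-≤ pos (≤-reflexive (≈-sym G≈)) ,
           ≤-trans (≤-reflexive (∣∣-cong (+-cong (≈-trans (real-ι (g (suc n)))
                 (ℛ.reflexive (cong ι (count-terms k (suc n) (bij (suc n)))))) (-‿cong G≈))))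
             (≤-trans near (≤-reflexive (*-congˡ (≈-sym G≈))))
      where
      x : ℝ
      x = (D.fromℕ 2 D.* D.fromℕ k D.+ D.√ D.fromℕ k) D.÷ D.fromℕ 4 D.* D.π D.* D.∏c k [ p ]
      Pos-4π∏ : Pos (four * π * ∏cs k)
      Pos-4π∏ = Pos-* (Pos-* Pos-four (real-Positive D.π D.π-positive)) (Pos-∏cs k)
      Pos-x : Pos (real x)
      Pos-x = Pos-≤ (Pos-* (Pos-≤ (Pos-* (Pos-+ (Pos-⌜⌝ D.0<1) 0≤1) (Pos-≤ (Pos-ι 0) (ι-mono 1≤k))) (≤-by (0≤√ (ι k)) ≈-refl))
            (inv-pos _ Pos-4π∏))
        (≤-reflexive (≈-trans (*-congʳ (≈-sym (radicand p))) (≈-trans (*-assoc _ _ _)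
              (≈-trans (*-congˡ (inv-inverseʳ _ Pos-4π∏)) (*-identityʳ _)))))
      κ : Real
      κ = real (D.√ x)
      y : Seq
      y zero    = 0#
      y (suc n) = real (suc n D.^-3/2)
      κ≈ : κ ≈ √ real x
      κ≈ = real-√ x
      Pos-κ : Pos κ
      Pos-κ = Pos-≤ (Pos-√ Pos-x) (≤-reflexive (≈-sym κ≈))
      κ² : κ * κ * (four * π * ∏cs k) ≈ (1# + 1#) * ι k + σ
      κ² = ≈-trans (*-congʳ (≈-trans (*-cong κ≈ κ≈) (√² (Pos⇒0≤ Pos-x)))) (radicand p)
      y-eq : ∀ n → y (suc n) * n√n (suc n) ≈ 1#
      y-eq n = ≈-trans (*-congˡ (≈-sym (≈-trans (real-* (D.fromℕ (suc n)) (D.√ D.fromℕ (suc n)))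
            (*-cong (real-ι (suc n)) (real-√ι (suc n))))))
        (real-⁻¹ (D.fromℕ (suc n) D.* D.√ D.fromℕ (suc n)) (D.Positive⇒#0 {D.fromℕ (suc n) D.* D.√ D.fromℕ (suc n)}
          (D.*-positive {D.fromℕ (suc n)} {D.√ D.fromℕ (suc n)} (D.fromℕ-positive (suc n))
                (D.√-positive {D.fromℕ (suc n)} (D.fromℕ-positive (suc n))))))
      r≈ : real (D.fromℕ 1 D.+ D.fromℕ 2 D.* D.√ D.fromℕ k) ≈ r
      r≈ = ≈-trans (real-+ (D.fromℕ 1) (D.fromℕ 2 D.* D.√ D.fromℕ k)) (+-cong real-1
            (≈-trans (real-* (D.fromℕ 2) (D.√ D.fromℕ k)) (*-cong real-2 (real-√ι k))))
      G′ : (n : ℕ) .{{_ : ℕ.NonZero n}} → ℝ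
      G′ n = D.√ x D.* n D.^-3/2 D.* (D.fromℕ 1 D.+ D.fromℕ 2 D.* D.√ D.fromℕ k) D.^ n
      real-G : ∀ n → real (G′ (suc n)) ≈ κ * y (suc n) * pow r (suc n)
      real-G n = ≈-trans (real-* (D.√ x D.* suc n D.^-3/2) ((D.fromℕ 1 D.+ D.fromℕ 2 D.* D.√ D.fromℕ k) D.^ suc n))
        (*-cong (real-* (D.√ x) (suc n D.^-3/2)) (real-^ (D.fromℕ 1 D.+ D.fromℕ 2 D.* D.√ D.fromℕ k) r≈ (suc n)))

open import Defs

theorem1 : (k : ℕ) .{{_ : NonZero k}}
    (g : ℕ → ℕ) → (∀ n → Fin (g n) ↔ BoundedTerm k n) →
    (λ n → fromℕ (g n)) ∼
    (λ n → √ ((fromℕ 2 * fromℕ k + √ fromℕ k)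
                ÷ fromℕ 4 * π * ∏c k [ Positive⇒#0 {fromℕ 4 * π * ∏c k} (4π∏c-positive k) ])
           * n ^-3/2 * (fromℕ 1 + fromℕ 2 * √ fromℕ k) ^ n)
theorem1 k@(suc _) g terms = Translation.asymptotics k (s≤s z≤n) g terms (Positive⇒#0 {fromℕ 4 * π * ∏c k} (4π∏c-positive k))
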